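{- Let $D<-4$ be the discriminant of an imaginary quadratic field, $N=|D|$, $\chi=\chi_D$, $h=h(D)$, and let $B>1$ be an integer with $\gcd(B,N)=1$. Then $$\sum_{k=0}^{\left[\frac B2\right]-1}(B-1-2k)\,E_k(B)=(B-\chi(B))\,h.$$ Moreover, if $B=B_1B_2$ is a factorization into positive integers with $1<B_1<B$, then $$\sum_{k=0}^{\left[\frac{B_1}{2}\right]-1}(B_1-1-2k)\sum_{j=0}^{B_2-1}E_{kB_2+j}(B)=(B_1-\chi(B_1))\,h.$$
   Context: $[t]$ denotes the greatest integer $\le t$. Discriminant and character: let $K=\mathbb{Q}(\sqrt m)$ with $m$ a negative square-free integer. Its discriminant is $D=m$ if $m\equiv 1\pmod 4$ and $D=4m$ otherwise. $h(D)$ is the order of the ideal class group of $K$. The quadratic character $\chi_D:\mathbb{Z}\to\{0,1,-1\}$ modulo $N=|D|$ satisfies $\chi_D(x)=0$ if $\gcd(x,N)>1$, and for $\gcd(x,N)=1$ it is given by: $\chi_D(x)=\left(\frac{x}{|m|}\right)$ (Jacobi symbol) if $D=m\equiv1\pmod 4$; and for $D=4m$: $\chi_D(x)=\chi_4(x)\left(\frac{x}{|m|}\right)$ if $m\equiv3\pmod4$; $\chi_D(x)=\chi_8(x)\left(\frac{x}{|n|}\right)$ if $m=2n$, $n\equiv1\pmod4$; $\chi_D(x)=\chi_4(x)\chi_8(x)\left(\frac{x}{|n|}\right)$ if $m=2n$, $n\equiv3\pmod4$. Here, for odd $x$, $\chi_4(x)=(-1)^{(x-1)/2}$ and $\chi_8(x)=(-1)^{(x^2-1)/8}$.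 It is an odd character: $\chi_D(-1)=-1$. Let $X=\{x\in\mathbb{Z}:1\le x\le N,\ \gcd(x,N)=1\}$. For $0\le k\le B-1$ set $X_k(B)=\{x\in X:\frac{kN}{B}<x<\frac{(k+1)N}{B}\}$ and $E_k(B)=\sum_{x\in X_k(B)}\chi(x)$. -}

module Defs where

open import Data.Bool.Base using (if_then_else_)
open import Data.Fin.Base using (Fin; toℕ)
open import Data.Fin.Properties using (any?)
open import Data.Integer.Base using (ℤ; +_; -[1+_]; ∣_∣; 0ℤ; 1ℤ; -1ℤ; _+_; _-_; _*_; _^_)
open import Data.Integer.DivMod using (_%ℕ_; _/ℕ_)
open import Data.Integer.Divisibility.Signed using (_∣_; _∣?_)
open import Data.List.Base using (List; []; _∷_; map; foldr; filter; upTo)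
open import Data.List.Relation.Unary.Any using (Any)
open import Data.Nat.Base as ℕ using (ℕ; zero; suc)
open import Data.Nat.Coprimality using (coprime?)
open import Data.Nat.GCD using (gcd)
open import Data.Nat.Primality.Factorisation using (PrimeFactorisation; factorise)
import Data.Nat.Properties as ℕ
open import Data.Product.Base using (∃-syntax; _×_; _,_)
open import Data.Rational.Base as ℚ using (ℚ; 0ℚ; 1ℚ)
open import Data.Rational.Solver using (module +-*-Solver)
open import Function.Base using (_∘_)
open import Function.Bundles using (Inverse; _⇔_; mk⇔; Equivalence)
open import Level using (0ℓ)
open import Relation.Binary.Bundles using (Setoid)
open import Relation.Binary.PropositionalEquality
open import Relation.Nullary.Decidable using (does; _×-dec_)

SquareFree : ℤ → Set
SquareFree m = ∀ d → d * d ∣ m → d ∣ 1ℤ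

-- _%ℕ_ is the nonnegative remainder, also for negative m.
discriminant : ℤ → ℤ
discriminant m = if m %ℕ 4 ℕ.≡ᵇ 1 then m else + 4 * m

------------------------------------------------------------------------
-- The quadratic character

-- The symbol for a prime p.
legendre : ℤ → ℕ → ℤ
legendre a p =
  if does (+ p ∣? a) then 0ℤ
  else if does (any? {n = p} λ y → + p ∣? (a - + toℕ y * + toℕ y)) then 1ℤ
  else -1ℤ

-- Only used for odd n; the value at n = 0 is a dummy.
jacobi : ℤ → ℕ → ℤ
jacobi a zero      = 0ℤ
jacobi a n@(suc _) =
  foldr _*_ 1ℤ (map (legendre a) (PrimeFactorisation.factors (factorise n)))

-- χ₄ and χ₈ are meaningful for odd arguments, where the divisions below are
-- exact. The absolute values only make the exponents natural numbers; they
-- do not change their parity.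
χ₄ : ℤ → ℤ
χ₄ x = -1ℤ ^ ∣ (x - 1ℤ) /ℕ 2 ∣

χ₈ : ℤ → ℤ
χ₈ x = -1ℤ ^ ∣ (x * x - 1ℤ) /ℕ 8 ∣

-- The character of ℚ(√m), for square-free m (so that m is not divisible by 4
-- and, in the last two cases, m = 2n with n odd).
χ : ℤ → ℤ → ℤ
χ m x = if gcd ∣ x ∣ ∣ discriminant m ∣ ℕ.≡ᵇ 1 then onUnits else 0ℤ
  where
  n : ℤ
  n = m /ℕ 2

  onUnits : ℤ
  onUnits =
    if m %ℕ 4 ℕ.≡ᵇ 1 then jacobi x ∣ m ∣
    else if m %ℕ 4 ℕ.≡ᵇ 3 then χ₄ x * jacobi x ∣ m ∣
    else if n %ℕ 4 ℕ.≡ᵇ 1 then χ₈ x * jacobi x ∣ n ∣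
    else χ₄ x * χ₈ x * jacobi x ∣ n ∣

------------------------------------------------------------------------
-- Character sums

sumℤ : List ℤ → ℤ
sumℤ = foldr _+_ 0ℤ

-- Σ< n f = f 0 + ⋯ + f (n - 1)
Σ< : ℕ → (ℕ → ℤ) → ℤ
Σ< n f = sumℤ (map f (upTo n))

-- The x with 1 ≤ x ≤ N and gcd(x , N) = 1, in increasing order.
X : ℕ → List ℕ
X N = filter (λ x → coprime? x N) (map suc (upTo N))

-- kN/B < x < (k+1)N/B, with the denominator B > 0 cleared.
X[_] : ℕ → ℕ → ℕ → List ℕ
X[ N ] B k =
  filter (λ x → (k ℕ.* N ℕ.<? x ℕ.* B) ×-dec (x ℕ.* B ℕ.<? suc k ℕ.* N)) (X N)

E : ℤ → ℕ → ℕ → ℤ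
E m B k = sumℤ (map (χ m ∘ +_) (X[ ∣ discriminant m ∣ ] B k))

------------------------------------------------------------------------
-- The field ℚ(√m) and its ideal classes

-- a +√ b stands for a + b√m; this is the field ℚ(√m) when m is not a square.
record ℚ√ (m : ℤ) : Set where
  constructor _+√_
  field
    rat  : ℚ
    irr  : ℚ

module QuadraticField (m : ℤ) where

  K : Set
  K = ℚ√ m

  infixl 6 _⊕_
  infixl 7 _⊗_

  _⊕_ : K → K → K
  (a +√ b) ⊕ (c +√ d) = (a ℚ.+ c) +√ (b ℚ.+ d)

  _⊗_ : K → K → K
  (a +√ b) ⊗ (c +√ d) =
    (a ℚ.* c ℚ.+ (m ℚ./ 1) ℚ.* (b ℚ.* d)) +√ (a ℚ.* d ℚ.+ b ℚ.* c)

  0K 1K : K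
  0K = 0ℚ +√ 0ℚ
  1K = 1ℚ +√ 0ℚ

  fromℤ : ℤ → K
  fromℤ n = (n ℚ./ 1) +√ 0ℚ

  -- monic [c₀ , … , cₙ₋₁] α = c₀ + c₁ α + ⋯ + cₙ₋₁ αⁿ⁻¹ + αⁿ
  monic : List ℤ → K → K
  monic []       α = 1K
  monic (c ∷ cs) α = fromℤ c ⊕ α ⊗ monic cs α

  -- α belongs to the ring of integers 𝓞.
  Integral : K → Set
  Integral α = ∃[ cs ] monic cs α ≡ 0K

  infix 4 _∈⟨_⟩

  -- Membership in the 𝓞-submodule of K generated by a finite list.
  data _∈⟨_⟩ : K → List K → Set where
    []  : 0K ∈⟨ [] ⟩
    _∷_ : ∀ {c g x gs} → Integral c → x ∈⟨ gs ⟩ → c ⊗ g ⊕ x ∈⟨ g ∷ gs ⟩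

  -- Fractional ideals of K: nonzero finitely generated 𝓞-submodules of K.
  record FractionalIdeal : Set where
    field
      generators : List K
      nonzero    : Any (_≢ 0K) generators

  infix 4 _∈_ _≈_

  _∈_ : K → FractionalIdeal → Set
  x ∈ I = x ∈⟨ FractionalIdeal.generators I ⟩

  -- J = κI for some κ ∈ K^×, i.e. I and J agree modulo principal
  -- fractional ideals.
  _≈_ : FractionalIdeal → FractionalIdeal → Set
  I ≈ J = ∃[ κ ] (∃[ κ⁻¹ ] κ ⊗ κ⁻¹ ≡ 1K) ×
                 (∀ y → y ∈ J ⇔ (∃[ x ] x ∈ I × y ≡ κ ⊗ x))

  private
    open +-*-Solver

    ⊗-comm : ∀ x y → x ⊗ y ≡ y ⊗ x
    ⊗-comm (a +√ b) (c +√ d) = cong₂ _+√_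
      (solve 5 (λ q a b c d → a :* c :+ q :* (b :* d) := c :* a :+ q :* (d :* b))
         refl (m ℚ./ 1) a b c d)
      (solve 4 (λ a b c d → a :* d :+ b :* c := c :* b :+ d :* a) refl a b c d)

    ⊗-assoc : ∀ x y z → (x ⊗ y) ⊗ z ≡ x ⊗ (y ⊗ z)
    ⊗-assoc (a +√ b) (c +√ d) (e +√ f) = cong₂ _+√_
      (solve 7 (λ q a b c d e f →
           (a :* c :+ q :* (b :* d)) :* e :+ q :* ((a :* d :+ b :* c) :* f)
        := a :* (c :* e :+ q :* (d :* f)) :+ q :* (b :* (c :* f :+ d :* e)))
         refl (m ℚ./ 1) a b c d e f)
      (solve 7 (λ q a b c d e f →
           (a :* c :+ q :* (b :* d)) :* f :+ (a :* d :+ b :* c) :* e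
        := a :* (c :* f :+ d :* e) :+ b :* (c :* e :+ q :* (d :* f)))
         refl (m ℚ./ 1) a b c d e f)

    ⊗-identityˡ : ∀ x → 1K ⊗ x ≡ x
    ⊗-identityˡ (a +√ b) = cong₂ _+√_
      (solve 3 (λ q a b → con 1ℚ :* a :+ q :* (con 0ℚ :* b) := a)
         refl (m ℚ./ 1) a b)
      (solve 2 (λ a b → con 1ℚ :* b :+ con 0ℚ :* a := b) refl a b)

    cancel : ∀ κ κ⁻¹ → κ ⊗ κ⁻¹ ≡ 1K → ∀ x → κ⁻¹ ⊗ (κ ⊗ x) ≡ x
    cancel κ κ⁻¹ inv x = begin
      κ⁻¹ ⊗ (κ ⊗ x)  ≡⟨ ⊗-assoc κ⁻¹ κ x ⟨
      (κ⁻¹ ⊗ κ) ⊗ x  ≡⟨ cong (_⊗ x) (trans (⊗-comm κ⁻¹ κ) inv) ⟩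
      1K ⊗ x         ≡⟨ ⊗-identityˡ x ⟩
      x              ∎
      where open ≡-Reasoning

    ≈-refl : ∀ {I} → I ≈ I
    ≈-refl {I} = 1K , (1K , ⊗-identityˡ 1K) , λ y → mk⇔
      (λ y∈I → y , y∈I , sym (⊗-identityˡ y))
      (λ { (x , x∈I , y≡x) → subst (_∈ I) (sym (trans y≡x (⊗-identityˡ x))) x∈I })

    ≈-sym : ∀ {I J} → I ≈ J → J ≈ I
    ≈-sym {I} {J} (κ , (κ⁻¹ , inv) , J=κI) = κ⁻¹ , (κ , inv′) , λ x → mk⇔
      (λ x∈I → κ ⊗ x , Equivalence.from (J=κI (κ ⊗ x)) (x , x∈I , refl)
                     , sym (cancel κ κ⁻¹ inv x))
      (λ { (y , y∈J , x≡κ⁻¹y) → back x≡κ⁻¹y (Equivalence.to (J=κI y) y∈J) })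
      where
      inv′ : κ⁻¹ ⊗ κ ≡ 1K
      inv′ = trans (⊗-comm κ⁻¹ κ) inv

      back : ∀ {x y} → x ≡ κ⁻¹ ⊗ y → (∃[ z ] z ∈ I × y ≡ κ ⊗ z) → x ∈ I
      back x≡ (z , z∈I , refl) =
        subst (_∈ I) (sym (trans x≡ (cancel κ κ⁻¹ inv z))) z∈I

    ≈-trans : ∀ {I J L} → I ≈ J → J ≈ L → I ≈ L
    ≈-trans {I} {J} {L} (κ , (κ⁻¹ , invκ) , J=κI) (μ , (μ⁻¹ , invμ) , L=μJ) =
      μ ⊗ κ , (κ⁻¹ ⊗ μ⁻¹ , inv) , λ z → mk⇔ (to z) (from z)
      where
      inv : (μ ⊗ κ) ⊗ (κ⁻¹ ⊗ μ⁻¹) ≡ 1K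
      inv = begin
        (μ ⊗ κ) ⊗ (κ⁻¹ ⊗ μ⁻¹)  ≡⟨ ⊗-assoc μ κ (κ⁻¹ ⊗ μ⁻¹) ⟩
        μ ⊗ (κ ⊗ (κ⁻¹ ⊗ μ⁻¹))  ≡⟨ cong (μ ⊗_) (cancel κ⁻¹ κ (trans (⊗-comm κ⁻¹ κ) invκ) μ⁻¹) ⟩
        μ ⊗ μ⁻¹                ≡⟨ invμ ⟩
        1K                     ∎
        where open ≡-Reasoning

      to : ∀ z → z ∈ L → ∃[ x ] x ∈ I × z ≡ (μ ⊗ κ) ⊗ x
      to z z∈L with Equivalence.to (L=μJ z) z∈L
      ... | y , y∈J , refl with Equivalence.to (J=κI y) y∈J
      ... | x , x∈I , refl = x , x∈I , sym (⊗-assoc μ κ x)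

      from : ∀ z → (∃[ x ] x ∈ I × z ≡ (μ ⊗ κ) ⊗ x) → z ∈ L
      from z (x , x∈I , z≡) = Equivalence.from (L=μJ z)
        (κ ⊗ x , Equivalence.from (J=κI (κ ⊗ x)) (x , x∈I , refl)
               , trans z≡ (⊗-assoc μ κ x))

  -- Underlying set of the ideal class group.
  ClassGroup : Setoid 0ℓ 0ℓ
  ClassGroup = record
    { Carrier       = FractionalIdeal
    ; _≈_           = _≈_
    ; isEquivalence = record
        { refl  = λ {I} → ≈-refl {I}
        ; sym   = λ {I} {J} → ≈-sym {I} {J}
        ; trans = λ {I} {J} {L} → ≈-trans {I} {J} {L}
        }
    }

open QuadraticField public using (ClassGroup)

HasOrder : Setoid 0ℓ 0ℓ → ℕ → Set
HasOrder S n = Inverse S (setoid (Fin n))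

{-# OPTIONS --safe #-}
-- The h classes of forms, weighted by w(n) = 1 - p[p ∣ n] for a prime p dividing m and by the
-- truncated cube U(z) = max(z,0)³, are summed over all lattice points with Y = Z², Z = N·(s+1).
-- Since n is represented 2 Σ_{e ∣ n} χ(e) times in all, the sum is 2 Σ_e Σ_j χ(e) w(j) U(Y - e j)
-- plus the term of the origin. As w and χ have mean zero over a period, repeated Abel summation
-- evaluates both sides up to O(Z⁵), and the coefficients of Y³ = Z⁶ give Dirichlet's formula
-- N h = - Σ x χ(x). From Σ_k k E_k = Σ χ(x) ⌊x B / N⌋, where r ≡ x B mod N has χ(r) = χ(x) χ(B), and
-- from E_{B-1-k} = - E_k, the identities follow; blocks of B₂ intervals for B form one for B₁.

module Submission where

open import Defs
open import Data.Bool.Base using (Bool; true; false; not; if_then_else_)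
import Data.Bool.Properties as Bool
open import Data.Empty using (⊥; ⊥-elim)
open import Data.Fin.Base using (Fin; toℕ; fromℕ<)
import Data.Fin.Properties as Fin
open import Data.Integer.Base as ℤ
  using (ℤ; +_; -[1+_]; -_; ∣_∣; 0ℤ; 1ℤ; -1ℤ; _+_; _-_; _*_; _^_; _≤_; _<_; +≤+; -≤+; -≤-; +<+; -<-)
open import Data.Integer.DivMod using (_%ℕ_; _/ℕ_; n%ℕd<d; a≡a%ℕn+[a/ℕn]*n)
open import Data.Integer.Divisibility.Signed using (_∣_; _∣?_; divides; ∣ᵤ⇒∣; ∣⇒∣ᵤ; ∣m∣n⇒∣m+n; ∣m∣n⇒∣m-n; ∣n⇒∣m*n; ∣m⇒∣m*n; ∣m⇒∣-m; ∣-refl; ∣-trans; *-cancelˡ-∣)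
import Data.Integer.Properties as ℤ
open import Data.Integer.Properties using (*-assoc; *-comm; *-identityʳ; *-identityˡ; *-zeroʳ; *-zeroˡ; +-identityˡ; +-injective; +-inverseʳ; -1*i≡-i; abs-*; m-n≡m⊖n; neg-involutive; pos-*; ∣-i∣≡∣i∣; ∣i∣≡0⇒i≡0)
open import Data.Integer.Tactic.RingSolver using () renaming (solve-∀ to ring)
open import Data.List.Base using (List; []; _∷_; map; foldr; filter; upTo; _++_; allFin; cartesianProduct; length; replicate)
open import Data.List.Membership.Propositional using (_∈_)
open import Data.List.Membership.Propositional.Properties
  using (∈-map⁺; ∈-map⁻; ∈-upTo⁺; ∈-upTo⁻; ∈-filter⁺; ∈-filter⁻; ∈-allFin; ∈-cartesianProduct⁺; ∈-cartesianProduct⁻)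
open import Data.List.Membership.Propositional.Properties.WithK using (unique∧set⇒bag)
import Data.List.Properties as List
open import Data.List.Relation.Binary.BagAndSetEquality using (∼bag⇒↭)
open import Data.List.Relation.Binary.Permutation.Propositional as Perm using (_↭_)
open import Data.List.Relation.Unary.All as All using (All; []; _∷_)
open import Data.List.Relation.Unary.AllPairs as AllPairs using ([]; _∷_)
open import Data.List.Relation.Unary.Any using (Any; here; there)
open import Data.List.Relation.Unary.Unique.Propositional using (Unique)
import Data.List.Relation.Unary.Unique.Propositional.Properties as Unique
open import Data.Nat.Base as ℕ using (ℕ; zero; suc; z≤n; s≤s; NonZero; _/_) renaming (_*_ to _·_)
open import Data.Nat.Coprimality using (Coprime; coprime?)
open import Data.Nat.Divisibility as ℕ∣ using () renaming (_∣_ to _∣ₙ_; divides to dividesₙ)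
open import Data.Nat.DivMod using (m≡m%n+[m/n]*n; m%n<n)
import Data.Nat.DivMod as ℕ
open import Data.Nat.GCD using (gcd)
import Data.Nat.GCD as ℕ
open import Data.Nat.Primality using (Prime; euclidsLemma; prime⇒nonZero)
import Data.Nat.Primality as ℕ
open import Data.Nat.Primality.Factorisation using (PrimeFactorisation; factorise)
import Data.Nat.Properties as ℕ
open import Data.Nat.Properties using (*-distribʳ-∸; *-mono-≤; *-monoʳ-≤; *-monoˡ-≤; +-assoc; +-comm; +-identityʳ; +-mono-≤; +-monoˡ-≤; +-suc; +-∸-assoc; <-trans; <-≤-trans; ^-monoˡ-≤; m*n≢0; m≤m*n; m≤m+n; m≤n*m; m≤n+m; n≢0⇒n>0; n≤1+n; pred[n]≤n; suc-injective; suc-pred; ∸-monoʳ-<; ≤-<-trans; ≤-refl; ≤-reflexive; ≤-trans)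
open import Data.Nat.Tactic.RingSolver using () renaming (solve-∀ to ringₙ)
open import Data.Product.Base using (Σ; ∃-syntax; Σ-syntax; _×_; _,_; proj₁; proj₂)
open import Data.Sum.Base using (_⊎_; inj₁; inj₂; [_,_]′)
open import Function.Base using (_∘_; id; _$_; case_of_; const)
open import Function.Bundles using (Inverse; _⇔_; mk⇔; Equivalence)
open import Relation.Binary.PropositionalEquality
  using (_≡_; _≢_; refl; sym; trans; cong; cong₂; subst; subst₂; module ≡-Reasoning)
open import Relation.Nullary using (¬_; Dec; yes; no; does; contradiction)
open import Relation.Nullary.Decidable using (dec⇒maybe; map′; _×-dec_; dec-true; dec-false; ¬?)
open import Relation.Unary using (Pred; Decidable)
open import Data.Rational.Base as ℚ using (ℚ)
import Data.Rational.Properties as ℚ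
import Data.Rational.Solver as ℚSolver
import Data.Rational.Unnormalised.Base as ℚᵘ
import Data.Rational.Unnormalised.Properties as ℚᵘ
open import Data.Nat.Induction using (<-rec)
import Tactic.RingSolver as Solver
import Tactic.RingSolver.Core.AlmostCommutativeRing as ACR
open import Level using (0ℓ)
open import Relation.Binary.Bundles using (Setoid)
import Data.Nat.Coprimality as Coprimality
open import Data.Nat.ListAction using (product)
open ≡-Reasoning


infixr 7 _∙_
_∙_ : ∀ {A : Set} {x y z : A} → x ≡ y → y ≡ z → x ≡ z
_∙_ = trans

*-left-swap : ∀ x y z → x * (y * z) ≡ y * (x * z)
*-left-swap = ring

*-interchange : ∀ x y z w → x * y * (z * w) ≡ x * z * (y * w)
*-interchange = ring

*-rotate : ∀ x y z → x * (y * z) ≡ y * (z * x)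
*-rotate = ring

split-off : ∀ x y → x ≡ y + (x - y)
split-off = ring

+-minus : ∀ x y → x + y - y ≡ x
+-minus = ring

+-minusˡ : ∀ x y → x + y - x ≡ 1ℤ * y
+-minusˡ = ring

suc-* : ∀ x y → x + y * x ≡ (1ℤ + y) * x
suc-* = ring

minus-minus : ∀ x y z → x - y - (x - z) ≡ z - y
minus-minus = ring

minus-cancel : ∀ x y → x - y - x ≡ - y
minus-cancel = ring

poly-shift : ∀ x t n y → x * x + t * x + n - (x - y) * (x + y + t) ≡ y * y + t * y + n
poly-shift = ring

+-double : ∀ x → x + x ≡ + 2 * x
+-double = ring

minus-chain : ∀ x y z w → x - y - (x - z) + (y - w) ≡ z - w
minus-chain = ring

factor-square : ∀ g a r b v → g * a * (g * r) + g * b * (g * v) ≡ g * g * (a * r + b * v)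
factor-square = ring

minus-involutive : ∀ x y → x - (x - y) ≡ y
minus-involutive = ring

+-minus-cancel : ∀ x y → x + (y - x) ≡ y
+-minus-cancel = ring

+-congˡ : ∀ {x y z : ℤ} → y ≡ z → x + y ≡ x + z
+-congˡ {x} = cong (λ w → x + w)

⟦_⟧ : ∀ {p} {P : Set p} → Dec P → ℤ
⟦ d ⟧ = if does d then 1ℤ else 0ℤ

⟦⟧-yes : ∀ {p} {P : Set p} (d : Dec P) → P → ⟦ d ⟧ ≡ 1ℤ
⟦⟧-yes d p = cong (if_then 1ℤ else 0ℤ) (dec-true d p)

⟦⟧-no : ∀ {p} {P : Set p} (d : Dec P) → ¬ P → ⟦ d ⟧ ≡ 0ℤ
⟦⟧-no d ¬p = cong (if_then 1ℤ else 0ℤ) (dec-false d ¬p)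

⟦⟧-cong : ∀ {p q} {P : Set p} {Q : Set q} (d : Dec P) (e : Dec Q) → (P → Q) → (Q → P) → ⟦ d ⟧ ≡ ⟦ e ⟧
⟦⟧-cong (yes p) e f g = sym (⟦⟧-yes e (f p))
⟦⟧-cong (no ¬p) e f g = sym (⟦⟧-no e (¬p ∘ g))

⟦⟧-× : ∀ {p q} {P : Set p} {Q : Set q} (d : Dec P) (e : Dec Q) → ⟦ d ×-dec e ⟧ ≡ ⟦ d ⟧ * ⟦ e ⟧
⟦⟧-× (yes p) (yes q) = refl
⟦⟧-× (yes p) (no _) = refl
⟦⟧-× (no _) (yes _) = refl
⟦⟧-× (no _) (no _) = refl

-- Finite sums and products

opaque
  ∑ ∏ : ∀ {A : Set} → List A → (A → ℤ) → ℤ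
  ∑ xs f = sumℤ (map f xs)
  ∏ xs f = foldr _*_ 1ℤ (map f xs)

  ∑-def : ∀ {A : Set} (xs : List A) f → ∑ xs f ≡ sumℤ (map f xs)
  ∑-def xs f = refl

  ∏-[] : ∀ {A : Set} (f : A → ℤ) → ∏ [] f ≡ 1ℤ
  ∏-[] f = refl

  ∏-∷ : ∀ {A : Set} x xs (f : A → ℤ) → ∏ (x ∷ xs) f ≡ f x * ∏ xs f
  ∏-∷ x xs f = refl


  ∑-map : ∀ {A B : Set} (φ : B → A) (ys : List B) f → ∑ (map φ ys) f ≡ ∑ ys (f ∘ φ)
  ∑-map φ ys f = cong sumℤ (sym (List.map-∘ ys))

  ∏-map : ∀ {A B : Set} (φ : B → A) (ys : List B) f → ∏ (map φ ys) f ≡ ∏ ys (f ∘ φ)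
  ∏-map φ ys f = cong (foldr _*_ 1ℤ) (sym (List.map-∘ ys))

  ∑-++ : ∀ {A : Set} (xs ys : List A) f → ∑ (xs ++ ys) f ≡ ∑ xs f + ∑ ys f
  ∑-++ [] ys f = sym (+-identityˡ _)
  ∑-++ (x ∷ xs) ys f = +-congˡ {f x} (∑-++ xs ys f) ∙ sym (ℤ.+-assoc (f x) _ _)


  ∑-cong : ∀ {A : Set} (xs : List A) {f g} → (∀ {x} → x ∈ xs → f x ≡ g x) → ∑ xs f ≡ ∑ xs g
  ∑-cong [] h = refl
  ∑-cong (x ∷ xs) h = cong₂ _+_ (h (here refl)) (∑-cong xs (h ∘ there))

  ∏-cong : ∀ {A : Set} (xs : List A) {f g} → (∀ {x} → x ∈ xs → f x ≡ g x) → ∏ xs f ≡ ∏ xs g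
  ∏-cong [] h = refl
  ∏-cong (x ∷ xs) h = cong₂ _*_ (h (here refl)) (∏-cong xs (h ∘ there))

  ∑-zero : ∀ {A : Set} (xs : List A) {f} → (∀ {x} → x ∈ xs → f x ≡ 0ℤ) → ∑ xs f ≡ 0ℤ
  ∑-zero [] h = refl
  ∑-zero (x ∷ xs) h = cong₂ _+_ (h (here refl)) (∑-zero xs (h ∘ there))

  ∏-one : ∀ {A : Set} (xs : List A) {f} → (∀ {x} → x ∈ xs → f x ≡ 1ℤ) → ∏ xs f ≡ 1ℤ
  ∏-one [] h = refl
  ∏-one (x ∷ xs) h = cong₂ _*_ (h (here refl)) (∏-one xs (h ∘ there))

  ∑-+ : ∀ {A : Set} (xs : List A) f g → ∑ xs (λ x → f x + g x) ≡ ∑ xs f + ∑ xs g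
  ∑-+ [] f g = refl
  ∑-+ (x ∷ xs) f g = +-congˡ {f x + g x} (∑-+ xs f g) ∙ lem (f x) (g x) (∑ xs f) (∑ xs g)
    where lem : ∀ a b c d → a + b + (c + d) ≡ a + c + (b + d)
          lem = ring

  ∏-* : ∀ {A : Set} (xs : List A) f g → ∏ xs (λ x → f x * g x) ≡ ∏ xs f * ∏ xs g
  ∏-* [] f g = refl
  ∏-* (x ∷ xs) f g = cong ((f x * g x) *_) (∏-* xs f g) ∙ lem (f x) (g x) (∏ xs f) (∏ xs g)
    where lem : ∀ a b c d → (a * b) * (c * d) ≡ a * c * (b * d)
          lem = ring

  ∑-*ˡ : ∀ {A : Set} (xs : List A) c f → ∑ xs (λ x → c * f x) ≡ c * ∑ xs f
  ∑-*ˡ [] c f = sym (*-zeroʳ c)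
  ∑-*ˡ (x ∷ xs) c f = +-congˡ {c * f x} (∑-*ˡ xs c f) ∙ sym (ℤ.*-distribˡ-+ c (f x) (∑ xs f))

  ∑-*ʳ : ∀ {A : Set} (xs : List A) c f → ∑ xs (λ x → f x * c) ≡ ∑ xs f * c
  ∑-*ʳ xs c f = ∑-cong xs (λ {x} _ → *-comm (f x) c) ∙ ∑-*ˡ xs c f ∙ *-comm c (∑ xs f)

  ∑-swap : ∀ {A B : Set} (xs : List A) (ys : List B) (f : A → B → ℤ) →
           ∑ xs (λ x → ∑ ys (f x)) ≡ ∑ ys (λ y → ∑ xs (λ x → f x y))
  ∑-swap [] ys f = sym (∑-zero ys (λ _ → refl))
  ∑-swap (x ∷ xs) ys f = +-congˡ {∑ ys (f x)} (∑-swap xs ys f) ∙ sym (∑-+ ys (f x) (λ y → ∑ xs (λ x → f x y)))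

  ∑-filter : ∀ {A : Set} {p} {P : Pred A p} (P? : Decidable P) (xs : List A) f →
             ∑ (filter P? xs) f ≡ ∑ xs (λ x → ⟦ P? x ⟧ * f x)
  ∑-filter P? [] f = refl
  ∑-filter P? (x ∷ xs) f with does (P? x)
  ... | true = cong₂ _+_ (sym (*-identityˡ (f x))) (∑-filter P? xs f)
  ... | false = ∑-filter P? xs f ∙ sym (+-identityˡ _)

  ∑-× : ∀ {A B : Set} (xs : List A) (ys : List B) (f : A × B → ℤ) →
        ∑ (cartesianProduct xs ys) f ≡ ∑ xs (λ x → ∑ ys (λ y → f (x , y)))
  ∑-× [] ys f = refl
  ∑-× (x ∷ xs) ys f = ∑-++ (map (x ,_) ys) _ f ∙ cong₂ _+_ (∑-map (x ,_) ys f) (∑-× xs ys f)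

  ∑-↭ : ∀ {A : Set} {xs ys : List A} f → xs ↭ ys → ∑ xs f ≡ ∑ ys f
  ∑-↭ f Perm.refl = refl
  ∑-↭ f (Perm.prep x p) = +-congˡ {f x} (∑-↭ f p)
  ∑-↭ f (Perm.swap {ys = ys} x y p) = cong (λ s → f x + (f y + s)) (∑-↭ f p) ∙ lem (f x) (f y) (∑ ys f)
    where lem : ∀ a b c → a + (b + c) ≡ b + (a + c)
          lem = ring
  ∑-↭ f (Perm.trans p q) = ∑-↭ f p ∙ ∑-↭ f q

  ∏-↭ : ∀ {A : Set} {xs ys : List A} f → xs ↭ ys → ∏ xs f ≡ ∏ ys f
  ∏-↭ f Perm.refl = refl
  ∏-↭ f (Perm.prep x p) = cong (f x *_) (∏-↭ f p)
  ∏-↭ f (Perm.swap {ys = ys} x y p) = cong (λ s → f x * (f y * s)) (∏-↭ f p) ∙ *-left-swap (f x) (f y) (∏ ys f)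
  ∏-↭ f (Perm.trans p q) = ∏-↭ f p ∙ ∏-↭ f q

  ∑-single : ∀ {A : Set} {xs : List A} {x₀} f → Unique xs → x₀ ∈ xs → (∀ {x} → x ∈ xs → x ≢ x₀ → f x ≡ 0ℤ) →
             ∑ xs f ≡ f x₀
  ∑-single f (x∉ ∷ u) (here refl) h =
    trans (+-congˡ {f _} (∑-zero _ λ x∈ → h (there x∈) (λ { refl → All.lookup x∉ x∈ refl })))
          (ℤ.+-identityʳ _)
  ∑-single f (x∉ ∷ u) (there x₀∈) h =
    trans (cong₂ _+_ (h (here refl) (λ { refl → All.lookup x∉ x₀∈ refl }))
                     (∑-single f u x₀∈ (h ∘ there)))
          (+-identityˡ _)

  map-unique : ∀ {A B : Set} (φ : A → B) {xs : List A} → (∀ {x y} → x ∈ xs → y ∈ xs → φ x ≡ φ y → x ≡ y) →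
               Unique xs → Unique (map φ xs)
  map-unique φ {[]} inj [] = []
  map-unique φ {x ∷ xs} inj (x∉ ∷ u) =
    All.tabulate (λ y∈ eq → case ∈-map⁻ φ y∈ of λ { (z , z∈ , y≡) →
      All.lookup x∉ z∈ (inj (here refl) (there z∈) (eq ∙ y≡)) })
    ∷ map-unique φ (λ x∈ y∈ → inj (there x∈) (there y∈)) u

  map-↭ : ∀ {A B : Set} {xs : List A} {ys : List B} (φ : A → B) (ψ : B → A) → Unique xs → Unique ys →
          (∀ {x} → x ∈ xs → φ x ∈ ys) → (∀ {y} → y ∈ ys → ψ y ∈ xs) →
          (∀ {x} → x ∈ xs → ψ (φ x) ≡ x) → (∀ {y} → y ∈ ys → φ (ψ y) ≡ y) → map φ xs ↭ ys
  map-↭ φ ψ ux uy φ∈ ψ∈ ψφ φψ = ∼bag⇒↭ $ unique∧set⇒bag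
    (map-unique φ (λ x∈ y∈ eq → sym (ψφ x∈) ∙ cong ψ eq ∙ ψφ y∈) ux) uy
    (mk⇔ (λ z∈ → case ∈-map⁻ φ z∈ of λ { (x , x∈ , refl) → φ∈ x∈ })
         (λ z∈ → subst (_∈ map φ _) (φψ z∈) (∈-map⁺ φ (ψ∈ z∈))))

  ∑-reindex : ∀ {A B : Set} {xs : List A} {ys : List B} (φ : A → B) (ψ : B → A) → Unique xs → Unique ys →
          (∀ {x} → x ∈ xs → φ x ∈ ys) → (∀ {y} → y ∈ ys → ψ y ∈ xs) →
          (∀ {x} → x ∈ xs → ψ (φ x) ≡ x) → (∀ {y} → y ∈ ys → φ (ψ y) ≡ y) →
          ∀ f → ∑ xs (f ∘ φ) ≡ ∑ ys f
  ∑-reindex {xs = xs} φ ψ ux uy a b c d f = sym (∑-map φ xs f) ∙ ∑-↭ f (map-↭ φ ψ ux uy a b c d)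


-- Sums over initial segments

upTo-suc : ∀ n → upTo (suc n) ≡ upTo n ++ n ∷ []
upTo-suc n = sym (List.upTo-∷ʳ n)

opaque
  unfolding ∑

  ∑< : ℕ → (ℕ → ℤ) → ℤ
  ∑< n f = ∑ (upTo n) f

  Σ<≡∑< : ∀ n f → Σ< n f ≡ ∑< n f
  Σ<≡∑< n f = refl

  ∑<≡∑ : ∀ n f → ∑< n f ≡ ∑ (upTo n) f
  ∑<≡∑ n f = refl

  ∑<-0 : ∀ f → ∑< 0 f ≡ 0ℤ
  ∑<-0 f = refl

  ∑<-suc : ∀ n f → ∑< (suc n) f ≡ ∑< n f + f n
  ∑<-suc n f = cong (λ l → ∑ l f) (upTo-suc n) ∙ ∑-++ (upTo n) _ f ∙ +-congˡ {∑< n f} (ℤ.+-identityʳ _)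

  ∑<-shift : ∀ n f → ∑< (suc n) f ≡ f 0 + ∑< n (f ∘ suc)
  ∑<-shift n f = +-congˡ {f 0} (cong (λ l → ∑ l f) (sym (List.map-upTo suc n)) ∙ ∑-map suc (upTo n) f)

  ∑<-cong : ∀ n {f g} → (∀ {i} → i ℕ.< n → f i ≡ g i) → ∑< n f ≡ ∑< n g
  ∑<-cong n h = ∑-cong (upTo n) (h ∘ ∈-upTo⁻)

  ∑<-zero : ∀ n {f} → (∀ {i} → i ℕ.< n → f i ≡ 0ℤ) → ∑< n f ≡ 0ℤ
  ∑<-zero n h = ∑-zero (upTo n) (h ∘ ∈-upTo⁻)

  ∑<-single : ∀ n {x₀} f → x₀ ℕ.< n → (∀ {x} → x ℕ.< n → x ≢ x₀ → f x ≡ 0ℤ) → ∑< n f ≡ f x₀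
  ∑<-single n f x₀< h = ∑-single f (Unique.upTo⁺ n) (∈-upTo⁺ x₀<) (h ∘ ∈-upTo⁻)

  ∑<-+ : ∀ m n f → ∑< (m ℕ.+ n) f ≡ ∑< m f + ∑< n (λ i → f (m ℕ.+ i))
  ∑<-+ zero n f = sym (+-identityˡ _)
  ∑<-+ (suc m) n f = begin
    ∑< (suc (m ℕ.+ n)) f ≡⟨ ∑<-shift (m ℕ.+ n) f ⟩
    f 0 + ∑< (m ℕ.+ n) (f ∘ suc) ≡⟨ +-congˡ {f 0} (∑<-+ m n (f ∘ suc)) ⟩
    f 0 + (∑< m (f ∘ suc) + ∑< n (λ i → f (suc m ℕ.+ i))) ≡⟨ ℤ.+-assoc (f 0) _ _ ⟨
    f 0 + ∑< m (f ∘ suc) + ∑< n (λ i → f (suc m ℕ.+ i)) ≡⟨ cong (_+ ∑< n (λ i → f (suc m ℕ.+ i))) (∑<-shift m f) ⟨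
    ∑< (suc m) f + ∑< n (λ i → f (suc m ℕ.+ i)) ∎


  ∑<-extend : ∀ {m n} f → m ℕ.≤ n → (∀ {i} → m ℕ.≤ i → f i ≡ 0ℤ) → ∑< n f ≡ ∑< m f
  ∑<-extend {m} {n} f m≤n h = begin
    ∑< n f ≡⟨ cong (λ k → ∑< k f) (ℕ.m+[n∸m]≡n m≤n) ⟨
    ∑< (m ℕ.+ (n ℕ.∸ m)) f ≡⟨ ∑<-+ m (n ℕ.∸ m) f ⟩
    ∑< m f + ∑< (n ℕ.∸ m) (λ i → f (m ℕ.+ i)) ≡⟨ +-congˡ {∑< m f} (∑<-zero (n ℕ.∸ m) (λ {i} _ → h (m≤m+n m i))) ⟩
    ∑< m f + 0ℤ ≡⟨ ℤ.+-identityʳ _ ⟩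
    ∑< m f ∎


  ∑<-blocks : ∀ q p f → ∑< (q · p) f ≡ ∑< q (λ k → ∑< p (λ i → f (k · p ℕ.+ i)))
  ∑<-blocks zero p f = refl
  ∑<-blocks (suc q) p f = begin
    ∑< (p ℕ.+ q · p) f ≡⟨ ∑<-+ p (q · p) f ⟩
    ∑< p f + ∑< (q · p) (λ i → f (p ℕ.+ i)) ≡⟨ +-congˡ {∑< p f} (∑<-blocks q p _) ⟩
    ∑< p f + ∑< q (λ k → ∑< p (λ i → f (p ℕ.+ (k · p ℕ.+ i))))
      ≡⟨ +-congˡ {∑< p f} (∑<-cong q λ {k} _ → ∑<-cong p λ {i} _ → cong f (sym (+-assoc p (k · p) i))) ⟩
    ∑< p f + ∑< q (λ k → ∑< p (λ i → f (suc k · p ℕ.+ i)))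
      ≡⟨ ∑<-shift q (λ k → ∑< p (λ i → f (k · p ℕ.+ i))) ⟨
    ∑< (suc q) (λ k → ∑< p (λ i → f (k · p ℕ.+ i))) ∎


  ∑<-const : ∀ n c → ∑< n (λ _ → c) ≡ + n * c
  ∑<-const zero c = sym (*-zeroˡ c)
  ∑<-const (suc n) c = ∑<-shift n (λ _ → c) ∙ +-congˡ {c} (∑<-const n c) ∙ suc-* c (+ n)


  ∑<-reverse : ∀ n f → ∑< n f ≡ ∑< n (λ i → f (n ℕ.∸ suc i))
  ∑<-reverse zero f = refl
  ∑<-reverse (suc n) f = ∑<-suc n f ∙ ℤ.+-comm _ (f n) ∙
    trans (+-congˡ {f n} (∑<-reverse n f)) (sym (∑<-shift n (λ i → f (n ℕ.∸ i))))

  ∣∑∣≤ : ∀ {A : Set} (xs : List A) f c → (∀ {x} → x ∈ xs → ∣ f x ∣ ℕ.≤ c) → ∣ ∑ xs f ∣ ℕ.≤ length xs · c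
  ∣∑∣≤ [] f c h = z≤n
  ∣∑∣≤ (x ∷ xs) f c h = ≤-trans (ℤ.∣i+j∣≤∣i∣+∣j∣ (f x) _) (+-mono-≤ (h (here refl)) (∣∑∣≤ xs f c (h ∘ there)))

  ∣∑<∣≤ : ∀ n f c → (∀ {i} → i ℕ.< n → ∣ f i ∣ ℕ.≤ c) → ∣ ∑< n f ∣ ℕ.≤ n · c
  ∣∑<∣≤ n f c h = subst (λ k → ∣ ∑< n f ∣ ℕ.≤ k · c) (List.length-upTo n) (∣∑∣≤ (upTo n) f c (h ∘ ∈-upTo⁻))


-- Functions of residue classes

Mod : ∀ {A : Set} → ℕ → (ℤ → A) → Set
Mod q F = ∀ {x y} → + q ∣ x - y → F x ≡ F y

∣-%ℕ : ∀ z q .{{_ : NonZero q}} → + q ∣ z - + (z %ℕ q)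
∣-%ℕ z q = divides (z /ℕ q) (cong (_- + (z %ℕ q)) (a≡a%ℕn+[a/ℕn]*n z q) ∙ lem (+ (z %ℕ q)) _)
  where lem : ∀ r s → r + s - r ≡ s
        lem = ring

small-∣⇒≡0 : ∀ {q z} → + q ∣ z → ∣ z ∣ ℕ.< q → z ≡ 0ℤ
small-∣⇒≡0 {q} {z} q∣z lt with ∣ z ∣ in eq
... | zero = ∣i∣≡0⇒i≡0 eq
... | suc n = contradiction (ℕ∣.∣⇒≤ (subst (q ∣ₙ_) eq (∣⇒∣ᵤ q∣z))) (ℕ.<⇒≱ lt)

∣m-n∣< : ∀ {m n q} → m ℕ.< q → n ℕ.< q → ∣ + m - + n ∣ ℕ.< q
∣m-n∣< {m} {n} m< n< = subst (ℕ._< _) (cong ∣_∣ (sym (m-n≡m⊖n m n)))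
  (≤-<-trans (ℤ.∣m⊝n∣≤m⊔n m n) (ℕ.⊔-pres-<m m< n<))

residue-unique : ∀ {q m n} → m ℕ.< q → n ℕ.< q → + q ∣ + m - + n → m ≡ n
residue-unique {m = m} {n} m< n< d = +-injective (ℤ.i-j≡0⇒i≡j (+ m) (+ n) (small-∣⇒≡0 d (∣m-n∣< m< n<)))

∣-sym : ∀ {q x y} → q ∣ x - y → q ∣ y - x
∣-sym {q} {x} {y} d = subst (q ∣_) (lem x y) (∣m⇒∣-m d)
  where lem : ∀ x y → - (x - y) ≡ y - x
        lem = ring

∑<-affine : ∀ q .{{_ : NonZero q}} a a' b {F : ℤ → ℤ} → Mod q F → + q ∣ a * a' - 1ℤ →
            ∑< q (λ s → F (b + a * + s)) ≡ ∑< q (λ s → F (+ s))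
∑<-affine q a a' b {F} Fm inv = ∑<-cong q (λ {s} _ → Fm (∣-%ℕ (b + a * + s) q)) ∙
  trans (∑<≡∑ q _) (∑-reindex φ ψ (Unique.upTo⁺ q) (Unique.upTo⁺ q) (λ {x} _ → ∈-upTo⁺ (n%ℕd<d (b + a * + x) q)) (λ {y} _ → ∈-upTo⁺ (n%ℕd<d (a' * (+ y - b)) q))
    (λ {x} x∈ → residue-unique (n%ℕd<d (a' * (+ φ x - b)) q) (∈-upTo⁻ x∈)
       (subst (+ q ∣_) (lem₁ a a' b (+ x) (+ φ x) (+ ψ (φ x)))
         (∣m∣n⇒∣m+n (∣m∣n⇒∣m-n (∣n⇒∣m*n (- a') (∣-%ℕ (b + a * + x) q)) (∣-%ℕ (a' * (+ φ x - b)) q)) (∣m⇒∣m*n (+ x) inv))))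
    (λ {y} y∈ → residue-unique (n%ℕd<d (b + a * + ψ y) q) (∈-upTo⁻ y∈)
       (subst (+ q ∣_) (lem₂ a a' b (+ y) (+ ψ y) (+ φ (ψ y)))
         (∣m∣n⇒∣m+n (∣m∣n⇒∣m-n (∣n⇒∣m*n (- a) (∣-%ℕ (a' * (+ y - b)) q)) (∣-%ℕ (b + a * + ψ y) q)) (∣m⇒∣m*n (+ y - b) inv))))
    (F ∘ +_) ∙ sym (∑<≡∑ q _))
  where
  φ ψ : ℕ → ℕ
  φ s = (b + a * + s) %ℕ q
  ψ y = (a' * (+ y - b)) %ℕ q
  lem₁ : ∀ a a' b x u v → - a' * (b + a * x - u) - (a' * (u - b) - v) + (a * a' - 1ℤ) * x ≡ v - x
  lem₁ = ring
  lem₂ : ∀ a a' b y u v → - a * (a' * (y - b) - u) - (b + a * u - v) + (a * a' - 1ℤ) * (y - b) ≡ v - y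
  lem₂ = ring

-- Arithmetic of ℚ(√m)

module ℚS = ℚSolver.+-*-Solver

ℚring : ACR.AlmostCommutativeRing 0ℓ 0ℓ
ℚring = ACR.fromCommutativeRing ℚ.+-*-commutativeRing (λ x → dec⇒maybe (ℚ.0ℚ ℚ.≟ x))

q : ℤ → ℚ
q n = n ℚ./ 1

q≃ : ∀ n → ℚ.toℚᵘ (q n) ℚᵘ.≃ ℚᵘ.mkℚᵘ n 0
q≃ n = ℚ.toℚᵘ-fromℚᵘ (ℚᵘ.mkℚᵘ n 0)

q-+ : ∀ a b → q (a + b) ≡ q a ℚ.+ q b
q-+ a b = ℚ.toℚᵘ-injective (ℚᵘ.≃-trans (q≃ (a + b)) (ℚᵘ.≃-trans (ℚᵘ.*≡* (lem a b))
  (ℚᵘ.≃-sym (ℚᵘ.≃-trans (ℚ.toℚᵘ-homo-+ (q a) (q b)) (ℚᵘ.+-cong (q≃ a) (q≃ b))))))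
  where lem : ∀ a b → (a + b) * 1ℤ ≡ (a * 1ℤ + b * 1ℤ) * 1ℤ
        lem = ring

q-* : ∀ a b → q (a * b) ≡ q a ℚ.* q b
q-* a b = ℚ.toℚᵘ-injective (ℚᵘ.≃-trans (q≃ (a * b)) (ℚᵘ.≃-trans (ℚᵘ.*≡* refl)
  (ℚᵘ.≃-sym (ℚᵘ.≃-trans (ℚ.toℚᵘ-homo-* (q a) (q b)) (ℚᵘ.*-cong (q≃ a) (q≃ b))))))

q-injective : ∀ {a b} → q a ≡ q b → a ≡ b
q-injective {a} {b} eq with ℚᵘ.*≡* e ← ℚᵘ.≃-trans (ℚᵘ.≃-sym (q≃ a)) (ℚᵘ.≃-trans (ℚ.toℚᵘ-cong eq) (q≃ b)) =
  trans (sym (*-identityʳ a)) (e ∙ *-identityʳ b)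

q-↥↧ : ∀ r → q (+ ℚ.↧ₙ r) ℚ.* r ≡ q (ℚ.↥ r)
q-↥↧ r@record{} = ℚ.toℚᵘ-injective (ℚᵘ.≃-trans (ℚ.toℚᵘ-homo-* (q (+ ℚ.↧ₙ r)) r)
  (ℚᵘ.≃-trans (ℚᵘ.*-cong (q≃ (+ ℚ.↧ₙ r)) ℚᵘ.≃-refl) (ℚᵘ.≃-trans (ℚᵘ.*≡* (lem (ℚ.↧ r) (ℚ.↥ r) ∙ cong (λ z → ℚ.↥ r * + z) (sym (ℕ.*-identityˡ (ℚ.↧ₙ r))))) (ℚᵘ.≃-sym (q≃ (ℚ.↥ r))))))
  where lem : ∀ (d n : ℤ) → d * n * 1ℤ ≡ n * d
        lem = ring

q-inverse : ∀ d → d ≢ 0ℤ → ∃[ r ] q d ℚ.* r ≡ ℚ.1ℚ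
q-inverse d d≢0 = ℚ.1/_ (q d) {{nz}} , ℚ.*-inverseʳ (q d) {{nz}}
  where nz : ℚ.NonZero (q d)
        nz = ℚ.≢-nonZero (d≢0 ∘ q-injective)

module QuadraticArithmetic (m : ℤ) where
  module Q = QuadraticField m
  open Q public using (K; Integral)
  open ℚS using (_:+_; _:*_; _:=_; con)

  infixl 6 _⊕_
  infixl 7 _⊗_

  opaque
    _⊕_ _⊗_ : K → K → K
    _⊕_ = Q._⊕_
    _⊗_ = Q._⊗_

    0K 1K : K
    0K = Q.0K
    1K = Q.1K

    ι : ℤ → K
    ι = Q.fromℤ

    ⊕-def : ∀ x y → x ⊕ y ≡ x Q.⊕ y
    ⊕-def x y = refl

    ⊗-def : ∀ x y → x ⊗ y ≡ x Q.⊗ y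
    ⊗-def x y = refl

    0K-def : 0K ≡ Q.0K
    0K-def = refl

    1K-def : 1K ≡ Q.1K
    1K-def = refl

    ι-1 : ι 1ℤ ≡ 1K
    ι-1 = refl

    monic : List ℤ → K → K
    monic = Q.monic

    monic-def : ∀ cs α → monic cs α ≡ Q.monic cs α
    monic-def cs α = refl

    monic-[] : ∀ α → monic [] α ≡ 1K
    monic-[] α = refl

    monic-∷ : ∀ c cs α → monic (c ∷ cs) α ≡ ι c ⊕ α ⊗ monic cs α
    monic-∷ c cs α = refl

    ⊗-comm : ∀ x y → x ⊗ y ≡ y ⊗ x
    ⊗-comm (a +√ b) (c +√ d) = cong₂ _+√_
      (ℚS.solve 5 (λ q a b c d → a :* c :+ q :* (b :* d) := c :* a :+ q :* (d :* b)) refl (q m) a b c d)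
      (ℚS.solve 4 (λ a b c d → a :* d :+ b :* c := c :* b :+ d :* a) refl a b c d)

    ⊗-assoc : ∀ x y z → (x ⊗ y) ⊗ z ≡ x ⊗ (y ⊗ z)
    ⊗-assoc (a +√ b) (c +√ d) (e +√ f) = cong₂ _+√_
      (ℚS.solve 7 (λ q a b c d e f →
           (a :* c :+ q :* (b :* d)) :* e :+ q :* ((a :* d :+ b :* c) :* f)
        := a :* (c :* e :+ q :* (d :* f)) :+ q :* (b :* (c :* f :+ d :* e)))
         refl (q m) a b c d e f)
      (ℚS.solve 7 (λ q a b c d e f →
           (a :* c :+ q :* (b :* d)) :* f :+ (a :* d :+ b :* c) :* e
        := a :* (c :* f :+ d :* e) :+ b :* (c :* e :+ q :* (d :* f)))
         refl (q m) a b c d e f)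

    ⊗-identityˡ : ∀ x → 1K ⊗ x ≡ x
    ⊗-identityˡ (a +√ b) = cong₂ _+√_
      (ℚS.solve 3 (λ q a b → con ℚ.1ℚ :* a :+ q :* (con ℚ.0ℚ :* b) := a) refl (q m) a b)
      (ℚS.solve 2 (λ a b → con ℚ.1ℚ :* b :+ con ℚ.0ℚ :* a := b) refl a b)

    ⊗-distribˡ : ∀ x y z → x ⊗ (y ⊕ z) ≡ x ⊗ y ⊕ x ⊗ z
    ⊗-distribˡ (a +√ b) (c +√ d) (e +√ f) = cong₂ _+√_
      (ℚS.solve 7 (λ q a b c d e f → a :* (c :+ e) :+ q :* (b :* (d :+ f)) := a :* c :+ q :* (b :* d) :+ (a :* e :+ q :* (b :* f)))
         refl (q m) a b c d e f)
      (ℚS.solve 6 (λ a b c d e f → a :* (d :+ f) :+ b :* (c :+ e) := a :* d :+ b :* c :+ (a :* f :+ b :* e)) refl a b c d e f)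

    ⊕-identityˡ : ∀ x → 0K ⊕ x ≡ x
    ⊕-identityˡ (a +√ b) = cong₂ _+√_ (ℚ.+-identityˡ a) (ℚ.+-identityˡ b)

    ⊕-identityʳ : ∀ x → x ⊕ 0K ≡ x
    ⊕-identityʳ (a +√ b) = cong₂ _+√_ (ℚ.+-identityʳ a) (ℚ.+-identityʳ b)

    ⊗-zeroʳ : ∀ x → x ⊗ 0K ≡ 0K
    ⊗-zeroʳ (a +√ b) = cong₂ _+√_
      (ℚS.solve 3 (λ q a b → a :* con ℚ.0ℚ :+ q :* (b :* con ℚ.0ℚ) := con ℚ.0ℚ) refl (q m) a b)
      (ℚS.solve 2 (λ a b → a :* con ℚ.0ℚ :+ b :* con ℚ.0ℚ := con ℚ.0ℚ) refl a b)

    ⊗-interchange : ∀ x y z w → (x ⊗ y) ⊗ (z ⊗ w) ≡ (x ⊗ z) ⊗ (y ⊗ w)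
    ⊗-interchange x y z w = begin
      (x ⊗ y) ⊗ (z ⊗ w) ≡⟨ ⊗-assoc x y (z ⊗ w) ⟩
      x ⊗ (y ⊗ (z ⊗ w)) ≡⟨ cong (x ⊗_) (⊗-assoc y z w) ⟨
      x ⊗ ((y ⊗ z) ⊗ w) ≡⟨ cong (λ u → x ⊗ (u ⊗ w)) (⊗-comm y z) ⟩
      x ⊗ ((z ⊗ y) ⊗ w) ≡⟨ cong (x ⊗_) (⊗-assoc z y w) ⟩
      x ⊗ (z ⊗ (y ⊗ w)) ≡⟨ ⊗-assoc x z (y ⊗ w) ⟨
      (x ⊗ z) ⊗ (y ⊗ w) ∎


    ι-* : ∀ a b → ι (a * b) ≡ ι a ⊗ ι b
    ι-* a b = cong₂ _+√_
      (q-* a b ∙ ℚS.solve 3 (λ q a b → a :* b := a :* b :+ q :* (con ℚ.0ℚ :* con ℚ.0ℚ)) refl (q m) (q a) (q b))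
      (ℚS.solve 2 (λ a b → con ℚ.0ℚ := a :* con ℚ.0ℚ :+ con ℚ.0ℚ :* b) refl (q a) (q b))

    ι-inverse : ∀ d → d ≢ 0ℤ → ∃[ κ ] ι d ⊗ κ ≡ 1K
    ι-inverse d d≢0 = let r , e = q-inverse d d≢0 in (r +√ ℚ.0ℚ) , cong₂ _+√_
      (ℚS.solve 3 (λ q a b → a :* b :+ q :* (con ℚ.0ℚ :* con ℚ.0ℚ) := a :* b) refl (q m) (q d) r ∙ e)
      (ℚS.solve 2 (λ a b → a :* con ℚ.0ℚ :+ con ℚ.0ℚ :* b := con ℚ.0ℚ) refl (q d) r)

    ⊕-assoc : ∀ x y z → (x ⊕ y) ⊕ z ≡ x ⊕ (y ⊕ z)
    ⊕-assoc (a +√ b) (c +√ d) (e +√ f) = cong₂ _+√_ (ℚ.+-assoc a c e) (ℚ.+-assoc b d f)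

    ⊗-cancelˡ : ∀ κ κ⁻¹ {α β} → κ ⊗ κ⁻¹ ≡ 1K → κ ⊗ α ≡ κ ⊗ β → α ≡ β
    ⊗-cancelˡ κ κ⁻¹ {α} {β} inv eq = sym (back α) ∙ cong (κ⁻¹ ⊗_) eq ∙ back β
      where
      back : ∀ x → κ⁻¹ ⊗ (κ ⊗ x) ≡ x
      back x = sym (⊗-assoc κ⁻¹ κ x) ∙ cong (_⊗ x) (⊗-comm κ⁻¹ κ ∙ inv) ∙ ⊗-identityˡ x

    ι-cancel : ∀ d {α β} → d ≢ 0ℤ → ι d ⊗ α ≡ ι d ⊗ β → α ≡ β
    ι-cancel d d≢0 = let κ , e = ι-inverse d d≢0 in ⊗-cancelˡ (ι d) κ e

-- Bézout arithmetic over ℤ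

i*j≢0 : ∀ {i j} → i ≢ 0ℤ → j ≢ 0ℤ → i * j ≢ 0ℤ
i*j≢0 {i} i≢0 j≢0 eq = [ i≢0 , j≢0 ]′ (ℤ.i*j≡0⇒i≡0∨j≡0 i eq)

*-cancelˡ : ∀ k {i j} → k ≢ 0ℤ → k * i ≡ k * j → i ≡ j
*-cancelˡ k {i} {j} k≢0 = ℤ.*-cancelˡ-≡ k i j {{ℤ.≢-nonZero k≢0}}

-- An equation x = y is proved by writing x - y as a linear combination of
-- differences that vanish by hypothesis.
infixr 5 _⊞_
infix 6 _⊛_

_⊛_ : ∀ c {u v} → u ≡ v → c * (u - v) ≡ 0ℤ
_⊛_ c {u} refl = cong (c *_) (+-inverseʳ u) ∙ *-zeroʳ c

_⊞_ : ∀ {x y} → x ≡ 0ℤ → y ≡ 0ℤ → x + y ≡ 0ℤ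
refl ⊞ refl = refl

combination : ∀ {x y z} → x - y ≡ z → z ≡ 0ℤ → x ≡ y
combination {x} {y} e z≡0 = ℤ.i-j≡0⇒i≡j x y (e ∙ z≡0)

record Bézout (r v : ℤ) : Set where
  constructor bézout
  field
    {g r₁ v₁ x y} : ℤ
    r≡ : r ≡ g * r₁
    v≡ : v ≡ g * v₁
    one : x * r₁ + y * v₁ ≡ 1ℤ

bézout-step : ∀ {n s} r k → r ≡ s + k * n → Bézout n s → Bézout r n
bézout-step r k r≡ (bézout {g} {a} {b} {x} {y} n≡ s≡ one) =
  bézout {g = g} {b + k * a} {a} {y} {x - y * k}
    (r≡ ∙ cong₂ (λ u v → u + k * v) s≡ n≡ ∙ lem₁ g b k a) n≡ (lem₂ y b k a x ∙ one)
  where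
  lem₁ : ∀ g b k a → g * b + k * (g * a) ≡ g * (b + k * a)
  lem₁ = ring
  lem₂ : ∀ y b k a x → y * (b + k * a) + (x - y * k) * a ≡ x * a + y * b
  lem₂ = ring

bézout-neg : ∀ {r v} → Bézout r v → Bézout r (- v)
bézout-neg (bézout {g} {a} {b} {x} {y} r≡ v≡ one) =
  bézout {g = g} {a} { - b} {x} { - y} r≡ (cong -_ v≡ ∙ ℤ.neg-distribʳ-* g b) (lem x a y b ∙ one)
  where lem : ∀ x a y b → x * a + - y * - b ≡ x * a + y * b
        lem = ring

opaque
  bézout-ℕ : ∀ n r → Bézout r (+ n)
  bézout-ℕ = <-rec (λ n → ∀ r → Bézout r (+ n)) step
    where
    step : ∀ n → (∀ {k} → k ℕ.< n → ∀ r → Bézout r (+ k)) → ∀ r → Bézout r (+ n)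
    step zero rec r = bézout {g = r} {1ℤ} {0ℤ} {1ℤ} {0ℤ} (sym (*-identityʳ r)) (sym (*-zeroʳ r)) refl
    step n@(suc _) rec r = bézout-step r (r /ℕ n) (a≡a%ℕn+[a/ℕn]*n r n) (rec (n%ℕd<d r n) (+ n))

  bézout-ℤ : ∀ r v → Bézout r v
  bézout-ℤ r (+ n) = bézout-ℕ n r
  bézout-ℤ r -[1+ n ] = bézout-neg (bézout-ℕ (suc n) r)

Cop : ℤ → ℤ → Set
Cop a b = ∃[ x ] ∃[ y ] x * a + y * b ≡ 1ℤ

cop-sym : ∀ {a b} → Cop a b → Cop b a
cop-sym {a} {b} (x , y , e) = y , x , ℤ.+-comm (y * b) (x * a) ∙ e

cop-* : ∀ {a b c} → Cop a b → Cop a c → Cop a (b * c)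
cop-* {a} {b} {c} (x , y , e) (x' , y' , e') =
  x * x' * a + x * y' * c + y * b * x' , y * y' , lem x y x' y' a b c ∙ cong₂ _*_ e e'
  where lem : ∀ x y x' y' a b c → (x * x' * a + x * y' * c + y * b * x') * a + y * y' * (b * c) ≡ (x * a + y * b) * (x' * a + y' * c)
        lem = ring

cop-^ : ∀ {a b} k → Cop a b → Cop a (b ^ k)
cop-^ {a} zero c = 0ℤ , 1ℤ , cong (_+ 1ℤ) (*-zeroˡ a) ∙ refl
cop-^ (suc k) c = cop-* c (cop-^ k c)

cop-∣ : ∀ {a b c} → Cop a b → a ∣ b * c → a ∣ c
cop-∣ {a} {b} {c} (x , y , e) d = subst (a ∣_) (lem x y a b c ∙ cong (_* c) e ∙ *-identityˡ c)
  (∣m∣n⇒∣m+n (∣m⇒∣m*n (x * c) ∣-refl) (∣n⇒∣m*n y d))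
  where lem : ∀ x y a b c → a * (x * c) + y * (b * c) ≡ (x * a + y * b) * c
        lem = ring

∣-*-cancelˡ : ∀ k {i j} → k ≢ 0ℤ → k * i ∣ k * j → i ∣ j
∣-*-cancelˡ k k≢0 = *-cancelˡ-∣ k {{ℤ.≢-nonZero k≢0}}

∣-reduce : ∀ {x y g a b} → y ≡ g * a → x ≡ g * b → a ∣ 1ℤ → y ∣ x
∣-reduce {g = g} {a} {b} refl refl (divides c 1≡ca) = divides (b * c) (lem g b ∙ cong (g * b *_) 1≡ca ∙ lem' g b c a)
  where
  lem : ∀ g b → g * b ≡ g * b * 1ℤ
  lem = ring
  lem' : ∀ g b c a → g * b * (c * a) ≡ b * c * (g * a)
  lem' = ring

squareFree-∣ : ∀ {m} → SquareFree m → ∀ y x → y * y ∣ m * (x * x) → y ∣ x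
squareFree-∣ {m} sf y x y²∣ = reduce (bézout-ℤ y x)
  where
  lem₁ : ∀ g a → g * a * (g * a) ≡ g * g * (a * a)
  lem₁ = ring
  lem₂ : ∀ m g b → m * (g * b * (g * b)) ≡ g * g * (b * b * m)
  lem₂ = ring
  a²∣m : ∀ {g a b} → g ≢ 0ℤ → y ≡ g * a → x ≡ g * b → Cop a b → a * a ∣ m
  a²∣m {g} {a} {b} g≢0 y≡ x≡ ab = cop-∣ (cop-* (cop-sym (cop-* (cop-sym ab) (cop-sym ab))) (cop-sym (cop-* (cop-sym ab) (cop-sym ab))))
    (∣-*-cancelˡ (g * g) (i*j≢0 g≢0 g≢0)
      (subst₂ _∣_ (cong₂ _*_ y≡ y≡ ∙ lem₁ g a) (cong (λ z → m * (z * z)) x≡ ∙ lem₂ m g b) y²∣))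
  reduce : Bézout y x → y ∣ x
  reduce (bézout {g} {a} {b} {u} {v} y≡ x≡ one) = case g ℤ.≟ 0ℤ of λ where
    (yes g≡0) → divides 0ℤ (x≡ ∙ cong (_* b) g≡0 ∙ *-zeroˡ b ∙ sym (*-zeroˡ y))
    (no g≢0) → ∣-reduce {g = g} {a} {b} y≡ x≡ (sf a (a²∣m g≢0 y≡ x≡ (u , v , one)))

^≢0 : ∀ {a} k → a ≢ 0ℤ → a ^ k ≢ 0ℤ
^≢0 zero a≢0 = λ ()
^≢0 (suc k) a≢0 = i*j≢0 a≢0 (^≢0 k a≢0)

*-^ : ∀ a b k → (a * b) ^ k ≡ a ^ k * b ^ k
*-^ a b zero = refl
*-^ a b (suc k) = cong (a * b *_) (*-^ a b k) ∙ *-interchange a b (a ^ k) (b ^ k)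


∣^∣ : ∀ a k → ∣ a ^ k ∣ ≡ ∣ a ∣ ℕ.^ k
∣^∣ a zero = refl
∣^∣ a (suc k) = abs-* a (a ^ k) ∙ cong (∣ a ∣ ·_) (∣^∣ a k)

n<2^n : ∀ n → n ℕ.< 2 ℕ.^ n
n<2^n zero = s≤s z≤n
n<2^n (suc n) = +-mono-≤ (ℕ.>-nonZero⁻¹ (2 ℕ.^ n) {{ℕ.m^n≢0 2 n}}) (≤-trans (n<2^n n) (m≤m+n _ 0))

unit-from-powers : ∀ e b → e ≢ 0ℤ → b ≢ 0ℤ → (∀ k → b ^ k ∣ e) → b ∣ 1ℤ
unit-from-powers e b e≢0 b≢0 h with ∣ b ∣ in eq
... | 0 = contradiction (∣i∣≡0⇒i≡0 eq) b≢0
... | 1 = ∣ᵤ⇒∣ (ℕ∣.∣-reflexive eq)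
... | suc (suc n) = contradiction
  (ℕ∣.∣⇒≤ {{ℕ.≢-nonZero (e≢0 ∘ ∣i∣≡0⇒i≡0)}} (subst (_∣ₙ ∣ e ∣) (∣^∣ b ∣ e ∣ ∙ cong (ℕ._^ ∣ e ∣) eq) (∣⇒∣ᵤ (h ∣ e ∣))))
  (ℕ.<⇒≱ (<-≤-trans (n<2^n ∣ e ∣) (^-monoˡ-≤ ∣ e ∣ (s≤s (s≤s z≤n)))))

bounded-denominators : ∀ e b a → e ≢ 0ℤ → b ≢ 0ℤ → (∀ k → b ^ k ∣ e * a ^ k) → b ∣ a
bounded-denominators e b a e≢0 b≢0 h = reduce (bézout-ℤ b a)
  where
  reduce : Bézout b a → b ∣ a
  reduce (bézout {g} {b₁} {a₁} {x} {y} b≡ a≡ one) = ∣-reduce {g = g} {b₁} {a₁} b≡ a≡ (unit-from-powers e b₁ e≢0 b₁≢0 b₁^k∣e)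
    where
    g≢0 : g ≢ 0ℤ
    g≢0 g≡0 = b≢0 (b≡ ∙ cong (_* b₁) g≡0 ∙ *-zeroˡ b₁)
    b₁≢0 : b₁ ≢ 0ℤ
    b₁≢0 b₁≡0 = b≢0 (b≡ ∙ cong (g *_) b₁≡0 ∙ *-zeroʳ g)
    b₁^k∣e : ∀ k → b₁ ^ k ∣ e
    b₁^k∣e k = cop-∣ (cop-sym (cop-^ k (cop-sym (cop-^ k (x , y , one)))))
      (∣-*-cancelˡ (g ^ k) (^≢0 k g≢0)
        (subst₂ _∣_ (cong (_^ k) b≡ ∙ *-^ g b₁ k) (cong (λ z → e * z ^ k) a≡ ∙ cong (e *_) (*-^ g a₁ k) ∙ *-rotate e (g ^ k) (a₁ ^ k)) (h k)))

prime-∣-* : ∀ {p} → Prime p → ∀ x y → + p ∣ x * y → (+ p ∣ x) ⊎ (+ p ∣ y)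
prime-∣-* {p} pr x y d = [ inj₁ ∘ ∣ᵤ⇒∣ , inj₂ ∘ ∣ᵤ⇒∣ ]′ (euclidsLemma ∣ x ∣ ∣ y ∣ pr (subst (p ∣ₙ_) (abs-* x y) (∣⇒∣ᵤ d)))

prime-∤1 : ∀ {p} → Prime p → ¬ (+ p ∣ 1ℤ)
prime-∤1 {p} pr d = ℕ.¬prime[1] (subst Prime (ℕ∣.∣1⇒≡1 (∣⇒∣ᵤ d)) pr)

q-neg : ∀ a → q (- a) ≡ ℚ.- q a
q-neg a = cong q (sym (-1*i≡-i a)) ∙ q-* -1ℤ a ∙ ℚS.solve 1 (λ a → ℚS.con (q -1ℤ) ℚS.:* a ℚS.:= ℚS.:- a) refl (q a)

data Kind (m t f : ℤ) : Set where
  odd-disc : t ≡ 1ℤ → f ≡ 1ℤ → Kind m t f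
  even-disc : ∀ j → t ≡ 0ℤ → f ≡ + 2 → m ≡ + 4 * j + + 2 ⊎ m ≡ + 4 * j + + 3 → Kind m t f

parity : ∀ w → (∃[ y ] w ≡ + 2 * y) ⊎ (∃[ y ] w ≡ + 2 * y + 1ℤ)
parity w = cases (w %ℕ 2) (n%ℕd<d w 2) (a≡a%ℕn+[a/ℕn]*n w 2)
  where
  lem₀ : ∀ y → + 0 + y * + 2 ≡ + 2 * y
  lem₀ = ring
  lem₁ : ∀ y → + 1 + y * + 2 ≡ + 2 * y + 1ℤ
  lem₁ = ring
  cases : ∀ r → r ℕ.< 2 → w ≡ + r + w /ℕ 2 * + 2 → (∃[ y ] w ≡ + 2 * y) ⊎ (∃[ y ] w ≡ + 2 * y + 1ℤ)
  cases 0 _ e = inj₁ (w /ℕ 2 , e ∙ lem₀ (w /ℕ 2))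
  cases 1 _ e = inj₂ (w /ℕ 2 , e ∙ lem₁ (w /ℕ 2))
  cases (suc (suc _)) (s≤s (s≤s ())) _

not-multiple : ∀ q r x → 0 ℕ.< r → r ℕ.< q → + q * x ≢ + r
not-multiple q r x 0<r r<q e = ℕ.<⇒≢ 0<r (sym (+-injective (small-∣⇒≡0 {q} {+ r} (divides x (sym e ∙ *-comm (+ q) x)) r<q)))

square-ℕ : ∀ i → i * i ≡ + (∣ i ∣ · ∣ i ∣)
square-ℕ (+ n) = sym (pos-* n n)
square-ℕ -[1+ n ] = refl

Span₂ : (p q r X Y : ℤ) → Set
Span₂ p q r X Y = ∃[ s ] ∃[ s' ] (X ≡ s * p + s' * q) × (Y ≡ s' * r)

Span₃ : (p q r u v X Y : ℤ) → Set
Span₃ p q r u v X Y = ∃[ s ] ∃[ s' ] ∃[ w ] (X ≡ s * p + s' * q + w * u) × (Y ≡ s' * r + w * v)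

Triangular : (p q r u v : ℤ) → Set
Triangular p q r u v = ∃[ p' ] ∃[ q' ] ∃[ r' ] (∀ X Y → Span₃ p q r u v X Y ⇔ Span₂ p' q' r' X Y)

hermite : ∀ p q r u v → Triangular p q r u v
hermite p q r u v = outer (bézout-ℤ r v)
  where
  outer : Bézout r v → Triangular p q r u v
  outer (bézout {g} {r₁} {v₁} {x} {y} r≡ v≡ one) = inner (bézout-ℤ p (v₁ * q - r₁ * u))
    where
    inner : Bézout p (v₁ * q - r₁ * u) → Triangular p q r u v
    inner (bézout {p'} {a} {b} {x₂} {y₂} p≡ q″≡ one₂) = p' , x * q + y * u , g , λ X Y → mk⇔
      (λ (s , s' , w , X≡ , Y≡) → s * a + (s' * y - w * x) * b , s' * r₁ + w * v₁ ,
        combination (lem₁ X s s' w p q u x y r₁ v₁ a b p') (1ℤ ⊛ X≡ ⊞ (- (s' * q + w * u)) ⊛ one ⊞ s ⊛ p≡ ⊞ (s' * y - w * x) ⊛ q″≡) ,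
        combination (lem₂ Y s' w r v r₁ v₁ g) (1ℤ ⊛ Y≡ ⊞ s' ⊛ r≡ ⊞ w ⊛ v≡))
      (λ (s , s' , X≡ , Y≡) → s * x₂ , s * (y₂ * v₁) + s' * x , s' * y - s * (y₂ * r₁) ,
        combination (lem₃ X s s' p q u x y r₁ v₁ a b p' x₂ y₂) (1ℤ ⊛ X≡ ⊞ (- (s * p')) ⊛ one₂ ⊞ (- (s * x₂)) ⊛ p≡ ⊞ (- (s * y₂)) ⊛ q″≡) ,
        combination (lem₄ Y s s' r v x y r₁ v₁ g y₂) (1ℤ ⊛ Y≡ ⊞ (- (s' * g)) ⊛ one ⊞ (- (s * (y₂ * v₁) + s' * x)) ⊛ r≡ ⊞ (- (s' * y - s * (y₂ * r₁))) ⊛ v≡))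
      where
      lem₁ : ∀ X s s' w p q u x y r v a b p' → X - ((s * a + (s' * y - w * x) * b) * p' + (s' * r + w * v) * (x * q + y * u)) ≡
        1ℤ * (X - (s * p + s' * q + w * u)) + (- (s' * q + w * u) * (x * r + y * v - 1ℤ) + (s * (p - p' * a) + (s' * y - w * x) * (v * q - r * u - p' * b)))
      lem₁ = ring
      lem₂ : ∀ Y s w r v r₁ v₁ g → Y - (s * r₁ + w * v₁) * g ≡ 1ℤ * (Y - (s * r + w * v)) + (s * (r - g * r₁) + w * (v - g * v₁))
      lem₂ = ring
      lem₃ : ∀ X s s' p q u x y r v a b p' x₂ y₂ → X - (s * x₂ * p + (s * (y₂ * v) + s' * x) * q + (s' * y - s * (y₂ * r)) * u) ≡
        1ℤ * (X - (s * p' + s' * (x * q + y * u))) + (- (s * p') * (x₂ * a + y₂ * b - 1ℤ) + (- (s * x₂) * (p - p' * a) + - (s * y₂) * (v * q - r * u - p' * b)))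
      lem₃ = ring
      lem₄ : ∀ Y s s' r v x y r₁ v₁ g y₂ → Y - ((s * (y₂ * v₁) + s' * x) * r + (s' * y - s * (y₂ * r₁)) * v) ≡
        1ℤ * (Y - s' * g) + (- (s' * g) * (x * r₁ + y * v₁ - 1ℤ) + (- (s * (y₂ * v₁) + s' * x) * (r - g * r₁) + - (s' * y - s * (y₂ * r₁)) * (v - g * v₁)))
      lem₄ = ring

squares-sum≡0 : ∀ x n y → 0 ℕ.< n → x · x ℕ.+ n · (y · y) ≡ 0 → x ≡ 0 × y ≡ 0
squares-sum≡0 zero (suc n) zero _ _ = refl , refl
squares-sum≡0 zero (suc n) (suc y) _ ()
squares-sum≡0 (suc x) (suc n) y _ ()

large-coefficient : ∀ n e s → 4 ℕ.< n → n · (e · e) ℕ.+ s ≡ 4 → e ≡ 0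
large-coefficient n zero s 4<n eq = refl
large-coefficient n (suc e) s 4<n eq = contradiction eq (ℕ.<⇒≢ (<-≤-trans 4<n
  (≤-trans (m≤m*n n (suc e · suc e)) (m≤m+n (n · (suc e · suc e)) s))) ∘ sym)

unit-cases : ∀ i j → i * j ≡ 1ℤ → i ≡ 1ℤ ⊎ i ≡ -1ℤ
unit-cases i j eq = cases i refl (ℕ∣.∣1⇒≡1 (∣⇒∣ᵤ {i} {1ℤ} (divides j (sym eq ∙ *-comm i j))))
  where
  cases : ∀ z → i ≡ z → ∣ z ∣ ≡ 1 → i ≡ 1ℤ ⊎ i ≡ -1ℤ
  cases (+ 1) e refl = inj₁ e
  cases -[1+ 0 ] e refl = inj₂ e

record QuadraticOrder : Set where
  field
    m t f n₀ : ℤ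
    N        : ℕ
    disc     : f * f * m + + 4 * n₀ ≡ t * t
    disc-N   : + 4 * n₀ - t * t ≡ + N
    N>4      : 4 ℕ.< N
    kind     : Kind m t f
    sf       : SquareFree m

  N>0 : 0 ℕ.< N
  N>0 = <-trans (s≤s z≤n) N>4

module QuadraticForms (𝓞 : QuadraticOrder) where
  open QuadraticOrder 𝓞 public

  -- The maximal order ℤ[ω], ω² = tω - n₀, t² - 4n₀ = f²m, ω = (t + f√m)/2

  open QuadraticArithmetic m public
  private module S = ℚS
  open ℚS using (_:+_; _:*_; _:=_; con; :-_)

  private
    tq fq mq nq : ℚ
    tq = q t
    fq = q f
    mq = q m
    nq = q n₀

    disc-ℚ : fq ℚ.* fq ℚ.* mq ℚ.+ q (+ 4) ℚ.* nq ≡ tq ℚ.* tq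
    disc-ℚ = sym (q-+ (f * f * m) (+ 4 * n₀) ∙ cong₂ ℚ._+_ (q-* (f * f) m ∙ cong (ℚ._* mq) (q-* f f)) (q-* (+ 4) n₀)) ∙
      trans (cong q disc) (q-* t t)

    τ gq : ℚ
    τ = tq ℚ.* ℚ.½
    gq = fq ℚ.* ℚ.½

    τ+τ : τ ℚ.+ τ ≡ tq
    τ+τ = sym (ℚ.*-distribˡ-+ tq ℚ.½ ℚ.½) ∙ ℚ.*-identityʳ tq

    norm-ℚ : gq ℚ.* gq ℚ.* mq ≡ τ ℚ.* τ ℚ.+ ℚ.- nq
    norm-ℚ = begin
      fq ℚ.* h ℚ.* (fq ℚ.* h) ℚ.* mq ≡⟨ lem₁ fq mq h (q (+ 4) ℚ.* nq) ⟩
      (fq ℚ.* fq ℚ.* mq ℚ.+ q (+ 4) ℚ.* nq) ℚ.* (h ℚ.* h) ℚ.+ ℚ.- (q (+ 4) ℚ.* nq ℚ.* (h ℚ.* h))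
        ≡⟨ cong₂ (λ x y → x ℚ.* (h ℚ.* h) ℚ.+ ℚ.- y) disc-ℚ (lem₂ (q (+ 4)) nq (h ℚ.* h) ∙ ℚ.*-identityˡ nq) ⟩
      tq ℚ.* tq ℚ.* (h ℚ.* h) ℚ.+ ℚ.- nq ≡⟨ cong (ℚ._+ ℚ.- nq) (lem₃ tq h) ⟩
      τ ℚ.* τ ℚ.+ ℚ.- nq ∎
      where
      h = ℚ.½
      lem₁ : ∀ fq mq h r → fq ℚ.* h ℚ.* (fq ℚ.* h) ℚ.* mq ≡ (fq ℚ.* fq ℚ.* mq ℚ.+ r) ℚ.* (h ℚ.* h) ℚ.+ ℚ.- (r ℚ.* (h ℚ.* h))
      lem₁ = Solver.solve-∀ ℚring
      lem₂ : ∀ a b c → a ℚ.* b ℚ.* c ≡ a ℚ.* c ℚ.* b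
      lem₂ = Solver.solve-∀ ℚring
      lem₃ : ∀ tq h → tq ℚ.* tq ℚ.* (h ℚ.* h) ≡ tq ℚ.* h ℚ.* (tq ℚ.* h)
      lem₃ = Solver.solve-∀ ℚring

  -- ⟪ u , v ⟫ is u + vω.
  opaque
    unfolding _⊗_

    ⟪_,_⟫ : ℤ → ℤ → K
    ⟪ u , v ⟫ = (q u ℚ.+ q v ℚ.* τ) +√ (q v ℚ.* gq)

    ⟪⟫-⊕ : ∀ u v u' v' → ⟪ u , v ⟫ ⊕ ⟪ u' , v' ⟫ ≡ ⟪ u + u' , v + v' ⟫
    ⟪⟫-⊕ u v u' v' = sym (cong₂ _+√_
      (cong₂ (λ x y → x ℚ.+ y ℚ.* τ) (q-+ u u') (q-+ v v') ∙
        S.solve 5 (λ a b c d e → (a :+ b) :+ (c :+ d) :* e := (a :+ c :* e) :+ (b :+ d :* e)) refl (q u) (q u') (q v) (q v') τ)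
      (cong (ℚ._* gq) (q-+ v v') ∙ ℚ.*-distribʳ-+ gq (q v) (q v')))

    ⟪⟫-⊗ : ∀ u v u' v' → ⟪ u , v ⟫ ⊗ ⟪ u' , v' ⟫ ≡ ⟪ u * u' - n₀ * v * v' , u * v' + v * u' + t * v * v' ⟫
    ⟪⟫-⊗ u v u' v' = cong₂ _+√_
      (begin
        (U ℚ.+ V ℚ.* τ) ℚ.* (U' ℚ.+ V' ℚ.* τ) ℚ.+ mq ℚ.* (V ℚ.* gq ℚ.* (V' ℚ.* gq))
          ≡⟨ lem₁ U V U' V' τ gq mq ⟩
        U ℚ.* U' ℚ.+ (U ℚ.* V' ℚ.+ V ℚ.* U') ℚ.* τ ℚ.+ V ℚ.* V' ℚ.* (τ ℚ.* τ ℚ.+ gq ℚ.* gq ℚ.* mq)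
          ≡⟨ cong (λ z → U ℚ.* U' ℚ.+ (U ℚ.* V' ℚ.+ V ℚ.* U') ℚ.* τ ℚ.+ V ℚ.* V' ℚ.* (τ ℚ.* τ ℚ.+ z)) norm-ℚ ⟩
        U ℚ.* U' ℚ.+ (U ℚ.* V' ℚ.+ V ℚ.* U') ℚ.* τ ℚ.+ V ℚ.* V' ℚ.* (τ ℚ.* τ ℚ.+ (τ ℚ.* τ ℚ.+ ℚ.- nq))
          ≡⟨ lem₂ U V U' V' τ nq ⟩
        (U ℚ.* U' ℚ.+ ℚ.- (nq ℚ.* V ℚ.* V')) ℚ.+ (U ℚ.* V' ℚ.+ V ℚ.* U' ℚ.+ (τ ℚ.+ τ) ℚ.* V ℚ.* V') ℚ.* τ
          ≡⟨ cong (λ z → (U ℚ.* U' ℚ.+ ℚ.- (nq ℚ.* V ℚ.* V')) ℚ.+ (U ℚ.* V' ℚ.+ V ℚ.* U' ℚ.+ z ℚ.* V ℚ.* V') ℚ.* τ) τ+τ ⟩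
        (U ℚ.* U' ℚ.+ ℚ.- (nq ℚ.* V ℚ.* V')) ℚ.+ (U ℚ.* V' ℚ.+ V ℚ.* U' ℚ.+ tq ℚ.* V ℚ.* V') ℚ.* τ
          ≡⟨ cong₂ (λ x y → x ℚ.+ y ℚ.* τ) q-re q-im ⟨
        q (u * u' - n₀ * v * v') ℚ.+ q (u * v' + v * u' + t * v * v') ℚ.* τ ∎)
      (lem₃ U V U' V' τ gq ∙
             cong (ℚ._* gq) (cong (λ z → U ℚ.* V' ℚ.+ V ℚ.* U' ℚ.+ z ℚ.* V ℚ.* V') τ+τ ∙ sym q-im))
      where
      U V U' V' : ℚ
      U = q u
      V = q v
      U' = q u'
      V' = q v'
      lem₁ : ∀ U V U' V' τ gq mq → (U ℚ.+ V ℚ.* τ) ℚ.* (U' ℚ.+ V' ℚ.* τ) ℚ.+ mq ℚ.* (V ℚ.* gq ℚ.* (V' ℚ.* gq))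
             ≡ U ℚ.* U' ℚ.+ (U ℚ.* V' ℚ.+ V ℚ.* U') ℚ.* τ ℚ.+ V ℚ.* V' ℚ.* (τ ℚ.* τ ℚ.+ gq ℚ.* gq ℚ.* mq)
      lem₁ = Solver.solve-∀ ℚring
      lem₂ : ∀ U V U' V' τ nq → U ℚ.* U' ℚ.+ (U ℚ.* V' ℚ.+ V ℚ.* U') ℚ.* τ ℚ.+ V ℚ.* V' ℚ.* (τ ℚ.* τ ℚ.+ (τ ℚ.* τ ℚ.+ ℚ.- nq))
             ≡ (U ℚ.* U' ℚ.+ ℚ.- (nq ℚ.* V ℚ.* V')) ℚ.+ (U ℚ.* V' ℚ.+ V ℚ.* U' ℚ.+ (τ ℚ.+ τ) ℚ.* V ℚ.* V') ℚ.* τ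
      lem₂ = Solver.solve-∀ ℚring
      lem₃ : ∀ U V U' V' τ gq → (U ℚ.+ V ℚ.* τ) ℚ.* (V' ℚ.* gq) ℚ.+ V ℚ.* gq ℚ.* (U' ℚ.+ V' ℚ.* τ)
             ≡ (U ℚ.* V' ℚ.+ V ℚ.* U' ℚ.+ (τ ℚ.+ τ) ℚ.* V ℚ.* V') ℚ.* gq
      lem₃ = Solver.solve-∀ ℚring
      q-*₃ : ∀ a b c → q (a * b * c) ≡ q a ℚ.* q b ℚ.* q c
      q-*₃ a b c = q-* (a * b) c ∙ cong (ℚ._* q c) (q-* a b)
      q-re : q (u * u' - n₀ * v * v') ≡ U ℚ.* U' ℚ.+ ℚ.- (nq ℚ.* V ℚ.* V')
      q-re = q-+ (u * u') (- (n₀ * v * v')) ∙ cong₂ ℚ._+_ (q-* u u') (q-neg (n₀ * v * v') ∙ cong ℚ.-_ (q-*₃ n₀ v v'))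
      q-im : q (u * v' + v * u' + t * v * v') ≡ U ℚ.* V' ℚ.+ V ℚ.* U' ℚ.+ tq ℚ.* V ℚ.* V'
      q-im = q-+ (u * v' + v * u') (t * v * v') ∙ cong₂ ℚ._+_ (q-+ (u * v') (v * u') ∙ cong₂ ℚ._+_ (q-* u v') (q-* v u')) (q-*₃ t v v')

    ⟪⟫-ι : ∀ u → ⟪ u , 0ℤ ⟫ ≡ ι u
    ⟪⟫-ι u = cong₂ _+√_ (S.solve 2 (λ u h → u :+ con (q 0ℤ) :* h := u) refl (q u) τ) (ℚ.*-zeroˡ gq)

    ⟪⟫-0 : ⟪ 0ℤ , 0ℤ ⟫ ≡ 0K
    ⟪⟫-0 = ⟪⟫-ι 0ℤ

    ⟪⟫-injective : ∀ {u v u' v'} → ⟪ u , v ⟫ ≡ ⟪ u' , v' ⟫ → u ≡ u' × v ≡ v'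
    ⟪⟫-injective {u} {v} {u'} {v'} eq = u≡ , v≡
      where
      half : ∀ x → fq ℚ.* (x ℚ.* gq) ≡ x ℚ.* (fq ℚ.* fq ℚ.* ℚ.½)
      half = S.solve 2 (λ fq x → fq :* (x :* (fq :* con ℚ.½)) := x :* (fq :* fq :* con ℚ.½)) refl fq
      double : ∀ x → q x ℚ.* gq ℚ.* q (+ 2) ≡ q (f * x)
      double x = S.solve 2 (λ fq x → x :* (fq :* con ℚ.½) :* con (q (+ 2)) := fq :* x) refl fq (q x) ∙ sym (q-* f x)
      f≢0 : ∀ {f t m} → Kind m t f → f ≢ 0ℤ
      f≢0 (odd-disc _ refl) ()
      f≢0 (even-disc _ _ refl _) ()
      v≡ : v ≡ v'
      v≡ = *-cancelˡ f (f≢0 kind) (q-injective (sym (double v) ∙ cong (λ z → ℚ√.irr z ℚ.* q (+ 2)) eq ∙ double v'))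
      undo : ∀ x y h → (x ℚ.+ y ℚ.* h) ℚ.+ ℚ.- (y ℚ.* h) ≡ x
      undo = S.solve 3 (λ x y h → (x :+ y :* h) :+ :- (y :* h) := x) refl
      u≡ : u ≡ u'
      u≡ = q-injective (sym (undo (q u) (q v) τ) ∙
        trans (cong₂ (λ x w → ℚ√.rat x ℚ.+ ℚ.- (q w ℚ.* τ)) eq v≡) (undo (q u') (q v') τ))

    private
      integral-multiple' : ∀ {t f m} → Kind m t f → ∀ d r₁ r₂ n₁ n₂ → q d ℚ.* r₁ ≡ q n₁ → q d ℚ.* r₂ ≡ q n₂ →
        ∃[ u ] ∃[ v ] (q d ℚ.* r₁ ≡ q u ℚ.+ q v ℚ.* (q t ℚ.* ℚ.½)) × (q d ℚ.* r₂ ≡ q v ℚ.* (q f ℚ.* ℚ.½))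
      integral-multiple' (odd-disc refl refl) d r₁ r₂ n₁ n₂ e₁ e₂ = n₁ - n₂ , + 2 * n₂ ,
        trans e₁ (S.solve 2 (λ a b → a := (a :+ :- b) :+ con (q (+ 2)) :* b :* con (q 1ℤ ℚ.* ℚ.½)) refl (q n₁) (q n₂) ∙
          sym (cong₂ (λ x y → x ℚ.+ y ℚ.* (q 1ℤ ℚ.* ℚ.½)) (q-+ n₁ (- n₂) ∙ cong (q n₁ ℚ.+_) (q-neg n₂)) (q-* (+ 2) n₂))) ,
        trans e₂ (S.solve 1 (λ b → b := con (q (+ 2)) :* b :* con (q 1ℤ ℚ.* ℚ.½)) refl (q n₂) ∙ sym (cong (ℚ._* (q 1ℤ ℚ.* ℚ.½)) (q-* (+ 2) n₂)))
      integral-multiple' (even-disc j refl refl _) d r₁ r₂ n₁ n₂ e₁ e₂ = n₁ , n₂ ,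
        trans e₁ (S.solve 2 (λ a b → a := a :+ b :* con (q 0ℤ ℚ.* ℚ.½)) refl (q n₁) (q n₂)) ,
        trans e₂ (S.solve 1 (λ b → b := b :* con (q (+ 2) ℚ.* ℚ.½)) refl (q n₂))

    integral-multiple : ∀ α → ∃[ d ] ∃[ u ] ∃[ v ] d ≢ 0ℤ × ι d ⊗ α ≡ ⟪ u , v ⟫
    integral-multiple (r₁ +√ r₂) = finish (integral-multiple' kind d r₁ r₂ (d₂ * ℚ.↥ r₁) (d₁ * ℚ.↥ r₂) e₁ e₂)
      where
      lem₁ : ∀ x y r → x ℚ.* y ℚ.* r ≡ y ℚ.* (x ℚ.* r)
      lem₁ = Solver.solve-∀ ℚring
      d₁ d₂ d : ℤ
      d₁ = + ℚ.↧ₙ r₁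
      d₂ = + ℚ.↧ₙ r₂
      d = d₁ * d₂
      d≢0 : d ≢ 0ℤ
      d≢0 = i*j≢0 {d₁} {d₂} (λ ()) (λ ())
      e₁ : q d ℚ.* r₁ ≡ q (d₂ * ℚ.↥ r₁)
      e₁ = cong (ℚ._* r₁) (q-* d₁ d₂) ∙ lem₁ (q d₁) (q d₂) r₁ ∙
        trans (cong (q d₂ ℚ.*_) (q-↥↧ r₁)) (sym (q-* d₂ (ℚ.↥ r₁)))
      e₂ : q d ℚ.* r₂ ≡ q (d₁ * ℚ.↥ r₂)
      e₂ = cong (ℚ._* r₂) (q-* d₁ d₂) ∙ ℚ.*-assoc (q d₁) (q d₂) r₂ ∙
        trans (cong (q d₁ ℚ.*_) (q-↥↧ r₂)) (sym (q-* d₁ (ℚ.↥ r₂)))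
      re : ∀ mq d a b → d ℚ.* a ℚ.+ mq ℚ.* (ℚ.0ℚ ℚ.* b) ≡ d ℚ.* a
      re mq d a b = cong (λ z → d ℚ.* a ℚ.+ mq ℚ.* z) (ℚ.*-zeroˡ b) ∙ cong (d ℚ.* a ℚ.+_) (ℚ.*-zeroʳ mq) ∙ ℚ.+-identityʳ (d ℚ.* a)
      im : ∀ d a b → d ℚ.* b ℚ.+ ℚ.0ℚ ℚ.* a ≡ d ℚ.* b
      im d a b = cong (d ℚ.* b ℚ.+_) (ℚ.*-zeroˡ a) ∙ ℚ.+-identityʳ (d ℚ.* b)
      finish : (∃[ u ] ∃[ v ] (q d ℚ.* r₁ ≡ q u ℚ.+ q v ℚ.* τ) × (q d ℚ.* r₂ ≡ q v ℚ.* gq)) →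
               ∃[ d ] ∃[ u ] ∃[ v ] d ≢ 0ℤ × ι d ⊗ (r₁ +√ r₂) ≡ ⟪ u , v ⟫
      finish (u , v , e-re , e-im) = d , u , v , d≢0 ,
        cong₂ _+√_ (re mq (q d) r₁ r₂ ∙ e-re) (im (q d) r₁ r₂ ∙ e-im)

  -- The elements of ℤ[ω] are exactly the integral elements

  ⟪⟫-cong : ∀ {u v u' v'} → u ≡ u' → v ≡ v' → ⟪ u , v ⟫ ≡ ⟪ u' , v' ⟫
  ⟪⟫-cong = cong₂ ⟪_,_⟫

  ι-⟪⟫ : ∀ d u v → ι d ⊗ ⟪ u , v ⟫ ≡ ⟪ d * u , d * v ⟫
  ι-⟪⟫ d u v = cong (_⊗ ⟪ u , v ⟫) (sym (⟪⟫-ι d)) ∙ ⟪⟫-⊗ d 0ℤ u v ∙ ⟪⟫-cong (lem₁ d u v n₀) (lem₂ d u v t)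
    where lem₁ : ∀ d u v n → d * u - n * 0ℤ * v ≡ d * u
          lem₁ = ring
          lem₂ : ∀ d u v t → d * v + 0ℤ * u + t * 0ℤ * v ≡ d * v
          lem₂ = ring

  norm : ℤ → ℤ → ℤ
  norm u v = u * u + t * u * v + n₀ * v * v

  ⟪⟫-integral : ∀ u v → Integral ⟪ u , v ⟫
  ⟪⟫-integral u v = norm u v ∷ c ∷ [] , sym (monic-def (norm u v ∷ c ∷ []) α) ∙ (begin
    monic (norm u v ∷ c ∷ []) α
      ≡⟨ monic-∷ (norm u v) (c ∷ []) α ∙ cong (λ z → ι (norm u v) ⊕ α ⊗ z) (monic-∷ c [] α ∙ cong (λ z → ι c ⊕ α ⊗ z) (monic-[] α)) ⟩
    ι (norm u v) ⊕ α ⊗ (ι c ⊕ α ⊗ 1K)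
      ≡⟨ cong₂ (λ x y → x ⊕ α ⊗ y) (sym (⟪⟫-ι (norm u v)))
           (cong₂ _⊕_ (sym (⟪⟫-ι c)) (⊗-comm α 1K ∙ ⊗-identityˡ α) ∙ ⟪⟫-⊕ c 0ℤ u v) ⟩
    ⟪ norm u v , 0ℤ ⟫ ⊕ α ⊗ ⟪ c + u , 0ℤ + v ⟫
      ≡⟨ cong (⟪ norm u v , 0ℤ ⟫ ⊕_) (⟪⟫-⊗ u v (c + u) (0ℤ + v)) ∙ ⟪⟫-⊕ (norm u v) 0ℤ _ _ ⟩
    ⟪ norm u v + (u * (c + u) - n₀ * v * (0ℤ + v)) , 0ℤ + (u * (0ℤ + v) + v * (c + u) + t * v * (0ℤ + v)) ⟫
      ≡⟨ ⟪⟫-cong (lem₁ u v t n₀) (lem₂ u v t) ⟩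
    ⟪ 0ℤ , 0ℤ ⟫ ≡⟨ ⟪⟫-0 ⟩
    0K ∎) ∙ 0K-def
    where
    α = ⟪ u , v ⟫
    c = - (+ 2 * u + t * v)
    lem₁ : ∀ u v t n → u * u + t * u * v + n * v * v + (u * (- (+ 2 * u + t * v) + u) - n * v * (0ℤ + v)) ≡ 0ℤ
    lem₁ = ring
    lem₂ : ∀ u v t → 0ℤ + (u * (0ℤ + v) + v * (- (+ 2 * u + t * v) + u) + t * v * (0ℤ + v)) ≡ 0ℤ
    lem₂ = ring

  InO : K → Set
  InO β = ∃[ u ] ∃[ v ] β ≡ ⟪ u , v ⟫

  InO-⊕ : ∀ {β γ} → InO β → InO γ → InO (β ⊕ γ)
  InO-⊕ (u , v , refl) (u' , v' , refl) = _ , _ , ⟪⟫-⊕ u v u' v'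

  InO-ι⊗ : ∀ c {β} → InO β → InO (ι c ⊗ β)
  InO-ι⊗ c (u , v , refl) = _ , _ , ι-⟪⟫ c u v

  InO-cancel : ∀ {β γ} → InO β → β ⊕ γ ≡ 0K → InO γ
  InO-cancel {γ = γ} (u , v , refl) eq = - u , - v , (begin
    γ ≡⟨ ⊕-identityˡ γ ⟨
    0K ⊕ γ ≡⟨ cong (_⊕ γ) ⟪⟫-0 ⟨
    ⟪ 0ℤ , 0ℤ ⟫ ⊕ γ ≡⟨ cong (_⊕ γ) (⟪⟫-⊕ (- u) (- v) u v ∙ ⟪⟫-cong (ℤ.+-inverseˡ u) (ℤ.+-inverseˡ v)) ⟨
    (⟪ - u , - v ⟫ ⊕ ⟪ u , v ⟫) ⊕ γ ≡⟨ ⊕-assoc _ _ γ ⟩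
    ⟪ - u , - v ⟫ ⊕ (⟪ u , v ⟫ ⊕ γ) ≡⟨ cong (⟪ - u , - v ⟫ ⊕_) eq ⟩
    ⟪ - u , - v ⟫ ⊕ 0K ≡⟨ ⊕-identityʳ _ ⟩
    ⟪ - u , - v ⟫ ∎)

  pow : K → ℕ → K
  pow α zero = 1K
  pow α (suc k) = α ⊗ pow α k

  pow-⊗ : ∀ α β k → pow (α ⊗ β) k ≡ pow α k ⊗ pow β k
  pow-⊗ α β zero = sym (⊗-identityˡ 1K)
  pow-⊗ α β (suc k) = cong ((α ⊗ β) ⊗_) (pow-⊗ α β k) ∙ ⊗-interchange α β (pow α k) (pow β k)

  pow-ι : ∀ d k → pow (ι d) k ≡ ι (d ^ k)
  pow-ι d zero = sym ι-1
  pow-ι d (suc k) = cong (ι d ⊗_) (pow-ι d k) ∙ sym (ι-* d (d ^ k))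

  Bounded : K → Set
  Bounded α = ∃[ e ] e ≢ 0ℤ × (∀ k → InO (ι e ⊗ pow α k))

  monic-window : ∀ e α cs j → (∀ i → i ℕ.< length cs → InO (ι e ⊗ pow α (j ℕ.+ i))) →
                 ∃[ β ] InO β × ι e ⊗ (pow α j ⊗ monic cs α) ≡ β ⊕ ι e ⊗ pow α (j ℕ.+ length cs)
  monic-window e α [] j h = 0K , (0ℤ , 0ℤ , sym ⟪⟫-0) , (begin
    ι e ⊗ (pow α j ⊗ monic [] α) ≡⟨ cong (λ z → ι e ⊗ (pow α j ⊗ z)) (monic-[] α) ⟩
    ι e ⊗ (pow α j ⊗ 1K) ≡⟨ cong (ι e ⊗_) (⊗-comm (pow α j) 1K ∙ ⊗-identityˡ (pow α j)) ⟩
    ι e ⊗ pow α j ≡⟨ cong (λ k → ι e ⊗ pow α k) (sym (+-identityʳ j)) ⟩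
    ι e ⊗ pow α (j ℕ.+ 0) ≡⟨ ⊕-identityˡ _ ⟨
    0K ⊕ ι e ⊗ pow α (j ℕ.+ 0) ∎)
  monic-window e α (c ∷ cs) j h with monic-window e α cs (suc j) (λ i i< → subst (λ k → InO (ι e ⊗ pow α k)) (+-suc j i) (h (suc i) (s≤s i<)))
  ... | β , β∈ , eq = ι c ⊗ (ι e ⊗ pow α j) ⊕ β
      , InO-⊕ (InO-ι⊗ c (subst (λ k → InO (ι e ⊗ pow α k)) (+-identityʳ j) (h 0 (s≤s z≤n)))) β∈ , (begin
    ι e ⊗ (pow α j ⊗ monic (c ∷ cs) α)
      ≡⟨ cong (λ z → ι e ⊗ (pow α j ⊗ z)) (monic-∷ c cs α) ⟩
    ι e ⊗ (pow α j ⊗ (ι c ⊕ α ⊗ M))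
      ≡⟨ cong (ι e ⊗_) (⊗-distribˡ (pow α j) (ι c) (α ⊗ M)) ⟩
    ι e ⊗ (pow α j ⊗ ι c ⊕ pow α j ⊗ (α ⊗ M))
      ≡⟨ ⊗-distribˡ (ι e) _ _ ⟩
    ι e ⊗ (pow α j ⊗ ι c) ⊕ ι e ⊗ (pow α j ⊗ (α ⊗ M))
      ≡⟨ cong₂ _⊕_ (sym (⊗-assoc (ι e) (pow α j) (ι c)) ∙ ⊗-comm _ (ι c))
           (cong (ι e ⊗_) (sym (⊗-assoc (pow α j) α M) ∙ cong (_⊗ M) (⊗-comm (pow α j) α))) ⟩
    ι c ⊗ (ι e ⊗ pow α j) ⊕ ι e ⊗ (pow α (suc j) ⊗ M)
      ≡⟨ cong (ι c ⊗ (ι e ⊗ pow α j) ⊕_) eq ⟩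
    ι c ⊗ (ι e ⊗ pow α j) ⊕ (β ⊕ ι e ⊗ pow α (suc j ℕ.+ length cs))
      ≡⟨ ⊕-assoc _ β _ ⟨
    ι c ⊗ (ι e ⊗ pow α j) ⊕ β ⊕ ι e ⊗ pow α (suc j ℕ.+ length cs)
      ≡⟨ cong (λ k → ι c ⊗ (ι e ⊗ pow α j) ⊕ β ⊕ ι e ⊗ pow α k) (sym (+-suc j (length cs))) ⟩
    ι c ⊗ (ι e ⊗ pow α j) ⊕ β ⊕ ι e ⊗ pow α (j ℕ.+ suc (length cs)) ∎)
    where M = monic cs α

  pow-InO : ∀ {β} → InO β → ∀ k → InO (pow β k)
  pow-InO h zero = 1ℤ , 0ℤ , sym (⟪⟫-ι 1ℤ ∙ ι-1)
  pow-InO (u , v , refl) (suc k) with pow-InO (u , v , refl) k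
  ... | u' , v' , eq = _ , _ , cong (⟪ u , v ⟫ ⊗_) eq ∙ ⟪⟫-⊗ u v u' v'

  integral-bounded : ∀ α → Integral α → Bounded α
  integral-bounded α (cs , root) = bound (integral-multiple α)
    where
    n = length cs
    bound : (∃[ d ] ∃[ u ] ∃[ v ] d ≢ 0ℤ × ι d ⊗ α ≡ ⟪ u , v ⟫) → Bounded α
    bound (d , u , v , d≢0 , dα≡) = e , ^≢0 n d≢0 , λ k → subst (λ j → InO (ι e ⊗ pow α j)) (+-identityʳ k) (window k 0 z≤n)
      where
      e = d ^ n
      base : ∀ i → i ℕ.≤ n → InO (ι e ⊗ pow α i)
      base i i≤n = subst InO (begin
        ι (d ^ (n ℕ.∸ i)) ⊗ pow (ι d ⊗ α) i ≡⟨ cong (ι (d ^ (n ℕ.∸ i)) ⊗_) (pow-⊗ (ι d) α i) ⟩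
        ι (d ^ (n ℕ.∸ i)) ⊗ (pow (ι d) i ⊗ pow α i) ≡⟨ ⊗-assoc _ _ _ ⟨
        (ι (d ^ (n ℕ.∸ i)) ⊗ pow (ι d) i) ⊗ pow α i ≡⟨ cong (λ z → (ι (d ^ (n ℕ.∸ i)) ⊗ z) ⊗ pow α i) (pow-ι d i) ⟩
        (ι (d ^ (n ℕ.∸ i)) ⊗ ι (d ^ i)) ⊗ pow α i ≡⟨ cong (_⊗ pow α i) (ι-* (d ^ (n ℕ.∸ i)) (d ^ i)) ⟨
        ι (d ^ (n ℕ.∸ i) * d ^ i) ⊗ pow α i
          ≡⟨ cong (λ z → ι z ⊗ pow α i) (sym (ℤ.^-distribˡ-+-* d (n ℕ.∸ i) i) ∙ cong (d ^_) (ℕ.m∸n+n≡m i≤n)) ⟩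
        ι e ⊗ pow α i ∎)
        (InO-ι⊗ (d ^ (n ℕ.∸ i)) (pow-InO (u , v , dα≡) i))
      top : ∀ j → (∀ i → i ℕ.< n → InO (ι e ⊗ pow α (j ℕ.+ i))) → InO (ι e ⊗ pow α (j ℕ.+ n))
      top j h with monic-window e α cs j h
      ... | β , β∈ , eq = InO-cancel β∈ (sym eq ∙ cong (λ z → ι e ⊗ (pow α j ⊗ z)) (monic-def cs α ∙ root ∙ sym 0K-def) ∙
              trans (cong (ι e ⊗_) (⊗-zeroʳ (pow α j))) (⊗-zeroʳ (ι e)))
      window : ∀ j i → i ℕ.≤ n → InO (ι e ⊗ pow α (j ℕ.+ i))
      window zero i i≤n = base i i≤n
      window (suc j) i i≤n = [ (λ i<n → shift i i<n) , (λ { refl → top (suc j) shift }) ]′ (ℕ.m≤n⇒m<n∨m≡n i≤n)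
        where
        shift : ∀ i → i ℕ.< n → InO (ι e ⊗ pow α (suc j ℕ.+ i))
        shift i i<n = subst (λ k → InO (ι e ⊗ pow α k)) (+-suc j i) (window j (suc i) i<n)

  bounded-suc : ∀ {α} → Bounded α → Bounded (α ⊕ 1K)
  bounded-suc {α} (e , e≢0 , h) = e , e≢0 , λ k → subst (λ z → InO (ι e ⊗ z)) (⊗-comm _ 1K ∙ ⊗-identityˡ _) (go k 0)
    where
    β = α ⊕ 1K
    go : ∀ k j → InO (ι e ⊗ (pow β k ⊗ pow α j))
    go zero j = subst (λ z → InO (ι e ⊗ z)) (sym (⊗-identityˡ _)) (h j)
    go (suc k) j = subst InO (begin
      ι e ⊗ (pow β k ⊗ (α ⊗ pow α j)) ⊕ ι e ⊗ (pow β k ⊗ pow α j) ≡⟨ ⊗-distribˡ (ι e) _ _ ⟨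
      ι e ⊗ (pow β k ⊗ (α ⊗ pow α j) ⊕ pow β k ⊗ pow α j) ≡⟨ cong (λ z → ι e ⊗ (pow β k ⊗ (α ⊗ pow α j) ⊕ pow β k ⊗ z)) (⊗-identityˡ (pow α j)) ⟨
      ι e ⊗ (pow β k ⊗ (α ⊗ pow α j) ⊕ pow β k ⊗ (1K ⊗ pow α j)) ≡⟨ cong (ι e ⊗_) (⊗-distribˡ (pow β k) _ _) ⟨
      ι e ⊗ (pow β k ⊗ (α ⊗ pow α j ⊕ 1K ⊗ pow α j))
        ≡⟨ cong (λ z → ι e ⊗ (pow β k ⊗ z)) (⊗-comm β _ ∙ ⊗-distribˡ _ α 1K ∙ cong₂ _⊕_ (⊗-comm _ α) (⊗-comm _ 1K)) ⟨
      ι e ⊗ (pow β k ⊗ (β ⊗ pow α j)) ≡⟨ cong (ι e ⊗_) (sym (⊗-assoc _ β _) ∙ cong (_⊗ pow α j) (⊗-comm _ β)) ⟩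
      ι e ⊗ (pow β (suc k) ⊗ pow α j) ∎)
      (InO-⊕ (go k (suc j)) (go k j))

  norm-pow : ∀ u v k → ∃[ a ] ∃[ b ] pow ⟪ u , v ⟫ k ≡ ⟪ a , b ⟫ × norm a b ≡ norm u v ^ k
  norm-pow u v zero = 1ℤ , 0ℤ , sym (⟪⟫-ι 1ℤ ∙ ι-1) , lem t n₀
    where lem : ∀ t n → 1ℤ * 1ℤ + t * 1ℤ * 0ℤ + n * 0ℤ * 0ℤ ≡ 1ℤ
          lem = ring
  norm-pow u v (suc k) with norm-pow u v k
  ... | a , b , eq , nm = _ , _ , cong (⟪ u , v ⟫ ⊗_) eq ∙ ⟪⟫-⊗ u v a b , lem u v a b t n₀ ∙ cong (norm u v *_) nm
    where lem : ∀ u v a b t n → (u * a - n * v * b) * (u * a - n * v * b) + t * (u * a - n * v * b) * (u * b + v * a + t * v * b) + n * (u * b + v * a + t * v * b) * (u * b + v * a + t * v * b)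
                  ≡ (u * u + t * u * v + n * v * v) * (a * a + t * a * b + n * b * b)
          lem = ring

  bounded-norm : ∀ {α} d u v → Bounded α → d ≢ 0ℤ → ι d ⊗ α ≡ ⟪ u , v ⟫ → d * d ∣ norm u v
  bounded-norm {α} d u v (e , e≢0 , h) d≢0 dα≡ =
    bounded-denominators (e * e) (d * d) (norm u v) (i*j≢0 e≢0 e≢0) (i*j≢0 d≢0 d≢0) divisible
    where
    divisible : ∀ k → (d * d) ^ k ∣ (e * e) * norm u v ^ k
    divisible k with norm-pow u v k | h k
    ... | a , b , eq , nm | x , y , eαᵏ = divides (norm x y) (begin
      e * e * norm u v ^ k ≡⟨ cong (e * e *_) (sym nm) ⟩
      e * e * norm a b ≡⟨ lem e a b t n₀ ⟩
      norm (e * a) (e * b) ≡⟨ cong₂ norm (proj₁ ea≡) (proj₂ ea≡) ⟩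
      norm (d ^ k * x) (d ^ k * y) ≡⟨ lem (d ^ k) x y t n₀ ⟨
      d ^ k * d ^ k * norm x y ≡⟨ cong (_* norm x y) (*-^ d d k) ⟨
      (d * d) ^ k * norm x y ≡⟨ *-comm ((d * d) ^ k) (norm x y) ⟩
      norm x y * (d * d) ^ k ∎)
      where
      lem : ∀ e a b t n → e * e * (a * a + t * a * b + n * b * b) ≡ e * a * (e * a) + t * (e * a) * (e * b) + n * (e * b) * (e * b)
      lem = ring
      ea≡ : e * a ≡ d ^ k * x × e * b ≡ d ^ k * y
      ea≡ = ⟪⟫-injective (begin
        ⟪ e * a , e * b ⟫ ≡⟨ ι-⟪⟫ e a b ⟨
        ι e ⊗ ⟪ a , b ⟫ ≡⟨ cong (ι e ⊗_) eq ⟨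
        ι e ⊗ pow ⟪ u , v ⟫ k ≡⟨ cong (λ z → ι e ⊗ pow z k) dα≡ ⟨
        ι e ⊗ pow (ι d ⊗ α) k ≡⟨ cong (ι e ⊗_) (pow-⊗ (ι d) α k ∙ cong (_⊗ pow α k) (pow-ι d k)) ⟩
        ι e ⊗ (ι (d ^ k) ⊗ pow α k) ≡⟨ sym (⊗-assoc _ _ _) ∙ cong (_⊗ pow α k) (⊗-comm _ _) ∙ ⊗-assoc _ _ _ ⟩
        ι (d ^ k) ⊗ (ι e ⊗ pow α k) ≡⟨ cong (ι (d ^ k) ⊗_) eαᵏ ⟩
        ι (d ^ k) ⊗ ⟪ x , y ⟫ ≡⟨ ι-⟪⟫ (d ^ k) x y ⟩
        ⟪ d ^ k * x , d ^ k * y ⟫ ∎)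

  bounded-trace : ∀ {α} d u v → Bounded α → d ≢ 0ℤ → ι d ⊗ α ≡ ⟪ u , v ⟫ → d ∣ + 2 * u + t * v
  bounded-trace {α} d u v b d≢0 dα≡ = ∣-*-cancelˡ d d≢0 (subst (d * d ∣_) (lem d u v t n₀)
    (∣m∣n⇒∣m-n (∣m∣n⇒∣m-n (bounded-norm d (u + d) v (bounded-suc b) d≢0 eq) (bounded-norm d u v b d≢0 dα≡)) ∣-refl))
    where
    lem : ∀ d u v t n → (u + d) * (u + d) + t * (u + d) * v + n * v * v - (u * u + t * u * v + n * v * v) - d * d ≡ d * (+ 2 * u + t * v)
    lem = ring
    eq : ι d ⊗ (α ⊕ 1K) ≡ ⟪ u + d , v ⟫
    eq = ⊗-distribˡ (ι d) α 1K ∙ cong₂ _⊕_ dα≡ (⊗-comm (ι d) 1K ∙ ⊗-identityˡ (ι d) ∙ sym (⟪⟫-ι d)) ∙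
      trans (⟪⟫-⊕ u v d 0ℤ) (⟪⟫-cong refl (ℤ.+-identityʳ v))

  halve : ∀ {d x w} → + 2 * x ≡ w * d → + 2 ∣ w → d ∣ x
  halve {d} {x} {w} 2x≡ (divides y w≡) = divides y (*-cancelˡ (+ 2) (λ ()) (combination (lem x y d w) (1ℤ ⊛ 2x≡ ⊞ d ⊛ w≡)))
    where lem : ∀ x y d w → + 2 * x - + 2 * (y * d) ≡ 1ℤ * (+ 2 * x - w * d) + d * (w - y * + 2)
          lem = ring

  even-square : ∀ w → + 2 ∣ w * w → + 2 ∣ w
  even-square w = [ id , id ]′ ∘ prime-∣-* ℕ.prime[2] w w

  square-mod-4 : ∀ w → ∃[ y ] (w * w ≡ + 4 * y + 0ℤ ⊎ w * w ≡ + 4 * y + 1ℤ)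
  square-mod-4 w = [ (λ { (y , refl) → y * y , inj₁ (lem y) }) , (λ { (y , refl) → y * y + y , inj₂ (lem' y) }) ]′ (parity w)
    where
    lem : ∀ y → + 2 * y * (+ 2 * y) ≡ + 4 * (y * y) + 0ℤ
    lem = ring
    lem' : ∀ y → (+ 2 * y + 1ℤ) * (+ 2 * y + 1ℤ) ≡ + 4 * (y * y + y) + 1ℤ
    lem' = ring

  -- The trace w d and f v = s d of an element with norm k d².
  divide : ∀ d u v → d ≢ 0ℤ → d * d ∣ norm u v → d ∣ + 2 * u + t * v → (d ∣ u) × (d ∣ v)
  divide d u v d≢0 (divides k nm) (divides w tr) = go (squareFree-∣ sf d (f * v) (divides (w * w - + 4 * k) fv²))
    where
    fv² : m * (f * v * (f * v)) ≡ (w * w - + 4 * k) * (d * d)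
    fv² = combination (lem m f n₀ t u v w k d) ((v * v) ⊛ disc ⊞ (+ 2 * u + t * v + w * d) ⊛ tr ⊞ (- + 4) ⊛ nm)
      where lem : ∀ m f n t u v w k d → m * (f * v * (f * v)) - (w * w - + 4 * k) * (d * d) ≡
                  v * v * (f * f * m + + 4 * n - t * t) + ((+ 2 * u + t * v + w * d) * (+ 2 * u + t * v - w * d) + - + 4 * (u * u + t * u * v + n * v * v - k * (d * d)))
            lem = ring
    go : d ∣ f * v → (d ∣ u) × (d ∣ v)
    go (divides s fv) = by-kind kind
      where
      4k≡ : + 4 * k ≡ w * w - m * (s * s)
      4k≡ = *-cancelˡ (d * d) (i*j≢0 d≢0 d≢0) (combination (lem m f v w k d s) (1ℤ ⊛ fv² ⊞ (- (m * (f * v + s * d))) ⊛ fv))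
        where lem : ∀ m f v w k d s → d * d * (+ 4 * k) - d * d * (w * w - m * (s * s)) ≡
                    1ℤ * (m * (f * v * (f * v)) - (w * w - + 4 * k) * (d * d)) + - (m * (f * v + s * d)) * (f * v - s * d)
              lem = ring
      by-kind : Kind m t f → (d ∣ u) × (d ∣ v)
      by-kind (odd-disc t≡ f≡) = halve (combination (lem₁ u t v w d s) (1ℤ ⊛ tr ⊞ -1ℤ ⊛ v≡ ⊞ (- v) ⊛ t≡)) (even-square (w - s) (divides (+ 2 * k + (1ℤ - + 2 * n₀) * (s * s) - w * s) (combination (lem₂ w s k n₀ m) (-1ℤ ⊛ 4k≡ ⊞ (s * s) ⊛ m≡)))) , divides s v≡
        where
        v≡ : v ≡ s * d
        v≡ = combination (lem f v s d) (1ℤ ⊛ fv ⊞ (- v) ⊛ f≡)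
          where lem : ∀ f v s d → v - s * d ≡ 1ℤ * (f * v - s * d) + - v * (f - 1ℤ)
                lem = ring
        m≡ : m ≡ 1ℤ - + 4 * n₀
        m≡ = combination (lem f m n₀ t) (1ℤ ⊛ disc ⊞ (- ((f + 1ℤ) * m)) ⊛ f≡ ⊞ (t + 1ℤ) ⊛ t≡)
          where lem : ∀ f m n t → m - (1ℤ - + 4 * n) ≡ 1ℤ * (f * f * m + + 4 * n - t * t) + (- ((f + 1ℤ) * m) * (f - 1ℤ) + (t + 1ℤ) * (t - 1ℤ))
                lem = ring
        lem₁ : ∀ u t v w d s → + 2 * u - (w - s) * d ≡ 1ℤ * (+ 2 * u + t * v - w * d) + (-1ℤ * (v - s * d) + - v * (t - 1ℤ))
        lem₁ = ring
        lem₂ : ∀ w s k n m → (w - s) * (w - s) - (+ 2 * k + (1ℤ - + 2 * n) * (s * s) - w * s) * + 2 ≡ -1ℤ * (+ 4 * k - (w * w - m * (s * s))) + s * s * (m - (1ℤ - + 4 * n))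
        lem₂ = ring
      by-kind (even-disc j t≡ f≡ m≡) = by-squares (square-mod-4 w) (square-mod-4 s)
        where
        2u≡ : + 2 * u ≡ w * d
        2u≡ = combination (lem u t v w d) (1ℤ ⊛ tr ⊞ (- v) ⊛ t≡)
          where lem : ∀ u t v w d → + 2 * u - w * d ≡ 1ℤ * (+ 2 * u + t * v - w * d) + - v * (t - 0ℤ)
                lem = ring
        2v≡ : + 2 * v ≡ s * d
        2v≡ = combination (lem f v s d) (1ℤ ⊛ fv ⊞ (- v) ⊛ f≡)
          where lem : ∀ f v s d → + 2 * v - s * d ≡ 1ℤ * (f * v - s * d) + - v * (f - + 2)
                lem = ring
        contra : ∀ ρ ε y q r → ρ - ε ≡ + r → 0 ℕ.< r → r ℕ.< 4 → m ≡ + 4 * j + ρ → w * w ≡ + 4 * y + ε → s * s ≡ + 4 * q + 1ℤ → (d ∣ u) × (d ∣ v)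
        contra ρ ε y q r ρ-ε 0<r r<4 m≡ w≡ s≡ = contradiction (combination (lem y j q ρ ε k) (-1ℤ ⊛ (4k≡ ∙ cong₂ _-_ w≡ (cong₂ _*_ m≡ s≡))) ∙ ρ-ε) (not-multiple 4 r (y - j * (+ 4 * q + 1ℤ) - ρ * q - k) 0<r r<4)
          where lem : ∀ y j q ρ ε k → + 4 * (y - j * (+ 4 * q + 1ℤ) - ρ * q - k) - (ρ - ε) ≡ -1ℤ * (+ 4 * k - (+ 4 * y + ε - (+ 4 * j + ρ) * (+ 4 * q + 1ℤ)))
                lem = ring
        0<1 : ∀ {n} → 0 ℕ.< suc n
        0<1 = s≤s z≤n
        by-squares : (∃[ y ] (w * w ≡ + 4 * y + 0ℤ ⊎ w * w ≡ + 4 * y + 1ℤ)) → (∃[ q ] (s * s ≡ + 4 * q + 0ℤ ⊎ s * s ≡ + 4 * q + 1ℤ)) → (d ∣ u) × (d ∣ v)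
        by-squares _ (q , inj₁ s≡) =
          halve 2u≡ (even-square w (divides (+ 2 * k + + 2 * m * q) (combination (lem w k m q s) (-1ℤ ⊛ 4k≡ ⊞ m ⊛ s≡)))) ,
          halve 2v≡ (even-square s (divides (+ 2 * q) (combination (lem' s q) (1ℤ ⊛ s≡))))
          where
          lem : ∀ w k m q s → w * w - (+ 2 * k + + 2 * m * q) * + 2 ≡ -1ℤ * (+ 4 * k - (w * w - m * (s * s))) + m * (s * s - (+ 4 * q + 0ℤ))
          lem = ring
          lem' : ∀ s q → s * s - + 2 * q * + 2 ≡ 1ℤ * (s * s - (+ 4 * q + 0ℤ))
          lem' = ring
        by-squares (y , inj₁ w≡) (q , inj₂ s≡) = [ (λ m≡ → contra (+ 2) 0ℤ y q 2 refl 0<1 (s≤s (s≤s 0<1)) m≡ w≡ s≡) , (λ m≡ → contra (+ 3) 0ℤ y q 3 refl 0<1 (s≤s (s≤s (s≤s 0<1))) m≡ w≡ s≡) ]′ m≡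
        by-squares (y , inj₂ w≡) (q , inj₂ s≡) = [ (λ m≡ → contra (+ 2) 1ℤ y q 1 refl 0<1 (s≤s 0<1) m≡ w≡ s≡) , (λ m≡ → contra (+ 3) 1ℤ y q 2 refl 0<1 (s≤s (s≤s 0<1)) m≡ w≡ s≡) ]′ m≡

  integral-⟪⟫ : ∀ α → Integral α → InO α
  integral-⟪⟫ α α-int = go (integral-multiple α)
    where
    b = integral-bounded α α-int
    go : (∃[ d ] ∃[ u ] ∃[ v ] d ≢ 0ℤ × ι d ⊗ α ≡ ⟪ u , v ⟫) → InO α
    go (d , u , v , d≢0 , dα≡) = quotient (divide d u v d≢0 (bounded-norm d u v b d≢0 dα≡) (bounded-trace d u v b d≢0 dα≡))
      where
      quotient : (d ∣ u) × (d ∣ v) → InO α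
      quotient (divides u' u≡ , divides v' v≡) = u' , v' , ι-cancel d d≢0 (dα≡ ∙
        trans (⟪⟫-cong (u≡ ∙ *-comm u' d) (v≡ ∙ *-comm v' d)) (sym (ι-⟪⟫ d u' v')))

  -- Fractional ideals and binary quadratic forms

  open Q using (_∈⟨_⟩; FractionalIdeal) renaming (_≈_ to _≃_; _∈_ to _∈ᴵ_) public
  open Q._∈⟨_⟩

  4norm : ∀ u v → + 4 * norm u v ≡ (+ 2 * u + t * v) * (+ 2 * u + t * v) + + N * (v * v)
  4norm u v = combination (lem u v t n₀ (+ N)) ((v * v) ⊛ disc-N)
    where lem : ∀ u v t n N → + 4 * (u * u + t * u * v + n * v * v) - ((+ 2 * u + t * v) * (+ 2 * u + t * v) + N * (v * v)) ≡ v * v * (+ 4 * n - t * t - N)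
          lem = ring

  4norm-ℕ : ∀ u v → + 4 * norm u v ≡ + (∣ + 2 * u + t * v ∣ · ∣ + 2 * u + t * v ∣ ℕ.+ N · (∣ v ∣ · ∣ v ∣))
  4norm-ℕ u v = 4norm u v ∙ cong₂ (λ a b → a + + N * b) (square-ℕ (+ 2 * u + t * v)) (square-ℕ v) ∙
    cong (λ z → + (∣ + 2 * u + t * v ∣ · ∣ + 2 * u + t * v ∣) + z) (sym (pos-* N (∣ v ∣ · ∣ v ∣)))

  P : ℤ → ℤ
  P k = k * k + t * k + n₀

  P≢0 : ∀ k → P k ≢ 0ℤ
  P≢0 k eq = ℕ.<⇒≢ (<-≤-trans N>0 (m≤n+m N (∣ z ∣ · ∣ z ∣))) (sym (+-injective (begin
    + (∣ z ∣ · ∣ z ∣ ℕ.+ N) ≡⟨ cong (λ w → + (∣ z ∣ · ∣ z ∣ ℕ.+ w)) (ℕ.*-identityʳ N) ⟨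
    + (∣ z ∣ · ∣ z ∣ ℕ.+ N · 1) ≡⟨ 4norm-ℕ k 1ℤ ⟨
    + 4 * norm k 1ℤ ≡⟨ cong (+ 4 *_) (lem k t n₀) ⟩
    + 4 * P k ≡⟨ cong (+ 4 *_) eq ⟩
    + 0 ∎)))
    where
    z = + 2 * k + t * 1ℤ
    lem : ∀ k t n → k * k + t * k * 1ℤ + n * 1ℤ * 1ℤ ≡ k * k + t * k + n
    lem = ring

  InO-⊗ : ∀ {β γ} → InO β → InO γ → InO (β ⊗ γ)
  InO-⊗ (u , v , refl) (u' , v' , refl) = _ , _ , ⟪⟫-⊗ u v u' v'

  InO-integral : ∀ {α} → InO α → Integral α
  InO-integral (u , v , refl) = ⟪⟫-integral u v

  ∈-∷ : ∀ {c g x y gs} → InO c → x ∈⟨ gs ⟩ → y ≡ c ⊗ g ⊕ x → y ∈⟨ g ∷ gs ⟩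
  ∈-∷ {c} {g} {x} {y} {gs} c∈ x∈ y≡ = subst (_∈⟨ g ∷ gs ⟩) (sym (y≡ ∙ ⊕-def _ x ∙ cong (Q._⊕ x) (⊗-def c g))) (InO-integral c∈ ∷ x∈)

  ∈-[] : ∀ {y} → y ≡ 0K → y ∈⟨ [] ⟩
  ∈-[] y≡ = subst (_∈⟨ [] ⟩) (sym (y≡ ∙ 0K-def)) []

  data Split (g : K) (gs : List K) (y : K) : Set where
    split : ∀ c x → InO c → x ∈⟨ gs ⟩ → y ≡ c ⊗ g ⊕ x → Split g gs y

  ∈-split : ∀ {g gs y} → y ∈⟨ g ∷ gs ⟩ → Split g gs y
  ∈-split {g} (_∷_ {c} {x = x} ci x∈) = split c x (integral-⟪⟫ c ci) x∈ (sym (⊕-def _ x ∙ cong (Q._⊕ x) (⊗-def c g)))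

  ∈-nil : ∀ {y} → y ∈⟨ [] ⟩ → y ≡ 0K
  ∈-nil [] = sym 0K-def

  ∈-scale : ∀ {γ gs y} → InO γ → y ∈⟨ gs ⟩ → γ ⊗ y ∈⟨ gs ⟩
  ∈-scale {γ} {[]} γ∈ y∈ = ∈-[] (cong (γ ⊗_) (∈-nil y∈) ∙ ⊗-zeroʳ γ)
  ∈-scale {γ} {g ∷ gs} γ∈ y∈ = go (∈-split y∈)
    where
    go : ∀ {y} → Split g gs y → γ ⊗ y ∈⟨ g ∷ gs ⟩
    go (split c x c∈ x∈ y≡) = ∈-∷ (InO-⊗ γ∈ c∈) (∈-scale γ∈ x∈)
      (cong (γ ⊗_) y≡ ∙ ⊗-distribˡ γ (c ⊗ g) x ∙ cong (_⊕ γ ⊗ x) (sym (⊗-assoc γ c g)))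

  0∈ : ∀ gs → 0K ∈⟨ gs ⟩
  0∈ [] = ∈-[] refl
  0∈ (g ∷ gs) = ∈-∷ (0ℤ , 0ℤ , sym ⟪⟫-0) (0∈ gs) (sym (⊕-identityʳ _ ∙ ⊗-comm 0K g ∙ ⊗-zeroʳ g))

  generator-∈ : ∀ {g gs} → g ∈ gs → g ∈⟨ gs ⟩
  generator-∈ {g} {_ ∷ gs} (here refl) = ∈-∷ (1ℤ , 0ℤ , sym (⟪⟫-ι 1ℤ ∙ ι-1)) (0∈ gs) (sym (⊕-identityʳ _ ∙ ⊗-identityˡ g))
  generator-∈ {g} {g' ∷ gs} (there g∈) = ∈-∷ (0ℤ , 0ℤ , sym ⟪⟫-0) (generator-∈ g∈) (sym (cong (_⊕ g) (⊗-comm 0K g' ∙ ⊗-zeroʳ g') ∙ ⊕-identityˡ g))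

  nonzero-∈ : ∀ I → ∃[ y ] y ≢ 0K × y ∈ᴵ I
  nonzero-∈ I = go (FractionalIdeal.nonzero I)
    where
    go : ∀ {gs} → Any (_≢ Q.0K) gs → ∃[ y ] y ≢ 0K × y ∈⟨ gs ⟩
    go {g ∷ gs} (here g≢) = g , (λ e → g≢ (e ∙ 0K-def)) , generator-∈ (here refl)
    go {g ∷ gs} (there h) with go h
    ... | y , y≢ , y∈ = y , y≢ , ∈-∷ (0ℤ , 0ℤ , sym ⟪⟫-0) y∈ (sym (cong (_⊕ y) (⊗-comm 0K g ∙ ⊗-zeroʳ g) ∙ ⊕-identityˡ y))

  divide-ι : ∀ d → d ≢ 0ℤ → ∀ β → ∃[ α ] ι d ⊗ α ≡ β
  divide-ι d d≢0 β = go (ι-inverse d d≢0)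
    where
    go : (∃[ κ ] ι d ⊗ κ ≡ 1K) → ∃[ α ] ι d ⊗ α ≡ β
    go (κ , e) = κ ⊗ β , sym (⊗-assoc (ι d) κ β) ∙ cong (_⊗ β) e ∙ ⊗-identityˡ β

  Represented : (d p q r : ℤ) → K → Set
  Represented d p q r y = ∃[ s ] ∃[ s' ] ι d ⊗ y ≡ ⟪ s * p + s' * q , s' * r ⟫

  record Lattice (gs : List K) : Set where
    constructor lattice
    field
      den p₀ q₀ r₀ : ℤ
      den≢0 : den ≢ 0ℤ
      to : ∀ y → y ∈⟨ gs ⟩ → Represented den p₀ q₀ r₀ y
      from : ∀ y s s' → ι den ⊗ y ≡ ⟪ s * p₀ + s' * q₀ , s' * r₀ ⟫ → y ∈⟨ gs ⟩

  toLattice : ∀ gs → Lattice gs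
  toLattice [] = lattice 1ℤ 0ℤ 0ℤ 0ℤ (λ ())
    (λ y y∈ → 0ℤ , 0ℤ , cong (ι 1ℤ ⊗_) (∈-nil y∈) ∙ ⊗-zeroʳ (ι 1ℤ) ∙ sym ⟪⟫-0)
    (λ y s s' e → ∈-[] (sym (⊗-identityˡ y) ∙ cong (_⊗ y) (sym ι-1) ∙ e ∙ ⟪⟫-cong (cong₂ _+_ (*-zeroʳ s) (*-zeroʳ s')) (*-zeroʳ s') ∙ ⟪⟫-0))
  toLattice (g ∷ gs) = step (toLattice gs) (integral-multiple g)
    where
    step : Lattice gs → (∃[ e ] ∃[ u ] ∃[ v ] e ≢ 0ℤ × ι e ⊗ g ≡ ⟪ u , v ⟫) → Lattice (g ∷ gs)
    step (lattice d p q r d≢0 to from) (e , u , v , e≢0 , eg≡) = first (hermite (e * p) (e * q) (e * r) (d * u) (d * v))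
      where
      u₂ v₂ : ℤ
      u₂ = - (d * (n₀ * v))
      v₂ = d * (u + t * v)
      scaled : ∀ c₁ c₂ x X Y → ι d ⊗ x ≡ ⟪ X , Y ⟫ →
               ι (d * e) ⊗ (⟪ c₁ , c₂ ⟫ ⊗ g ⊕ x) ≡ ⟪ e * X + c₁ * (d * u) + c₂ * u₂ , e * Y + c₁ * (d * v) + c₂ * v₂ ⟫
      scaled c₁ c₂ x X Y dx≡ = begin
        ι (d * e) ⊗ (c ⊗ g ⊕ x) ≡⟨ cong (_⊗ (c ⊗ g ⊕ x)) (ι-* d e) ⟩
        (ι d ⊗ ι e) ⊗ (c ⊗ g ⊕ x) ≡⟨ ⊗-distribˡ (ι d ⊗ ι e) (c ⊗ g) x ⟩
        (ι d ⊗ ι e) ⊗ (c ⊗ g) ⊕ (ι d ⊗ ι e) ⊗ x ≡⟨ cong₂ _⊕_ (⊗-interchange (ι d) (ι e) c g) (cong (_⊗ x) (⊗-comm (ι d) (ι e)) ∙ ⊗-assoc (ι e) (ι d) x) ⟩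
        (ι d ⊗ c) ⊗ (ι e ⊗ g) ⊕ ι e ⊗ (ι d ⊗ x) ≡⟨ cong₂ _⊕_ (cong₂ _⊗_ (ι-⟪⟫ d c₁ c₂) eg≡) (cong (ι e ⊗_) dx≡ ∙ ι-⟪⟫ e X Y) ⟩
        ⟪ d * c₁ , d * c₂ ⟫ ⊗ ⟪ u , v ⟫ ⊕ ⟪ e * X , e * Y ⟫ ≡⟨ cong (_⊕ ⟪ e * X , e * Y ⟫) (⟪⟫-⊗ (d * c₁) (d * c₂) u v) ∙ ⟪⟫-⊕ _ _ _ _ ⟩
        ⟪ (d * c₁ * u - n₀ * (d * c₂) * v) + e * X , (d * c₁ * v + d * c₂ * u + t * (d * c₂) * v) + e * Y ⟫
          ≡⟨ ⟪⟫-cong (lem₁ d c₁ c₂ u v n₀ (e * X)) (lem₂ d c₁ c₂ u v t (e * Y)) ⟩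
        ⟪ e * X + c₁ * (d * u) + c₂ * u₂ , e * Y + c₁ * (d * v) + c₂ * v₂ ⟫ ∎
        where
        c = ⟪ c₁ , c₂ ⟫
        lem₁ : ∀ d c₁ c₂ u v n X → (d * c₁ * u - n * (d * c₂) * v) + X ≡ X + c₁ * (d * u) + c₂ * - (d * (n * v))
        lem₁ = ring
        lem₂ : ∀ d c₁ c₂ u v t Y → (d * c₁ * v + d * c₂ * u + t * (d * c₂) * v) + Y ≡ Y + c₁ * (d * v) + c₂ * (d * (u + t * v))
        lem₂ = ring
      lemX : ∀ e s p s' q → e * (s * p + s' * q) ≡ s * (e * p) + s' * (e * q)
      lemX = ring
      first : Triangular (e * p) (e * q) (e * r) (d * u) (d * v) → Lattice (g ∷ gs)
      first (p₁ , q₁ , r₁ , h₁) = second (hermite p₁ q₁ r₁ u₂ v₂)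
        where
        second : Triangular p₁ q₁ r₁ u₂ v₂ → Lattice (g ∷ gs)
        second (p₂ , q₂ , r₂ , h₂) = lattice (d * e) p₂ q₂ r₂ (i*j≢0 d≢0 e≢0) to' from'
          where
          to' : ∀ y → y ∈⟨ g ∷ gs ⟩ → Represented (d * e) p₂ q₂ r₂ y
          to' y y∈ = go (∈-split y∈)
            where
            go : Split g gs y → Represented (d * e) p₂ q₂ r₂ y
            go (split c x (c₁ , c₂ , c≡) x∈ y≡) = go₁ (to x x∈)
              where
              go₁ : Represented d p q r x → Represented (d * e) p₂ q₂ r₂ y
              go₁ (s , s' , dx≡) = go₂ (Equivalence.to (h₁ _ _) (s , s' , c₁ , refl , refl))
                where
                x₀ y₀ : ℤ
                x₀ = s * (e * p) + s' * (e * q) + c₁ * (d * u)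
                y₀ = s' * (e * r) + c₁ * (d * v)
                go₂ : Span₂ p₁ q₁ r₁ x₀ y₀ → Represented (d * e) p₂ q₂ r₂ y
                go₂ (σ , σ' , X≡ , Y≡) = go₃ (Equivalence.to (h₂ _ _) (σ , σ' , c₂ , cong (_+ c₂ * u₂) X≡ , cong (_+ c₂ * v₂) Y≡))
                  where
                  go₃ : Span₂ p₂ q₂ r₂ (x₀ + c₂ * u₂) (y₀ + c₂ * v₂) → Represented (d * e) p₂ q₂ r₂ y
                  go₃ (ρ , ρ' , X≡' , Y≡') = ρ , ρ' , (begin
                    ι (d * e) ⊗ y ≡⟨ cong (ι (d * e) ⊗_) (y≡ ∙ cong (λ z → z ⊗ g ⊕ x) c≡) ⟩
                    ι (d * e) ⊗ (⟪ c₁ , c₂ ⟫ ⊗ g ⊕ x) ≡⟨ scaled c₁ c₂ x _ _ dx≡ ⟩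
                    ⟪ e * (s * p + s' * q) + c₁ * (d * u) + c₂ * u₂ , e * (s' * r) + c₁ * (d * v) + c₂ * v₂ ⟫
                      ≡⟨ ⟪⟫-cong (cong (λ z → z + c₁ * (d * u) + c₂ * u₂) (lemX e s p s' q) ∙ X≡')
                                 (cong (λ z → z + c₁ * (d * v) + c₂ * v₂) (*-left-swap e s' r) ∙ Y≡') ⟩
                    ⟪ ρ * p₂ + ρ' * q₂ , ρ' * r₂ ⟫ ∎)
          from' : ∀ y s s' → ι (d * e) ⊗ y ≡ ⟪ s * p₂ + s' * q₂ , s' * r₂ ⟫ → y ∈⟨ g ∷ gs ⟩
          from' y ρ ρ' y≡ = go₂ (Equivalence.from (h₂ _ _) (ρ , ρ' , refl , refl))
            where
            go₂ : Span₃ p₁ q₁ r₁ u₂ v₂ (ρ * p₂ + ρ' * q₂) (ρ' * r₂) → y ∈⟨ g ∷ gs ⟩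
            go₂ (σ , σ' , c₂ , X≡ , Y≡) = go₁ (Equivalence.from (h₁ _ _) (σ , σ' , refl , refl))
              where
              go₁ : Span₃ (e * p) (e * q) (e * r) (d * u) (d * v) (σ * p₁ + σ' * q₁) (σ' * r₁) → y ∈⟨ g ∷ gs ⟩
              go₁ (s , s' , c₁ , X≡' , Y≡') = go₀ (divide-ι d d≢0 ⟪ s * p + s' * q , s' * r ⟫)
                where
                go₀ : (∃[ x ] ι d ⊗ x ≡ ⟪ s * p + s' * q , s' * r ⟫) → y ∈⟨ g ∷ gs ⟩
                go₀ (x , dx≡) = ∈-∷ (c₁ , c₂ , refl) (from x s s' dx≡) (ι-cancel (d * e) (i*j≢0 d≢0 e≢0) (begin
                  ι (d * e) ⊗ y ≡⟨ y≡ ⟩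
                  ⟪ ρ * p₂ + ρ' * q₂ , ρ' * r₂ ⟫ ≡⟨ ⟪⟫-cong (X≡ ∙ cong (_+ c₂ * u₂) X≡') (Y≡ ∙ cong (_+ c₂ * v₂) Y≡') ⟩
                  ⟪ s * (e * p) + s' * (e * q) + c₁ * (d * u) + c₂ * u₂ , s' * (e * r) + c₁ * (d * v) + c₂ * v₂ ⟫
                    ≡⟨ ⟪⟫-cong (cong (λ z → z + c₁ * (d * u) + c₂ * u₂) (lemX e s p s' q)) (cong (λ z → z + c₁ * (d * v) + c₂ * v₂) (*-left-swap e s' r)) ⟨
                  ⟪ e * (s * p + s' * q) + c₁ * (d * u) + c₂ * u₂ , e * (s' * r) + c₁ * (d * v) + c₂ * v₂ ⟫
                    ≡⟨ scaled c₁ c₂ x _ _ dx≡ ⟨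
                  ι (d * e) ⊗ (⟪ c₁ , c₂ ⟫ ⊗ g ⊕ x) ∎))

  -- Ideal classes and SL₂(ℤ)-classes of forms

  -- The form a x² + (2k + t) x y + c y².
  record Form : Set where
    constructor form
    field
      a k c : ℤ
      a>0 : 0ℤ < a
      ac≡ : a * c ≡ P k

    a≢0 : a ≢ 0ℤ
    a≢0 a≡0 = ℤ.<-irrefl refl (subst (0ℤ <_) a≡0 a>0)

    eval : ℤ → ℤ → ℤ
    eval x y = a * x * x + (+ 2 * k + t) * x * y + c * y * y

    point : ℤ → ℤ → K
    point s s' = ⟪ s * a + s' * k , s' ⟫

    -- k' such that the form becomes (eval α γ) x² + (2k' + t) x y + ⋯ under a substitution of determinant 1.
    middle : ℤ → ℤ → ℤ → ℤ → ℤ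
    middle α β γ δ = a * α * β + k * α * δ + k * β * γ + c * γ * δ + t * β * γ

  record SL₂ : Set where
    constructor sl₂
    field
      α β γ δ : ℤ
      det : α * δ - β * γ ≡ 1ℤ

  record _⟶_ (g h : Form) : Set where
    constructor transform
    field
      mat : SL₂
    open SL₂ mat public
    field
      a≡ : Form.a h ≡ Form.eval g α γ
      k≡ : Form.k h ≡ Form.middle g α β γ δ

  ideal : Form → FractionalIdeal
  ideal g = record
    { generators = ⟪ a , 0ℤ ⟫ ∷ ⟪ k , 1ℤ ⟫ ∷ []
    ; nonzero = here (λ e → a≢0 (proj₁ (⟪⟫-injective (e ∙ sym 0K-def ∙ sym ⟪⟫-0))))
    }
    where open Form g

  ideal-to : ∀ g y → y ∈ᴵ ideal g → ∃[ s ] ∃[ s' ] y ≡ Form.point g s s'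
  ideal-to g y y∈ = go (∈-split y∈)
    where
    open Form g
    go : Split ⟪ a , 0ℤ ⟫ (⟪ k , 1ℤ ⟫ ∷ []) y → ∃[ s ] ∃[ s' ] y ≡ point s s'
    go (split c₁ x (u , v , c₁≡) x∈ y≡) = go₂ (∈-split x∈)
      where
      go₂ : Split ⟪ k , 1ℤ ⟫ [] x → ∃[ s ] ∃[ s' ] y ≡ point s s'
      go₂ (split c₂ z (u' , v' , c₂≡) z∈ x≡) = u - v * k - v' * c , v * a + u' + v' * k + t * v' , (begin
        y
          ≡⟨ y≡ ∙ cong₂ _⊕_ (cong (_⊗ ⟪ a , 0ℤ ⟫) c₁≡ ∙ ⟪⟫-⊗ u v a 0ℤ)
               (x≡ ∙ cong₂ _⊕_ (cong (_⊗ ⟪ k , 1ℤ ⟫) c₂≡ ∙ ⟪⟫-⊗ u' v' k 1ℤ) (∈-nil z∈) ∙ ⊕-identityʳ _) ⟩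
        ⟪ u * a - n₀ * v * 0ℤ , u * 0ℤ + v * a + t * v * 0ℤ ⟫ ⊕ ⟪ u' * k - n₀ * v' * 1ℤ , u' * 1ℤ + v' * k + t * v' * 1ℤ ⟫
          ≡⟨ ⟪⟫-⊕ _ _ _ _ ⟩
        ⟪ (u * a - n₀ * v * 0ℤ) + (u' * k - n₀ * v' * 1ℤ) , (u * 0ℤ + v * a + t * v * 0ℤ) + (u' * 1ℤ + v' * k + t * v' * 1ℤ) ⟫
          ≡⟨ ⟪⟫-cong (combination (lem₁ u v a c k u' v' t n₀) (v' ⊛ ac≡)) (lem₂ u v a t u' v' k) ⟩
        point (u - v * k - v' * c) (v * a + u' + v' * k + t * v') ∎)
        where
        lem₁ : ∀ u v a c k u' v' t n → (u * a - n * v * 0ℤ) + (u' * k - n * v' * 1ℤ) - ((u - v * k - v' * c) * a + (v * a + u' + v' * k + t * v') * k) ≡ v' * (a * c - (k * k + t * k + n))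
        lem₁ = ring
        lem₂ : ∀ u v a t u' v' k → (u * 0ℤ + v * a + t * v * 0ℤ) + (u' * 1ℤ + v' * k + t * v' * 1ℤ) ≡ v * a + u' + v' * k + t * v'
        lem₂ = ring

  basis : ∀ s a s' k → ⟪ s * a + s' * k , s' ⟫ ≡ ι s ⊗ ⟪ a , 0ℤ ⟫ ⊕ ι s' ⊗ ⟪ k , 1ℤ ⟫
  basis s a s' k = sym (begin
    ι s ⊗ ⟪ a , 0ℤ ⟫ ⊕ ι s' ⊗ ⟪ k , 1ℤ ⟫ ≡⟨ cong₂ _⊕_ (ι-⟪⟫ s a 0ℤ) (ι-⟪⟫ s' k 1ℤ) ⟩
    ⟪ s * a , s * 0ℤ ⟫ ⊕ ⟪ s' * k , s' * 1ℤ ⟫ ≡⟨ ⟪⟫-⊕ _ _ _ _ ⟩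
    ⟪ s * a + s' * k , s * 0ℤ + s' * 1ℤ ⟫ ≡⟨ ⟪⟫-cong refl (lem s s') ⟩
    ⟪ s * a + s' * k , s' ⟫ ∎)
    where
    lem : ∀ s s' → s * 0ℤ + s' * 1ℤ ≡ s'
    lem = ring

  ideal-from : ∀ g y s s' → y ≡ Form.point g s s' → y ∈ᴵ ideal g
  ideal-from g y s s' y≡ = ∈-∷ {c = ι s} (s , 0ℤ , sym (⟪⟫-ι s)) (∈-∷ {c = ι s'} (s' , 0ℤ , sym (⟪⟫-ι s')) (∈-[] refl) refl)
    (y≡ ∙ basis s (Form.a g) s' (Form.k g) ∙ cong (ι s ⊗ ⟪ Form.a g , 0ℤ ⟫ ⊕_) (sym (⊕-identityʳ _)))

  equivalence : ∀ {I J} κ κ⁻¹ → κ ⊗ κ⁻¹ ≡ 1K → (∀ y → y ∈ᴵ J → ∃[ x ] x ∈ᴵ I × y ≡ κ ⊗ x) → (∀ x → x ∈ᴵ I → κ ⊗ x ∈ᴵ J) → I ≃ J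
  equivalence {I} {J} κ κ⁻¹ inv to from = κ , (κ⁻¹ , sym (⊗-def κ κ⁻¹) ∙ inv ∙ 1K-def) , λ y → mk⇔
    (λ y∈ → let x , x∈ , y≡ = to y y∈ in x , x∈ , y≡ ∙ ⊗-def κ x)
    (λ (x , x∈ , y≡) → subst (_∈ᴵ J) (sym (y≡ ∙ sym (⊗-def κ x))) (from x x∈))

  positive-part : ∀ a c {p} → a * c ≡ p → p ≢ 0ℤ → ∃[ a' ] ∃[ c' ] 0ℤ < a' × a' * c' ≡ p × (a' ≡ a ⊎ a' ≡ - a)
  positive-part (+ zero) c e p≢0 = contradiction (sym e ∙ *-zeroˡ c) p≢0
  positive-part (+ suc n) c e p≢0 = + suc n , c , +<+ (s≤s z≤n) , e , inj₁ refl
  positive-part -[1+ n ] c e p≢0 = + suc n , - c , +<+ (s≤s z≤n) , lem (+ suc n) c ∙ e , inj₂ refl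
    where lem : ∀ a c → a * - c ≡ - a * c
          lem = ring

  every-class-contains-form : ∀ I → ∃[ g ] ideal g ≃ I
  every-class-contains-form I = go (toLattice (FractionalIdeal.generators I))
    where
    go : Lattice (FractionalIdeal.generators I) → ∃[ g ] ideal g ≃ I
    go (lattice d p q r d≢0 to from) = omega (ω-closed 1ℤ 0ℤ) (ω-closed 0ℤ 1ℤ)
      where
      Closed : ℤ → ℤ → Set
      Closed s s' = ∃[ σ ] ∃[ σ' ] (- (n₀ * (s' * r)) ≡ σ * p + σ' * q) × (s * p + s' * q + t * (s' * r) ≡ σ' * r)
      ω-closed : ∀ s s' → Closed s s'
      ω-closed s s' = go₁ (divide-ι d d≢0 ⟪ s * p + s' * q , s' * r ⟫)
        where
        go₁ : (∃[ y ] ι d ⊗ y ≡ ⟪ s * p + s' * q , s' * r ⟫) → Closed s s'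
        go₁ (y , dy≡) = go₂ (to (⟪ 0ℤ , 1ℤ ⟫ ⊗ y) (∈-scale (0ℤ , 1ℤ , refl) (from y s s' dy≡)))
          where
          go₂ : Represented d p q r (⟪ 0ℤ , 1ℤ ⟫ ⊗ y) → Closed s s'
          go₂ (σ , σ' , e) = σ , σ' , lem₁ n₀ (s * p + s' * q) (s' * r) ∙ proj₁ eqs , lem₂ t (s * p + s' * q) (s' * r) ∙ proj₂ eqs
            where
            lem₁ : ∀ n x y → - (n * y) ≡ 0ℤ * x - n * 1ℤ * y
            lem₁ = ring
            lem₂ : ∀ t x y → x + t * y ≡ 0ℤ * y + 1ℤ * x + t * 1ℤ * y
            lem₂ = ring
            eqs = ⟪⟫-injective (begin
              ⟪ 0ℤ * (s * p + s' * q) - n₀ * 1ℤ * (s' * r) , 0ℤ * (s' * r) + 1ℤ * (s * p + s' * q) + t * 1ℤ * (s' * r) ⟫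
                ≡⟨ ⟪⟫-⊗ 0ℤ 1ℤ (s * p + s' * q) (s' * r) ⟨
              ⟪ 0ℤ , 1ℤ ⟫ ⊗ ⟪ s * p + s' * q , s' * r ⟫ ≡⟨ cong (⟪ 0ℤ , 1ℤ ⟫ ⊗_) dy≡ ⟨
              ⟪ 0ℤ , 1ℤ ⟫ ⊗ (ι d ⊗ y) ≡⟨ sym (⊗-assoc _ (ι d) y) ∙ cong (_⊗ y) (⊗-comm _ (ι d)) ∙ ⊗-assoc (ι d) _ y ⟩
              ι d ⊗ (⟪ 0ℤ , 1ℤ ⟫ ⊗ y) ≡⟨ e ⟩
              ⟪ σ * p + σ' * q , σ' * r ⟫ ∎)
      omega : Closed 1ℤ 0ℤ → Closed 0ℤ 1ℤ → ∃[ g ] ideal g ≃ I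
      omega (_ , a , _ , p≡') (σ , b , n₀r≡ , q≡') = build (positive-part a (- σ) norm≡ (P≢0 k))
        where
        k : ℤ
        k = b - t
        p≡ : p ≡ a * r
        p≡ = combination (lem p q t r a) (1ℤ ⊛ p≡')
          where lem : ∀ p q t r a → p - a * r ≡ 1ℤ * (1ℤ * p + 0ℤ * q + t * (0ℤ * r) - a * r)
                lem = ring
        q≡ : q ≡ k * r
        q≡ = combination (lem p q t r b) (1ℤ ⊛ q≡')
          where lem : ∀ p q t r b → q - (b - t) * r ≡ 1ℤ * (0ℤ * p + 1ℤ * q + t * (1ℤ * r) - b * r)
                lem = ring
        r≢0 : r ≢ 0ℤ
        r≢0 r≡0 = go₁ (nonzero-∈ I)
          where
          kill : ∀ z → z * r ≡ 0ℤ
          kill z = cong (z *_) r≡0 ∙ *-zeroʳ z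
          go₁ : (∃[ y ] y ≢ 0K × y ∈ᴵ I) → ⊥
          go₁ (y , y≢0 , y∈) = go₂ (to y y∈)
            where
            go₂ : Represented d p q r y → ⊥
            go₂ (s , s' , e) = y≢0 (ι-cancel d d≢0 (e ∙ ⟪⟫-cong
              (cong₂ (λ x z → s * x + s' * z) (p≡ ∙ kill a) (q≡ ∙ kill k) ∙ cong₂ _+_ (*-zeroʳ s) (*-zeroʳ s')) (kill s') ∙ ⟪⟫-0 ∙ sym (⊗-zeroʳ (ι d))))
        norm≡ : a * - σ ≡ P k
        norm≡ = *-cancelˡ r r≢0 (combination (lem n₀ r a σ b t p q) (σ ⊛ p≡ ⊞ 1ℤ ⊛ n₀r≡ ⊞ b ⊛ q≡))
          where lem : ∀ n r a σ b t p q → r * (a * - σ) - r * ((b - t) * (b - t) + t * (b - t) + n) ≡ σ * (p - a * r) + (1ℤ * (- (n * (1ℤ * r)) - (σ * p + b * q)) + b * (q - (b - t) * r))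
                lem = ring
        build : (∃[ a' ] ∃[ c' ] 0ℤ < a' × a' * c' ≡ P k × (a' ≡ a ⊎ a' ≡ - a)) → ∃[ g ] ideal g ≃ I
        build (a' , c' , a'>0 , a'c'≡ , a'≡) = g , equivalence {ideal g} {I} κ κ⁻¹ inv to' from'
          where
          g : Form
          g = form a' k c' a'>0 a'c'≡
          κ κ⁻¹ d⁻¹ r⁻¹ : K
          d⁻¹ = proj₁ (ι-inverse d d≢0)
          r⁻¹ = proj₁ (ι-inverse r r≢0)
          κ = ι r ⊗ d⁻¹
          κ⁻¹ = r⁻¹ ⊗ ι d
          inv : κ ⊗ κ⁻¹ ≡ 1K
          inv = ⊗-interchange (ι r) d⁻¹ r⁻¹ (ι d) ∙ cong₂ _⊗_ (proj₂ (ι-inverse r r≢0)) (⊗-comm d⁻¹ (ι d) ∙ proj₂ (ι-inverse d d≢0)) ∙ ⊗-identityˡ 1K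
          dκ : ∀ x → ι d ⊗ (κ ⊗ x) ≡ ι r ⊗ x
          dκ x = sym (⊗-assoc (ι d) κ x) ∙ cong (_⊗ x) (⊗-comm (ι d) κ ∙ ⊗-assoc (ι r) d⁻¹ (ι d) ∙
            trans (cong (ι r ⊗_) (⊗-comm d⁻¹ (ι d) ∙ proj₂ (ι-inverse d d≢0))) (⊗-comm (ι r) 1K ∙ ⊗-identityˡ (ι r)))
          lem : ∀ r s a s' k → r * (s * a + s' * k) ≡ s * (a * r) + s' * (k * r)
          lem = ring
          sign : ∀ s → ∃[ s₁ ] s * a ≡ s₁ * a'
          sign s = [ (λ e → s , cong (s *_) (sym e)) , (λ e → - s , lem' s a ∙ cong (- s *_) (sym e)) ]′ a'≡
            where lem' : ∀ s a → s * a ≡ - s * - a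
                  lem' = ring
          sign' : ∀ s → ∃[ s₁ ] s * a' ≡ s₁ * a
          sign' s = [ (λ e → s , cong (s *_) e) , (λ e → - s , cong (s *_) e ∙ lem' s a) ]′ a'≡
            where lem' : ∀ s a → s * - a ≡ - s * a
                  lem' = ring
          to' : ∀ y → y ∈ᴵ I → ∃[ x ] x ∈ᴵ ideal g × y ≡ κ ⊗ x
          to' y y∈ = go₁ (to y y∈)
            where
            go₁ : Represented d p q r y → ∃[ x ] x ∈ᴵ ideal g × y ≡ κ ⊗ x
            go₁ (s , s' , e) = x , ideal-from g x s₁ s' refl , ι-cancel d d≢0 (begin
              ι d ⊗ y ≡⟨ e ⟩
              ⟪ s * p + s' * q , s' * r ⟫ ≡⟨ ⟪⟫-cong (cong₂ (λ u v → s * u + s' * v) p≡ q≡ ∙ sym (lem r s a s' k)) (*-comm s' r) ⟩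
              ⟪ r * (s * a + s' * k) , r * s' ⟫ ≡⟨ ⟪⟫-cong (cong (λ u → r * (u + s' * k)) (proj₂ (sign s))) refl ⟩
              ⟪ r * (s₁ * a' + s' * k) , r * s' ⟫ ≡⟨ dκ x ∙ ι-⟪⟫ r _ _ ⟨
              ι d ⊗ (κ ⊗ x) ∎)
              where
              s₁ : ℤ
              s₁ = proj₁ (sign s)
              x : K
              x = ⟪ s₁ * a' + s' * k , s' ⟫
          from' : ∀ x → x ∈ᴵ ideal g → κ ⊗ x ∈ᴵ I
          from' x x∈ = go₁ (ideal-to g x x∈)
            where
            go₁ : (∃[ s ] ∃[ s' ] x ≡ Form.point g s s') → κ ⊗ x ∈ᴵ I
            go₁ (s , s' , x≡) = from (κ ⊗ x) s₁ s' (begin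
              ι d ⊗ (κ ⊗ x) ≡⟨ dκ x ∙ cong (ι r ⊗_) x≡ ∙ ι-⟪⟫ r _ _ ⟩
              ⟪ r * (s * a' + s' * k) , r * s' ⟫ ≡⟨ ⟪⟫-cong (cong (λ u → r * (u + s' * k)) (proj₂ (sign' s))) refl ⟩
              ⟪ r * (s₁ * a + s' * k) , r * s' ⟫ ≡⟨ ⟪⟫-cong (cong₂ (λ u v → s₁ * u + s' * v) p≡ q≡ ∙ sym (lem r s₁ a s' k)) (*-comm s' r) ⟨
              ⟪ s₁ * p + s' * q , s' * r ⟫ ∎)
              where
              s₁ : ℤ
              s₁ = proj₁ (sign' s)

  module Columns (g h : Form) (α β γ δ : ℤ) where
    open Form g
    open Form h public using () renaming (a to a'; k to k')

    V W D : ℤ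
    V = α * a + γ * k
    W = β * a + δ * k
    D = α * δ - β * γ

    -- (V + γω)(k' + ω) = a'(W + δω): the columns of the matrix are proportional to the basis a', k' + ω.
    Proportional : Set
    Proportional = (V * k' - n₀ * γ ≡ a' * W) × (V + γ * k' + t * γ ≡ a' * δ)

    transform⇒proportional : D ≡ 1ℤ → a' ≡ eval α γ → k' ≡ middle α β γ δ → Proportional
    transform⇒proportional det a≡ k≡ =
      combination (lem₁ α β γ δ a k c t n₀ a' k') (V ⊛ k≡ ⊞ (n₀ * γ) ⊛ det ⊞ (- W) ⊛ a≡ ⊞ (γ * D) ⊛ ac≡) ,
      combination (lem₂ α β γ δ a k c t a' k') (γ ⊛ k≡ ⊞ (- (V + t * γ)) ⊛ det ⊞ (- δ) ⊛ a≡)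
      where
      lem₁ : ∀ α β γ δ a k c t n a' k' → let V = α * a + γ * k; W = β * a + δ * k; D = α * δ - β * γ in
        V * k' - n * γ - a' * W ≡ V * (k' - (a * α * β + k * α * δ + k * β * γ + c * γ * δ + t * β * γ)) + (n * γ * (D - 1ℤ)
          + (- W * (a' - (a * α * α + (+ 2 * k + t) * α * γ + c * γ * γ)) + γ * D * (a * c - (k * k + t * k + n))))
      lem₁ = ring
      lem₂ : ∀ α β γ δ a k c t a' k' → let V = α * a + γ * k; D = α * δ - β * γ in
        V + γ * k' + t * γ - a' * δ ≡ γ * (k' - (a * α * β + k * α * δ + k * β * γ + c * γ * δ + t * β * γ)) + (- (V + t * γ) * (D - 1ℤ)
          + - δ * (a' - (a * α * α + (+ 2 * k + t) * α * γ + c * γ * γ)))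
      lem₂ = ring

    norm-V : V * V + t * V * γ + n₀ * γ * γ ≡ a * eval α γ
    norm-V = combination (lem α γ a k c t n₀) ((- (γ * γ)) ⊛ ac≡)
      where
      lem : ∀ α γ a k c t n → let V = α * a + γ * k in
        V * V + t * V * γ + n * γ * γ - a * (a * α * α + (+ 2 * k + t) * α * γ + c * γ * γ) ≡ - (γ * γ) * (a * c - (k * k + t * k + n))
      lem = ring

    proportional⇒eval : Proportional → eval α γ ≡ a' * D
    proportional⇒eval (e₁ , e₂) = *-cancelˡ a a≢0 (combination (lem α β γ δ a k t n₀ a' k' (eval α γ)) (-1ℤ ⊛ norm-V ⊞ V ⊛ e₂ ⊞ (- γ) ⊛ e₁))
      where
      lem : ∀ α β γ δ a k t n a' k' e → let V = α * a + γ * k in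
        a * e - a * (a' * (α * δ - β * γ)) ≡ -1ℤ * (V * V + t * V * γ + n * γ * γ - a * e) + (V * (V + γ * k' + t * γ - a' * δ) + - γ * (V * k' - n * γ - a' * (β * a + δ * k)))
      lem = ring

    proportional⇒middle : Proportional → D ≡ 1ℤ → k' ≡ middle α β γ δ
    proportional⇒middle (e₁ , e₂) det = *-cancelˡ (a * a') (i*j≢0 a≢0 (Form.a≢0 h)) (combination (lem α β γ δ a k c t n₀ a' k' (eval α γ))
        ((- (a * k' * a')) ⊛ det ⊞ (- (a * k')) ⊛ proportional⇒eval (e₁ , e₂) ⊞ (- k') ⊛ norm-V ⊞ (V + t * γ) ⊛ e₁ ⊞ (n₀ * γ) ⊛ e₂ ⊞ (- (a' * γ * δ)) ⊛ ac≡))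
      where
      lem : ∀ α β γ δ a k c t n a' k' e → let V = α * a + γ * k; D = α * δ - β * γ in
        a * a' * k' - a * a' * (a * α * β + k * α * δ + k * β * γ + c * γ * δ + t * β * γ) ≡ - (a * k' * a') * (D - 1ℤ) + (- (a * k') * (e - a' * D)
          + (- k' * (V * V + t * V * γ + n * γ * γ - a * e) + ((V + t * γ) * (V * k' - n * γ - a' * (β * a + δ * k))
          + (n * γ * (V + γ * k' + t * γ - a' * δ) + - (a' * γ * δ) * (a * c - (k * k + t * k + n))))))
      lem = ring

    proportional-⊗ : Proportional → ∀ r r' → ⟪ V , γ ⟫ ⊗ Form.point h r r' ≡ ι a' ⊗ point (r * α + r' * β) (r * γ + r' * δ)
    proportional-⊗ (e₁ , e₂) r r' = begin
      ⟪ V , γ ⟫ ⊗ Form.point h r r'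
        ≡⟨ ⟪⟫-⊗ V γ (r * a' + r' * k') r' ⟩
      ⟪ V * (r * a' + r' * k') - n₀ * γ * r' , V * r' + γ * (r * a' + r' * k') + t * γ * r' ⟫
        ≡⟨ ⟪⟫-cong (combination (lem₁ α β γ δ a k n₀ a' k' r r') (r' ⊛ e₁)) (combination (lem₂ V γ δ t a' k' r r') (r' ⊛ e₂)) ⟩
      ⟪ a' * ((r * α + r' * β) * a + (r * γ + r' * δ) * k) , a' * (r * γ + r' * δ) ⟫
        ≡⟨ ι-⟪⟫ a' _ _ ⟨
      ι a' ⊗ point (r * α + r' * β) (r * γ + r' * δ) ∎
      where
      lem₁ : ∀ α β γ δ a k n a' k' r r' → let V = α * a + γ * k in
        V * (r * a' + r' * k') - n * γ * r' - a' * ((r * α + r' * β) * a + (r * γ + r' * δ) * k) ≡ r' * (V * k' - n * γ - a' * (β * a + δ * k))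
      lem₁ = ring
      lem₂ : ∀ V γ δ t a' k' r r' → V * r' + γ * (r * a' + r' * k') + t * γ * r' - a' * (r * γ + r' * δ) ≡ r' * (V + γ * k' + t * γ - a' * δ)
      lem₂ = ring

  transform⇒≃ : ∀ {g h} → g ⟶ h → ideal h ≃ ideal g
  transform⇒≃ {g} {h} (transform (sl₂ α β γ δ det) a≡ k≡) = equivalence {ideal h} {ideal g} κ κ⁻¹ inv to from
    where
    open Form g
    open Columns g h α β γ δ
    prop : Proportional
    prop = transform⇒proportional det a≡ k≡
    a⁻¹ a'⁻¹ κ κ⁻¹ : K
    a⁻¹ = proj₁ (ι-inverse a a≢0)
    a'⁻¹ = proj₁ (ι-inverse a' (Form.a≢0 h))
    κ = ⟪ V , γ ⟫ ⊗ a'⁻¹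
    κ⁻¹ = ⟪ V + t * γ , - γ ⟫ ⊗ a⁻¹
    inv : κ ⊗ κ⁻¹ ≡ 1K
    inv = begin
      (⟪ V , γ ⟫ ⊗ a'⁻¹) ⊗ (⟪ V + t * γ , - γ ⟫ ⊗ a⁻¹) ≡⟨ ⊗-interchange _ _ _ _ ⟩
      (⟪ V , γ ⟫ ⊗ ⟪ V + t * γ , - γ ⟫) ⊗ (a'⁻¹ ⊗ a⁻¹) ≡⟨ cong (_⊗ (a'⁻¹ ⊗ a⁻¹)) (⟪⟫-⊗ V γ (V + t * γ) (- γ) ∙ ⟪⟫-cong (lem₁ V t γ n₀ ∙ norm-V ∙ cong (a *_) (sym a≡)) (lem₂ V t γ)) ⟩
      ⟪ a * a' , 0ℤ ⟫ ⊗ (a'⁻¹ ⊗ a⁻¹) ≡⟨ cong₂ _⊗_ (⟪⟫-ι (a * a') ∙ ι-* a a') (⊗-comm a'⁻¹ a⁻¹) ⟩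
      (ι a ⊗ ι a') ⊗ (a⁻¹ ⊗ a'⁻¹) ≡⟨ ⊗-interchange _ _ _ _ ⟩
      (ι a ⊗ a⁻¹) ⊗ (ι a' ⊗ a'⁻¹) ≡⟨ cong₂ _⊗_ (proj₂ (ι-inverse a a≢0)) (proj₂ (ι-inverse a' (Form.a≢0 h))) ⟩
      1K ⊗ 1K ≡⟨ ⊗-identityˡ 1K ⟩
      1K ∎
      where
      lem₁ : ∀ V t γ n → V * (V + t * γ) - n * γ * - γ ≡ V * V + t * V * γ + n * γ * γ
      lem₁ = ring
      lem₂ : ∀ V t γ → V * - γ + γ * (V + t * γ) + t * γ * - γ ≡ 0ℤ
      lem₂ = ring
    action : ∀ r r' → κ ⊗ Form.point h r r' ≡ point (r * α + r' * β) (r * γ + r' * δ)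
    action r r' = ι-cancel a' (Form.a≢0 h) (begin
      ι a' ⊗ ((⟪ V , γ ⟫ ⊗ a'⁻¹) ⊗ x) ≡⟨ sym (⊗-assoc (ι a') _ x) ∙ cong (λ z → (ι a' ⊗ z) ⊗ x) (⊗-comm ⟪ V , γ ⟫ a'⁻¹) ⟩
      (ι a' ⊗ (a'⁻¹ ⊗ ⟪ V , γ ⟫)) ⊗ x ≡⟨ cong (_⊗ x) (sym (⊗-assoc (ι a') a'⁻¹ _) ∙ cong (_⊗ ⟪ V , γ ⟫) (proj₂ (ι-inverse a' (Form.a≢0 h))) ∙ ⊗-identityˡ _) ⟩
      ⟪ V , γ ⟫ ⊗ x ≡⟨ proportional-⊗ prop r r' ⟩
      ι a' ⊗ point (r * α + r' * β) (r * γ + r' * δ) ∎)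
      where
      x : K
      x = Form.point h r r'
    to : ∀ y → y ∈ᴵ ideal g → ∃[ x ] x ∈ᴵ ideal h × y ≡ κ ⊗ x
    to y y∈ = go (ideal-to g y y∈)
      where
      go : (∃[ s ] ∃[ s' ] y ≡ point s s') → ∃[ x ] x ∈ᴵ ideal h × y ≡ κ ⊗ x
      go (s , s' , y≡) = Form.point h r r' , ideal-from h _ r r' refl ,
        trans y≡ (cong₂ point e₁ e₂ ∙ sym (action r r'))
        where
        r r' : ℤ
        r = s * δ - s' * β
        r' = s' * α - s * γ
        e₁ : s ≡ r * α + r' * β
        e₁ = combination (lem s s' α β γ δ) ((- s) ⊛ det)
          where lem : ∀ s s' α β γ δ → s - ((s * δ - s' * β) * α + (s' * α - s * γ) * β) ≡ - s * (α * δ - β * γ - 1ℤ)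
                lem = ring
        e₂ : s' ≡ r * γ + r' * δ
        e₂ = combination (lem s s' α β γ δ) ((- s') ⊛ det)
          where lem : ∀ s s' α β γ δ → s' - ((s * δ - s' * β) * γ + (s' * α - s * γ) * δ) ≡ - s' * (α * δ - β * γ - 1ℤ)
                lem = ring
    from : ∀ x → x ∈ᴵ ideal h → κ ⊗ x ∈ᴵ ideal g
    from x x∈ = go (ideal-to h x x∈)
      where
      go : (∃[ r ] ∃[ r' ] x ≡ Form.point h r r') → κ ⊗ x ∈ᴵ ideal g
      go (r , r' , x≡) = ideal-from g _ (r * α + r' * β) (r * γ + r' * δ) (cong (κ ⊗_) x≡ ∙ action r r')

  ≃⇒transform : ∀ {g h} → ideal h ≃ ideal g → g ⟶ h
  ≃⇒transform {g} {h} (κ , _ , image) =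
    go (ideal-to g _ (mul∈ ⟪ a' , 0ℤ ⟫ (generator-∈ (here refl)))) (ideal-to g _ (mul∈ ⟪ k' , 1ℤ ⟫ (generator-∈ (there (here refl)))))
    where
    open Form g
    a' k' : ℤ
    a' = Form.a h
    k' = Form.k h
    mul∈ : ∀ x → x ∈ᴵ ideal h → κ ⊗ x ∈ᴵ ideal g
    mul∈ x x∈ = Equivalence.from (image (κ ⊗ x)) (x , x∈ , ⊗-def κ x)
    preimage : ∀ y → y ∈ᴵ ideal g → ∃[ r ] ∃[ r' ] y ≡ κ ⊗ Form.point h r r'
    preimage y y∈ = go₁ (Equivalence.to (image y) y∈)
      where
      go₁ : (∃[ x ] x ∈ᴵ ideal h × y ≡ κ Q.⊗ x) → ∃[ r ] ∃[ r' ] y ≡ κ ⊗ Form.point h r r'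
      go₁ (x , x∈ , y≡) = go₂ (ideal-to h x x∈)
        where
        go₂ : (∃[ r ] ∃[ r' ] x ≡ Form.point h r r') → ∃[ r ] ∃[ r' ] y ≡ κ ⊗ Form.point h r r'
        go₂ (r , r' , x≡) = r , r' , y≡ ∙ sym (⊗-def κ x) ∙ cong (κ ⊗_) x≡
    go : (∃[ α ] ∃[ γ ] κ ⊗ ⟪ a' , 0ℤ ⟫ ≡ point α γ) → (∃[ β ] ∃[ δ ] κ ⊗ ⟪ k' , 1ℤ ⟫ ≡ point β δ) → g ⟶ h
    go (α , γ , κa≡) (β , δ , κk≡) = finish (preimage ⟪ a , 0ℤ ⟫ (generator-∈ (here refl))) (preimage ⟪ k , 1ℤ ⟫ (generator-∈ (there (here refl))))
      where
      open Columns g h α β γ δ hiding (a'; k')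
      prop : Proportional
      prop = combination (lem₁ V W k' a' n₀ γ δ) (1ℤ ⊛ proj₁ eqs) , combination (lem₂ V W k' a' t γ δ) (1ℤ ⊛ proj₂ eqs)
        where
        lem₁ : ∀ V W k a n γ δ → V * k - n * γ - a * W ≡ 1ℤ * (V * k - n * γ * 1ℤ - (W * a - n * δ * 0ℤ))
        lem₁ = ring
        lem₂ : ∀ V W k a t γ δ → V + γ * k + t * γ - a * δ ≡ 1ℤ * (V * 1ℤ + γ * k + t * γ * 1ℤ - (W * 0ℤ + δ * a + t * δ * 0ℤ))
        lem₂ = ring
        eqs = ⟪⟫-injective (begin
          ⟪ V * k' - n₀ * γ * 1ℤ , V * 1ℤ + γ * k' + t * γ * 1ℤ ⟫ ≡⟨ ⟪⟫-⊗ V γ k' 1ℤ ⟨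
          ⟪ V , γ ⟫ ⊗ ⟪ k' , 1ℤ ⟫ ≡⟨ cong (_⊗ ⟪ k' , 1ℤ ⟫) κa≡ ⟨
          (κ ⊗ ⟪ a' , 0ℤ ⟫) ⊗ ⟪ k' , 1ℤ ⟫ ≡⟨ ⊗-assoc κ _ _ ∙ cong (κ ⊗_) (⊗-comm _ _) ∙ sym (⊗-assoc κ _ _) ⟩
          (κ ⊗ ⟪ k' , 1ℤ ⟫) ⊗ ⟪ a' , 0ℤ ⟫ ≡⟨ cong (_⊗ ⟪ a' , 0ℤ ⟫) κk≡ ⟩
          ⟪ W , δ ⟫ ⊗ ⟪ a' , 0ℤ ⟫ ≡⟨ ⟪⟫-⊗ W δ a' 0ℤ ⟩
          ⟪ W * a' - n₀ * δ * 0ℤ , W * 0ℤ + δ * a' + t * δ * 0ℤ ⟫ ∎)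
      coords : ∀ r r' u v → ⟪ u , v ⟫ ≡ κ ⊗ Form.point h r r' → (u ≡ (r * α + r' * β) * a + v * k) × (v ≡ r * γ + r' * δ)
      coords r r' u v e = combination (lem α β γ δ a k r r' u v) (1ℤ ⊛ proj₁ eqs ⊞ (- k) ⊛ proj₂ eqs) , proj₂ eqs
        where
        lem : ∀ α β γ δ a k r r' u v → u - ((r * α + r' * β) * a + v * k) ≡ 1ℤ * (u - (r * (α * a + γ * k) + r' * (β * a + δ * k))) + - k * (v - (r * γ + r' * δ))
        lem = ring
        eqs : (u ≡ r * V + r' * W) × (v ≡ r * γ + r' * δ)
        eqs = ⟪⟫-injective (begin
          ⟪ u , v ⟫ ≡⟨ e ⟩
          κ ⊗ Form.point h r r' ≡⟨ cong (κ ⊗_) (basis r a' r' k') ⟩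
          κ ⊗ (ι r ⊗ ⟪ a' , 0ℤ ⟫ ⊕ ι r' ⊗ ⟪ k' , 1ℤ ⟫) ≡⟨ ⊗-distribˡ κ _ _ ⟩
          κ ⊗ (ι r ⊗ ⟪ a' , 0ℤ ⟫) ⊕ κ ⊗ (ι r' ⊗ ⟪ k' , 1ℤ ⟫) ≡⟨ cong₂ _⊕_ (pull r _) (pull r' _) ⟩
          ι r ⊗ (κ ⊗ ⟪ a' , 0ℤ ⟫) ⊕ ι r' ⊗ (κ ⊗ ⟪ k' , 1ℤ ⟫) ≡⟨ cong₂ (λ x y → ι r ⊗ x ⊕ ι r' ⊗ y) κa≡ κk≡ ⟩
          ι r ⊗ ⟪ V , γ ⟫ ⊕ ι r' ⊗ ⟪ W , δ ⟫ ≡⟨ cong₂ _⊕_ (ι-⟪⟫ r V γ) (ι-⟪⟫ r' W δ) ⟩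
          ⟪ r * V , r * γ ⟫ ⊕ ⟪ r' * W , r' * δ ⟫ ≡⟨ ⟪⟫-⊕ _ _ _ _ ⟩
          ⟪ r * V + r' * W , r * γ + r' * δ ⟫ ∎)
          where
          pull : ∀ r x → κ ⊗ (ι r ⊗ x) ≡ ι r ⊗ (κ ⊗ x)
          pull r x = sym (⊗-assoc κ (ι r) x) ∙ cong (_⊗ x) (⊗-comm κ (ι r)) ∙ ⊗-assoc (ι r) κ x
      positive : D ∣ 1ℤ → D ≡ 1ℤ
      positive D∣1 = sign D refl (ℕ∣.∣1⇒≡1 (∣⇒∣ᵤ D∣1))
        where
        sign : ∀ z → D ≡ z → ∣ z ∣ ≡ 1 → D ≡ 1ℤ
        sign (+ 1) e refl = e
        sign -[1+ 0 ] e refl = ⊥-elim (impossible (a * a') (a*a'>0 a>0 (Form.a>0 h)) (begin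
          + (∣ + 2 * V + t * γ ∣ · ∣ + 2 * V + t * γ ∣ ℕ.+ N · (∣ γ ∣ · ∣ γ ∣)) ≡⟨ 4norm-ℕ V γ ⟨
          + 4 * norm V γ ≡⟨ cong (+ 4 *_) (norm-V ∙ cong (a *_) (proportional⇒eval prop ∙ cong (a' *_) e)) ⟩
          + 4 * (a * (a' * -1ℤ)) ≡⟨ lem a a' ⟩
          - (+ 4 * (a * a')) ∎))
          where
          lem : ∀ a b → + 4 * (a * (b * -1ℤ)) ≡ - (+ 4 * (a * b))
          lem = ring
          a*a'>0 : ∀ {x y} → 0ℤ < x → 0ℤ < y → 0ℤ < x * y
          a*a'>0 {+ suc x} {+ suc y} _ _ = +<+ (s≤s z≤n)
          a*a'>0 {+ zero} (+<+ ())
          a*a'>0 {+ suc x} {+ zero} _ (+<+ ())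
          impossible : ∀ z {n} → 0ℤ < z → + n ≡ - (+ 4 * z) → ⊥
          impossible (+ suc z) _ ()
          impossible (+ zero) (+<+ ()) _
      finish : (∃[ r ] ∃[ r' ] ⟪ a , 0ℤ ⟫ ≡ κ ⊗ Form.point h r r') → (∃[ r ] ∃[ r' ] ⟪ k , 1ℤ ⟫ ≡ κ ⊗ Form.point h r r') → g ⟶ h
      finish (r₁ , r₂ , e₁) (r₃ , r₄ , e₂) = transform (sl₂ α β γ δ det) (sym (cong (a' *_) det ∙ *-identityʳ a') ∙ sym (proportional⇒eval prop)) (proportional⇒middle prop det)
        where
        c₁ = coords r₁ r₂ a 0ℤ e₁
        c₂ = coords r₃ r₄ k 1ℤ e₂
        x₁ : r₁ * α + r₂ * β ≡ 1ℤ
        x₁ = *-cancelˡ a a≢0 (combination (lem (r₁ * α + r₂ * β) a k) (-1ℤ ⊛ proj₁ c₁))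
          where lem : ∀ x a k → a * x - a * 1ℤ ≡ -1ℤ * (a - (x * a + 0ℤ * k))
                lem = ring
        x₂ : r₃ * α + r₄ * β ≡ 0ℤ
        x₂ = *-cancelˡ a a≢0 (combination (lem (r₃ * α + r₄ * β) a k) (-1ℤ ⊛ proj₁ c₂))
          where lem : ∀ x a k → a * x - a * 0ℤ ≡ -1ℤ * (k - (x * a + 1ℤ * k))
                lem = ring
        det : D ≡ 1ℤ
        det = positive (divides (r₁ * r₄ - r₂ * r₃) (combination (lem r₁ r₂ r₃ r₄ α β γ δ) (1ℤ ⊛ proj₂ c₂ ⊞ (- (r₃ * γ + r₄ * δ)) ⊛ x₁ ⊞ (r₁ * γ + r₂ * δ) ⊛ x₂)))
          where
          lem : ∀ r₁ r₂ r₃ r₄ α β γ δ → 1ℤ - (r₁ * r₄ - r₂ * r₃) * (α * δ - β * γ) ≡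
            1ℤ * (1ℤ - (r₃ * γ + r₄ * δ)) + (- (r₃ * γ + r₄ * δ) * (r₁ * α + r₂ * β - 1ℤ) + (r₁ * γ + r₂ * δ) * (r₃ * α + r₄ * β - 0ℤ))
          lem = ring

  -- Automorphisms and primitive representations

  transform-linear : ∀ {g h} (T : g ⟶ h) →
    let open Form g
        open _⟶_ T in
    (Form.a h * β ≡ (Form.k h - k) * α - c * γ) × (Form.a h * δ ≡ a * α + (Form.k h + k + t) * γ)
  transform-linear {g} {h} (transform (sl₂ α β γ δ det) a≡ k≡) = first , second
    where
    open Form g
    open Columns g h α β γ δ
    prop : Proportional
    prop = transform⇒proportional det a≡ k≡
    second : a' * δ ≡ a * α + (k' + k + t) * γ
    second = combination (lem α a γ k k' t (a' * δ)) (-1ℤ ⊛ proj₂ prop)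
      where lem : ∀ α a γ k k' t x → x - (a * α + (k' + k + t) * γ) ≡ -1ℤ * (α * a + γ * k + γ * k' + t * γ - x)
            lem = ring
    first : a' * β ≡ (k' - k) * α - c * γ
    first = *-cancelˡ a a≢0 (combination (lem α a γ k k' n₀ t c a' β δ) (-1ℤ ⊛ proj₁ prop ⊞ k ⊛ proj₂ prop ⊞ γ ⊛ ac≡))
      where lem : ∀ α a γ k k' n t c a' β δ → a * (a' * β) - a * ((k' - k) * α - c * γ) ≡
                  -1ℤ * ((α * a + γ * k) * k' - n * γ - a' * (β * a + δ * k)) + (k * (α * a + γ * k + γ * k' + t * γ - a' * δ) + γ * (a * c - (k * k + t * k + n)))
            lem = ring

  N≡ : + N ≡ - (f * f * m)
  N≡ = combination (lem (f * f * m) (+ 4 * n₀) (t * t) (+ N)) (-1ℤ ⊛ disc-N ⊞ 1ℤ ⊛ disc)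
    where lem : ∀ x n t N → N - - x ≡ -1ℤ * (n - t - N) + 1ℤ * (x + n - t)
          lem = ring

  trivial-automorphism : ∀ a r s → a ≢ 0ℤ → + N * (r * r) ≡ a * a * (+ 4 - s * s) → r ≡ 0ℤ
  trivial-automorphism a r s a≢0 eq = go (squareFree-∣ sf a (f * r) (divides (s * s - + 4) fr²))
    where
    fr² : m * (f * r * (f * r)) ≡ (s * s - + 4) * (a * a)
    fr² = combination (lem m f r s a (+ N)) ((r * r) ⊛ N≡ ⊞ -1ℤ ⊛ eq)
      where lem : ∀ m f r s a N → m * (f * r * (f * r)) - (s * s - + 4) * (a * a) ≡ r * r * (N - - (f * f * m)) + -1ℤ * (N * (r * r) - a * a * (+ 4 - s * s))
            lem = ring
    vanish : ∀ e → + N * (e * e) + s * s ≡ + 4 → e ≡ 0ℤ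
    vanish e e≡ = ∣i∣≡0⇒i≡0 (large-coefficient N (∣_∣ e) (∣ s ∣ · ∣ s ∣) N>4 (+-injective (trans
      (sym (cong₂ _+_ (cong (+ N *_) (square-ℕ e) ∙ sym (pos-* N (∣ e ∣ · ∣ e ∣))) (square-ℕ s))) e≡)))
    go : a ∣ f * r → r ≡ 0ℤ
    go (divides e fr≡) = by-kind kind
      where
      norm≡ : - m * (e * e) + s * s ≡ + 4
      norm≡ = *-cancelˡ (a * a) (i*j≢0 a≢0 a≢0) (combination (lem m f r s a e) (-1ℤ ⊛ fr² ⊞ (m * (f * r + e * a)) ⊛ fr≡))
        where lem : ∀ m f r s a e → a * a * (- m * (e * e) + s * s) - a * a * + 4 ≡ -1ℤ * (m * (f * r * (f * r)) - (s * s - + 4) * (a * a)) + m * (f * r + e * a) * (f * r - e * a)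
              lem = ring
      conclude : f ≢ 0ℤ → e ≡ 0ℤ → r ≡ 0ℤ
      conclude f≢0 e≡0 = [ (λ z → contradiction z f≢0) , id ]′ (ℤ.i*j≡0⇒i≡0∨j≡0 f {r} (fr≡ ∙ cong (_* a) e≡0 ∙ *-zeroˡ a))
      by-kind : Kind m t f → r ≡ 0ℤ
      by-kind (odd-disc t≡ f≡) = conclude (λ z → contradiction (sym f≡ ∙ z) (λ ()))
        (vanish e (combination (lem (+ N) m f e s) ((e * e) ⊛ N≡ ⊞ 1ℤ ⊛ norm≡ ⊞ (- ((f + 1ℤ) * m * (e * e))) ⊛ f≡)))
        where lem : ∀ N m f e s → N * (e * e) + s * s - + 4 ≡ e * e * (N - - (f * f * m)) + (1ℤ * (- m * (e * e) + s * s - + 4) + - ((f + 1ℤ) * m * (e * e)) * (f - 1ℤ))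
              lem = ring
      by-kind (even-disc j t≡ f≡ m≡) = both-even (divide (+ 2) s e (λ ()) (divides 1ℤ (combination (lem₁ s e t m n₀) (1ℤ ⊛ norm≡ ⊞ (s * e) ⊛ t≡ ⊞ (e * e) ⊛ n₀≡))) (divides s (combination (lem₂ s t e) (e ⊛ t≡))))
        where
        lem₁ : ∀ s e t m n → s * s + t * s * e + n * e * e - 1ℤ * (+ 2 * + 2) ≡ 1ℤ * (- m * (e * e) + s * s - + 4) + (s * e * (t - 0ℤ) + e * e * (n - - m))
        lem₁ = ring
        lem₂ : ∀ s t e → + 2 * s + t * e - s * + 2 ≡ e * (t - 0ℤ)
        lem₂ = ring
        n₀≡ : n₀ ≡ - m
        n₀≡ = *-cancelˡ (+ 4) (λ ()) (combination (lem m f n₀ t) (1ℤ ⊛ disc ⊞ (- ((f + + 2) * m)) ⊛ f≡ ⊞ t ⊛ t≡))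
          where lem : ∀ m f n t → + 4 * n - + 4 * - m ≡ 1ℤ * (f * f * m + + 4 * n - t * t) + (- ((f + + 2) * m) * (f - + 2) + t * (t - 0ℤ))
                lem = ring
        both-even : (+ 2 ∣ s) × (+ 2 ∣ e) → r ≡ 0ℤ
        both-even (_ , divides e₁ e≡) = conclude (λ z → contradiction (sym f≡ ∙ z) (λ ())) (e≡ ∙ cong (_* + 2)
            (vanish e₁ (combination (lem (+ N) m f e e₁ s) ((e₁ * e₁) ⊛ N≡ ⊞ 1ℤ ⊛ norm≡ ⊞ (m * (e + e₁ * + 2)) ⊛ e≡ ⊞ (- ((f + + 2) * m * (e₁ * e₁))) ⊛ f≡))))
          where lem : ∀ N m f e e₁ s → N * (e₁ * e₁) + s * s - + 4 ≡ e₁ * e₁ * (N - - (f * f * m)) + (1ℤ * (- m * (e * e) + s * s - + 4) + (m * (e + e₁ * + 2) * (e - e₁ * + 2) + - ((f + + 2) * m * (e₁ * e₁)) * (f - + 2)))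
                lem = ring

  module _ {g h : Form} (T T' : g ⟶ h) where
    open Form g
    open Form h using () renaming (a to a″; k to k″; c to c″; a≢0 to a″≢0; ac≡ to ac″≡)
    open _⟶_ T
    open _⟶_ T' using () renaming (α to α'; β to β'; γ to γ'; δ to δ')

    column-unique : (α' ≡ α × γ' ≡ γ) ⊎ (α' ≡ - α × γ' ≡ - γ)
    column-unique = by-sign (unit-cases r s rs≡1)
      where
      det' : α' * δ' - β' * γ' ≡ 1ℤ
      det' = SL₂.det (_⟶_.mat T')
      r r' q₁ s : ℤ
      r = α' * δ - γ' * β
      r' = α * γ' - γ * α'
      q₁ = β' * δ - δ' * β
      s = α * δ' - γ * β'
      L = transform-linear T
      L' = transform-linear T'
      eq₁ : a″ * (s - r) ≡ (t + + 2 * k″) * r'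
      eq₁ = combination (lem a k c t k″ a″ α β γ δ α' β' γ' δ') (α ⊛ proj₂ L' ⊞ (- γ) ⊛ proj₁ L' ⊞ (- α') ⊛ proj₂ L ⊞ γ' ⊛ proj₁ L)
        where
        lem : ∀ a k c t k″ a″ α β γ δ α' β' γ' δ' → a″ * ((α * δ' - γ * β') - (α' * δ - γ' * β)) - (t + + 2 * k″) * (α * γ' - γ * α') ≡
              α * (a″ * δ' - (a * α' + (k″ + k + t) * γ')) + (- γ * (a″ * β' - ((k″ - k) * α' - c * γ'))
              + (- α' * (a″ * δ - (a * α + (k″ + k + t) * γ)) + γ' * (a″ * β - ((k″ - k) * α - c * γ))))
        lem = ring
      eq₂ : a″ * q₁ ≡ - (r' * c″)
      eq₂ = *-cancelˡ a″ a″≢0 (combination (lem a k c t k″ n₀ a″ c″ α β γ δ α' β' γ' δ')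
          (1ℤ ⊛ cong₂ _-_ (cong₂ _*_ (proj₁ L') (proj₂ L)) (cong₂ _*_ (proj₂ L') (proj₁ L)) ⊞ r' ⊛ ac″≡ ⊞ (- r') ⊛ ac≡))
        where
        lem : ∀ a k c t k″ n a″ c″ α β γ δ α' β' γ' δ' → a″ * (a″ * (β' * δ - δ' * β)) - a″ * - ((α * γ' - γ * α') * c″) ≡
              1ℤ * (a″ * β' * (a″ * δ) - a″ * δ' * (a″ * β) - (((k″ - k) * α' - c * γ') * (a * α + (k″ + k + t) * γ) - (a * α' + (k″ + k + t) * γ') * ((k″ - k) * α - c * γ)))
              + ((α * γ' - γ * α') * (a″ * c″ - (k″ * k″ + t * k″ + n)) + - (α * γ' - γ * α') * (a * c - (k * k + t * k + n)))
        lem = ring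
      det″ : r * s - q₁ * r' ≡ 1ℤ
      det″ = lem α β γ δ α' β' γ' δ' ∙ cong₂ _*_ det det'
        where lem : ∀ α β γ δ α' β' γ' δ' → (α' * δ - γ' * β) * (α * δ' - γ * β') - (β' * δ - δ' * β) * (α * γ' - γ * α') ≡ (α * δ - β * γ) * (α' * δ' - β' * γ')
              lem = ring
      r'≡0 : r' ≡ 0ℤ
      r'≡0 = trivial-automorphism a″ r' (r + s) a″≢0 (combination (lem n₀ t k″ a″ c″ (+ N) r s q₁ r')
          ((- (r' * r')) ⊛ disc-N ⊞ (- (+ 4 * (r' * r'))) ⊛ ac″≡ ⊞ (+ 4 * r' * a″) ⊛ eq₂ ⊞ (a″ * (s - r) + (t + + 2 * k″) * r') ⊛ eq₁ ⊞ (+ 4 * (a″ * a″)) ⊛ det″))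
        where
        lem : ∀ n t k a c N r s q r' → N * (r' * r') - a * a * (+ 4 - (r + s) * (r + s)) ≡
              - (r' * r') * (+ 4 * n - t * t - N) + (- (+ 4 * (r' * r')) * (a * c - (k * k + t * k + n)) + (+ 4 * r' * a * (a * q - - (r' * c))
              + ((a * (s - r) + (t + + 2 * k) * r') * (a * (s - r) - (t + + 2 * k) * r') + + 4 * (a * a) * (r * s - q * r' - 1ℤ))))
        lem = ring
      rs≡1 : r * s ≡ 1ℤ
      rs≡1 = combination (lem r s q₁ r') (1ℤ ⊛ det″ ⊞ q₁ ⊛ r'≡0)
        where lem : ∀ r s q r' → r * s - 1ℤ ≡ 1ℤ * (r * s - q * r' - 1ℤ) + q * (r' - 0ℤ)
              lem = ring
      column : ∀ ε → r ≡ ε → (α' ≡ ε * α) × (γ' ≡ ε * γ)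
      column ε r≡ = combination (lem α β γ δ α' γ' ε) ((- α') ⊛ det ⊞ α ⊛ r≡ ⊞ β ⊛ r'≡0) , combination (lem' α β γ δ α' γ' ε) ((- γ') ⊛ det ⊞ γ ⊛ r≡ ⊞ δ ⊛ r'≡0)
        where
        lem : ∀ α β γ δ α' γ' ε → α' - ε * α ≡ - α' * (α * δ - β * γ - 1ℤ) + (α * (α' * δ - γ' * β - ε) + β * (α * γ' - γ * α' - 0ℤ))
        lem = ring
        lem' : ∀ α β γ δ α' γ' ε → γ' - ε * γ ≡ - γ' * (α * δ - β * γ - 1ℤ) + (γ * (α' * δ - γ' * β - ε) + δ * (α * γ' - γ * α' - 0ℤ))
        lem' = ring
      by-sign : r ≡ 1ℤ ⊎ r ≡ -1ℤ → (α' ≡ α × γ' ≡ γ) ⊎ (α' ≡ - α × γ' ≡ - γ)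
      by-sign (inj₁ r≡) = inj₁ (proj₁ (column 1ℤ r≡) ∙ *-identityˡ α , proj₂ (column 1ℤ r≡) ∙ *-identityˡ γ)
      by-sign (inj₂ r≡) = inj₂ (proj₁ (column -1ℤ r≡) ∙ -1*i≡-i α , proj₂ (column -1ℤ r≡) ∙ -1*i≡-i γ)

  middle-shift : ∀ g α β γ δ j → let open Form g in middle α (β + j * α) γ (δ + j * γ) ≡ middle α β γ δ + j * eval α γ
  middle-shift (form a k c _ _) α β γ δ j = lem a k c t α β γ δ j
    where
    lem : ∀ a k c t α β γ δ j → a * α * (β + j * α) + k * α * (δ + j * γ) + k * (β + j * α) * γ + c * γ * (δ + j * γ) + t * (β + j * α) * γ
          ≡ a * α * β + k * α * δ + k * β * γ + c * γ * δ + t * β * γ + j * (a * α * α + (+ 2 * k + t) * α * γ + c * γ * γ)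
    lem = ring

  translate : ∀ {g h h'} → g ⟶ h → Form.a h' ≡ Form.a h → Form.a h ∣ Form.k h' - Form.k h → g ⟶ h'
  translate {g} {h} {h'} (transform (sl₂ α β γ δ det) a≡ k≡) a'≡ (divides j k'≡) = transform (sl₂ α (β + j * α) γ (δ + j * γ) (lem α β γ δ j ∙ det))
    (a'≡ ∙ a≡) (split-off (Form.k h') (Form.k h) ∙ cong₂ _+_ k≡ (k'≡ ∙ cong (j *_) a≡) ∙ sym (middle-shift g α β γ δ j))
    where
    lem : ∀ α β γ δ j → α * (δ + j * γ) - (β + j * α) * γ ≡ α * δ - β * γ
    lem = ring


  middle-same-column : ∀ g α β γ δ β' δ' → α * δ - β * γ ≡ 1ℤ → α * δ' - β' * γ ≡ 1ℤ → let open Form g in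
    eval α γ ∣ middle α β' γ δ' - middle α β γ δ
  middle-same-column g α β γ δ β' δ' det det' = divides j (begin
    middle α β' γ δ' - middle α β γ δ ≡⟨ cong₂ (λ x y → middle α x γ y - middle α β γ δ) β'≡ δ'≡ ⟩
    middle α (β + j * α) γ (δ + j * γ) - middle α β γ δ ≡⟨ cong (_- middle α β γ δ) (middle-shift g α β γ δ j) ⟩
    middle α β γ δ + j * eval α γ - middle α β γ δ ≡⟨ lem (middle α β γ δ) (j * eval α γ) ⟩
    j * eval α γ ∎)
    where
    open Form g
    j : ℤ
    j = β' * δ - β * δ'
    lem : ∀ x y → x + y - x ≡ y
    lem = ring
    lemβ : ∀ α β γ δ β' δ' → β' - (β + (β' * δ - β * δ') * α) ≡ - β' * (α * δ - β * γ - 1ℤ) + β * (α * δ' - β' * γ - 1ℤ)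
    lemβ = ring
    lemδ : ∀ α β γ δ β' δ' → δ' - (δ + (β' * δ - β * δ') * γ) ≡ - δ' * (α * δ - β * γ - 1ℤ) + δ * (α * δ' - β' * γ - 1ℤ)
    lemδ = ring
    β'≡ : β' ≡ β + j * α
    β'≡ = combination (lemβ α β γ δ β' δ') ((- β') ⊛ det ⊞ β ⊛ det')
    δ'≡ : δ' ≡ δ + j * γ
    δ'≡ = combination (lemδ α β γ δ β' δ') ((- δ') ⊛ det ⊞ δ ⊛ det')

  module _ (g : Form) where
    open Form g

    eval-norm : ∀ x y → + 4 * (a * eval x y) ≡ + (∣ + 2 * (x * a + y * k) + t * y ∣ · ∣ + 2 * (x * a + y * k) + t * y ∣ ℕ.+ N · (∣ y ∣ · ∣ y ∣))
    eval-norm x y = cong (+ 4 *_) (sym (Columns.norm-V g g x 0ℤ y 0ℤ)) ∙ 4norm-ℕ (x * a + y * k) y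

    eval>0 : ∀ x y → ¬ (x ≡ 0ℤ × y ≡ 0ℤ) → 0ℤ < eval x y
    eval>0 x y nz = cases (eval x y) refl
      where
      cases : ∀ z → eval x y ≡ z → 0ℤ < eval x y
      cases (+ suc n) e = subst (0ℤ <_) (sym e) (+<+ (s≤s z≤n))
      cases (+ zero) e = contradiction (x≡0 , y≡0) nz
        where
        zeros = squares-sum≡0 (∣_∣ (+ 2 * (x * a + y * k) + t * y)) N (∣_∣ y) N>0 (+-injective (sym (eval-norm x y) ∙ cong (λ w → + 4 * w) (cong (a *_) e ∙ *-zeroʳ a)))
        y≡0 : y ≡ 0ℤ
        y≡0 = ∣i∣≡0⇒i≡0 (proj₂ zeros)
        x≡0 : x ≡ 0ℤ
        x≡0 = *-cancelˡ a a≢0 (*-cancelˡ (+ 2) (λ ()) (begin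
          + 2 * (a * x) ≡⟨ lem₁ a x k t ⟩
          + 2 * (x * a + 0ℤ * k) + t * 0ℤ ≡⟨ cong (λ w → + 2 * (x * a + w * k) + t * w) y≡0 ⟨
          + 2 * (x * a + y * k) + t * y ≡⟨ ∣i∣≡0⇒i≡0 (proj₁ zeros) ⟩
          0ℤ ≡⟨ lem₂ a ⟩
          + 2 * (a * 0ℤ) ∎))
          where
          lem₁ : ∀ a x k t → + 2 * (a * x) ≡ + 2 * (x * a + 0ℤ * k) + t * 0ℤ
          lem₁ = ring
          lem₂ : ∀ a → 0ℤ ≡ + 2 * (a * 0ℤ)
          lem₂ = ring
      cases -[1+ n ] e = ⊥-elim (impossible a a>0 (sym (eval-norm x y) ∙ cong (λ w → + 4 * (a * w)) e))
        where
        impossible : ∀ z {u} → 0ℤ < z → + u ≡ + 4 * (z * -[1+ n ]) → ⊥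
        impossible (+ suc z) _ ()
        impossible (+ zero) (+<+ ()) _

-- Representations by the classes of forms and roots of P

orientation : ℤ → ℤ → Bool
orientation x (+ suc _) = true
orientation x -[1+ _ ] = false
orientation (+ suc _) (+ zero) = true
orientation (+ zero) (+ zero) = false
orientation -[1+ _ ] (+ zero) = false

orientation-neg : ∀ x y → ¬ (x ≡ 0ℤ × y ≡ 0ℤ) → orientation (- x) (- y) ≡ not (orientation x y)
orientation-neg x (+ suc _) nz = refl
orientation-neg x -[1+ _ ] nz = refl
orientation-neg (+ suc _) (+ zero) nz = refl
orientation-neg (+ zero) (+ zero) nz = contradiction (refl , refl) nz
orientation-neg -[1+ _ ] (+ zero) nz = refl

orient : Bool → ℤ → ℤ → ℤ × ℤ
orient s x y = if does (orientation x y Bool.≟ s) then x , y else - x , - y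

data SameUpToSign (x y x' y' : ℤ) : Set where
  same : x' ≡ x → y' ≡ y → SameUpToSign x y x' y'
  opposite : x' ≡ - x → y' ≡ - y → SameUpToSign x y x' y'

orient-sign : ∀ s x y → ¬ (x ≡ 0ℤ × y ≡ 0ℤ) → orientation (proj₁ (orient s x y)) (proj₂ (orient s x y)) ≡ s
orient-sign s x y nz with orientation x y Bool.≟ s
... | yes e = e
... | no ≢s = orientation-neg x y nz ∙ sym (Bool.¬-not (≢s ∘ sym))

orient-same : ∀ s x y → SameUpToSign x y (proj₁ (orient s x y)) (proj₂ (orient s x y))
orient-same s x y with orientation x y Bool.≟ s
... | yes e = same refl refl
... | no ≢s = opposite refl refl

orient-unique : ∀ x y x' y' → ¬ (x ≡ 0ℤ × y ≡ 0ℤ) → SameUpToSign x y x' y' → orient (orientation x y) x' y' ≡ (x , y)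
orient-unique x y x' y' nz (same refl refl) with orientation x y Bool.≟ orientation x y
... | yes _ = refl
... | no ≢ = contradiction refl ≢
orient-unique x y x' y' nz (opposite refl refl) with orientation (- x) (- y) Bool.≟ orientation x y
... | yes e = contradiction (sym e ∙ orientation-neg x y nz) (Bool.not-¬ refl)
... | no _ = cong₂ _,_ (neg-involutive x) (neg-involutive y)

_mod_ : ℤ → ℕ → ℕ
z mod zero = 0
z mod suc n = z %ℕ suc n

mod-< : ∀ z n → 0 ℕ.< n → z mod n ℕ.< n
mod-< z (suc n) _ = n%ℕd<d z (suc n)

∣-mod : ∀ z n → 0 ℕ.< n → + n ∣ z - + (z mod n)
∣-mod z (suc n) _ = ∣-%ℕ z (suc n)

primitive-unique : ∀ g r s h α γ x y x' y' → h ≢ 0ℤ → g * r ≡ h * α → g * s ≡ h * γ →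
  x * r + y * s ≡ 1ℤ → x' * α + y' * γ ≡ 1ℤ → ∣ g ∣ ≡ ∣ h ∣ × SameUpToSign α γ r s
primitive-unique g r s h α γ x y x' y' h≢0 r≡ s≡ one one' = by-sign (unit-cases u u' uu'≡1)
  where
  u u' : ℤ
  u = x * α + y * γ
  u' = x' * r + y' * s
  lem₁ : ∀ g r s h α γ x y → g - h * (x * α + y * γ) ≡ - g * (x * r + y * s - 1ℤ) + (x * (g * r - h * α) + y * (g * s - h * γ))
  lem₁ = ring
  lem₂ : ∀ g r s h α γ x y → h - g * (x * r + y * s) ≡ - h * (x * α + y * γ - 1ℤ) + (- x * (g * r - h * α) + - y * (g * s - h * γ))
  lem₂ = ring
  lem₃ : ∀ g h u u' → h * (u * u') - h * 1ℤ ≡ - u' * (g - h * u) + -1ℤ * (h - g * u')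
  lem₃ = ring
  g≡ : g ≡ h * u
  g≡ = combination (lem₁ g r s h α γ x y) ((- g) ⊛ one ⊞ x ⊛ r≡ ⊞ y ⊛ s≡)
  h≡ : h ≡ g * u'
  h≡ = combination (lem₂ g r s h α γ x' y') ((- h) ⊛ one' ⊞ (- x') ⊛ r≡ ⊞ (- y') ⊛ s≡)
  uu'≡1 : u * u' ≡ 1ℤ
  uu'≡1 = *-cancelˡ h h≢0 (combination (lem₃ g h u u') ((- u') ⊛ g≡ ⊞ -1ℤ ⊛ h≡))
  by-sign : u ≡ 1ℤ ⊎ u ≡ -1ℤ → ∣ g ∣ ≡ ∣ h ∣ × SameUpToSign α γ r s
  by-sign (inj₁ u≡) = cong ∣_∣ (g≡ ∙ cong (h *_) u≡ ∙ *-identityʳ h) , same (pos r α r≡) (pos s γ s≡)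
    where
    lem : ∀ g h u z w → h * z - h * w ≡ - z * (g - h * u) + (1ℤ * (g * z - h * w) + - (h * z) * (u - 1ℤ))
    lem = ring
    pos : ∀ z w → g * z ≡ h * w → z ≡ w
    pos z w e = *-cancelˡ h h≢0 (combination (lem g h u z w) ((- z) ⊛ g≡ ⊞ 1ℤ ⊛ e ⊞ (- (h * z)) ⊛ u≡))
  by-sign (inj₂ u≡) = cong ∣_∣ (g≡ ∙ cong (h *_) u≡ ∙ *-comm h -1ℤ ∙ -1*i≡-i h) ∙ ∣-i∣≡∣i∣ h , opposite (neg r α r≡) (neg s γ s≡)
    where
    lem : ∀ g h u z w → h * z - h * - w ≡ z * (g - h * u) + (-1ℤ * (g * z - h * w) + h * z * (u - -1ℤ))
    lem = ring
    neg : ∀ z w → g * z ≡ h * w → z ≡ - w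
    neg z w e = *-cancelˡ h h≢0 (combination (lem g h u z w) (z ⊛ g≡ ⊞ -1ℤ ⊛ e ⊞ (h * z) ⊛ u≡))

same-trans : ∀ {x y x' y' x″ y″} → SameUpToSign x y x' y' → SameUpToSign x' y' x″ y″ → SameUpToSign x y x″ y″
same-trans (same refl refl) s = s
same-trans (opposite refl refl) (same refl refl) = opposite refl refl
same-trans {x} {y} (opposite refl refl) (opposite refl refl) = same (neg-involutive x) (neg-involutive y)

mod-unique : ∀ {z n x} → x ℕ.< n → + n ∣ z - + x → z mod n ≡ x
mod-unique {z} {n} {x} x<n d = residue-unique (mod-< z n n>0) x<n
  (subst (+ n ∣_) (minus-minus z (+ x) (+ (z mod n))) (∣m∣n⇒∣m-n d (∣-mod z n n>0)))
  where
  n>0 : 0 ℕ.< n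
  n>0 = ≤-<-trans z≤n x<n


interval : ℕ → List ℤ
interval S = map (λ i → + i - + S) (upTo (suc (S ℕ.+ S)))

∈-interval : ∀ {S z} → ∣ z ∣ ℕ.≤ S → z ∈ interval S
∈-interval {S} {+ n} n≤S = subst (_∈ interval S) (+-minus (+ n) (+ S)) (∈-map⁺ (λ i → + i - + S) (∈-upTo⁺ (s≤s (+-monoˡ-≤ S n≤S))))
∈-interval {S} { -[1+ n ]} n<S = subst (_∈ interval S) eq (∈-map⁺ (λ i → + i - + S) (∈-upTo⁺ (s≤s (≤-trans (ℕ.m∸n≤m S (suc n)) (m≤m+n S S)))))
  where
  eq : + (S ℕ.∸ suc n) - + S ≡ -[1+ n ]
  eq = cong (_- + S) (sym (ℤ.⊖-≥ n<S) ∙ sym (m-n≡m⊖n S (suc n))) ∙ minus-cancel (+ S) (+ suc n)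

interval-unique : ∀ S → Unique (interval S)
interval-unique S = Unique.map⁺ (λ {i} {j} e → +-injective (sym (lem (+ i) (+ S)) ∙ cong (_+ + S) e ∙ lem (+ j) (+ S))) (Unique.upTo⁺ _)
  where lem : ∀ n s → n - s + s ≡ n
        lem = ring

opaque
  unfolding ∑

  ∑-const : ∀ {A : Set} (xs : List A) c → ∑ xs (λ _ → c) ≡ + length xs * c
  ∑-const [] c = sym (*-zeroˡ c)
  ∑-const (x ∷ xs) c = +-congˡ {c} (∑-const xs c) ∙ suc-* c (+ length xs)


  ∑-bools : ∀ (f : Bool → ℤ) → ∑ (true ∷ false ∷ []) f ≡ f true + f false
  ∑-bools f = +-congˡ {f true} (ℤ.+-identityʳ (f false))

module Representations (𝓞 : QuadraticOrder) (h : ℕ) (order : HasOrder (ClassGroup (QuadraticOrder.m 𝓞)) h) where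
  open QuadraticForms 𝓞 public

  private module C = Setoid (ClassGroup m)

  opaque
    rep : Fin h → Form
    rep i = proj₁ (every-class-contains-form (Inverse.from order i))

    rep-≃ : ∀ i → ideal (rep i) ≃ Inverse.from order i
    rep-≃ i = proj₂ (every-class-contains-form (Inverse.from order i))

    class : Form → Fin h
    class g = Inverse.to order (ideal g)

    reach : ∀ g → rep (class g) ⟶ g
    reach g = ≃⇒transform {rep (class g)} {g} (C.sym {ideal (rep (class g))} {ideal g}
      (C.trans {ideal (rep (class g))} {Inverse.from order (class g)} {ideal g} (rep-≃ (class g)) (Inverse.inverseʳ order refl)))

    class-unique : ∀ i g → rep i ⟶ g → class g ≡ i
    class-unique i g T = Inverse.to-cong order {ideal g} {Inverse.from order i}
      (C.trans {ideal g} {ideal (rep i)} {Inverse.from order i} (transform⇒≃ T) (rep-≃ i)) ∙ Inverse.inverseˡ order (C.refl {Inverse.from order i})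

  value : Fin h → ℤ → ℤ → ℤ
  value i x y = Form.eval (rep i) x y

  Code : Set
  Code = Bool × (ℕ × (ℕ × ℕ))

  encode' : ∀ i v₁ v₂ → Bézout v₁ v₂ → Code
  encode' i v₁ v₂ (bézout {g} {r} {s} {x} {y} _ _ _) =
    orientation v₁ v₂ , ∣ g ∣ , ∣ value i r s ∣ , Form.middle (rep i) r (- y) s x mod ∣ value i r s ∣

  encode : Fin h × (ℤ × ℤ) → Code
  encode (i , (v₁ , v₂)) = encode' i v₁ v₂ (bézout-ℤ v₁ v₂)

  record Valid (a x : ℕ) : Set where
    constructor root
    field
      a>0 : 0 ℕ.< a
      a∣P : + a ∣ P (+ x)

  formOf : ∀ {a x} → Valid a x → Form
  formOf {a} {x} (root a>0 (divides c e)) = form (+ a) (+ x) c (+<+ a>0) (*-comm (+ a) c ∙ sym e)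

  formOf-a : ∀ {a x} (v : Valid a x) → Form.a (formOf v) ≡ + a
  formOf-a (root _ (divides _ _)) = refl

  formOf-k : ∀ {a x} (v : Valid a x) → Form.k (formOf v) ≡ + x
  formOf-k (root _ (divides _ _)) = refl

  decode' : ∀ (s : Bool) (g : ℕ) {a x} → Dec (Valid a x) → Fin h × (ℤ × ℤ)
  decode' s g (yes v) = class F , orient s (+ g * _⟶_.α (reach F)) (+ g * _⟶_.γ (reach F))
    where
    F : Form
    F = formOf v
  decode' s g (no _) = class (form 1ℤ 0ℤ n₀ (+<+ (s≤s z≤n)) (lem t n₀)) , (0ℤ , 0ℤ)
    where
    lem : ∀ t n → 1ℤ * n ≡ 0ℤ * 0ℤ + t * 0ℤ + n
    lem = ring

  valid? : ∀ a x → Dec (Valid a x)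
  valid? a x = map′ (λ (p , d) → root p d) (λ v → Valid.a>0 v , Valid.a∣P v) ((0 ℕ.<? a) ×-dec (+ a ∣? P (+ x)))

  decode : Code → Fin h × (ℤ × ℤ)
  decode (s , (g , (a , x))) = decode' s g (valid? a x)

  record Encoded (i : Fin h) (v₁ v₂ : ℤ) (σ : Bool) (g a x : ℕ) : Set where
    field
      g>0 : 0 ℕ.< g
      x<a : x ℕ.< a
      valid : Valid a x
      value≡ : value i v₁ v₂ ≡ + (g · g · a)
      sign≡ : σ ≡ orientation v₁ v₂
      transf : rep i ⟶ formOf valid
      column : SameUpToSign v₁ v₂ (+ g * _⟶_.α transf) (+ g * _⟶_.γ transf)

  ∣∣-same : ∀ g x y → SameUpToSign (g * x) (g * y) (+ ∣ g ∣ * x) (+ ∣ g ∣ * y)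
  ∣∣-same (+ n) x y = same refl refl
  ∣∣-same -[1+ n ] x y = opposite (lem (+ suc n) x) (lem (+ suc n) y)
    where lem : ∀ n x → n * x ≡ - (- n * x)
          lem = ring

  0<⇒+∣∣ : ∀ {z} → 0ℤ < z → + ∣ z ∣ ≡ z
  0<⇒+∣∣ {+ n} _ = refl

  eval-scale : ∀ g e x y → let open Form g in eval (e * x) (e * y) ≡ e * e * eval x y
  eval-scale (form a k c _ _) e x y = lem a k c t e x y
    where lem : ∀ a k c t e x y → a * (e * x) * (e * x) + (+ 2 * k + t) * (e * x) * (e * y) + c * (e * y) * (e * y) ≡ e * e * (a * x * x + (+ 2 * k + t) * x * y + c * y * y)
          lem = ring

  eval-product : ∀ g α β γ δ → let open Form g in α * δ - β * γ ≡ 1ℤ → eval α γ * eval β δ ≡ P (middle α β γ δ)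
  eval-product (form a k c _ ac≡) α β γ δ det =
    combination (lem a k c t n₀ α β γ δ) ((t * (a * α * β + k * α * δ + k * β * γ + c * γ * δ + t * β * γ) + (α * δ - β * γ + 1ℤ) * n₀) ⊛ det ⊞ ((α * δ - β * γ) * (α * δ - β * γ)) ⊛ ac≡)
    where
    lem : ∀ a k c t n α β γ δ → let k₁ = a * α * β + k * α * δ + k * β * γ + c * γ * δ + t * β * γ; D = α * δ - β * γ in
      (a * α * α + (+ 2 * k + t) * α * γ + c * γ * γ) * (a * β * β + (+ 2 * k + t) * β * δ + c * δ * δ) - (k₁ * k₁ + t * k₁ + n)
      ≡ (t * k₁ + (D + 1ℤ) * n) * (D - 1ℤ) + D * D * (a * c - (k * k + t * k + n))
    lem = ring

  P-mod : ∀ a x y → a ∣ x - y → a ∣ P x → a ∣ P y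
  P-mod a x y d p = subst (a ∣_) (poly-shift x t n₀ y) (∣m∣n⇒∣m-n p (∣m⇒∣m*n (x + y + t) d))


  encode'-Encoded : ∀ i v₁ v₂ → ¬ (v₁ ≡ 0ℤ × v₂ ≡ 0ℤ) → (b : Bézout v₁ v₂) →
    let (σ , (g , (a , x))) = encode' i v₁ v₂ b in Encoded i v₁ v₂ σ g a x
  encode'-Encoded i v₁ v₂ nz (bézout {g} {r} {s} {x} {y} v₁≡ v₂≡ one) = record
    { g>0 = n≢0⇒n>0 g≢0
    ; x<a = mod-< k₁ A A>0
    ; valid = valid
    ; value≡ = begin
        value i v₁ v₂ ≡⟨ cong₂ (value i) v₁≡ v₂≡ ⟩
        value i (g * r) (g * s) ≡⟨ eval-scale (rep i) g r s ⟩
        g * g * value i r s ≡⟨ cong₂ _*_ (square-ℕ g) (sym A≡) ⟩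
        + (∣ g ∣ · ∣ g ∣) * + A ≡⟨ pos-* (∣ g ∣ · ∣ g ∣) A ⟨
        + (∣ g ∣ · ∣ g ∣ · A) ∎
    ; sign≡ = refl
    ; transf = T
    ; column = subst₂ (λ a b → SameUpToSign a b (+ ∣ g ∣ * r) (+ ∣ g ∣ * s)) (sym v₁≡) (sym v₂≡) (∣∣-same g r s)
    }
    where
    open Form (rep i) using (middle; eval)
    g≢0 : ∣ g ∣ ≢ 0
    g≢0 e = nz (zero-multiple v₁ r v₁≡ , zero-multiple v₂ s v₂≡)
      where zero-multiple : ∀ v z → v ≡ g * z → v ≡ 0ℤ
            zero-multiple v z v≡ = v≡ ∙ cong (_* z) (∣i∣≡0⇒i≡0 {g} e) ∙ *-zeroˡ z
    value>0 : 0ℤ < value i r s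
    value>0 = eval>0 (rep i) r s (λ (r≡ , s≡) → contradiction (sym one ∙ cong₂ (λ a b → x * a + y * b) r≡ s≡ ∙ cong₂ _+_ (*-zeroʳ x) (*-zeroʳ y)) (λ ()))
    A : ℕ
    A = ∣ value i r s ∣
    A≡ : + A ≡ value i r s
    A≡ = 0<⇒+∣∣ value>0
    A>0 : 0 ℕ.< A
    A>0 = n≢0⇒n>0 (λ e → ℤ.<⇒≢ value>0 (sym (∣i∣≡0⇒i≡0 e)))
    k₁ : ℤ
    k₁ = middle r (- y) s x
    det : r * x - - y * s ≡ 1ℤ
    det = lem r s x y ∙ one
      where lem : ∀ r s x y → r * x - - y * s ≡ x * r + y * s
            lem = ring
    A∣PK : + A ∣ P k₁
    A∣PK = divides (eval (- y) x) (sym (eval-product (rep i) r (- y) s x det) ∙ *-comm (value i r s) (eval (- y) x) ∙ cong (eval (- y) x *_) (sym A≡))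
    valid : Valid A (k₁ mod A)
    valid = root A>0 (P-mod (+ A) k₁ (+ (k₁ mod A)) (∣-mod k₁ A A>0) A∣PK)
    FK : Form
    FK = form (value i r s) k₁ (eval (- y) x) value>0 (eval-product (rep i) r (- y) s x det)
    shifted : rep i ⟶ formOf valid
    shifted = translate {rep i} {FK} {formOf valid} (transform (sl₂ r (- y) s x det) refl refl) (formOf-a valid ∙ A≡)
      (subst₂ (λ a k → a ∣ k - k₁) A≡ (sym (formOf-k valid)) (∣-sym {+ A} {k₁} {+ (k₁ mod A)} (∣-mod k₁ A A>0)))
    T : rep i ⟶ formOf valid
    T = shifted

  opaque
    encode-Encoded : ∀ i v₁ v₂ → ¬ (v₁ ≡ 0ℤ × v₂ ≡ 0ℤ) →
      let (σ , (g , (a , x))) = encode (i , (v₁ , v₂)) in Encoded i v₁ v₂ σ g a x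
    encode-Encoded i v₁ v₂ nz = encode'-Encoded i v₁ v₂ nz (bézout-ℤ v₁ v₂)

  retarget : ∀ {i a x} (v w : Valid a x) → rep i ⟶ formOf v → rep i ⟶ formOf w
  retarget v w (transform mat a≡ k≡) = transform mat (formOf-a w ∙ sym (formOf-a v) ∙ a≡) (formOf-k w ∙ sym (formOf-k v) ∙ k≡)

  scaled-columns : ∀ {g h'} k (T T' : g ⟶ h') → SameUpToSign (k * _⟶_.α T) (k * _⟶_.γ T) (k * _⟶_.α T') (k * _⟶_.γ T')
  scaled-columns k T T' = go (column-unique T T')
    where
    open _⟶_ T
    open _⟶_ T' using () renaming (α to α'; γ to γ')
    go : (α' ≡ α × γ' ≡ γ) ⊎ (α' ≡ - α × γ' ≡ - γ) → SameUpToSign (k * α) (k * γ) (k * α') (k * γ')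
    go (inj₁ (e , e')) = same (cong (k *_) e) (cong (k *_) e')
    go (inj₂ (e , e')) = opposite (cong (k *_) e ∙ sym (ℤ.neg-distribʳ-* k α)) (cong (k *_) e' ∙ sym (ℤ.neg-distribʳ-* k γ))

  decode'-Encoded : ∀ {i v₁ v₂ σ g a x} → ¬ (v₁ ≡ 0ℤ × v₂ ≡ 0ℤ) → Encoded i v₁ v₂ σ g a x → (d : Dec (Valid a x)) → decode' σ g d ≡ (i , (v₁ , v₂))
  decode'-Encoded nz enc (no ¬v) = contradiction (Encoded.valid enc) ¬v
  decode'-Encoded {i} {v₁} {v₂} {σ} {g} nz enc (yes v) = cong₂ _,_ class≡ (columns (class F) class≡ (reach F))
    where
    open Encoded enc
    F : Form
    F = formOf v
    T : rep i ⟶ F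
    T = retarget valid v transf
    class≡ : class F ≡ i
    class≡ = class-unique i F T
    columns : ∀ j → j ≡ i → (T' : rep j ⟶ F) → orient σ (+ g * _⟶_.α T') (+ g * _⟶_.γ T') ≡ (v₁ , v₂)
    columns j refl T' = cong (λ s → orient s (+ g * _⟶_.α T') (+ g * _⟶_.γ T')) sign≡ ∙
      orient-unique v₁ v₂ _ _ nz (same-trans column (scaled-columns (+ g) T T'))

  decode-encode : ∀ i v₁ v₂ → ¬ (v₁ ≡ 0ℤ × v₂ ≡ 0ℤ) → decode (encode (i , (v₁ , v₂))) ≡ (i , (v₁ , v₂))
  decode-encode i v₁ v₂ nz = decode'-Encoded nz (encode-Encoded i v₁ v₂ nz) (valid? _ _)

  eval-neg : ∀ g α γ → Form.eval g (- α) (- γ) ≡ Form.eval g α γ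
  eval-neg (form a k c _ _) α γ = lem a k c t α γ
    where lem : ∀ a k c t α γ → a * - α * - α + (+ 2 * k + t) * - α * - γ + c * - γ * - γ ≡ a * α * α + (+ 2 * k + t) * α * γ + c * γ * γ
          lem = ring

  middle-neg : ∀ g α β γ δ → Form.middle g (- α) (- β) (- γ) (- δ) ≡ Form.middle g α β γ δ
  middle-neg (form a k c _ _) α β γ δ = lem a k c t α β γ δ
    where lem : ∀ a k c t α β γ δ → a * - α * - β + k * - α * - δ + k * - β * - γ + c * - γ * - δ + t * - β * - γ ≡ a * α * β + k * α * δ + k * β * γ + c * γ * δ + t * β * γ
          lem = ring

  completion : ∀ {g h'} (T : g ⟶ h') {r s} → SameUpToSign (_⟶_.α T) (_⟶_.γ T) r s → ∀ x y → r * x - y * s ≡ 1ℤ →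
    (Form.eval g r s ≡ Form.a h') × (Form.a h' ∣ Form.middle g r y s x - Form.k h')
  completion {g} (transform (sl₂ α β γ δ det) a≡ k≡) (same refl refl) x y one =
    sym a≡ , subst₂ (λ a k → a ∣ Form.middle g α y γ x - k) (sym a≡) (sym k≡) (middle-same-column g α β γ δ y x det one)
  completion {g} (transform (sl₂ α β γ δ det) a≡ k≡) (opposite refl refl) x y one =
    trans (eval-neg g α γ) (sym a≡) , subst₂ (λ a k → a ∣ Form.middle g (- α) y (- γ) x - k) (eval-neg g α γ ∙ sym a≡) (middle-neg g α β γ δ ∙ sym k≡)
      (middle-same-column g (- α) (- β) (- γ) (- δ) y x (lem α β γ δ ∙ det) one)
    where lem : ∀ α β γ δ → - α * - δ - - β * - γ ≡ α * δ - β * γ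
          lem = ring

  column≢0 : ∀ {g h'} (T : g ⟶ h') → ¬ (_⟶_.α T ≡ 0ℤ × _⟶_.γ T ≡ 0ℤ)
  column≢0 (transform (sl₂ α β γ δ det) _ _) (refl , refl) = contradiction (sym det ∙ lem β δ) (λ ())
    where lem : ∀ β δ → 0ℤ * δ - β * 0ℤ ≡ 0ℤ
          lem = ring

  +n≢0 : ∀ {n} → 0 ℕ.< n → + n ≢ 0ℤ
  +n≢0 {suc n} _ ()

  multiple≢0 : ∀ {g h' n} (T : g ⟶ h') → 0 ℕ.< n → ¬ (+ n * _⟶_.α T ≡ 0ℤ × + n * _⟶_.γ T ≡ 0ℤ)
  multiple≢0 {n = n} T n>0 (e , e') = column≢0 T (zero' e , zero' e')
    where zero' : ∀ {z} → + n * z ≡ 0ℤ → z ≡ 0ℤ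
          zero' {z} eq = *-cancelˡ (+ n) (+n≢0 n>0) (eq ∙ sym (*-zeroʳ (+ n)))

  same≢0 : ∀ {x y x' y'} → SameUpToSign x y x' y' → ¬ (x ≡ 0ℤ × y ≡ 0ℤ) → ¬ (x' ≡ 0ℤ × y' ≡ 0ℤ)
  same≢0 (same refl refl) nz = nz
  same≢0 {x} {y} (opposite refl refl) nz (e , e') = nz (sym (neg-involutive x) ∙ cong -_ e , sym (neg-involutive y) ∙ cong -_ e')

  module Decoded (σ : Bool) (g : ℕ) {a x : ℕ} (v : Valid a x) (g>0 : 0 ℕ.< g) (x<a : x ℕ.< a) where
    F : Form
    F = formOf v
    i : Fin h
    i = class F
    T : rep i ⟶ F
    T = reach F
    open _⟶_ T
    v₁ v₂ : ℤ
    v₁ = proj₁ (orient σ (+ g * α) (+ g * γ))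
    v₂ = proj₂ (orient σ (+ g * α) (+ g * γ))

    same-column : SameUpToSign (+ g * α) (+ g * γ) v₁ v₂
    same-column = orient-same σ (+ g * α) (+ g * γ)

    nonzero : ¬ (v₁ ≡ 0ℤ × v₂ ≡ 0ℤ)
    nonzero = same≢0 same-column (multiple≢0 T g>0)

    signed : ∀ {w₁ w₂} → SameUpToSign (+ g * α) (+ g * γ) w₁ w₂ → ∃[ H ] ∣ H ∣ ≡ g × w₁ ≡ H * α × w₂ ≡ H * γ
    signed (same e e') = + g , refl , e , e'
    signed (opposite e e') = - + g , ∣-i∣≡∣i∣ (+ g) , e ∙ ℤ.neg-distribˡ-* (+ g) α , e' ∙ ℤ.neg-distribˡ-* (+ g) γ

    decoded-value : value i v₁ v₂ ≡ + (g · g · a)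
    decoded-value = go (signed same-column)
      where
      go : (∃[ H ] ∣ H ∣ ≡ g × v₁ ≡ H * α × v₂ ≡ H * γ) → value i v₁ v₂ ≡ + (g · g · a)
      go (H , H≡ , e , e') = begin
        value i v₁ v₂ ≡⟨ cong₂ (value i) e e' ⟩
        value i (H * α) (H * γ) ≡⟨ eval-scale (rep i) H α γ ⟩
        H * H * value i α γ ≡⟨ cong₂ _*_ (square-ℕ H ∙ cong (λ n → + (n · n)) H≡) (sym a≡ ∙ formOf-a v) ⟩
        + (g · g) * + a ≡⟨ pos-* (g · g) a ⟨
        + (g · g · a) ∎

    encode'-decoded : (b : Bézout v₁ v₂) → encode' i v₁ v₂ b ≡ (σ , (g , (a , x)))
    encode'-decoded (bézout {G} {r} {s} {x'} {y'} v₁≡ v₂≡ one) = go (signed same-column)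
      where
      go : (∃[ H ] ∣ H ∣ ≡ g × v₁ ≡ H * α × v₂ ≡ H * γ) → _ ≡ (σ , (g , (a , x)))
      go (H , H≡ , e , e') = cong₂ _,_ (orient-sign σ (+ g * α) (+ g * γ) (multiple≢0 T g>0)) (cong₂ _,_ (proj₁ unique ∙ H≡) (cong₂ _,_ ∣value∣≡ mod≡))
        where
        H≢0 : H ≢ 0ℤ
        H≢0 refl = ℕ.<⇒≢ g>0 H≡
        lem₁ : ∀ α β γ δ → δ * α + - β * γ ≡ α * δ - β * γ
        lem₁ = ring
        lem₂ : ∀ r s x y → r * x - - y * s ≡ x * r + y * s
        lem₂ = ring
        unique : ∣ G ∣ ≡ ∣ H ∣ × SameUpToSign α γ r s
        unique = primitive-unique G r s H α γ x' y' δ (- β) H≢0 (sym v₁≡ ∙ e) (sym v₂≡ ∙ e') one (lem₁ α β γ δ ∙ det)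
        comp = completion T (proj₂ unique) x' (- y') (lem₂ r s x' y' ∙ one)
        value≡ : value i r s ≡ + a
        value≡ = proj₁ comp ∙ formOf-a v
        ∣value∣≡ : ∣ value i r s ∣ ≡ a
        ∣value∣≡ = cong ∣_∣ value≡
        mod≡ : Form.middle (rep i) r (- y') s x' mod ∣ value i r s ∣ ≡ x
        mod≡ = cong (Form.middle (rep i) r (- y') s x' mod_) ∣value∣≡ ∙
          mod-unique x<a (subst₂ (λ A k → A ∣ Form.middle (rep i) r (- y') s x' - k) (formOf-a v) (formOf-k v) (proj₂ comp))

  opaque
    encode-decode' : ∀ σ g {a x} → 0 ℕ.< g → x ℕ.< a → Valid a x → (d : Dec (Valid a x)) → encode (decode' σ g d) ≡ (σ , (g , (a , x)))
    encode-decode' σ g g>0 x<a v (no ¬v) = contradiction v ¬v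
    encode-decode' σ g g>0 x<a _ (yes v) = Decoded.encode'-decoded σ g v g>0 x<a (bézout-ℤ _ _)

  Decodes : ℕ → ℕ → Fin h × (ℤ × ℤ) → Set
  Decodes g a (i , (v₁ , v₂)) = ¬ (v₁ ≡ 0ℤ × v₂ ≡ 0ℤ) × value i v₁ v₂ ≡ + (g · g · a)

  decode'-value : ∀ σ g {a x} → 0 ℕ.< g → x ℕ.< a → Valid a x → (d : Dec (Valid a x)) → Decodes g a (decode' σ g d)
  decode'-value σ g g>0 x<a v (no ¬v) = contradiction v ¬v
  decode'-value σ g g>0 x<a _ (yes v) = Decoded.nonzero σ g v g>0 x<a , Decoded.decoded-value σ g v g>0 x<a

  ρ : ℕ → ℤ
  ρ a = ∑< a (λ x → ⟦ + a ∣? P (+ x) ⟧)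

  value-0 : ∀ i → value i 0ℤ 0ℤ ≡ 0ℤ
  value-0 i = lem (Form.a (rep i)) (Form.k (rep i)) (Form.c (rep i)) t
    where lem : ∀ a k c t → a * 0ℤ * 0ℤ + (+ 2 * k + t) * 0ℤ * 0ℤ + c * 0ℤ * 0ℤ ≡ 0ℤ
          lem = ring

  value-ℕ : ∀ i x y → ¬ (x ≡ 0ℤ × y ≡ 0ℤ) → value i x y ≡ + ∣ value i x y ∣
  value-ℕ i x y nz = sym (0<⇒+∣∣ (eval>0 (rep i) x y nz))

  module Sum (W : ℤ → ℤ) (Y S : ℕ) (vanish : ∀ n → Y ℕ.≤ n → W (+ n) ≡ 0ℤ)
    (bounded : ∀ i x y n → value i x y ≡ + n → n ℕ.< Y → ∣ x ∣ ℕ.≤ S × ∣ y ∣ ℕ.≤ S) where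

    origin? : ∀ x y → Dec (x ≡ 0ℤ × y ≡ 0ℤ)
    origin? x y = (x ℤ.≟ 0ℤ) ×-dec (y ℤ.≟ 0ℤ)

    good? : (c : Fin h × (ℤ × ℤ)) → Dec (¬ (proj₁ (proj₂ c) ≡ 0ℤ × proj₂ (proj₂ c) ≡ 0ℤ) × ∣ value (proj₁ c) (proj₁ (proj₂ c)) (proj₂ (proj₂ c)) ∣ ℕ.< Y)
    good? (i , (x , y)) = ¬? (origin? x y) ×-dec (∣ value i x y ∣ ℕ.<? Y)

    Ok : Code → Set
    Ok (σ , (g , (a , x))) = x ℕ.< a × Valid a x × g · g · a ℕ.< Y

    ok? : (c : Code) → Dec (Ok c)
    ok? (σ , (g , (a , x))) = (x ℕ.<? a) ×-dec (valid? a x ×-dec (g · g · a ℕ.<? Y))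

    positives : List ℕ
    positives = map suc (upTo Y)

    bools : List Bool
    bools = true ∷ false ∷ []

    vectors : List (Fin h × (ℤ × ℤ))
    vectors = cartesianProduct (allFin h) (cartesianProduct (interval S) (interval S))

    codes-source : List Code
    codes-source = cartesianProduct bools (cartesianProduct positives (cartesianProduct positives (upTo Y)))

    L₁ : List (Fin h × (ℤ × ℤ))
    L₁ = filter good? vectors

    L₂ : List Code
    L₂ = filter ok? codes-source

    F₁ : Fin h × (ℤ × ℤ) → ℤ
    F₁ (i , (x , y)) = W (value i x y)

    F₂ : Code → ℤ
    F₂ (σ , (g , (a , x))) = W (+ (g · g · a))

    ∈-positives : ∀ {n} → 0 ℕ.< n → n ℕ.≤ Y → n ∈ positives
    ∈-positives {suc n} _ n<Y = ∈-map⁺ suc (∈-upTo⁺ n<Y)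

    positives-∈ : ∀ {n} → n ∈ positives → 0 ℕ.< n
    positives-∈ n∈ = case ∈-map⁻ suc n∈ of λ { (_ , _ , refl) → s≤s z≤n }

    ∈-bools : ∀ b → b ∈ bools
    ∈-bools true = here refl
    ∈-bools false = there (here refl)

    code-∈ : ∀ σ g a x → 0 ℕ.< g → Ok (σ , (g , (a , x))) → (σ , (g , (a , x))) ∈ L₂
    code-∈ σ g a x g>0 ok@(x<a , v , gga<Y) = ∈-filter⁺ ok? (∈-cartesianProduct⁺ (∈-bools σ)
      (∈-cartesianProduct⁺ (∈-positives g>0 (≤-trans g≤gga (ℕ.<⇒≤ gga<Y)))
        (∈-cartesianProduct⁺ (∈-positives (Valid.a>0 v) (≤-trans a≤gga (ℕ.<⇒≤ gga<Y))) (∈-upTo⁺ (<-trans x<a (≤-<-trans a≤gga gga<Y)))))) ok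
      where
      instance
        _ = ℕ.>-nonZero g>0
        _ = ℕ.>-nonZero (Valid.a>0 v)
        _ = m*n≢0 g g
      a≤gga : a ℕ.≤ g · g · a
      a≤gga = m≤n*m a (g · g)
      g≤gga : g ℕ.≤ g · g · a
      g≤gga = ≤-trans (m≤m*n g g) (m≤m*n (g · g) a)

    L₁-∈ : ∀ i x y → (i , (x , y)) ∈ L₁ → ¬ (x ≡ 0ℤ × y ≡ 0ℤ) × ∣ value i x y ∣ ℕ.< Y
    L₁-∈ i x y v∈ = proj₂ (∈-filter⁻ good? {xs = vectors} v∈)

    encode-∈ : ∀ i x y → (i , (x , y)) ∈ L₁ → encode (i , (x , y)) ∈ L₂
    encode-∈ i x y v∈ = code-∈ _ _ _ _ (Encoded.g>0 enc) (Encoded.x<a enc , Encoded.valid enc , subst (ℕ._< Y) (cong ∣_∣ (Encoded.value≡ enc)) (proj₂ (L₁-∈ i x y v∈)))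
      where enc = encode-Encoded i x y (proj₁ (L₁-∈ i x y v∈))

    L₂-∈ : ∀ σ g a x → (σ , (g , (a , x))) ∈ L₂ → 0 ℕ.< g × Ok (σ , (g , (a , x)))
    L₂-∈ σ g a x c∈ with ∈-filter⁻ ok? {xs = codes-source} c∈
    ... | c∈' , ok = positives-∈ (proj₁ (∈-cartesianProduct⁻ positives _ (proj₂ (∈-cartesianProduct⁻ bools _ c∈')))) , ok

    vector-∈ : ∀ g a (v : Fin h × (ℤ × ℤ)) → g · g · a ℕ.< Y → Decodes g a v → v ∈ L₁
    vector-∈ g a (i , (x , y)) lt (nz , val) = ∈-filter⁺ good? (∈-cartesianProduct⁺ (∈-allFin i)
      (∈-cartesianProduct⁺ (∈-interval (proj₁ bd)) (∈-interval (proj₂ bd)))) (nz , subst (ℕ._< Y) (sym (cong ∣_∣ val)) lt)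
      where bd = bounded i x y (g · g · a) val lt

    decode-∈ : ∀ σ g a x → (σ , (g , (a , x))) ∈ L₂ → decode (σ , (g , (a , x))) ∈ L₁
    decode-∈ σ g a x c∈ = go (L₂-∈ σ g a x c∈)
      where
      go : 0 ℕ.< g × Ok (σ , (g , (a , x))) → decode (σ , (g , (a , x))) ∈ L₁
      go (g>0 , x<a , v , lt) = vector-∈ g a _ lt (decode'-value σ g g>0 x<a v (valid? a x))

    bijection : ∑ L₁ F₁ ≡ ∑ L₂ F₂
    bijection = (∑-cong L₁ λ { {i , (x , y)} v∈ → cong W (Encoded.value≡ (encode-Encoded i x y (proj₁ (L₁-∈ i x y v∈)))) }) ∙
      ∑-reindex encode decode
        (Unique.filter⁺ good? (Unique.cartesianProduct⁺ (Unique.allFin⁺ h) (Unique.cartesianProduct⁺ (interval-unique S) (interval-unique S))))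
        (Unique.filter⁺ ok? (Unique.cartesianProduct⁺ bools-unique (Unique.cartesianProduct⁺ positives-unique (Unique.cartesianProduct⁺ positives-unique (Unique.upTo⁺ Y)))))
        (λ { {i , (x , y)} → encode-∈ i x y }) (λ { {σ , (g , (a , x))} → decode-∈ σ g a x })
        (λ { {i , (x , y)} v∈ → decode-encode i x y (proj₁ (L₁-∈ i x y v∈)) })
        (λ { {σ , (g , (a , x))} c∈ → let g>0 , x<a , v , _ = L₂-∈ σ g a x c∈ in encode-decode' σ g g>0 x<a v (valid? a x) })
        F₂
      where
      bools-unique : Unique bools
      bools-unique = ((λ ()) ∷ []) ∷ [] ∷ []
      positives-unique : Unique positives
      positives-unique = Unique.map⁺ suc-injective (Unique.upTo⁺ Y)

    ∑-L₁ : ∑ (allFin h) (λ i → ∑ (interval S) (λ x → ∑ (interval S) (λ y → W (value i x y)))) ≡ ∑ L₁ F₁ + + h * W 0ℤ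
    ∑-L₁ = begin
      ∑ (allFin h) (λ i → ∑ (interval S) (λ x → ∑ (interval S) (λ y → W (value i x y))))
        ≡⟨ ∑-× (allFin h) _ F₁ ∙ ∑-cong (allFin h) (λ {i} _ → ∑-× (interval S) _ (λ v → F₁ (i , v))) ⟨
      ∑ vectors F₁
        ≡⟨ ∑-cong vectors (λ { {i , (x , y)} _ → separate i x y }) ⟩
      ∑ vectors (λ v → ⟦ good? v ⟧ * F₁ v + ⟦ origin? (proj₁ (proj₂ v)) (proj₂ (proj₂ v)) ⟧ * W 0ℤ)
        ≡⟨ ∑-+ vectors _ _ ⟩
      ∑ vectors (λ v → ⟦ good? v ⟧ * F₁ v) + ∑ vectors (λ v → ⟦ origin? (proj₁ (proj₂ v)) (proj₂ (proj₂ v)) ⟧ * W 0ℤ)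
        ≡⟨ cong₂ _+_ (sym (∑-filter good? vectors F₁)) (∑-× (allFin h) _ _ ∙ ∑-cong (allFin h) (λ {i} _ → origin-sum) ∙ ∑-const (allFin h) (W 0ℤ) ∙ cong (λ n → + n * W 0ℤ) (List.length-tabulate {n = h} id)) ⟩
      ∑ L₁ F₁ + + h * W 0ℤ ∎
      where
      separate : ∀ i x y → F₁ (i , (x , y)) ≡ ⟦ good? (i , (x , y)) ⟧ * F₁ (i , (x , y)) + ⟦ origin? x y ⟧ * W 0ℤ
      separate i x y = by-origin (origin? x y)
        where
        zero-left : ∀ w → 0ℤ * w + 1ℤ * W 0ℤ ≡ W 0ℤ
        zero-left w = lem w (W 0ℤ)
          where lem : ∀ w z → 0ℤ * w + 1ℤ * z ≡ z
                lem = ring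
        one-left : ∀ w → 1ℤ * w + 0ℤ * W 0ℤ ≡ w
        one-left w = lem w (W 0ℤ)
          where lem : ∀ w z → 1ℤ * w + 0ℤ * z ≡ w
                lem = ring
        by-origin : Dec (x ≡ 0ℤ × y ≡ 0ℤ) → F₁ (i , (x , y)) ≡ ⟦ good? (i , (x , y)) ⟧ * F₁ (i , (x , y)) + ⟦ origin? x y ⟧ * W 0ℤ
        by-origin (yes o@(x≡ , y≡)) = cong W (cong₂ (value i) x≡ y≡ ∙ value-0 i) ∙ sym (cong₂ (λ u v → u * F₁ (i , (x , y)) + v * W 0ℤ)
          (⟦⟧-no (good? (i , (x , y))) (λ g → proj₁ g o)) (⟦⟧-yes (origin? x y) o) ∙ zero-left (F₁ (i , (x , y))))
        by-origin (no nz) = by-size (∣ value i x y ∣ ℕ.<? Y)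
          where
          by-size : Dec (∣ value i x y ∣ ℕ.< Y) → F₁ (i , (x , y)) ≡ ⟦ good? (i , (x , y)) ⟧ * F₁ (i , (x , y)) + ⟦ origin? x y ⟧ * W 0ℤ
          by-size (yes lt) = sym (cong₂ (λ u v → u * F₁ (i , (x , y)) + v * W 0ℤ) (⟦⟧-yes (good? (i , (x , y))) (nz , lt)) (⟦⟧-no (origin? x y) nz) ∙ one-left (F₁ (i , (x , y))))
          by-size (no ≮) = F₁≡0 ∙ sym (cong₂ (λ u v → u * F₁ (i , (x , y)) + v * W 0ℤ) (⟦⟧-no (good? (i , (x , y))) (≮ ∘ proj₂)) (⟦⟧-no (origin? x y) nz) ∙ lem (F₁ (i , (x , y))) (W 0ℤ))
            where
            F₁≡0 : F₁ (i , (x , y)) ≡ 0ℤ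
            F₁≡0 = cong W (value-ℕ i x y nz) ∙ vanish _ (ℕ.≮⇒≥ ≮)
            lem : ∀ w z → 0ℤ * w + 0ℤ * z ≡ 0ℤ
            lem = ring
      origin∈ : 0ℤ ∈ interval S
      origin∈ = ∈-interval {S} z≤n
      origin-sum : ∑ (cartesianProduct (interval S) (interval S)) (λ v → ⟦ origin? (proj₁ v) (proj₂ v) ⟧ * W 0ℤ) ≡ W 0ℤ
      origin-sum = ∑-single (λ v → ⟦ origin? (proj₁ v) (proj₂ v) ⟧ * W 0ℤ) (Unique.cartesianProduct⁺ (interval-unique S) (interval-unique S)) (∈-cartesianProduct⁺ origin∈ origin∈)
        (λ { {x , y} _ ≢o → trans (cong (_* W 0ℤ) (⟦⟧-no (origin? x y) (λ (e , e') → ≢o (cong₂ _,_ e e')))) (*-zeroˡ (W 0ℤ)) }) ∙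
        *-identityˡ (W 0ℤ)

    ∑-L₂ : ∑ L₂ F₂ ≡ + 2 * ∑< Y (λ g → ∑< Y (λ a → ρ (suc a) * W (+ (suc g · suc g · suc a))))
    ∑-L₂ = begin
      ∑ L₂ F₂ ≡⟨ ∑-filter ok? codes-source F₂ ⟩
      ∑ codes-source (λ c → ⟦ ok? c ⟧ * F₂ c) ≡⟨ ∑-× bools _ _ ⟩
      ∑ bools (λ σ → ∑ (cartesianProduct positives (cartesianProduct positives (upTo Y))) (λ c → ⟦ ok? (σ , c) ⟧ * F₂ (σ , c)))
        ≡⟨ ∑-cong bools (λ {σ} _ → sign-sum σ) ∙ ∑-bools _ ∙ +-double R ⟩
      + 2 * R ∎
      where
      R : ℤ
      R = ∑< Y (λ g → ∑< Y (λ a → ρ (suc a) * W (+ (suc g · suc g · suc a))))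
      positive-sum : ∀ f → ∑ positives f ≡ ∑< Y (f ∘ suc)
      positive-sum f = ∑-map suc (upTo Y) f ∙ sym (∑<≡∑ Y (f ∘ suc))
      cell : ∀ σ g a x → ⟦ ok? (σ , (g , (suc a , x))) ⟧ * W (+ (g · g · suc a)) ≡ ⟦ x ℕ.<? suc a ⟧ * ⟦ + suc a ∣? P (+ x) ⟧ * W (+ (g · g · suc a))
      cell σ g a x = by-size (g · g · suc a ℕ.<? Y)
        where
        w : ℤ
        w = W (+ (g · g · suc a))
        valid≡ : ⟦ valid? (suc a) x ⟧ ≡ ⟦ + suc a ∣? P (+ x) ⟧
        valid≡ = ⟦⟧-cong (valid? (suc a) x) (+ suc a ∣? P (+ x)) Valid.a∣P (root (s≤s z≤n))
        split-ok : ⟦ ok? (σ , (g , (suc a , x))) ⟧ ≡ ⟦ x ℕ.<? suc a ⟧ * (⟦ + suc a ∣? P (+ x) ⟧ * ⟦ g · g · suc a ℕ.<? Y ⟧)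
        split-ok = ⟦⟧-× (x ℕ.<? suc a) (valid? (suc a) x ×-dec (g · g · suc a ℕ.<? Y)) ∙ cong (⟦ x ℕ.<? suc a ⟧ *_) (⟦⟧-× (valid? (suc a) x) (g · g · suc a ℕ.<? Y) ∙ cong (_* ⟦ g · g · suc a ℕ.<? Y ⟧) valid≡)
        by-size : Dec (g · g · suc a ℕ.< Y) → ⟦ ok? (σ , (g , (suc a , x))) ⟧ * w ≡ ⟦ x ℕ.<? suc a ⟧ * ⟦ + suc a ∣? P (+ x) ⟧ * w
        by-size (yes lt) = cong (_* w) (split-ok ∙ cong (λ z → ⟦ x ℕ.<? suc a ⟧ * (⟦ + suc a ∣? P (+ x) ⟧ * z)) (⟦⟧-yes (g · g · suc a ℕ.<? Y) lt) ∙ cong (⟦ x ℕ.<? suc a ⟧ *_) (*-identityʳ _))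
        by-size (no ≮) = cong (⟦ ok? (σ , (g , (suc a , x))) ⟧ *_) w≡0 ∙ *-zeroʳ ⟦ ok? (σ , (g , (suc a , x))) ⟧ ∙ sym (cong (⟦ x ℕ.<? suc a ⟧ * ⟦ + suc a ∣? P (+ x) ⟧ *_) w≡0 ∙ *-zeroʳ (⟦ x ℕ.<? suc a ⟧ * ⟦ + suc a ∣? P (+ x) ⟧))
          where w≡0 : w ≡ 0ℤ
                w≡0 = vanish _ (ℕ.≮⇒≥ ≮)
      root-count : ∀ a → a ℕ.< Y → ∑< Y (λ x → ⟦ x ℕ.<? suc a ⟧ * ⟦ + suc a ∣? P (+ x) ⟧) ≡ ρ (suc a)
      root-count a a<Y = ∑<-extend _ a<Y (λ {x} a≤x → cong (_* ⟦ + suc a ∣? P (+ x) ⟧) (⟦⟧-no (x ℕ.<? suc a) (ℕ.≤⇒≯ a≤x)) ∙ (*-zeroˡ ⟦ + suc a ∣? P (+ x) ⟧)) ∙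
        ∑<-cong (suc a) (λ {x} x< → cong (_* ⟦ + suc a ∣? P (+ x) ⟧) (⟦⟧-yes (x ℕ.<? suc a) x<) ∙ *-identityˡ _)
      sign-sum : ∀ σ → ∑ (cartesianProduct positives (cartesianProduct positives (upTo Y))) (λ c → ⟦ ok? (σ , c) ⟧ * F₂ (σ , c)) ≡ R
      sign-sum σ = ∑-× positives _ _ ∙ positive-sum _ ∙ ∑<-cong Y (λ {g} _ → ∑-× positives _ _ ∙ positive-sum _ ∙
        ∑<-cong Y (λ {a} a<Y → ∑-cong (upTo Y) (λ {x} _ → cell σ (suc g) a x) ∙ ∑-*ʳ (upTo Y) (W (+ (suc g · suc g · suc a))) _ ∙
          cong (_* W (+ (suc g · suc g · suc a))) (sym (∑<≡∑ Y _) ∙ root-count a a<Y)))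

    representation-sum : ∑ (allFin h) (λ i → ∑ (interval S) (λ x → ∑ (interval S) (λ y → W (value i x y))))
      ≡ + 2 * ∑< Y (λ g → ∑< Y (λ a → ρ (suc a) * W (+ (suc g · suc g · suc a)))) + + h * W 0ℤ
    representation-sum = ∑-L₁ ∙ cong (_+ + h * W 0ℤ) (bijection ∙ ∑-L₂)

-- The Jacobi symbol through half-systems of residues

odd : ℕ → ℕ
odd k = suc (k ℕ.+ k)

Unit : ℤ → Set
Unit u = u ≡ 1ℤ ⊎ u ≡ -1ℤ

unit-* : ∀ {u v} → Unit u → Unit v → Unit (u * v)
unit-* (inj₁ refl) (inj₁ refl) = inj₁ refl
unit-* (inj₁ refl) (inj₂ refl) = inj₂ refl
unit-* (inj₂ refl) (inj₁ refl) = inj₂ refl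
unit-* (inj₂ refl) (inj₂ refl) = inj₁ refl

unit-square : ∀ {u} → Unit u → u * u ≡ 1ℤ
unit-square (inj₁ refl) = refl
unit-square (inj₂ refl) = refl

unit-∏ : ∀ {A : Set} (xs : List A) f → (∀ {x} → x ∈ xs → Unit (f x)) → Unit (∏ xs f)
unit-∏ [] f h = inj₁ (∏-[] f)
unit-∏ (x ∷ xs) f h = subst Unit (sym (∏-∷ x xs f)) (unit-* (h (here refl)) (unit-∏ xs f (h ∘ there)))

cop-∤ : ∀ {k b} → Cop (+ odd k) b → ∀ {x} → 0 ℕ.< x → x ℕ.≤ k → ¬ (+ odd k ∣ b * + x)
cop-∤ {k} cop {x} x>0 x≤k d = ℕ.<⇒≢ x>0 (sym (+-injective (small-∣⇒≡0 (cop-∣ cop d) (s≤s (≤-trans x≤k (m≤m+n k k))))))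

half : ℕ → List ℕ
half k = map suc (upTo k)

∈-half⁺ : ∀ {k x} → 0 ℕ.< x → x ℕ.≤ k → x ∈ half k
∈-half⁺ {x = suc x} _ x<k = ∈-map⁺ suc (∈-upTo⁺ x<k)

∈-half⁻ : ∀ {k x} → x ∈ half k → 0 ℕ.< x × x ℕ.≤ k
∈-half⁻ x∈ = case ∈-map⁻ suc x∈ of λ { (_ , i∈ , refl) → s≤s z≤n , ∈-upTo⁻ i∈ }

half-< : ∀ {k x} → x ∈ half k → x ℕ.< odd k
half-< {k} x∈ = s≤s (≤-trans (proj₂ (∈-half⁻ x∈)) (m≤m+n k k))

half-unique : ∀ k → Unique (half k)
half-unique k = Unique.map⁺ suc-injective (Unique.upTo⁺ k)

module HalfSystem (k : ℕ) where
  n : ℕ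
  n = odd k

  ε' : ∀ {r} → Dec (r ℕ.≤ k) → ℤ
  ε' d = if does d then 1ℤ else -1ℤ

  abs' : ∀ r → Dec (r ℕ.≤ k) → ℕ
  abs' r d = if does d then r else n ℕ.∸ r

  opaque
    -- z ≡ ε z · abs z mod n with ε z = ±1 and 0 ≤ abs z ≤ k.
    ε : ℤ → ℤ
    ε z = ε' (z %ℕ n ℕ.≤? k)

    abs : ℤ → ℕ
    abs z = abs' (z %ℕ n) (z %ℕ n ℕ.≤? k)

    ε-small : ∀ z → z %ℕ n ℕ.≤ k → ε z ≡ 1ℤ × abs z ≡ z %ℕ n
    ε-small z le = cong (if_then 1ℤ else -1ℤ) e , cong (if_then z %ℕ n else (n ℕ.∸ z %ℕ n)) e
      where
      e : does (z %ℕ n ℕ.≤? k) ≡ true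
      e = dec-true (z %ℕ n ℕ.≤? k) le

    ε-large : ∀ z → ¬ (z %ℕ n ℕ.≤ k) → ε z ≡ -1ℤ × abs z ≡ n ℕ.∸ z %ℕ n
    ε-large z nle = cong (if_then 1ℤ else -1ℤ) e , cong (if_then z %ℕ n else (n ℕ.∸ z %ℕ n)) e
      where
      e : does (z %ℕ n ℕ.≤? k) ≡ false
      e = dec-false (z %ℕ n ℕ.≤? k) nle

    ε-cong : Mod n ε
    ε-cong {x} {y} d = cong (λ r → ε' (r ℕ.≤? k)) same-residue
      where
      same-residue : x %ℕ n ≡ y %ℕ n
      same-residue = residue-unique (n%ℕd<d x n) (n%ℕd<d y n)
        (subst (+ n ∣_) (minus-chain x y (+ (x %ℕ n)) (+ (y %ℕ n))) (∣m∣n⇒∣m+n (∣m∣n⇒∣m-n d (∣-%ℕ x n)) (∣-%ℕ y n)))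

  unit-ε : ∀ z → Unit (ε z)
  unit-ε z with z %ℕ n ℕ.≤? k
  ... | yes le = inj₁ (proj₁ (ε-small z le))
  ... | no nle = inj₂ (proj₁ (ε-large z nle))

  abs≤k : ∀ z → abs z ℕ.≤ k
  abs≤k z with z %ℕ n ℕ.≤? k
  ... | yes le = subst (ℕ._≤ k) (sym (proj₂ (ε-small z le))) le
  ... | no nle = subst (ℕ._≤ k) (sym (proj₂ (ε-large z nle)))
    (≤-trans (ℕ.∸-monoʳ-≤ {suc k} {z %ℕ n} n (ℕ.≰⇒> nle)) (≤-reflexive (ℕ.m+n∸m≡n k k)))

  ε-abs : ∀ z → + n ∣ z - ε z * + abs z
  ε-abs z with z %ℕ n ℕ.≤? k
  ... | yes le = subst₂ (λ u y → + n ∣ z - u * + y) (sym (proj₁ (ε-small z le))) (sym (proj₂ (ε-small z le)))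
    (subst (λ w → + n ∣ z - w) (sym (*-identityˡ (+ (z %ℕ n)))) (∣-%ℕ z n))
  ... | no nle = subst₂ (λ u y → + n ∣ z - u * + y) (sym (proj₁ (ε-large z nle))) (sym (proj₂ (ε-large z nle)))
    (subst (+ n ∣_) (lem z (+ (z %ℕ n)) (+ n) ∙ cong (λ w → z - -1ℤ * w) (m-n≡m⊖n n (z %ℕ n) ∙ ℤ.⊖-≥ (ℕ.<⇒≤ (n%ℕd<d z n))))
      (∣m∣n⇒∣m+n (∣-%ℕ z n) ∣-refl))
    where lem : ∀ z r n → z - r + n ≡ z - -1ℤ * (n - r)
          lem = ring

  signed-unique : ∀ {u v x y} → Unit u → Unit v → x ℕ.≤ k → y ℕ.≤ k → + n ∣ u * + x - v * + y → x ≡ y × (x ≡ 0 ⊎ u ≡ v)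
  signed-unique {x = x} {y} (inj₁ refl) (inj₁ refl) x≤ y≤ d = residue-unique (s≤s (≤-trans x≤ (m≤m+n k k))) (s≤s (≤-trans y≤ (m≤m+n k k)))
    (subst (+ n ∣_) (lem (+ x) (+ y)) d) , inj₂ refl
    where lem : ∀ x y → 1ℤ * x - 1ℤ * y ≡ x - y
          lem = ring
  signed-unique {x = x} {y} (inj₂ refl) (inj₂ refl) x≤ y≤ d = sym (residue-unique (s≤s (≤-trans y≤ (m≤m+n k k))) (s≤s (≤-trans x≤ (m≤m+n k k)))
    (subst (+ n ∣_) (lem (+ x) (+ y)) d)) , inj₂ refl
    where lem : ∀ x y → -1ℤ * x - -1ℤ * y ≡ y - x
          lem = ring
  signed-unique {x = x} {y} (inj₁ refl) (inj₂ refl) x≤ y≤ d = x≡0 ∙ sym (ℕ.m+n≡0⇒n≡0 x x+y≡0) , inj₁ x≡0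
    where
    lem : ∀ x y → 1ℤ * x - -1ℤ * y ≡ x + y
    lem = ring
    x+y≡0 : x ℕ.+ y ≡ 0
    x+y≡0 = +-injective (small-∣⇒≡0 (subst (+ n ∣_) (lem (+ x) (+ y)) d) (s≤s (+-mono-≤ x≤ y≤)))
    x≡0 : x ≡ 0
    x≡0 = ℕ.m+n≡0⇒m≡0 x x+y≡0
  signed-unique {x = x} {y} (inj₂ refl) (inj₁ refl) x≤ y≤ d = x≡0 ∙ sym (ℕ.m+n≡0⇒n≡0 x x+y≡0) , inj₁ x≡0
    where
    lem : ∀ x y → - (-1ℤ * x - 1ℤ * y) ≡ x + y
    lem = ring
    x+y≡0 : x ℕ.+ y ≡ 0
    x+y≡0 = +-injective (small-∣⇒≡0 (subst (+ n ∣_) (lem (+ x) (+ y)) (∣m⇒∣-m d)) (s≤s (+-mono-≤ x≤ y≤)))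
    x≡0 : x ≡ 0
    x≡0 = ℕ.m+n≡0⇒m≡0 x x+y≡0

  ε-unique : ∀ z u y → ¬ (+ n ∣ z) → Unit u → y ℕ.≤ k → + n ∣ z - u * + y → ε z ≡ u × abs z ≡ y
  ε-unique z u y n∤z unit-u y≤k d = [ (λ abs≡0 → contradiction (abs-zero abs≡0) n∤z) , id ]′ (proj₂ eq) , proj₁ eq
    where
    eq : abs z ≡ y × (abs z ≡ 0 ⊎ ε z ≡ u)
    eq = signed-unique (unit-ε z) unit-u (abs≤k z) y≤k (subst (+ n ∣_) (minus-minus z (u * + y) (ε z * + abs z)) (∣m∣n⇒∣m-n d (ε-abs z)))
    abs-zero : abs z ≡ 0 → + n ∣ z
    abs-zero e = subst (+ n ∣_) (cong (λ w → z - ε z * + w) e ∙ lem₂ z (ε z)) (ε-abs z)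
      where lem₂ : ∀ z u → z - u * 0ℤ ≡ z
            lem₂ = ring

  abs>0 : ∀ z → ¬ (+ n ∣ z) → 0 ℕ.< abs z
  abs>0 z n∤z = n≢0⇒n>0 (λ e → n∤z (subst (+ n ∣_) (cong (λ w → z - ε z * + w) e ∙ lem z (ε z)) (ε-abs z)))
    where lem : ∀ z u → z - u * 0ℤ ≡ z
          lem = ring

  opaque
    symbol : ℤ → ℤ
    symbol a = ∏ (half k) (λ x → ε (a * + x))

    symbol-def : ∀ a → symbol a ≡ ∏ (half k) (λ x → ε (a * + x))
    symbol-def a = refl

  unit-symbol : ∀ a → Unit (symbol a)
  unit-symbol a = subst Unit (sym (symbol-def a)) (unit-∏ (half k) _ (λ {x} _ → unit-ε (a * + x)))

  symbol-cong : Mod n symbol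
  symbol-cong {a} {b} d = symbol-def a ∙ ∏-cong (half k) (λ {x} _ → ε-cong {a * + x} {b * + x} (subst (+ n ∣_) (lem a b (+ x)) (∣m⇒∣m*n (+ x) d))) ∙ sym (symbol-def b)
    where lem : ∀ a b x → (a - b) * x ≡ a * x - b * x
          lem = ring

  inverse-abs : ∀ b b' {x} → + n ∣ b' * b - 1ℤ → 0 ℕ.< x → x ℕ.≤ k → abs (b' * + abs (b * + x)) ≡ x
  inverse-abs b b' {x} inv x>0 x≤k = sym (proj₁ (signed-unique {1ℤ} {u * v} {x} {z} (inj₁ refl) (unit-* (unit-ε (b * + x)) (unit-ε (b' * + y))) x≤k (abs≤k (b' * + y))
    (subst (+ n ∣_) (lem b b' (+ x) u (+ y) v (+ z)) (∣m∣n⇒∣m-n (∣m∣n⇒∣m+n (∣n⇒∣m*n u (ε-abs (b' * + y))) (∣n⇒∣m*n b' (ε-abs (b * + x)))) (∣m⇒∣m*n (+ x) inv)))))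
    where
    y z : ℕ
    y = abs (b * + x)
    z = abs (b' * + y)
    u v : ℤ
    u = ε (b * + x)
    v = ε (b' * + y)
    lem : ∀ b b' x u y v z → u * (b' * y - v * z) + b' * (b * x - u * y) - (b' * b - 1ℤ) * x ≡ 1ℤ * x - u * v * z
    lem = ring

  half-permutation : ∀ b → Cop (+ n) b → map (λ x → abs (b * + x)) (half k) ↭ half k
  half-permutation b cop@(c , b' , one) = map-↭ (λ x → abs (b * + x)) (λ x → abs (b' * + x)) (half-unique k) (half-unique k)
    (λ x∈ → let x>0 , x≤k = ∈-half⁻ x∈ in ∈-half⁺ (abs>0 _ (cop-∤ cop x>0 x≤k)) (abs≤k _))
    (λ x∈ → let x>0 , x≤k = ∈-half⁻ x∈ in ∈-half⁺ (abs>0 _ (cop-∤ cop' x>0 x≤k)) (abs≤k _))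
    (λ x∈ → let x>0 , x≤k = ∈-half⁻ x∈ in inverse-abs b b' inv x>0 x≤k)
    (λ x∈ → let x>0 , x≤k = ∈-half⁻ x∈ in inverse-abs b' b (subst (λ z → + n ∣ z - 1ℤ) (*-comm b' b) inv) x>0 x≤k)
    where
    cop' : Cop (+ n) b'
    cop' = c , b , cong (λ z → c * + n + z) (*-comm b b') ∙ one
    inv : + n ∣ b' * b - 1ℤ
    inv = divides (- c) (cong (λ z → b' * b - z) (sym one) ∙ lem b b' c (+ n))
      where lem : ∀ b b' c n → b' * b - (c * n + b' * b) ≡ - c * n
            lem = ring

  ∏-half-permute : ∀ b → Cop (+ n) b → ∀ f → ∏ (half k) (λ x → f (abs (b * + x))) ≡ ∏ (half k) f
  ∏-half-permute b cop f = sym (∏-map (λ x → abs (b * + x)) (half k) f) ∙ ∏-↭ f (half-permutation b cop)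

  symbol-* : ∀ a b → Cop (+ n) a → Cop (+ n) b → symbol (a * b) ≡ symbol a * symbol b
  symbol-* a b cop-a cop-b = begin
    symbol (a * b) ≡⟨ symbol-def (a * b) ⟩
    ∏ (half k) (λ x → ε (a * b * + x)) ≡⟨ ∏-cong (half k) (λ {x} x∈ → pointwise x (proj₁ (∈-half⁻ x∈)) (proj₂ (∈-half⁻ x∈))) ⟩
    ∏ (half k) (λ x → ε (b * + x) * ε (a * + abs (b * + x))) ≡⟨ ∏-* (half k) _ _ ⟩
    ∏ (half k) (λ x → ε (b * + x)) * ∏ (half k) (λ x → ε (a * + abs (b * + x)))
      ≡⟨ cong₂ _*_ (sym (symbol-def b)) (∏-half-permute b cop-b (λ y → ε (a * + y)) ∙ sym (symbol-def a)) ⟩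
    symbol b * symbol a ≡⟨ *-comm (symbol b) (symbol a) ⟩
    symbol a * symbol b ∎
    where
    pointwise : ∀ x → 0 ℕ.< x → x ℕ.≤ k → ε (a * b * + x) ≡ ε (b * + x) * ε (a * + abs (b * + x))
    pointwise x x>0 x≤k = proj₁ (ε-unique (a * b * + x) (u * v) z (cop-∤ (cop-* cop-a cop-b) x>0 x≤k)
      (unit-* (unit-ε (b * + x)) (unit-ε (a * + y))) (abs≤k (a * + y))
      (subst (+ n ∣_) (lem a b (+ x) u (+ y) v (+ z)) (∣m∣n⇒∣m+n (∣n⇒∣m*n a (ε-abs (b * + x))) (∣n⇒∣m*n u (ε-abs (a * + y))))))
      where
      y z : ℕ
      y = abs (b * + x)
      z = abs (a * + y)
      u v : ℤ
      u = ε (b * + x)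
      v = ε (a * + y)
      lem : ∀ a b x u y v z → a * (b * x - u * y) + u * (a * y - v * z) ≡ a * b * x - u * v * z
      lem = ring

open HalfSystem using (symbol; unit-symbol; symbol-cong; symbol-*) public

-- Quadratic reciprocity

sgn : ℕ → ℤ
sgn n = -1ℤ ^ n

unit-sgn : ∀ n → Unit (sgn n)
unit-sgn zero = inj₁ refl
unit-sgn (suc n) = unit-* (inj₂ refl) (unit-sgn n)

sgn-+ : ∀ m n → sgn (m ℕ.+ n) ≡ sgn m * sgn n
sgn-+ = ℤ.^-distribˡ-+-* -1ℤ

sgn-even : ∀ n → sgn (n ℕ.+ n) ≡ 1ℤ
sgn-even n = sgn-+ n n ∙ unit-square (unit-sgn n)

sgn-odd : ∀ n → sgn (odd n) ≡ -1ℤ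
sgn-odd n = cong (-1ℤ *_) (sgn-even n)

sgn-odd-* : ∀ j x → sgn (odd j · x) ≡ sgn x
sgn-odd-* j x = sgn-+ x ((j ℕ.+ j) · x) ∙ cong (sgn x *_) (cong sgn (ℕ.*-distribʳ-+ x j j) ∙ sgn-even (j · x)) ∙ *-identityʳ (sgn x)

unit-cancel : ∀ {u v w} → Unit u → u * v ≡ w → v ≡ u * w
unit-cancel {u} {v} unit e = sym (*-identityˡ v) ∙ cong (_* v) (sym (unit-square unit)) ∙ *-assoc u u v ∙ cong (u *_) e

∏-swap : ∀ {A B : Set} (xs : List A) (ys : List B) (f : A → B → ℤ) → ∏ xs (λ x → ∏ ys (f x)) ≡ ∏ ys (λ y → ∏ xs (λ x → f x y))
∏-swap [] ys f = ∏-[] _ ∙ sym (∏-one ys (λ {y} _ → ∏-[] (λ x → f x y)))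
∏-swap (x ∷ xs) ys f = ∏-∷ x xs _ ∙ cong (∏ ys (f x) *_) (∏-swap xs ys f) ∙ sym (∏-* ys (f x) _) ∙ ∏-cong ys (λ {y} _ → sym (∏-∷ x xs (λ x → f x y)))

∏-const : ∀ {A : Set} (xs : List A) c → ∏ xs (λ _ → c) ≡ c ^ length xs
∏-const [] c = ∏-[] _
∏-const (x ∷ xs) c = ∏-∷ x xs _ ∙ cong (c *_) (∏-const xs c)

∏-++ : ∀ {A : Set} (xs ys : List A) f → ∏ (xs ++ ys) f ≡ ∏ xs f * ∏ ys f
∏-++ [] ys f = sym (*-identityˡ _) ∙ cong (_* ∏ ys f) (sym (∏-[] f))
∏-++ (x ∷ xs) ys f = ∏-∷ x _ f ∙ cong (f x *_) (∏-++ xs ys f) ∙ sym (*-assoc (f x) _ _) ∙ cong (_* ∏ ys f) (sym (∏-∷ x xs f))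

length-half : ∀ k → length (half k) ≡ k
length-half k = List.length-map suc (upTo k) ∙ List.length-upTo k

∏-half-suc : ∀ j f → ∏ (half (suc j)) f ≡ ∏ (half j) f * f (suc j)
∏-half-suc j f = cong (λ l → ∏ l f) (cong (map suc) (upTo-suc j) ∙ List.map-++ suc (upTo j) (j ∷ [])) ∙
  trans (∏-++ (half j) (suc j ∷ []) f) (cong (∏ (half j) f *_) (∏-∷ (suc j) [] f ∙ cong (f (suc j) *_) (∏-[] f) ∙ *-identityʳ _))

minus-if : ∀ {p} {P : Set p} → Dec P → ℤ
minus-if d = if does d then -1ℤ else 1ℤ

minus-if-yes : ∀ {p} {P : Set p} (d : Dec P) → P → minus-if d ≡ -1ℤ
minus-if-yes d p = cong (if_then -1ℤ else 1ℤ) (dec-true d p)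

minus-if-no : ∀ {p} {P : Set p} (d : Dec P) → ¬ P → minus-if d ≡ 1ℤ
minus-if-no d ¬p = cong (if_then -1ℤ else 1ℤ) (dec-false d ¬p)

minus-if-cong : ∀ {p q} {P : Set p} {Q : Set q} (d : Dec P) (e : Dec Q) → (P → Q) → (Q → P) → minus-if d ≡ minus-if e
minus-if-cong (yes p) e f g = sym (minus-if-yes e (f p))
minus-if-cong (no ¬p) e f g = sym (minus-if-no e (¬p ∘ g))

∏-minus : ∀ j q → q ℕ.≤ j → ∏ (half j) (λ y → minus-if (y ℕ.≤? q)) ≡ sgn q
∏-minus zero zero q≤ = ∏-[] _
∏-minus (suc j) q q≤ = [ (λ q<sj → ∏-half-suc j _ ∙ cong₂ _*_ (∏-minus j q (ℕ.s≤s⁻¹ q<sj)) (minus-if-no (suc j ℕ.≤? q) (ℕ.<⇒≱ q<sj)) ∙ *-identityʳ (sgn q))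
                              , top ]′ (ℕ.m≤n⇒m<n∨m≡n q≤)
  where
  top : q ≡ suc j → ∏ (half (suc j)) (λ y → minus-if (y ℕ.≤? q)) ≡ sgn q
  top refl = ∏-half-suc j _ ∙ cong₂ _*_ (∏-cong (half j) (λ {y} y∈ → minus-if-cong (y ℕ.≤? suc j) (y ℕ.≤? j) (const (proj₂ (∈-half⁻ y∈))) ℕ.m≤n⇒m≤1+n) ∙ ∏-minus j j ≤-refl)
    (minus-if-yes (suc j ℕ.≤? suc j) ≤-refl) ∙ *-comm (sgn j) -1ℤ

≤-/ : ∀ y m n .{{_ : NonZero n}} → y ℕ.≤ m ℕ./ n → y · n ℕ.≤ m
≤-/ y m n le = ≤-trans (*-monoˡ-≤ n le) (ℕ.m/n*n≤m m n)

/-≤ : ∀ y m n .{{_ : NonZero n}} → y · n ℕ.≤ m → y ℕ.≤ m ℕ./ n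
/-≤ y m n le = ℕ.s≤s⁻¹ (ℕ.*-cancelʳ-< n y (suc (m ℕ./ n)) (≤-<-trans le (subst (ℕ._< n ℕ.+ m ℕ./ n · n) (sym (m≡m%n+[m/n]*n m n)) (ℕ.+-monoˡ-< (m ℕ./ n · n) (m%n<n m n)))))

module _ (k j : ℕ) where
  private
    module H = HalfSystem k
    n A : ℕ
    n = odd k
    A = odd j

  module _ (cop : Cop (+ n) (+ A)) where

    private
      quotient : ℕ → ℕ
      quotient x = (A · x) ℕ./ n

      +A*x : ∀ x → + A * + x ≡ + (A · x)
      +A*x x = sym (pos-* A x)

      sgn-residue : ∀ z → sgn (z %ℕ n) ≡ H.ε z * sgn (H.abs z)
      sgn-residue z = by-size (z %ℕ n ℕ.≤? k)
        where
        r : ℕ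
        r = z %ℕ n
        by-size : Dec (r ℕ.≤ k) → sgn r ≡ H.ε z * sgn (H.abs z)
        by-size (yes le) = sym (cong₂ (λ u y → u * sgn y) (proj₁ (H.ε-small z le)) (proj₂ (H.ε-small z le)) ∙ *-identityˡ (sgn r))
        by-size (no nle) = unit-cancel (unit-sgn (n ℕ.∸ r)) (sym (sgn-+ (n ℕ.∸ r) r) ∙ cong sgn (ℕ.m∸n+n≡m (ℕ.<⇒≤ (n%ℕd<d z n))) ∙ sgn-odd k) ∙
          trans (*-comm (sgn (n ℕ.∸ r)) -1ℤ) (sym (cong₂ (λ u y → u * sgn y) (proj₁ (H.ε-large z nle)) (proj₂ (H.ε-large z nle))))

      pointwise : ∀ x → sgn x ≡ sgn (quotient x) * (H.ε (+ A * + x) * sgn (H.abs (+ A * + x)))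
      pointwise x = begin
        sgn x ≡⟨ sgn-odd-* j x ⟨
        sgn (A · x) ≡⟨ cong sgn (m≡m%n+[m/n]*n (A · x) n) ⟩
        sgn ((A · x) ℕ.% n ℕ.+ quotient x · n) ≡⟨ sgn-+ ((A · x) ℕ.% n) (quotient x · n) ⟩
        sgn ((A · x) ℕ.% n) * sgn (quotient x · n) ≡⟨ cong₂ _*_ (cong (λ z → sgn (z %ℕ n)) (sym (+A*x x)) ∙ sgn-residue (+ A * + x)) (cong sgn (ℕ.*-comm (quotient x) n) ∙ sgn-odd-* k (quotient x)) ⟩
        H.ε (+ A * + x) * sgn (H.abs (+ A * + x)) * sgn (quotient x) ≡⟨ *-comm _ (sgn (quotient x)) ⟩
        sgn (quotient x) * (H.ε (+ A * + x) * sgn (H.abs (+ A * + x))) ∎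

    symbol-floor : symbol k (+ A) ≡ ∏ (half k) (λ x → sgn (quotient x))
    symbol-floor = cancel (unit-∏ (half k) sgn (λ {x} _ → unit-sgn x)) (begin
      P₀ ≡⟨ ∏-cong (half k) (λ {x} _ → pointwise x) ⟩
      ∏ (half k) (λ x → sgn (quotient x) * (H.ε (+ A * + x) * sgn (H.abs (+ A * + x)))) ≡⟨ ∏-* (half k) _ _ ⟩
      Q₀ * ∏ (half k) (λ x → H.ε (+ A * + x) * sgn (H.abs (+ A * + x))) ≡⟨ cong (Q₀ *_) (∏-* (half k) _ _) ⟩
      Q₀ * (∏ (half k) (λ x → H.ε (+ A * + x)) * ∏ (half k) (λ x → sgn (H.abs (+ A * + x))))
        ≡⟨ cong₂ (λ u v → Q₀ * (u * v)) (sym (H.symbol-def (+ A))) (H.∏-half-permute (+ A) cop sgn) ⟩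
      Q₀ * (symbol k (+ A) * P₀) ∎)
      where
      P₀ Q₀ : ℤ
      P₀ = ∏ (half k) sgn
      Q₀ = ∏ (half k) (λ x → sgn (quotient x))
      lem : ∀ q s p → q * (s * p) * p * s ≡ q * (s * s) * (p * p)
      lem = ring
      cancel : Unit P₀ → P₀ ≡ Q₀ * (symbol k (+ A) * P₀) → symbol k (+ A) ≡ Q₀
      cancel unit-P e = begin
        s ≡⟨ *-identityˡ s ⟨
        1ℤ * s ≡⟨ cong (_* s) (unit-square unit-P) ⟨
        P₀ * P₀ * s ≡⟨ cong (λ z → z * P₀ * s) e ⟩
        Q₀ * (s * P₀) * P₀ * s ≡⟨ lem Q₀ s P₀ ⟩
        Q₀ * (s * s) * (P₀ * P₀) ≡⟨ cong₂ (λ u v → Q₀ * u * v) (unit-square (unit-symbol k (+ A))) (unit-square unit-P) ⟩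
        Q₀ * 1ℤ * 1ℤ ≡⟨ *-identityʳ (Q₀ * 1ℤ) ∙ *-identityʳ Q₀ ⟩
        Q₀ ∎
        where s = symbol k (+ A)

    quotient≤j : ∀ x → x ℕ.≤ k → quotient x ℕ.≤ j
    quotient≤j x x≤k = ℕ.≮⇒≥ λ j<q → ℕ.<⇒≱ (bound j k) (≤-trans (≤-/ (suc j) (A · x) n j<q) (*-monoʳ-≤ A x≤k))
      where
      bound : ∀ j k → odd j · k ℕ.< suc j · odd k
      bound j k = subst (odd j · k ℕ.<_) (lem j k) (s≤s (m≤m+n (odd j · k) (k ℕ.+ j)))
        where lem : ∀ j k → suc (suc (j ℕ.+ j) · k ℕ.+ (k ℕ.+ j)) ≡ suc j · suc (k ℕ.+ k)
              lem = ringₙ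

    symbol-lattice : symbol k (+ A) ≡ ∏ (half k) (λ x → ∏ (half j) (λ y → minus-if (y · n ℕ.≤? A · x)))
    symbol-lattice = symbol-floor ∙ ∏-cong (half k) (λ {x} x∈ → sym (∏-minus j (quotient x) (quotient≤j x (proj₂ (∈-half⁻ x∈)))) ∙
      ∏-cong (half j) (λ {y} _ → minus-if-cong (y ℕ.≤? quotient x) (y · n ℕ.≤? A · x) (≤-/ y (A · x) n) (/-≤ y (A · x) n)))

-- The lattice points (x , y) of the rectangle lie above or below the diagonal.
reciprocity : ∀ k j → Cop (+ odd k) (+ odd j) → symbol k (+ odd j) * symbol j (+ odd k) ≡ sgn (j · k)
reciprocity k j cop = begin
  symbol k (+ odd j) * symbol j (+ odd k)
    ≡⟨ cong₂ _*_ (symbol-lattice k j cop) (symbol-lattice j k (cop-sym cop) ∙ ∏-swap (half j) (half k) _) ⟩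
  ∏ (half k) (λ x → ∏ (half j) (λ y → minus-if (y · odd k ℕ.≤? odd j · x))) * ∏ (half k) (λ x → ∏ (half j) (λ y → minus-if (x · odd j ℕ.≤? odd k · y)))
    ≡⟨ ∏-cong (half k) (λ {x} _ → ∏-* (half j) _ _) ∙ ∏-* (half k) _ _ ⟨
  ∏ (half k) (λ x → ∏ (half j) (λ y → minus-if (y · odd k ℕ.≤? odd j · x) * minus-if (x · odd j ℕ.≤? odd k · y)))
    ≡⟨ ∏-cong (half k) (λ {x} x∈ → ∏-cong (half j) (λ {y} _ → opposite-sides x y x∈)) ⟩
  ∏ (half k) (λ x → ∏ (half j) (λ y → -1ℤ)) ≡⟨ ∏-cong (half k) (λ _ → ∏-const (half j) -1ℤ ∙ cong sgn (length-half j)) ⟩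
  ∏ (half k) (λ x → sgn j) ≡⟨ ∏-const (half k) (sgn j) ∙ cong (sgn j ^_) (length-half k) ⟩
  sgn j ^ k ≡⟨ ℤ.^-*-assoc -1ℤ j k ⟩
  sgn (j · k) ∎
  where
  opposite-sides : ∀ x y → x ∈ half k → minus-if (y · odd k ℕ.≤? odd j · x) * minus-if (x · odd j ℕ.≤? odd k · y) ≡ -1ℤ
  opposite-sides x y x∈ = by-order (y · odd k ℕ.≤? odd j · x)
    where
    distinct : y · odd k ≢ odd j · x
    distinct e = cop-∤ cop (proj₁ (∈-half⁻ x∈)) (proj₂ (∈-half⁻ x∈)) (divides (+ y) (sym (pos-* (odd j) x) ∙ cong +_ (sym e) ∙ pos-* y (odd k)))
    by-order : Dec (y · odd k ℕ.≤ odd j · x) → minus-if (y · odd k ℕ.≤? odd j · x) * minus-if (x · odd j ℕ.≤? odd k · y) ≡ -1ℤ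
    by-order (yes le) = cong₂ _*_ (minus-if-yes (y · odd k ℕ.≤? odd j · x) le)
      (minus-if-no (x · odd j ℕ.≤? odd k · y) λ ge → distinct (ℕ.≤-antisym le (subst₂ ℕ._≤_ (ℕ.*-comm x (odd j)) (ℕ.*-comm (odd k) y) ge)))
    by-order (no ≰) = cong₂ _*_ (minus-if-no (y · odd k ℕ.≤? odd j · x) ≰)
      (minus-if-yes (x · odd j ℕ.≤? odd k · y) (subst₂ ℕ._≤_ (ℕ.*-comm (odd j) x) (ℕ.*-comm y (odd k)) (ℕ.<⇒≤ (ℕ.≰⇒> ≰))))

reciprocity' : ∀ k j → Cop (+ odd k) (+ odd j) → symbol k (+ odd j) ≡ sgn (j · k) * symbol j (+ odd k)
reciprocity' k j cop = unit-cancel (unit-symbol j (+ odd k)) (*-comm _ (symbol k (+ odd j)) ∙ reciprocity k j cop) ∙ *-comm (symbol j (+ odd k)) _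

cop-neg1 : ∀ n → Cop n -1ℤ
cop-neg1 n = 0ℤ , -1ℤ , cong (_+ 1ℤ) (*-zeroˡ n)

symbol-neg1 : ∀ k → symbol k -1ℤ ≡ sgn k
symbol-neg1 k = H.symbol-def -1ℤ ∙ ∏-cong (half k) (λ {x} x∈ → let x>0 , x≤k = ∈-half⁻ x∈ in
  proj₁ (H.ε-unique (-1ℤ * + x) -1ℤ x (cop-∤ (cop-neg1 (+ odd k)) x>0 x≤k) (inj₂ refl) x≤k (divides 0ℤ (+-inverseʳ (-1ℤ * + x) ∙ sym (*-zeroˡ (+ odd k)))))) ∙
  trans (∏-const (half k) -1ℤ) (cong sgn (length-half k))
  where module H = HalfSystem k

triangle : ℕ → ℕ
triangle zero = 0
triangle (suc k) = suc k ℕ.+ triangle k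

symbol-2 : ∀ k → symbol k (+ 2) ≡ sgn (triangle k)
symbol-2 zero = HalfSystem.symbol-def 0 (+ 2) ∙ ∏-[] _
symbol-2 (suc k) = begin
  symbol (suc k) (+ 2) ≡⟨ symbol-cong (suc k) {+ 2} { -1ℤ * + odd k} (divides 1ℤ (lem₁ (+ k) ∙ cong (λ z → 1ℤ * z) (cong +_ (lem₂ k)))) ⟩
  symbol (suc k) (-1ℤ * + odd k) ≡⟨ symbol-* (suc k) -1ℤ (+ odd k) (cop-neg1 _) cop ⟩
  symbol (suc k) -1ℤ * symbol (suc k) (+ odd k) ≡⟨ cong₂ _*_ (symbol-neg1 (suc k)) (reciprocity' (suc k) k cop) ⟩
  sgn (suc k) * (sgn (k · suc k) * symbol k (+ odd (suc k))) ≡⟨ cong₂ (λ u v → sgn (suc k) * (u * v)) (even-product k) (symbol-cong k {+ odd (suc k)} {+ 2} (divides 1ℤ (cong (λ z → + z - + 2) (sym (lem₂ k)) ∙ lem₃ (+ odd k))) ∙ symbol-2 k) ⟩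
  sgn (suc k) * (1ℤ * sgn (triangle k)) ≡⟨ cong (sgn (suc k) *_) (*-identityˡ (sgn (triangle k))) ⟩
  sgn (suc k) * sgn (triangle k) ≡⟨ sgn-+ (suc k) (triangle k) ⟨
  sgn (triangle (suc k)) ∎
  where
  lem₁ : ∀ k → + 2 - -1ℤ * (1ℤ + (k + k)) ≡ 1ℤ * (+ 2 + (1ℤ + (k + k)))
  lem₁ = ring
  lem₂ : ∀ k → 2 ℕ.+ odd k ≡ odd (suc k)
  lem₂ k = cong (suc ∘ suc) (sym (+-suc k k))
  lem₃ : ∀ z → + 2 + z - + 2 ≡ 1ℤ * z
  lem₃ = ring
  even-product : ∀ k → sgn (k · suc k) ≡ 1ℤ
  even-product zero = refl
  even-product (suc k) = cong sgn (lem k) ∙ sgn-+ (k · suc k) (suc k ℕ.+ suc k) ∙ cong₂ _*_ (even-product k) (sgn-even (suc k))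
    where lem : ∀ k → suc k · suc (suc k) ≡ k · suc k ℕ.+ (suc k ℕ.+ suc k)
          lem = ringₙ
  cop : Cop (+ odd (suc k)) (+ odd k)
  cop = - + k , 1ℤ + + k , cong (λ z → - + k * + z + (1ℤ + + k) * + odd k) (sym (lem₂ k)) ∙ lem (+ k)
    where lem : ∀ k → - k * (+ 2 + (1ℤ + (k + k))) + (1ℤ + k) * (1ℤ + (k + k)) ≡ 1ℤ
          lem = ring

even⊎odd : ∀ r → (∃[ i ] r ≡ i ℕ.+ i) ⊎ (∃[ i ] r ≡ odd i)
even⊎odd zero = inj₁ (0 , refl)
even⊎odd (suc r) = [ (λ (i , e) → inj₂ (i , cong suc e)) , (λ (i , e) → inj₁ (suc i , cong suc e ∙ cong suc (sym (+-suc i i)))) ]′ (even⊎odd r)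

double-injective : ∀ {m n} → m ℕ.+ m ≡ n ℕ.+ n → m ≡ n
double-injective {m} {n} e = ℕ.*-cancelˡ-≡ m n 2 (cong (m ℕ.+_) (+-identityʳ m) ∙ e ∙ cong (n ℕ.+_) (sym (+-identityʳ n)))

odd-injective : ∀ {m n} → odd m ≡ odd n → m ≡ n
odd-injective e = double-injective (suc-injective e)

odd-* : ∀ k l → odd k · odd l ≡ odd (k ℕ.+ l ℕ.+ (k · l ℕ.+ k · l))
odd-* = lem
  where lem : ∀ k l → suc (k ℕ.+ k) · suc (l ℕ.+ l) ≡ suc (k ℕ.+ l ℕ.+ (k · l ℕ.+ k · l) ℕ.+ (k ℕ.+ l ℕ.+ (k · l ℕ.+ k · l)))
        lem = ringₙ

odd-representative : ∀ k a → ∃[ j ] + odd k ∣ a - + odd j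
odd-representative k a = [ (λ (i , e) → i ℕ.+ k , subst (+ odd k ∣_) (lem a (+ (a %ℕ odd k)) (+ odd k) ∙ cong (λ z → a - + z) (cong (ℕ._+ odd k) e ∙ lem₂ i k))
                                  (∣m∣n⇒∣m-n (∣-%ℕ a (odd k)) ∣-refl))
                         , (λ (i , e) → i , subst (λ r → + odd k ∣ a - + r) e (∣-%ℕ a (odd k))) ]′ (even⊎odd (a %ℕ odd k))
  where lem : ∀ a r n → a - r - n ≡ a - (r + n)
        lem = ring
        lem₂ : ∀ i k → i ℕ.+ i ℕ.+ suc (k ℕ.+ k) ≡ suc (i ℕ.+ k ℕ.+ (i ℕ.+ k))
        lem₂ = ringₙ

cop-mod : ∀ {n a b} → n ∣ a - b → Cop n a → Cop n b
cop-mod {n} {a} {b} (divides c e) (x , y , one) = x + y * c , y , lem x y c n b ∙ cong (λ z → x * n + y * (z + b)) (sym e) ∙ lem₂ (x * n) y a b ∙ one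
  where lem : ∀ x y c n b → (x + y * c) * n + y * b ≡ x * n + y * (c * n + b)
        lem = ring
        lem₂ : ∀ u y a b → u + y * (a - b + b) ≡ u + y * a
        lem₂ = ring

cop-factorˡ : ∀ {m n a} → Cop (m * n) a → Cop m a
cop-factorˡ {m} {n} (x , y , one) = x * n , y , cong (_+ _) (lem x n m) ∙ one
  where lem : ∀ x n m → x * n * m ≡ x * (m * n)
        lem = ring

symbol-modulus-* : ∀ k l → let kl = k ℕ.+ l ℕ.+ (k · l ℕ.+ k · l) in ∀ a → Cop (+ odd kl) a → symbol kl a ≡ symbol k a * symbol l a
symbol-modulus-* k l a cop = go (odd-representative kl a)
  where
  kl : ℕ
  kl = k ℕ.+ l ℕ.+ (k · l ℕ.+ k · l)
  n≡ : + odd kl ≡ + odd k * + odd l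
  n≡ = cong +_ (sym (odd-* k l)) ∙ pos-* (odd k) (odd l)
  k∣ : + odd k ∣ + odd kl
  k∣ = divides (+ odd l) (n≡ ∙ *-comm (+ odd k) (+ odd l))
  l∣ : + odd l ∣ + odd kl
  l∣ = divides (+ odd k) n≡
  go : (∃[ j ] + odd kl ∣ a - + odd j) → symbol kl a ≡ symbol k a * symbol l a
  go (j , d) = begin
    symbol kl a ≡⟨ symbol-cong kl d ⟩
    symbol kl (+ odd j) ≡⟨ reciprocity' kl j cop-j ⟩
    sgn (j · kl) * symbol j (+ odd kl) ≡⟨ cong₂ _*_ (sgn-split j k l) (cong (symbol j) n≡ ∙ symbol-* j (+ odd k) (+ odd l) (cop-sym cop-k) (cop-sym cop-l)) ⟩
    sgn (j · k) * sgn (j · l) * (symbol j (+ odd k) * symbol j (+ odd l)) ≡⟨ *-interchange (sgn (j · k)) (sgn (j · l)) (symbol j (+ odd k)) (symbol j (+ odd l)) ⟩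
    sgn (j · k) * symbol j (+ odd k) * (sgn (j · l) * symbol j (+ odd l)) ≡⟨ cong₂ _*_ (sym (reciprocity' k j cop-k)) (sym (reciprocity' l j cop-l)) ⟩
    symbol k (+ odd j) * symbol l (+ odd j) ≡⟨ cong₂ _*_ (symbol-cong k (∣-trans k∣ d)) (symbol-cong l (∣-trans l∣ d)) ⟨
    symbol k a * symbol l a ∎
    where
    cop-j : Cop (+ odd kl) (+ odd j)
    cop-j = cop-mod d cop
    cop-k : Cop (+ odd k) (+ odd j)
    cop-k = cop-factorˡ {+ odd k} {+ odd l} (subst (λ z → Cop z (+ odd j)) n≡ cop-j)
    cop-l : Cop (+ odd l) (+ odd j)
    cop-l = cop-factorˡ {+ odd l} {+ odd k} (subst (λ z → Cop z (+ odd j)) (n≡ ∙ *-comm (+ odd k) (+ odd l)) cop-j)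
    sgn-split : ∀ j k l → sgn (j · (k ℕ.+ l ℕ.+ (k · l ℕ.+ k · l))) ≡ sgn (j · k) * sgn (j · l)
    sgn-split j k l = cong sgn (lem' j k l) ∙ sgn-+ (j · k ℕ.+ j · l) _ ∙ cong₂ _*_ (sgn-+ (j · k) (j · l)) (sgn-even (j · (k · l))) ∙ *-identityʳ _
      where lem' : ∀ j k l → j · (k ℕ.+ l ℕ.+ (k · l ℕ.+ k · l)) ≡ j · k ℕ.+ j · l ℕ.+ (j · (k · l) ℕ.+ j · (k · l))
            lem' = ringₙ

-- The Legendre symbol

evalM : List ℤ → ℤ → ℤ
evalM [] x = 1ℤ
evalM (c ∷ cs) x = c + x * evalM cs x

quotient-by : ℤ → List ℤ → List ℤ
quotient-by r [] = []
quotient-by r (c ∷ []) = []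
quotient-by r (c ∷ cs@(_ ∷ _)) = evalM cs r ∷ quotient-by r cs

length-quotient : ∀ r c cs → length (quotient-by r (c ∷ cs)) ≡ length cs
length-quotient r c [] = refl
length-quotient r c (d ∷ cs) = cong suc (length-quotient r d cs)

factor-theorem : ∀ r c cs x → evalM (c ∷ cs) x - evalM (c ∷ cs) r ≡ (x - r) * evalM (quotient-by r (c ∷ cs)) x
factor-theorem r c [] x = lem c x r
  where lem : ∀ c x r → c + x * 1ℤ - (c + r * 1ℤ) ≡ (x - r) * 1ℤ
        lem = ring
factor-theorem r c cs@(d ∷ ds) x = begin
  c + x * F x - (c + r * F r) ≡⟨ lem₁ c x (F x) r (F r) ⟩
  (x - r) * F r + x * (F x - F r) ≡⟨ cong (λ z → (x - r) * F r + x * z) (factor-theorem r d ds x) ⟩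
  (x - r) * F r + x * ((x - r) * G) ≡⟨ lem₂ x r (F r) G ⟩
  (x - r) * (F r + x * G) ∎
  where
  F : ℤ → ℤ
  F = evalM cs
  G : ℤ
  G = evalM (quotient-by r cs) x
  lem₁ : ∀ c x a r b → c + x * a - (c + r * b) ≡ (x - r) * b + x * (a - b)
  lem₁ = ring
  lem₂ : ∀ x r b g → (x - r) * b + x * ((x - r) * g) ≡ (x - r) * (b + x * g)
  lem₂ = ring

lagrange : ∀ {p} → Prime p → ∀ n cs → length cs ≡ n → ∀ rs → AllPairs.AllPairs (λ x y → ¬ (+ p ∣ x - y)) rs → All (λ r → + p ∣ evalM cs r) rs → length rs ℕ.≤ length cs
lagrange pr n cs len [] _ _ = z≤n
lagrange pr n [] len (r ∷ rs) _ (d ∷ _) = contradiction d (prime-∤1 pr)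
lagrange pr (suc n) (c ∷ cs) len (r ∷ rs) (r≢ ∷ distinct) (d ∷ ds) = s≤s (subst (length rs ℕ.≤_) (length-quotient r c cs)
  (lagrange pr n (quotient-by r (c ∷ cs)) (length-quotient r c cs ∙ suc-injective len) rs distinct (All.zipWith (λ {x} → next {x}) (r≢ , ds))))
  where
  next : ∀ {x} → (¬ (+ _ ∣ r - x)) × (+ _ ∣ evalM (c ∷ cs) x) → + _ ∣ evalM (quotient-by r (c ∷ cs)) x
  next {x} (r≢x , dx) = [ (λ e → contradiction (∣-sym {x = x} {r} e) r≢x) , id ]′ (prime-∣-* pr (x - r) _ (subst (+ _ ∣_) (factor-theorem r c cs x) (∣m∣n⇒∣m-n dx d)))

∏-congruent : ∀ {A : Set} (xs : List A) q (f g : A → ℤ) → (∀ {x} → x ∈ xs → q ∣ f x - g x) → q ∣ ∏ xs f - ∏ xs g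
∏-congruent [] q f g h = subst (q ∣_) (sym (cong₂ _-_ (∏-[] f) (∏-[] g))) (divides 0ℤ (sym (*-zeroˡ q)))
∏-congruent (x ∷ xs) q f g h = subst (q ∣_) (lem (f x) (g x) (∏ xs f) (∏ xs g) ∙ sym (cong₂ _-_ (∏-∷ x xs f) (∏-∷ x xs g)))
  (∣m∣n⇒∣m+n (∣m⇒∣m*n (∏ xs f) (h (here refl))) (∣n⇒∣m*n (g x) (∏-congruent xs q f g (h ∘ there))))
  where lem : ∀ a b u v → (a - b) * u + b * (u - v) ≡ a * u - b * v
        lem = ring

∏-∤ : ∀ {A : Set} {p} → Prime p → ∀ (xs : List A) f → (∀ {x} → x ∈ xs → ¬ (+ p ∣ f x)) → ¬ (+ p ∣ ∏ xs f)
∏-∤ {p = p} pr [] f h d = prime-∤1 pr (subst (+ p ∣_) (∏-[] f) d)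
∏-∤ {p = p} pr (x ∷ xs) f h d = [ h (here refl) , ∏-∤ pr xs f (h ∘ there) ]′ (prime-∣-* pr (f x) (∏ xs f) (subst (+ p ∣_) (∏-∷ x xs f) d))

half-∤ : ∀ {k x} → x ∈ half k → ¬ (+ odd k ∣ + x)
half-∤ {k} {x} x∈ d = ℕ.<⇒≢ (proj₁ (∈-half⁻ x∈)) (sym (+-injective (small-∣⇒≡0 d (s≤s (≤-trans (proj₂ (∈-half⁻ x∈)) (m≤m+n k k))))))

euler-criterion : ∀ k → Prime (odd k) → ∀ a → Cop (+ odd k) a → + odd k ∣ a ^ k - symbol k a
euler-criterion k pr a cop = [ id , (λ d → contradiction d (∏-∤ pr (half k) (λ x → + x) half-∤)) ]′ (prime-∣-* pr (a ^ k - symbol k a) X₀ (subst (+ odd k ∣_) eq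
    (∏-congruent (half k) (+ odd k) (λ x → a * + x) (λ x → H.ε (a * + x) * + H.abs (a * + x)) (λ {x} _ → H.ε-abs (a * + x)))))
  where
  module H = HalfSystem k
  X₀ : ℤ
  X₀ = ∏ (half k) (λ x → + x)
  lem : ∀ a s x → a * x - s * x ≡ (a - s) * x
  lem = ring
  eq : ∏ (half k) (λ x → a * + x) - ∏ (half k) (λ x → H.ε (a * + x) * + H.abs (a * + x)) ≡ (a ^ k - symbol k a) * X₀
  eq = begin
    _ ≡⟨ cong₂ _-_ (∏-* (half k) (λ _ → a) (λ x → + x) ∙ cong (_* X₀) (∏-const (half k) a ∙ cong (a ^_) (length-half k)))
           (∏-* (half k) _ _ ∙ cong₂ _*_ (sym (H.symbol-def a)) (H.∏-half-permute a cop (λ x → + x))) ⟩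
    a ^ k * X₀ - symbol k a * X₀ ≡⟨ lem (a ^ k) (symbol k a) X₀ ⟩
    (a ^ k - symbol k a) * X₀ ∎

evalM-zeros : ∀ n x → evalM (replicate n 0ℤ) x ≡ x ^ n
evalM-zeros zero x = refl
evalM-zeros (suc n) x = +-identityˡ _ ∙ cong (x *_) (evalM-zeros n x)

symbol-square : ∀ k y → Cop (+ odd k) y → symbol k (y * y) ≡ 1ℤ
symbol-square k y cop = symbol-* k y y cop cop ∙ unit-square (unit-symbol k y)

cop-half : ∀ {k} → Prime (odd k) → ∀ {x} → ¬ (+ odd k ∣ + x) → Cop (+ odd k) (+ x)
cop-half {k} pr {x} n∤x = go (bézout-ℤ (+ odd k) (+ x))
  where
  go : Bézout (+ odd k) (+ x) → Cop (+ odd k) (+ x)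
  go (bézout {g} {r} {v} {a} {b} n≡ x≡ one) = by-cases (prime-∣-* pr g r (subst (+ odd k ∣_) n≡ ∣-refl))
    where
    by-cases : (+ odd k ∣ g) ⊎ (+ odd k ∣ r) → Cop (+ odd k) (+ x)
    by-cases (inj₁ d) = contradiction (subst (+ odd k ∣_) (sym x≡) (∣m⇒∣m*n v d)) n∤x
    by-cases (inj₂ (divides c r≡)) = scale-unit (unit-cases g c gc≡1)
      where
      gc≡1 : g * c ≡ 1ℤ
      gc≡1 = *-cancelˡ (+ odd k) (λ ()) (begin
        + odd k * (g * c) ≡⟨ *-rotate (+ odd k) g c ⟩
        g * (c * + odd k) ≡⟨ cong (g *_) r≡ ⟨
        g * r ≡⟨ n≡ ⟨
        + odd k ≡⟨ *-identityʳ (+ odd k) ⟨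
        + odd k * 1ℤ ∎)
      scale-unit : Unit g → Cop (+ odd k) (+ x)
      scale-unit u = g * a , g * b , (begin
        g * a * + odd k + g * b * + x ≡⟨ cong₂ (λ y z → g * a * y + g * b * z) n≡ x≡ ⟩
        g * a * (g * r) + g * b * (g * v) ≡⟨ factor-square g a r b v ⟩
        g * g * (a * r + b * v) ≡⟨ cong₂ _*_ (unit-square u) one ⟩
        1ℤ ∎)


nonresidue-symbol : ∀ k → Prime (odd k) → ∀ a → Cop (+ odd k) a → (∀ y → y ∈ half k → ¬ (+ odd k ∣ a - + y * + y)) → symbol k a ≡ -1ℤ
nonresidue-symbol zero pr a cop nonres = contradiction pr ℕ.¬prime[1]
nonresidue-symbol k@(suc k₀) pr a cop nonres = [ (λ s≡1 → contradiction (lagrange pr k cs len-cs roots distinct (root-of a cop s≡1 ∷ square-roots)) (ℕ.<⇒≱ too-many)) , id ]′ (unit-symbol k a)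
  where
  cs roots : List ℤ
  cs = -1ℤ ∷ replicate k₀ 0ℤ
  roots = a ∷ map (λ y → + y * + y) (half k)
  len-cs : length cs ≡ k
  len-cs = cong suc (List.length-replicate k₀)
  too-many : length cs ℕ.< length roots
  too-many = subst₂ ℕ._<_ (sym len-cs) (sym (cong suc (List.length-map (λ y → + y * + y) (half k) ∙ length-half k))) (ℕ.n<1+n k)
  root-of : ∀ x → Cop (+ odd k) x → symbol k x ≡ 1ℤ → + odd k ∣ evalM cs x
  root-of x cop-x s≡1 = subst (+ odd k ∣_) (cong (λ z → x ^ k - z) s≡1 ∙ ℤ.+-comm (x ^ k) -1ℤ ∙ cong (λ z → -1ℤ + x * z) (sym (evalM-zeros k₀ x))) (euler-criterion k pr x cop-x)
  square-roots : All (λ r → + odd k ∣ evalM cs r) (map (λ y → + y * + y) (half k))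
  square-roots = All.tabulate λ r∈ → case ∈-map⁻ (λ y → + y * + y) r∈ of λ { (y , y∈ , refl) →
    root-of (+ y * + y) (cop-* (cop-half {k} pr (half-∤ y∈)) (cop-half {k} pr (half-∤ y∈))) (symbol-square k (+ y) (cop-half {k} pr (half-∤ y∈))) }
  squares-distinct : ∀ {ys} → Unique ys → (∀ {y} → y ∈ ys → y ∈ half k) → AllPairs.AllPairs (λ x y → ¬ (+ odd k ∣ x - y)) (map (λ y → + y * + y) ys)
  squares-distinct {[]} [] _ = []
  squares-distinct {y ∷ ys} (y∉ ∷ u) sub = All.tabulate (λ r∈ d → case ∈-map⁻ (λ y → + y * + y) r∈ of λ { (z , z∈ , refl) →
      All.lookup y∉ z∈ (separate y z (sub (here refl)) (sub (there z∈)) d) }) ∷ squares-distinct u (sub ∘ there)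
    where
    lem : ∀ y z → y * y - z * z ≡ (y - z) * (y + z)
    lem = ring
    separate : ∀ y z → y ∈ half k → z ∈ half k → + odd k ∣ + y * + y - + z * + z → y ≡ z
    separate y z y∈ z∈ d = [ residue-unique (half-< y∈) (half-< z∈) , (λ e → contradiction (ℕ.m+n≡0⇒m≡0 y (+-injective (small-∣⇒≡0 e (s≤s (+-mono-≤ (proj₂ (∈-half⁻ y∈)) (proj₂ (∈-half⁻ z∈))))))) (ℕ.<⇒≢ (proj₁ (∈-half⁻ y∈)) ∘ sym)) ]′
      (prime-∣-* pr (+ y - + z) (+ y + + z) (subst (+ odd k ∣_) (lem (+ y) (+ z)) d))
  distinct : AllPairs.AllPairs (λ x y → ¬ (+ odd k ∣ x - y)) roots
  distinct = All.tabulate (λ r∈ d → case ∈-map⁻ (λ y → + y * + y) r∈ of λ { (y , y∈ , refl) → nonres y y∈ d }) ∷ squares-distinct (half-unique k) id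

cop-factorʳ : ∀ {n} a b → Cop n (a * b) → Cop n b
cop-factorʳ {n} a b (x , y , one) = x , y * a , cong (λ z → x * n + z) (*-assoc y a b) ∙ one

cop⇒∤ : ∀ {p a} → Prime p → Cop (+ p) a → ¬ (+ p ∣ a)
cop⇒∤ {p} {a} pr cop d = prime-∤1 pr (cop-∣ cop (subst (+ p ∣_) (sym (*-identityʳ a)) d))

legendre-symbol : ∀ k → Prime (odd k) → ∀ a → Cop (+ odd k) a → legendre a (odd k) ≡ symbol k a
legendre-symbol k pr a cop = cong (λ b → if b then 0ℤ else (if does square? then 1ℤ else -1ℤ)) (dec-false (+ odd k ∣? a) (cop⇒∤ pr cop)) ∙ by-square square?
  where
  square? : Dec (∃[ y ] + odd k ∣ a - + toℕ {odd k} y * + toℕ y)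
  square? = Fin.any? (λ y → + odd k ∣? (a - + toℕ y * + toℕ y))
  by-square : (d : Dec (∃[ y ] + odd k ∣ a - + toℕ {odd k} y * + toℕ y)) → (if does d then 1ℤ else -1ℤ) ≡ symbol k a
  by-square (yes (y , d)) = sym (symbol-cong k {a} {+ toℕ y * + toℕ y} d ∙ symbol-square k (+ toℕ y) (cop-factorʳ (+ toℕ y) (+ toℕ y) (cop-mod d cop)))
  by-square (no ∄) = sym (nonresidue-symbol k pr a cop λ y y∈ d → ∄ (fromℕ< (half-< y∈) , subst (λ z → + odd k ∣ a - + z * + z) (sym (Fin.toℕ-fromℕ< (half-< y∈))) d))

even≢odd : ∀ i k → i ℕ.+ i ≢ odd k
even≢odd (suc i) (suc k) e = even≢odd i k (suc-injective (suc-injective (sym (cong suc (+-suc i i)) ∙ e ∙ cong (λ z → suc (suc z)) (+-suc k k))))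
even≢odd (suc i) zero e = contradiction (suc-injective e) (λ e' → ℕ.1+n≢0 (sym (+-suc i i) ∙ e'))
even≢odd zero k ()

odd-factors : ∀ p r k → p · r ≡ odd k → (∃[ i ] p ≡ odd i) × (∃[ j ] r ≡ odd j)
odd-factors p r k e = [ (λ (i , p≡) → ⊥-elim (even≢odd (i · r) k (sym (ℕ.*-distribʳ-+ r i i) ∙ cong (_· r) (sym p≡) ∙ e))) , id ]′ (even⊎odd p) ,
                      [ (λ (j , r≡) → ⊥-elim (even≢odd (p · j) k (sym (ℕ.*-distribˡ-+ p j j) ∙ cong (p ·_) (sym r≡) ∙ e))) , id ]′ (even⊎odd r)

jacobi-symbol : ∀ k a → Cop (+ odd k) a → jacobi a (odd k) ≡ symbol k a
jacobi-symbol k a cop = over-factors (PrimeFactorisation.factors F) k (PrimeFactorisation.factorsPrime F) (PrimeFactorisation.isFactorisation F) cop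
  where
  F = factorise (odd k)
  over-factors : ∀ ps k → All Prime ps → odd k ≡ product ps → Cop (+ odd k) a → foldr _*_ 1ℤ (map (legendre a) ps) ≡ symbol k a
  over-factors [] k _ e cop = sym (cong (λ z → symbol z a) (odd-injective {k} {0} e) ∙ HalfSystem.symbol-def 0 a ∙ ∏-[] _)
  over-factors (p ∷ ps) k (pr ∷ prs) e cop = go (proj₁ (odd-factors p (product ps) k (sym e))) (proj₂ (odd-factors p (product ps) k (sym e)))
    where
    go : (∃[ i ] p ≡ odd i) → (∃[ j ] product ps ≡ odd j) → legendre a p * foldr _*_ 1ℤ (map (legendre a) ps) ≡ symbol k a
    go (i , p≡) (j , r≡) = cong₂ _*_ (cong (legendre a) p≡ ∙ legendre-symbol i (subst Prime p≡ pr) a cop-i) (over-factors ps j prs (sym r≡) cop-j) ∙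
      trans (sym (symbol-modulus-* i j a (subst (λ z → Cop (+ odd z) a) k≡ cop))) (cong (λ z → symbol z a) (sym k≡))
      where
      k≡ : k ≡ i ℕ.+ j ℕ.+ (i · j ℕ.+ i · j)
      k≡ = odd-injective (e ∙ cong₂ _·_ p≡ r≡ ∙ odd-* i j)
      n≡ : + odd k ≡ + odd i * + odd j
      n≡ = cong +_ (e ∙ cong₂ _·_ p≡ r≡) ∙ pos-* (odd i) (odd j)
      cop-i : Cop (+ odd i) a
      cop-i = cop-factorˡ {+ odd i} {+ odd j} (subst (λ z → Cop z a) n≡ cop)
      cop-j : Cop (+ odd j) a
      cop-j = cop-factorˡ {+ odd j} {+ odd i} (subst (λ z → Cop z a) (n≡ ∙ *-comm (+ odd i) (+ odd j)) cop)

-- Roots of x² + tx + n₀ modulo a prime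

rootCount : ℤ → ℤ → ℕ → ℤ
rootCount t n₀ a = ∑< a (λ x → ⟦ + a ∣? (+ x * + x + t * + x + n₀) ⟧)

∑<-indicator : ∀ n {x₀} → x₀ ℕ.< n → ∑< n (λ x → ⟦ x ℕ.≟ x₀ ⟧) ≡ 1ℤ
∑<-indicator n {x₀} x₀< = ∑<-single n (λ x → ⟦ x ℕ.≟ x₀ ⟧) x₀< (λ {x} _ x≢ → ⟦⟧-no (x ℕ.≟ x₀) x≢) ∙ ⟦⟧-yes (x₀ ℕ.≟ x₀) refl

∑<-+' : ∀ n f g → ∑< n (λ x → f x + g x) ≡ ∑< n f + ∑< n g
∑<-+' n f g = ∑<≡∑ n _ ∙ ∑-+ (upTo n) f g ∙ cong₂ _+_ (sym (∑<≡∑ n f)) (sym (∑<≡∑ n g))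

module _ (i : ℕ) (pr : Prime (odd i)) where
  private
    p : ℕ
    p = odd i

  squares-of : ℤ → ℤ
  squares-of D = ∑< p (λ x → ⟦ + p ∣? (+ x * + x - D) ⟧)

  rootCount-squares : ∀ t n₀ → rootCount t n₀ p ≡ squares-of (t * t - + 4 * n₀)
  rootCount-squares t n₀ = ∑<-cong p (λ {x} _ → ⟦⟧-cong (+ p ∣? (+ x * + x + t * + x + n₀)) (+ p ∣? ((t + + 2 * + x) * (t + + 2 * + x) - (t * t - + 4 * n₀)))
      (λ d → subst (+ p ∣_) (lem₁ (+ x) t n₀) (∣n⇒∣m*n (+ 4) d)) (λ d → [ (λ e → ⊥-elim (2∤ e)) , [ (λ e → ⊥-elim (2∤ e)) , id ]′ ∘ prime-∣-* pr (+ 2) _ ]′ (prime-∣-* pr (+ 2) _ (subst (+ p ∣_) (lem₂ (+ x) t n₀) d)))) ∙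
    ∑<-affine p (+ 2) (+ suc i) t {λ z → ⟦ + p ∣? (z * z - (t * t - + 4 * n₀)) ⟧} (λ {x} {y} → periodic {x} {y}) (divides 1ℤ (lem₃ (+ i)))
    where
    lem₁ : ∀ x t n → + 4 * (x * x + t * x + n) ≡ (t + + 2 * x) * (t + + 2 * x) - (t * t - + 4 * n)
    lem₁ = ring
    lem₂ : ∀ x t n → (t + + 2 * x) * (t + + 2 * x) - (t * t - + 4 * n) ≡ + 2 * (+ 2 * (x * x + t * x + n))
    lem₂ = ring
    lem₃ : ∀ i → + 2 * (1ℤ + i) - 1ℤ ≡ 1ℤ * (1ℤ + (i + i))
    lem₃ = ring
    2∤ : ¬ (+ p ∣ + 2)
    2∤ d = by-size i pr d
      where
      by-size : ∀ i → Prime (odd i) → ¬ (+ odd i ∣ + 2)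
      by-size zero pr d = ℕ.¬prime[1] pr
      by-size (suc i) pr d = contradiction (small-∣⇒≡0 d (s≤s (s≤s (≤-trans (s≤s z≤n) (≤-reflexive (sym (+-suc i i))))))) (λ ())
    periodic : Mod p (λ z → ⟦ + p ∣? (z * z - (t * t - + 4 * n₀)) ⟧)
    periodic {x} {y} d = ⟦⟧-cong (+ p ∣? (x * x - (t * t - + 4 * n₀))) (+ p ∣? (y * y - (t * t - + 4 * n₀)))
      (λ e → subst (+ p ∣_) (lem x y (t * t - + 4 * n₀)) (∣m∣n⇒∣m-n e (∣m⇒∣m*n (x + y) d)))
      (λ e → subst (+ p ∣_) (lem' x y (t * t - + 4 * n₀)) (∣m∣n⇒∣m+n e (∣m⇒∣m*n (x + y) d)))
      where lem : ∀ x y D → x * x - D - (x - y) * (x + y) ≡ y * y - D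
            lem = ring
            lem' : ∀ x y D → y * y - D + (x - y) * (x + y) ≡ x * x - D
            lem' = ring

  squares-ramified : ∀ D → + p ∣ D → squares-of D ≡ 1ℤ
  squares-ramified D p∣D = ∑<-cong p (λ {x} x< → ⟦⟧-cong (+ p ∣? (+ x * + x - D)) (x ℕ.≟ 0) (to x x<) (from x)) ∙ ∑<-indicator p (s≤s z≤n)
    where
    lem : ∀ x D → x * x - D + D ≡ x * x
    lem = ring
    to : ∀ x → x ℕ.< p → + p ∣ + x * + x - D → x ≡ 0
    to x x< d = +-injective (small-∣⇒≡0 ([ id , id ]′ (prime-∣-* pr (+ x) (+ x) (subst (+ p ∣_) (lem (+ x) D) (∣m∣n⇒∣m+n d p∣D)))) x<)
    from : ∀ x → x ≡ 0 → + p ∣ + x * + x - D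
    from x refl = subst (+ p ∣_) (sym (+-identityˡ (- D))) (∣m⇒∣-m p∣D)

  squares-unramified : ∀ D → Cop (+ p) D → squares-of D ≡ 1ℤ + symbol i D
  squares-unramified D cop = by-square (Fin.any? (λ y → + p ∣? (D - + toℕ {p} y * + toℕ y)))
    where
    bound : ∀ {y} → y ∈ half i → y ℕ.< p
    bound y∈ = s≤s (≤-trans (proj₂ (∈-half⁻ y∈)) (m≤m+n i i))
    by-square : Dec (∃[ y ] + p ∣ D - + toℕ {p} y * + toℕ y) → squares-of D ≡ 1ℤ + symbol i D
    by-square (no ∄) = ∑<-zero p (λ {x} x< → ⟦⟧-no (+ p ∣? (+ x * + x - D)) (λ d → ∄ (fromℕ< x< , subst (λ z → + p ∣ D - + z * + z) (sym (Fin.toℕ-fromℕ< x<)) (∣-sym {x = + x * + x} {D} d)))) ∙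
      cong (λ z → 1ℤ + z) (sym (nonresidue-symbol i pr D cop (λ y y∈ d → ∄ (fromℕ< (bound y∈) , subst (λ z → + p ∣ D - + z * + z) (sym (Fin.toℕ-fromℕ< (bound y∈))) d))))
    by-square (yes (yF , d)) = begin
      squares-of D ≡⟨ ∑<-cong p (λ {x} x< → two-roots x x<) ⟩
      ∑< p (λ x → ⟦ x ℕ.≟ y ⟧ + ⟦ x ℕ.≟ p ℕ.∸ y ⟧) ≡⟨ ∑<-+' p _ _ ⟩
      ∑< p (λ x → ⟦ x ℕ.≟ y ⟧) + ∑< p (λ x → ⟦ x ℕ.≟ p ℕ.∸ y ⟧) ≡⟨ cong₂ _+_ (∑<-indicator p y<p) (∑<-indicator p (∸-monoʳ-< y>0 (ℕ.<⇒≤ y<p))) ⟩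
      1ℤ + 1ℤ ≡⟨ cong (λ z → 1ℤ + z) (symbol-cong i {D} {+ y * + y} d ∙ symbol-square i (+ y) cop-y) ⟨
      1ℤ + symbol i D ∎
      where
      y : ℕ
      y = toℕ yF
      y<p : y ℕ.< p
      y<p = Fin.toℕ<n yF
      cop-y : Cop (+ p) (+ y)
      cop-y = cop-factorʳ (+ y) (+ y) (cop-mod d cop)
      y>0 : 0 ℕ.< y
      y>0 = n≢0⇒n>0 (λ e → cop⇒∤ pr cop-y (subst (λ z → + p ∣ + z) (sym e) (divides 0ℤ (sym (*-zeroˡ (+ p))))))
      p-y : + (p ℕ.∸ y) ≡ + p - + y
      p-y = sym (ℤ.⊖-≥ (ℕ.<⇒≤ y<p)) ∙ sym (m-n≡m⊖n p y)
      lem₁ : ∀ x y D → x * x - D + (D - y * y) ≡ (x - y) * (x + y)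
      lem₁ = ring
      lem₂ : ∀ x y p → x + y - p ≡ x - (p - y)
      lem₂ = ring
      lem₃ : ∀ x y D → (x - y) * (x + y) - (D - y * y) ≡ x * x - D
      lem₃ = ring
      root-cases : ∀ x → x ℕ.< p → + p ∣ + x * + x - D → x ≡ y ⊎ x ≡ p ℕ.∸ y
      root-cases x x< e = [ (λ r → inj₁ (residue-unique x< y<p r)) , (λ r → inj₂ (residue-unique x< (∸-monoʳ-< y>0 (ℕ.<⇒≤ y<p))
          (subst (+ p ∣_) (lem₂ (+ x) (+ y) (+ p) ∙ cong (λ z → + x - z) (sym p-y)) (∣m∣n⇒∣m-n r ∣-refl)))) ]′
        (prime-∣-* pr (+ x - + y) (+ x + + y) (subst (+ p ∣_) (lem₁ (+ x) (+ y) D) (∣m∣n⇒∣m+n e d)))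
      is-root : ∀ x → (+ p ∣ + x - + y) ⊎ (+ p ∣ + x + + y) → + p ∣ + x * + x - D
      is-root x r = subst (+ p ∣_) (lem₃ (+ x) (+ y) D) (∣m∣n⇒∣m-n ([ ∣m⇒∣m*n (+ x + + y) , ∣n⇒∣m*n (+ x - + y) ]′ r) d)
      y≢p-y : y ≢ p ℕ.∸ y
      y≢p-y e = even≢odd y i (cong (y ℕ.+_) e ∙ ℕ.m+[n∸m]≡n (ℕ.<⇒≤ y<p))
      two-roots : ∀ x → x ℕ.< p → ⟦ + p ∣? (+ x * + x - D) ⟧ ≡ ⟦ x ℕ.≟ y ⟧ + ⟦ x ℕ.≟ p ℕ.∸ y ⟧
      two-roots x x< = by-cases (x ℕ.≟ y) (x ℕ.≟ p ℕ.∸ y)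
        where
        by-cases : Dec (x ≡ y) → Dec (x ≡ p ℕ.∸ y) → ⟦ + p ∣? (+ x * + x - D) ⟧ ≡ ⟦ x ℕ.≟ y ⟧ + ⟦ x ℕ.≟ p ℕ.∸ y ⟧
        by-cases (yes e) (yes e') = contradiction (sym e ∙ e') y≢p-y
        by-cases (yes e) (no n) = ⟦⟧-yes (+ p ∣? (+ x * + x - D)) (is-root x (inj₁ (subst (+ p ∣_) (sym (cong (λ z → + z - + y) e ∙ +-inverseʳ (+ y))) (divides 0ℤ (sym (*-zeroˡ (+ p))))))) ∙
          sym (cong₂ _+_ (⟦⟧-yes (x ℕ.≟ y) e) (⟦⟧-no (x ℕ.≟ p ℕ.∸ y) n))
        by-cases (no n) (yes e) = ⟦⟧-yes (+ p ∣? (+ x * + x - D)) (is-root x (inj₂ (subst (+ p ∣_) (cong +_ (sym (cong (ℕ._+ y) e ∙ ℕ.m∸n+n≡m (ℕ.<⇒≤ y<p)))) ∣-refl))) ∙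
          sym (cong₂ _+_ (⟦⟧-no (x ℕ.≟ y) n) (⟦⟧-yes (x ℕ.≟ p ℕ.∸ y) e))
        by-cases (no n) (no n') = trans (⟦⟧-no (+ p ∣? (+ x * + x - D)) (λ e → [ n , n' ]′ (root-cases x x< e)))
          (sym (cong₂ _+_ (⟦⟧-no (x ℕ.≟ y) n) (⟦⟧-no (x ℕ.≟ p ℕ.∸ y) n')))

-- The character of ℚ(√m)

bézout-unit : ∀ {a b} (z : Bézout a b) → Unit (Bézout.g z) → Cop a b
bézout-unit {a} {b} (bézout {g} {r} {v} {x} {y} a≡ b≡ one) u = g * x , g * y , (begin
  g * x * a + g * y * b ≡⟨ cong₂ (λ c d → g * x * c + g * y * d) a≡ b≡ ⟩
  g * x * (g * r) + g * y * (g * v) ≡⟨ factor-square g x r y v ⟩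
  g * g * (x * r + y * v) ≡⟨ cong₂ _*_ (unit-square u) one ⟩
  1ℤ ∎)


∣1⇒unit : ∀ {g} → ∣ g ∣ ≡ 1 → Unit g
∣1⇒unit {+ 1} refl = inj₁ refl
∣1⇒unit { -[1+ 0 ]} refl = inj₂ refl

gcd⇒cop : ∀ a b → gcd b a ≡ 1 → Cop (+ a) (+ b)
gcd⇒cop a b e = go (bézout-ℤ (+ a) (+ b))
  where
  go : Bézout (+ a) (+ b) → Cop (+ a) (+ b)
  go z@(bézout {g} {r} {v} a≡ b≡ _) = bézout-unit z (∣1⇒unit (ℕ∣.∣1⇒≡1 (subst (∣ g ∣ ∣ₙ_) e (ℕ.gcd-greatest
    (∣⇒∣ᵤ {g} {+ b} (divides v (b≡ ∙ *-comm g v))) (∣⇒∣ᵤ {g} {+ a} (divides r (a≡ ∙ *-comm g r)))))))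

cop⇒gcd : ∀ a b → Cop (+ a) (+ b) → gcd b a ≡ 1
cop⇒gcd a b (x , y , one) = ℕ∣.∣1⇒≡1 (∣⇒∣ᵤ {+ gcd b a} {1ℤ} (subst (+ gcd b a ∣_) one
  (∣m∣n⇒∣m+n (∣n⇒∣m*n x (∣ᵤ⇒∣ (ℕ.gcd[m,n]∣n b a))) (∣n⇒∣m*n y (∣ᵤ⇒∣ (ℕ.gcd[m,n]∣m b a))))))

cop? : ∀ a b → Dec (Cop (+ a) (+ b))
cop? a b = map′ (gcd⇒cop a b) (cop⇒gcd a b) (gcd b a ℕ.≟ 1)

divmod-unique : ∀ z d .{{_ : NonZero d}} q r → r ℕ.< d → z ≡ + r + q * + d → z %ℕ d ≡ r × z /ℕ d ≡ q
divmod-unique z d q r r<d z≡ = r≡ , *-cancelˡ (+ d) d≢0 (begin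
  + d * (z /ℕ d) ≡⟨ lem₁ (+ d) (z /ℕ d) (+ (z %ℕ d)) ⟩
  + (z %ℕ d) + z /ℕ d * + d - + (z %ℕ d) ≡⟨ cong₂ (λ x y → x - + y) (sym (a≡a%ℕn+[a/ℕn]*n z d) ∙ z≡) r≡ ⟩
  + r + q * + d - + r ≡⟨ lem₁ (+ d) q (+ r) ⟨
  + d * q ∎)
  where
  lem₁ : ∀ d q r → d * q ≡ r + q * d - r
  lem₁ = ring
  lem₂ : ∀ r q d s z → r + q * d - s - (z - s) ≡ r - z + q * d
  lem₂ = ring
  lem₃ : ∀ z r q d → r + q * d - z - q * d ≡ r - z
  lem₃ = ring
  d≢0 : + d ≢ 0ℤ
  d≢0 e = ℕ.<⇒≢ (≤-<-trans z≤n r<d) (sym (+-injective e))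
  r≡ : z %ℕ d ≡ r
  r≡ = sym (residue-unique r<d (n%ℕd<d z d) (subst (+ d ∣_) (cong (λ w → w - + (z %ℕ d) - q * + d) z≡ ∙ lem₃ (+ (z %ℕ d)) (+ r) q (+ d)) (∣m∣n⇒∣m-n (∣-%ℕ z d) (∣n⇒∣m*n q ∣-refl))))

χ-formula : ∀ m x {r s n} → m %ℕ 4 ≡ r → m /ℕ 2 ≡ n → n %ℕ 4 ≡ s → χ m x ≡
  (if gcd ∣ x ∣ ∣ if r ℕ.≡ᵇ 1 then m else + 4 * m ∣ ℕ.≡ᵇ 1
   then (if r ℕ.≡ᵇ 1 then jacobi x ∣ m ∣
         else if r ℕ.≡ᵇ 3 then χ₄ x * jacobi x ∣ m ∣
         else if s ℕ.≡ᵇ 1 then χ₈ x * jacobi x ∣ n ∣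
         else χ₄ x * χ₈ x * jacobi x ∣ n ∣)
   else 0ℤ)
χ-formula m x refl refl refl = refl

discriminant-formula : ∀ m {r} → m %ℕ 4 ≡ r → discriminant m ≡ (if r ℕ.≡ᵇ 1 then m else + 4 * m)
discriminant-formula m refl = refl

triangle-double : ∀ i → triangle i ℕ.+ triangle i ≡ i · suc i
triangle-double zero = refl
triangle-double (suc i) = lem₁ i (triangle i) ∙ cong (ℕ._+ (suc i ℕ.+ suc i)) (triangle-double i) ∙ lem₂ i
  where lem₁ : ∀ i t → suc i ℕ.+ t ℕ.+ (suc i ℕ.+ t) ≡ t ℕ.+ t ℕ.+ (suc i ℕ.+ suc i)
        lem₁ = ringₙ
        lem₂ : ∀ i → i · suc i ℕ.+ (suc i ℕ.+ suc i) ≡ suc i · suc (suc i)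
        lem₂ = ringₙ

χ₄-odd : ∀ i → χ₄ (+ odd i) ≡ symbol i -1ℤ
χ₄-odd i = cong (λ z → -1ℤ ^ ∣ z ∣) (proj₂ (divmod-unique (+ odd i - 1ℤ) 2 (+ i) 0 (s≤s z≤n) (lem (+ i)))) ∙ sym (symbol-neg1 i)
  where lem : ∀ i → 1ℤ + (i + i) - 1ℤ ≡ 0ℤ + i * + 2
        lem = ring

χ₈-odd : ∀ i → χ₈ (+ odd i) ≡ symbol i (+ 2)
χ₈-odd i = cong (λ z → -1ℤ ^ ∣ z ∣) (proj₂ (divmod-unique (+ odd i * + odd i - 1ℤ) 8 (+ triangle i) 0 (s≤s z≤n) (begin
  + odd i * + odd i - 1ℤ ≡⟨ lem₁ (+ i) ⟩
  + 4 * (+ i * (1ℤ + + i)) ≡⟨ cong (+ 4 *_) (sym (pos-* i (suc i)) ∙ cong +_ (sym (triangle-double i))) ⟩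
  + 4 * (+ triangle i + + triangle i) ≡⟨ lem₂ (+ triangle i) ⟩
  + 0 + + triangle i * + 8 ∎))) ∙ sym (symbol-2 i)
  where
  lem₁ : ∀ i → (1ℤ + (i + i)) * (1ℤ + (i + i)) - 1ℤ ≡ + 4 * (i * (1ℤ + i))
  lem₁ = ring
  lem₂ : ∀ t → + 4 * (t + t) ≡ 0ℤ + t * + 8
  lem₂ = ring

record Character (N : ℕ) (ch : ℕ → ℤ) : Set where
  field
    periodic : ∀ x → ch (x ℕ.+ N) ≡ ch x
    mult : ∀ x y → ch (x · y) ≡ ch x * ch y
    minus-one : ch (N ℕ.∸ 1) ≡ -1ℤ
    zeros : ∀ x → ¬ Cop (+ N) (+ x) → ch x ≡ 0ℤ
    units : ∀ x → Cop (+ N) (+ x) → Unit (ch x)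

cop-sum : ∀ {N} x → Cop (+ N) (+ x) → Cop (+ N) (+ (x ℕ.+ N))
cop-sum {N} x = cop-mod (divides -1ℤ (lem (+ x) (+ N)))
  where lem : ∀ x n → x - (x + n) ≡ -1ℤ * n
        lem = ring

cop-sum⁻ : ∀ {N} x → Cop (+ N) (+ (x ℕ.+ N)) → Cop (+ N) (+ x)
cop-sum⁻ {N} x = cop-mod (divides 1ℤ (+-minusˡ (+ x) (+ N)))


cop-product : ∀ {N} x y → Cop (+ N) (+ x) → Cop (+ N) (+ y) → Cop (+ N) (+ (x · y))
cop-product {N} x y cx cy = subst (Cop (+ N)) (sym (pos-* x y)) (cop-* cx cy)

cop-product⁻ʳ : ∀ {N} x y → Cop (+ N) (+ (x · y)) → Cop (+ N) (+ y)
cop-product⁻ʳ {N} x y c = cop-factorʳ (+ x) (+ y) (subst (Cop (+ N)) (pos-* x y) c)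

cop-product⁻ˡ : ∀ {N} x y → Cop (+ N) (+ (x · y)) → Cop (+ N) (+ x)
cop-product⁻ˡ {N} x y c = cop-product⁻ʳ y x (subst (λ z → Cop (+ N) (+ z)) (ℕ.*-comm x y) c)

cop-pred : ∀ n → Cop (+ suc n) (+ n)
cop-pred n = 1ℤ , -1ℤ , lem (+ n)
  where lem : ∀ n → 1ℤ * (1ℤ + n) + -1ℤ * n ≡ 1ℤ
        lem = ring

-- It suffices to verify the identities on arguments coprime to N.
module _ {N : ℕ} {ch : ℕ → ℤ} (zeros : ∀ x → ¬ Cop (+ N) (+ x) → ch x ≡ 0ℤ) where
  periodic-from : (∀ x → Cop (+ N) (+ x) → ch (x ℕ.+ N) ≡ ch x) → ∀ x → ch (x ℕ.+ N) ≡ ch x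
  periodic-from h x = by-cop (cop? N x)
    where
    by-cop : Dec (Cop (+ N) (+ x)) → ch (x ℕ.+ N) ≡ ch x
    by-cop (yes c) = h x c
    by-cop (no ¬c) = zeros _ (¬c ∘ cop-sum⁻ x) ∙ sym (zeros _ ¬c)

  mult-from : (∀ x y → Cop (+ N) (+ x) → Cop (+ N) (+ y) → ch (x · y) ≡ ch x * ch y) → ∀ x y → ch (x · y) ≡ ch x * ch y
  mult-from h x y = by-cop (cop? N x) (cop? N y)
    where
    by-cop : Dec (Cop (+ N) (+ x)) → Dec (Cop (+ N) (+ y)) → ch (x · y) ≡ ch x * ch y
    by-cop (yes c) (yes d) = h x y c d
    by-cop (no ¬c) _ = zeros _ (¬c ∘ cop-product⁻ˡ x y) ∙ sym (cong (_* ch y) (zeros x ¬c) ∙ *-zeroˡ (ch y))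
    by-cop (yes _) (no ¬d) = zeros _ (¬d ∘ cop-product⁻ʳ x y) ∙ sym (cong (ch x *_) (zeros y ¬d) ∙ *-zeroʳ (ch x))

module OddCharacter (l : ℕ) (ch : ℕ → ℤ) (zeros : ∀ x → ¬ Cop (+ odd (odd l)) (+ x) → ch x ≡ 0ℤ)
  (values : ∀ x → Cop (+ odd (odd l)) (+ x) → ch x ≡ symbol (odd l) (+ x)) where
  private
    k N : ℕ
    k = odd l
    N = odd k

  odd-character : Character N ch
  odd-character = record
    { periodic = periodic-from zeros λ x c → values _ (cop-sum x c) ∙ symbol-cong k {+ (x ℕ.+ N)} {+ x} (divides 1ℤ (+-minusˡ (+ x) (+ N))) ∙ sym (values x c)
    ; mult = mult-from zeros λ x y c d → values _ (cop-product x y c d) ∙ cong (symbol k) (pos-* x y) ∙ symbol-* k (+ x) (+ y) c d ∙ sym (cong₂ _*_ (values x c) (values y d))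
    ; minus-one = values (k ℕ.+ k) (cop-pred (k ℕ.+ k)) ∙ symbol-cong k {+ (k ℕ.+ k)} { -1ℤ} (divides 1ℤ (lem' (+ (k ℕ.+ k)))) ∙ symbol-neg1 k ∙ sgn-odd l
    ; zeros = zeros
    ; units = λ x c → subst Unit (sym (values x c)) (unit-symbol k (+ x))
    }
    where lem' : ∀ x → x - -1ℤ ≡ 1ℤ * (1ℤ + x)
          lem' = ring

  odd-values : ∀ i → Cop (+ N) (+ odd i) → ch (odd i) ≡ symbol i (- + N)
  odd-values i c = begin
    ch (odd i) ≡⟨ values (odd i) c ⟩
    symbol k (+ odd i) ≡⟨ reciprocity' k i c ⟩
    sgn (i · k) * symbol i (+ N) ≡⟨ cong (_* symbol i (+ N)) (cong sgn (ℕ.*-comm i k) ∙ sgn-odd-* l i ∙ sym (symbol-neg1 i)) ⟩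
    symbol i -1ℤ * symbol i (+ N) ≡⟨ symbol-* i -1ℤ (+ N) (cop-neg1 _) (cop-sym c) ⟨
    symbol i (-1ℤ * + N) ≡⟨ cong (symbol i) (-1*i≡-i (+ N)) ⟩
    symbol i (- + N) ∎


cop-2-odd : ∀ i → Cop (+ 2) (+ odd i)
cop-2-odd i = - + i , 1ℤ , lem (+ i)
  where lem : ∀ i → - i * + 2 + 1ℤ * (1ℤ + (i + i)) ≡ 1ℤ
        lem = ring

even-not-cop : ∀ u j → ¬ Cop (+ (u ℕ.+ u)) (+ (j ℕ.+ j))
even-not-cop u j (x , y , one) = contradiction (small-∣⇒≡0 {2} {1ℤ} (divides (x * + u + y * + j) (sym one ∙ lem x y (+ u) (+ j))) (s≤s (s≤s z≤n))) (λ ())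
  where lem : ∀ x y u j → x * (u + u) + y * (j + j) ≡ (x * u + y * j) * + 2
        lem = ring

module EvenCharacter (k w' : ℕ) (c : ℤ) (ch : ℕ → ℤ) (k∣w : + odd k ∣ + suc w') (cop-c : ∀ i → Cop (+ odd i) c)
  (zeros : ∀ x → ¬ Cop (+ (suc w' ℕ.+ suc w')) (+ x) → ch x ≡ 0ℤ)
  (values : ∀ i → Cop (+ (suc w' ℕ.+ suc w')) (+ odd i) → ch (odd i) ≡ symbol i c * symbol k (+ odd i))
  (shift : ∀ i → symbol (i ℕ.+ suc w') c ≡ symbol i c) (top : symbol w' c * symbol k -1ℤ ≡ -1ℤ) where

  w N : ℕ
  w = suc w'
  N = w ℕ.+ w

  k∣N : + odd k ∣ + N
  k∣N = ∣m∣n⇒∣m+n k∣w k∣w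

  cop-k : ∀ {x} → Cop (+ N) x → Cop (+ odd k) x
  cop-k {x} (a , b , one) = go k∣N
    where
    go : + odd k ∣ + N → Cop (+ odd k) x
    go (divides s N≡) = a * s , b , cong (λ z → z + b * x) (*-assoc a s (+ odd k) ∙ cong (a *_) (sym N≡)) ∙ one

  odd-arg : ∀ x → Cop (+ N) (+ x) → ∃[ i ] x ≡ odd i
  odd-arg x cop = [ (λ (j , e) → ⊥-elim (even-not-cop w j (subst (λ z → Cop (+ N) (+ z)) e cop))) , id ]′ (even⊎odd x)

  even-character : Character N ch
  even-character = record
    { periodic = periodic-from zeros λ x cx → periodic-odd x cx (odd-arg x cx)
    ; mult = mult-from zeros λ x y cx cy → mult-odd x y cx cy (odd-arg x cx) (odd-arg y cy)
    ; minus-one = cong ch top-odd ∙ values w' (subst (λ z → Cop (+ N) (+ z)) top-odd (cop-pred (w' ℕ.+ w))) ∙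
        trans (cong (symbol w' c *_) (symbol-cong k {+ odd w'} { -1ℤ} (subst (+ odd k ∣_) (lem₁ (+ w')) k∣N))) top
    ; zeros = zeros
    ; units = λ x cx → units-odd x cx (odd-arg x cx)
    }
    where
    top-odd : w' ℕ.+ w ≡ odd w'
    top-odd = +-suc w' w'
    lem₁ : ∀ w → 1ℤ + w + (1ℤ + w) ≡ 1ℤ + (w + w) - -1ℤ
    lem₁ = ring
    odd-+ : ∀ i → odd i ℕ.+ N ≡ odd (i ℕ.+ w)
    odd-+ i = lem i w
      where lem : ∀ i w → suc (i ℕ.+ i) ℕ.+ (w ℕ.+ w) ≡ suc (i ℕ.+ w ℕ.+ (i ℕ.+ w))
            lem = ringₙ
    periodic-odd : ∀ x → Cop (+ N) (+ x) → (∃[ i ] x ≡ odd i) → ch (x ℕ.+ N) ≡ ch x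
    periodic-odd x cx (i , refl) = cong ch (odd-+ i) ∙ values (i ℕ.+ w) (subst (λ z → Cop (+ N) (+ z)) (odd-+ i) (cop-sum (odd i) cx)) ∙
      trans (cong₂ _*_ (shift i) (symbol-cong k {+ odd (i ℕ.+ w)} {+ odd i} (subst (+ odd k ∣_) (lem (+ odd i) (+ N) ∙ cong (λ z → + z - + odd i) (odd-+ i)) k∣N))) (sym (values i cx))
      where lem : ∀ x n → n ≡ x + n - x
            lem = ring
    mult-odd : ∀ x y → Cop (+ N) (+ x) → Cop (+ N) (+ y) → (∃[ i ] x ≡ odd i) → (∃[ j ] y ≡ odd j) → ch (x · y) ≡ ch x * ch y
    mult-odd x y cx cy (i , refl) (j , refl) = begin
      ch (odd i · odd j) ≡⟨ cong ch (odd-* i j) ⟩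
      ch (odd ij) ≡⟨ values ij (subst (λ z → Cop (+ N) (+ z)) (odd-* i j) (cop-product (odd i) (odd j) cx cy)) ⟩
      symbol ij c * symbol k (+ odd ij) ≡⟨ cong₂ _*_ (symbol-modulus-* i j c (cop-c ij)) (cong (symbol k) (cong +_ (sym (odd-* i j)) ∙ pos-* (odd i) (odd j)) ∙ symbol-* k (+ odd i) (+ odd j) (cop-k cx) (cop-k cy)) ⟩
      symbol i c * symbol j c * (symbol k (+ odd i) * symbol k (+ odd j)) ≡⟨ *-interchange (symbol i c) (symbol j c) (symbol k (+ odd i)) (symbol k (+ odd j)) ⟩
      symbol i c * symbol k (+ odd i) * (symbol j c * symbol k (+ odd j)) ≡⟨ cong₂ _*_ (values i cx) (values j cy) ⟨
      ch (odd i) * ch (odd j) ∎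
      where
      ij : ℕ
      ij = i ℕ.+ j ℕ.+ (i · j ℕ.+ i · j)
    units-odd : ∀ x → Cop (+ N) (+ x) → (∃[ i ] x ≡ odd i) → Unit (ch x)
    units-odd x cx (i , refl) = subst Unit (sym (values i cx)) (unit-* (unit-symbol i c) (unit-symbol k (+ odd i)))

  -- Reciprocity turns χ into the symbol with numerator -N = 4m, where m = -e · odd k.
  even-values : ∀ e → (∀ i → Cop (+ odd i) (- e)) → + N ≡ + 4 * (e * + odd k) → (∀ i → symbol i c * sgn (i · k) ≡ symbol i (- e)) →
    ∀ i → Cop (+ N) (+ odd i) → ch (odd i) ≡ symbol i (- + N)
  even-values e cop-e N≡ twist i cop = begin
    ch (odd i) ≡⟨ values i cop ⟩
    symbol i c * symbol k (+ odd i) ≡⟨ cong (symbol i c *_) (reciprocity' k i (cop-k cop)) ⟩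
    symbol i c * (sgn (i · k) * symbol i (+ odd k)) ≡⟨ *-assoc (symbol i c) (sgn (i · k)) (symbol i (+ odd k)) ⟨
    symbol i c * sgn (i · k) * symbol i (+ odd k) ≡⟨ cong (_* symbol i (+ odd k)) (twist i) ⟩
    symbol i (- e) * symbol i (+ odd k) ≡⟨ symbol-* i (- e) (+ odd k) (cop-e i) cop-ik ⟨
    symbol i (- e * + odd k) ≡⟨ *-identityˡ _ ⟨
    1ℤ * symbol i (- e * + odd k) ≡⟨ cong (_* symbol i (- e * + odd k)) (symbol-square i (+ 2) (cop-sym (cop-2-odd i))) ⟨
    symbol i (+ 2 * + 2) * symbol i (- e * + odd k) ≡⟨ symbol-* i (+ 2 * + 2) (- e * + odd k) (cop-* {b = + 2} {+ 2} (cop-sym (cop-2-odd i)) (cop-sym (cop-2-odd i))) (cop-* (cop-e i) cop-ik) ⟨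
    symbol i (+ 2 * + 2 * (- e * + odd k)) ≡⟨ cong (symbol i) (lem e (+ odd k) ∙ cong -_ (sym N≡)) ⟩
    symbol i (- + N) ∎
    where
    cop-ik : Cop (+ odd i) (+ odd k)
    cop-ik = cop-sym (cop-k cop)
    lem : ∀ e k → + 2 * + 2 * (- e * k) ≡ - (+ 4 * (e * k))
    lem = ring

-- The discriminants of imaginary quadratic fields

if-false : ∀ {b} {x y : ℤ} → b ≡ false → (if b then x else y) ≡ y
if-false refl = refl

χ-zero : ∀ m x N → ∣ discriminant m ∣ ≡ N → ¬ Cop (+ N) (+ x) → χ m (+ x) ≡ 0ℤ
χ-zero m x N refl ¬cop = if-false (dec-false (gcd x ∣ discriminant m ∣ ℕ.≟ 1) (¬cop ∘ gcd⇒cop N x))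

if-cop : ∀ {N x} → Cop (+ N) (+ x) → ∀ {a b : ℤ} → (if gcd x N ℕ.≡ᵇ 1 then a else b) ≡ a
if-cop {N} {x} cop {a} {b} = cong (if_then a else b) (dec-true (gcd x N ℕ.≟ 1) (cop⇒gcd N x cop))

rootCount-2 : ∀ t n₀ → rootCount t n₀ 2 ≡ ⟦ + 2 ∣? n₀ ⟧ + ⟦ + 2 ∣? (1ℤ + t + n₀) ⟧
rootCount-2 t n₀ = ∑<-suc 1 F ∙ cong₂ _+_
  (∑<-suc 0 F ∙ cong (_+ F 0) (∑<-0 F) ∙ +-identityˡ (F 0) ∙ cong (λ z → ⟦ + 2 ∣? z ⟧) (lem₀ t n₀))
  (cong (λ z → ⟦ + 2 ∣? z ⟧) (lem₁ t n₀))
  where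
  F : ℕ → ℤ
  F x = ⟦ + 2 ∣? (+ x * + x + t * + x + n₀) ⟧
  lem₀ : ∀ t n → 0ℤ * 0ℤ + t * 0ℤ + n ≡ n
  lem₀ = ring
  lem₁ : ∀ t n → 1ℤ * 1ℤ + t * 1ℤ + n ≡ 1ℤ + t + n
  lem₁ = ring

prime-even : ∀ {q j} → Prime q → q ≡ j ℕ.+ j → q ≡ 2
prime-even {q} {j} pr e = [ (λ ()) , sym ]′ (ℕ.prime⇒irreducible pr (dividesₙ j (e ∙ cong (j ℕ.+_) (sym (+-identityʳ j)) ∙ ℕ.*-comm 2 j)))

2∤odd : ∀ y → ¬ (+ 2 ∣ + 2 * y + 1ℤ)
2∤odd y (divides c e) = not-multiple 2 1 (c - y) (s≤s z≤n) (s≤s (s≤s z≤n)) (lem₁ c y ∙ cong (_- + 2 * y) (sym e) ∙ lem₂ y)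
  where lem₁ : ∀ c y → + 2 * (c - y) ≡ c * + 2 - + 2 * y
        lem₁ = ring
        lem₂ : ∀ y → + 2 * y + 1ℤ - + 2 * y ≡ + 1
        lem₂ = ring

rootCount-odd-prime : ∀ {N} ch → Character N ch → ∀ t n₀ → + 4 * n₀ - t * t ≡ + N → (∀ i → Cop (+ N) (+ odd i) → ch (odd i) ≡ symbol i (- + N)) →
  ∀ i → Prime (odd i) → rootCount t n₀ (odd i) ≡ 1ℤ + ch (odd i)
rootCount-odd-prime {N} ch character t n₀ disc-N values i pr = rootCount-squares i pr t n₀ ∙ cong (squares-of i pr) D≡ ∙ by-divisibility (+ odd i ∣? + N)
  where
  D≡ : t * t - + 4 * n₀ ≡ - + N
  D≡ = lem t n₀ ∙ cong -_ disc-N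
    where lem : ∀ t n → t * t - + 4 * n ≡ - (+ 4 * n - t * t)
          lem = ring
  by-divisibility : Dec (+ odd i ∣ + N) → squares-of i pr (- + N) ≡ 1ℤ + ch (odd i)
  by-divisibility (yes d) = squares-ramified i pr (- + N) (∣m⇒∣-m d) ∙ cong (λ z → 1ℤ + z) (sym (Character.zeros character (odd i) (λ cop → cop⇒∤ pr (cop-sym cop) d)))
  by-divisibility (no ∤) = squares-unramified i pr (- + N) cop-neg ∙ cong (λ z → 1ℤ + z) (sym (values i (cop-sym cop)))
    where
    cop : Cop (+ odd i) (+ N)
    cop = cop-half {i} pr ∤
    cop-neg : Cop (+ odd i) (- + N)
    cop-neg = subst (Cop (+ odd i)) (-1*i≡-i (+ N)) (cop-* (cop-neg1 (+ odd i)) cop)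

record Setting (m : ℤ) : Set where
  field
    t f n₀ : ℤ
    N : ℕ
    disc : f * f * m + + 4 * n₀ ≡ t * t
    kind : Kind m t f
    disc-N : + 4 * n₀ - t * t ≡ + N
    N≡ : ∣ discriminant m ∣ ≡ N
    character : Character N (λ x → χ m (+ x))
    roots : ∀ q → Prime q → rootCount t n₀ q ≡ 1ℤ + χ m (+ q)

roots-by-parity : ∀ t n₀ (ch : ℕ → ℤ) → rootCount t n₀ 2 ≡ 1ℤ + ch 2 → (∀ i → Prime (odd i) → rootCount t n₀ (odd i) ≡ 1ℤ + ch (odd i)) →
  ∀ q → Prime q → rootCount t n₀ q ≡ 1ℤ + ch q
roots-by-parity t n₀ ch two odds q pr = by-parity (even⊎odd q)
  where
  by-parity : (∃[ j ] q ≡ j ℕ.+ j) ⊎ (∃[ i ] q ≡ odd i) → rootCount t n₀ q ≡ 1ℤ + ch q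
  by-parity (inj₁ (j , e)) = subst (λ r → rootCount t n₀ r ≡ 1ℤ + ch r) (sym (prime-even {j = j} pr e)) two
  by-parity (inj₂ (i , e)) = subst (λ r → rootCount t n₀ r ≡ 1ℤ + ch r) (sym e) (odds i (subst Prime e pr))

setting-1 : ∀ l → Setting (- + odd (odd l))
setting-1 l = record
  { t = 1ℤ ; f = 1ℤ ; n₀ = + suc l ; N = N
  ; disc = lem₁ (+ l)
  ; kind = odd-disc refl refl
  ; disc-N = lem₂ (+ l)
  ; N≡ = N≡
  ; character = OC.odd-character
  ; roots = roots-by-parity 1ℤ (+ suc l) (λ x → χ m (+ x)) at-2 (rootCount-odd-prime (λ x → χ m (+ x)) OC.odd-character 1ℤ (+ suc l) (lem₂ (+ l)) OC.odd-values)
  }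
  where
  k N : ℕ
  k = odd l
  N = odd k
  m : ℤ
  m = - + odd k
  lem₁ : ∀ l → 1ℤ * 1ℤ * - (1ℤ + (1ℤ + (l + l) + (1ℤ + (l + l)))) + + 4 * (1ℤ + l) ≡ 1ℤ * 1ℤ
  lem₁ = ring
  lem₂ : ∀ l → + 4 * (1ℤ + l) - 1ℤ * 1ℤ ≡ 1ℤ + (1ℤ + (l + l) + (1ℤ + (l + l)))
  lem₂ = ring
  lem₃ : ∀ l → - (1ℤ + (1ℤ + (l + l) + (1ℤ + (l + l)))) ≡ 1ℤ + - (1ℤ + l) * + 4
  lem₃ = ring
  m%4 : m %ℕ 4 ≡ 1
  m%4 = proj₁ (divmod-unique m 4 (- (1ℤ + + l)) 1 (s≤s (s≤s z≤n)) (lem₃ (+ l)))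
  N≡ : ∣ discriminant m ∣ ≡ N
  N≡ = cong ∣_∣ (discriminant-formula m m%4)
  zeros : ∀ x → ¬ Cop (+ N) (+ x) → χ m (+ x) ≡ 0ℤ
  zeros x = χ-zero m x N N≡
  values : ∀ x → Cop (+ N) (+ x) → χ m (+ x) ≡ symbol k (+ x)
  values x cop = χ-formula m (+ x) m%4 refl refl ∙ if-cop {N} {x} cop ∙ jacobi-symbol k (+ x) cop
  module OC = OddCharacter l (λ x → χ m (+ x)) zeros values
  sgn-triangle : sgn (triangle k) ≡ sgn (suc l)
  sgn-triangle = cong sgn (double-injective (triangle-double k ∙ lem l)) ∙ sgn-odd-* l (suc l)
    where lem : ∀ l → suc (l ℕ.+ l) · suc (suc (l ℕ.+ l)) ≡ suc (l ℕ.+ l) · suc l ℕ.+ suc (l ℕ.+ l) · suc l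
          lem = ringₙ
  at-2 : rootCount 1ℤ (+ suc l) 2 ≡ 1ℤ + χ m (+ 2)
  at-2 = begin
    rootCount 1ℤ (+ suc l) 2 ≡⟨ rootCount-2 1ℤ (+ suc l) ⟩
    ⟦ + 2 ∣? + suc l ⟧ + ⟦ + 2 ∣? (1ℤ + 1ℤ + + suc l) ⟧ ≡⟨ by-parity (parity (+ suc l)) ⟩
    1ℤ + sgn (suc l) ≡⟨ cong (λ z → 1ℤ + z) (values 2 (cop-sym (cop-2-odd k)) ∙ symbol-2 k ∙ sgn-triangle) ⟨
    1ℤ + χ m (+ 2) ∎
    where
    lem : ∀ n → 1ℤ + 1ℤ + n ≡ n + 1ℤ * + 2
    lem = ring
    double : ∀ n → + 2 ∣ n → + 2 ∣ 1ℤ + 1ℤ + n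
    double n d = subst (+ 2 ∣_) (sym (lem n)) (∣m∣n⇒∣m+n d (∣n⇒∣m*n 1ℤ ∣-refl))
    halve : ∀ n → + 2 ∣ 1ℤ + 1ℤ + n → + 2 ∣ n
    halve n d = subst (+ 2 ∣_) (lem' n) (∣m∣n⇒∣m-n d (∣n⇒∣m*n 1ℤ ∣-refl))
      where lem' : ∀ n → 1ℤ + 1ℤ + n - 1ℤ * + 2 ≡ n
            lem' = ring
    sgn-by : ∀ n → (+ 2 ∣ + n → sgn n ≡ 1ℤ) × (¬ (+ 2 ∣ + n) → sgn n ≡ -1ℤ)
    sgn-by n = [ (λ (i , e) → (λ _ → cong sgn e ∙ sgn-even i) , (λ ∤ → contradiction (divides (+ i) (cong +_ e ∙ lem″ (+ i))) ∤))
               , (λ (i , e) → (λ d → contradiction (subst (+ 2 ∣_) (cong +_ e ∙ lem‴ (+ i)) d) (2∤odd (+ i))) , (λ _ → cong sgn e ∙ sgn-odd i)) ]′ (even⊎odd n)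
      where lem″ : ∀ i → i + i ≡ i * + 2
            lem″ = ring
            lem‴ : ∀ i → 1ℤ + (i + i) ≡ + 2 * i + 1ℤ
            lem‴ = ring
    by-parity : (∃[ y ] + suc l ≡ + 2 * y) ⊎ (∃[ y ] + suc l ≡ + 2 * y + 1ℤ) → ⟦ + 2 ∣? + suc l ⟧ + ⟦ + 2 ∣? (1ℤ + 1ℤ + + suc l) ⟧ ≡ 1ℤ + sgn (suc l)
    by-parity (inj₁ (y , e)) = cong₂ _+_ (⟦⟧-yes (+ 2 ∣? + suc l) d) (⟦⟧-yes (+ 2 ∣? (1ℤ + 1ℤ + + suc l)) (double (+ suc l) d)) ∙ cong (λ z → 1ℤ + z) (sym (proj₁ (sgn-by (suc l)) d))
      where d : + 2 ∣ + suc l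
            d = divides y (e ∙ *-comm (+ 2) y)
    by-parity (inj₂ (y , e)) = cong₂ _+_ (⟦⟧-no (+ 2 ∣? + suc l) ∤) (⟦⟧-no (+ 2 ∣? (1ℤ + 1ℤ + + suc l)) (∤ ∘ halve (+ suc l))) ∙ cong (λ z → 1ℤ + z) (sym (proj₂ (sgn-by (suc l)) ∤))
      where ∤ : ¬ (+ 2 ∣ + suc l)
            ∤ d = 2∤odd y (subst (+ 2 ∣_) e d)

rootCount-2-even : ∀ n₀ → rootCount 0ℤ n₀ 2 ≡ 1ℤ
rootCount-2-even n₀ = rootCount-2 0ℤ n₀ ∙ by-parity (parity n₀)
  where
  by-parity : (∃[ y ] n₀ ≡ + 2 * y) ⊎ (∃[ y ] n₀ ≡ + 2 * y + 1ℤ) → ⟦ + 2 ∣? n₀ ⟧ + ⟦ + 2 ∣? (1ℤ + 0ℤ + n₀) ⟧ ≡ 1ℤ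
  by-parity (inj₁ (y , e)) = cong₂ _+_ (⟦⟧-yes (+ 2 ∣? n₀) (divides y (e ∙ *-comm (+ 2) y))) (⟦⟧-no (+ 2 ∣? (1ℤ + 0ℤ + n₀)) (λ d → 2∤odd y (subst (+ 2 ∣_) (cong (λ z → 1ℤ + 0ℤ + z) e ∙ ℤ.+-comm (1ℤ + 0ℤ) (+ 2 * y)) d)))
  by-parity (inj₂ (y , e)) = cong₂ _+_ (⟦⟧-no (+ 2 ∣? n₀) (λ d → 2∤odd y (subst (+ 2 ∣_) e d))) (⟦⟧-yes (+ 2 ∣? (1ℤ + 0ℤ + n₀)) (divides (y + 1ℤ) (cong (λ z → 1ℤ + 0ℤ + z) e ∙ lem y)))
    where lem : ∀ y → 1ℤ + 0ℤ + (+ 2 * y + 1ℤ) ≡ (y + 1ℤ) * + 2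
          lem = ring

-- m = -e · odd k with m ≢ 1 mod 4.
module EvenSetting (e k w' : ℕ) (c : ℤ)
  (w≡ : + suc w' ≡ + 2 * (+ e * + odd k)) (j : ℤ) (m-mod : - (+ e * + odd k) ≡ + 4 * j + + 2 ⊎ - (+ e * + odd k) ≡ + 4 * j + + 3) (N≡ : ∣ discriminant (- (+ e * + odd k)) ∣ ≡ suc w' ℕ.+ suc w')
  (cop-c : ∀ i → Cop (+ odd i) c) (cop-e : ∀ i → Cop (+ odd i) (- + e))
  (values : ∀ i → Cop (+ (suc w' ℕ.+ suc w')) (+ odd i) → χ (- (+ e * + odd k)) (+ odd i) ≡ symbol i c * symbol k (+ odd i))
  (shift : ∀ i → symbol (i ℕ.+ suc w') c ≡ symbol i c) (top : symbol w' c * symbol k -1ℤ ≡ -1ℤ)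
  (twist : ∀ i → symbol i c * sgn (i · k) ≡ symbol i (- + e)) where

  private
    m : ℤ
    m = - (+ e * + odd k)
    w N : ℕ
    w = suc w'
    N = w ℕ.+ w
    zeros : ∀ x → ¬ Cop (+ N) (+ x) → χ m (+ x) ≡ 0ℤ
    zeros x = χ-zero m x N N≡
    k∣w : + odd k ∣ + w
    k∣w = divides (+ 2 * + e) (w≡ ∙ sym (*-assoc (+ 2) (+ e) (+ odd k)))
    module EC = EvenCharacter k w' c (λ x → χ m (+ x)) k∣w cop-c zeros values shift top
    +N≡ : + N ≡ + 4 * (+ e * + odd k)
    +N≡ = cong₂ _+_ w≡ w≡ ∙ lem (+ e * + odd k)
      where lem : ∀ x → + 2 * x + + 2 * x ≡ + 4 * x
            lem = ring
    disc-N : + 4 * (+ e * + odd k) - 0ℤ * 0ℤ ≡ + N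
    disc-N = lem (+ 4 * (+ e * + odd k)) ∙ sym +N≡
      where lem : ∀ x → x - 0ℤ * 0ℤ ≡ x
            lem = ring

  even-setting : Setting m
  even-setting = record
    { t = 0ℤ ; f = + 2 ; n₀ = + e * + odd k ; N = N
    ; disc = lem (+ e * + odd k)
    ; kind = even-disc j refl refl m-mod
    ; disc-N = disc-N
    ; N≡ = N≡
    ; character = EC.even-character
    ; roots = roots-by-parity 0ℤ (+ e * + odd k) (λ x → χ m (+ x)) (rootCount-2-even (+ e * + odd k) ∙ cong (λ z → 1ℤ + z) (sym (zeros 2 (even-not-cop w 1))))
        (rootCount-odd-prime (λ x → χ m (+ x)) EC.even-character 0ℤ (+ e * + odd k) disc-N (EC.even-values (+ e) cop-e +N≡ twist))
    }
    where lem : ∀ x → + 2 * + 2 * - x + + 4 * x ≡ 0ℤ * 0ℤ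
          lem = ring

cop-divisor : ∀ {n n' x} → n ∣ n' → Cop n' x → Cop n x
cop-divisor {n} {n'} {x} (divides s n'≡) (a , b , one) = a * s , b , cong (λ z → z + b * x) (*-assoc a s n ∙ cong (a *_) (sym n'≡)) ∙ one

if-cop' : ∀ {N x} D → D ≡ N → Cop (+ N) (+ x) → ∀ {a b : ℤ} → (if gcd x D ℕ.≡ᵇ 1 then a else b) ≡ a
if-cop' {N} {x} D refl cop = if-cop {N} {x} cop

∣4m∣ : ∀ e k → ∣ + 4 * - (+ e * + odd k) ∣ ≡ 4 · (e · odd k)
∣4m∣ e k = abs-* (+ 4) (- (+ e * + odd k)) ∙ cong (4 ·_) (∣-i∣≡∣i∣ (+ e * + odd k) ∙ abs-* (+ e) (+ odd k))

sgn-pred : ∀ w → sgn (suc w) ≡ 1ℤ → sgn w ≡ -1ℤ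
sgn-pred w e = unit-cancel (inj₂ refl) e

sgn-even-* : ∀ i l → sgn (i · (l ℕ.+ l)) ≡ 1ℤ
sgn-even-* i l = cong sgn (ℕ.*-distribˡ-+ i l l) ∙ sgn-even (i · l)

setting-3 : ∀ l → Setting (- (+ 1 * + odd (l ℕ.+ l)))
setting-3 l = EvenSetting.even-setting 1 k w' -1ℤ (lem₁ (+ k)) (- (1ℤ + + l)) (inj₂ (lem₂ (+ l))) N≡ (λ _ → cop-neg1 _) (λ _ → cop-neg1 _) values
  (λ i → symbol-neg1 (i ℕ.+ w) ∙ sgn-+ i w ∙ cong (sgn i *_) (sgn-even (odd k)) ∙ *-identityʳ (sgn i) ∙ sym (symbol-neg1 i))
  (cong₂ _*_ (symbol-neg1 w' ∙ sgn-pred w' (sgn-even (odd k))) (symbol-neg1 k ∙ sgn-even l))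
  (λ i → cong (symbol i -1ℤ *_) (sgn-even-* i l) ∙ *-identityʳ (symbol i -1ℤ))
  where
  k w w' N : ℕ
  k = l ℕ.+ l
  w = odd k ℕ.+ odd k
  w' = k ℕ.+ k ℕ.+ odd k
  N = w ℕ.+ w
  m : ℤ
  m = - (+ 1 * + odd k)
  lem₁ : ∀ k → 1ℤ + (k + k) + (1ℤ + (k + k)) ≡ + 2 * (+ 1 * (1ℤ + (k + k)))
  lem₁ = ring
  lem₂ : ∀ l → - (+ 1 * (1ℤ + (l + l + (l + l)))) ≡ + 4 * - (1ℤ + l) + + 3
  lem₂ = ring
  lem₃ : ∀ l → - (+ 1 * (1ℤ + (l + l + (l + l)))) ≡ + 3 + - (1ℤ + l) * + 4
  lem₃ = ring
  lem₄ : ∀ o → 4 · (1 · o) ≡ o ℕ.+ o ℕ.+ (o ℕ.+ o)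
  lem₄ = ringₙ
  lem₅ : ∀ k → 1ℤ + (k + k) + (1ℤ + (k + k)) + (1ℤ + (k + k) + (1ℤ + (k + k))) ≡ + 4 * (1ℤ + (k + k))
  lem₅ = ring
  m%4 : m %ℕ 4 ≡ 3
  m%4 = proj₁ (divmod-unique m 4 (- (1ℤ + + l)) 3 (s≤s (s≤s (s≤s (s≤s z≤n)))) (lem₃ (+ l)))
  D≡ : ∣ + 4 * m ∣ ≡ N
  D≡ = ∣4m∣ 1 k ∙ lem₄ (odd k)
  N≡ : ∣ discriminant m ∣ ≡ N
  N≡ = cong ∣_∣ (discriminant-formula m m%4) ∙ D≡
  ∣m∣≡ : ∣ m ∣ ≡ odd k
  ∣m∣≡ = ∣-i∣≡∣i∣ (+ 1 * + odd k) ∙ cong ∣_∣ (*-identityˡ (+ odd k))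
  values : ∀ i → Cop (+ N) (+ odd i) → χ m (+ odd i) ≡ symbol i -1ℤ * symbol k (+ odd i)
  values i cop = χ-formula m (+ odd i) m%4 refl refl ∙ (if-cop' {N} {odd i} ∣ + 4 * m ∣ D≡ cop) ∙
    cong₂ _*_ (χ₄-odd i) (cong (jacobi (+ odd i)) ∣m∣≡ ∙ jacobi-symbol k (+ odd i) (cop-divisor {+ odd k} {+ N} (divides (+ 4) (lem₅ (+ k))) cop))

triangle-shift : ∀ u j → sgn (triangle (j ℕ.+ (u ℕ.+ u ℕ.+ (u ℕ.+ u)))) ≡ sgn (triangle j)
triangle-shift zero j = cong (sgn ∘ triangle) (+-identityʳ j)
triangle-shift (suc u) j = cong (sgn ∘ triangle) (lem₁ j u) ∙ four (j ℕ.+ (u ℕ.+ u ℕ.+ (u ℕ.+ u))) ∙ triangle-shift u j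
  where
  lem₁ : ∀ j u → j ℕ.+ (suc u ℕ.+ suc u ℕ.+ (suc u ℕ.+ suc u)) ≡ 4 ℕ.+ (j ℕ.+ (u ℕ.+ u ℕ.+ (u ℕ.+ u)))
  lem₁ = ringₙ
  lem₂ : ∀ v T → 4 ℕ.+ v ℕ.+ (3 ℕ.+ v ℕ.+ (2 ℕ.+ v ℕ.+ (1 ℕ.+ v ℕ.+ T))) ≡ (5 ℕ.+ (v ℕ.+ v)) ℕ.+ (5 ℕ.+ (v ℕ.+ v)) ℕ.+ T
  lem₂ = ringₙ
  four : ∀ v → sgn (triangle (4 ℕ.+ v)) ≡ sgn (triangle v)
  four v = cong sgn (lem₂ v (triangle v)) ∙ sgn-+ (5 ℕ.+ (v ℕ.+ v) ℕ.+ (5 ℕ.+ (v ℕ.+ v))) (triangle v) ∙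
    trans (cong (_* sgn (triangle v)) (sgn-even (5 ℕ.+ (v ℕ.+ v)))) (*-identityˡ (sgn (triangle v)))

cop-odd-2 : ∀ i → Cop (+ odd i) (+ 2)
cop-odd-2 i = cop-sym (cop-2-odd i)

cop-odd-neg2 : ∀ i → Cop (+ odd i) (- + 2)
cop-odd-neg2 i = cop-* {b = -1ℤ} {+ 2} (cop-neg1 (+ odd i)) (cop-odd-2 i)

symbol-neg2 : ∀ i → symbol i (- + 2) ≡ symbol i -1ℤ * symbol i (+ 2)
symbol-neg2 i = symbol-* i -1ℤ (+ 2) (cop-neg1 (+ odd i)) (cop-odd-2 i)

module TwiceOdd (k : ℕ) where
  w w' N : ℕ
  w = odd k ℕ.+ odd k ℕ.+ (odd k ℕ.+ odd k)
  w' = k ℕ.+ k ℕ.+ odd k ℕ.+ (odd k ℕ.+ odd k)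
  N = w ℕ.+ w
  m : ℤ
  m = - (+ 2 * + odd k)

  w≡ : + w ≡ + 2 * (+ 2 * + odd k)
  w≡ = lem (+ odd k)
    where lem : ∀ o → o + o + (o + o) ≡ + 2 * (+ 2 * o)
          lem = ring

  D≡ : ∣ + 4 * m ∣ ≡ N
  D≡ = ∣4m∣ 2 k ∙ lem (odd k)
    where lem : ∀ o → 4 · (2 · o) ≡ o ℕ.+ o ℕ.+ (o ℕ.+ o) ℕ.+ (o ℕ.+ o ℕ.+ (o ℕ.+ o))
          lem = ringₙ

  k∣N : + odd k ∣ + N
  k∣N = divides (+ 8) (lem (+ odd k))
    where lem : ∀ o → o + o + (o + o) + (o + o + (o + o)) ≡ + 8 * o
          lem = ring

  m/2 : m /ℕ 2 ≡ - + odd k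
  m/2 = proj₂ (divmod-unique m 2 (- + odd k) 0 (s≤s z≤n) (lem (+ odd k)))
    where lem : ∀ o → - (+ 2 * o) ≡ 0ℤ + - o * + 2
          lem = ring

  sgn-w : sgn w ≡ 1ℤ
  sgn-w = sgn-even (odd k ℕ.+ odd k)

  shift₁ : ∀ i → symbol (i ℕ.+ w) -1ℤ ≡ symbol i -1ℤ
  shift₁ i = symbol-neg1 (i ℕ.+ w) ∙ sgn-+ i w ∙ cong (sgn i *_) sgn-w ∙ *-identityʳ (sgn i) ∙ sym (symbol-neg1 i)

  shift₂ : ∀ i → symbol (i ℕ.+ w) (+ 2) ≡ symbol i (+ 2)
  shift₂ i = symbol-2 (i ℕ.+ w) ∙ triangle-shift (odd k) i ∙ sym (symbol-2 i)

  top₁ : symbol w' -1ℤ ≡ -1ℤ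
  top₁ = symbol-neg1 w' ∙ sgn-pred w' sgn-w

  top₂ : symbol w' (+ 2) ≡ 1ℤ
  top₂ = symbol-2 w' ∙ sym (*-identityˡ (sgn (triangle w'))) ∙ cong (_* sgn (triangle w')) (sym sgn-w) ∙ sym (sgn-+ w (triangle w')) ∙ triangle-shift (odd k) 0

  jacobi-n : ∀ i → Cop (+ N) (+ odd i) → jacobi (+ odd i) (odd k) ≡ symbol k (+ odd i)
  jacobi-n i cop = jacobi-symbol k (+ odd i) (cop-divisor {+ odd k} {+ N} k∣N cop)

  value-formula : m %ℕ 4 ≡ 2 → ∀ {s} → (- + odd k) %ℕ 4 ≡ s → ∀ i → Cop (+ N) (+ odd i) →
    χ m (+ odd i) ≡ (if s ℕ.≡ᵇ 1 then χ₈ (+ odd i) * jacobi (+ odd i) (odd k) else χ₄ (+ odd i) * χ₈ (+ odd i) * jacobi (+ odd i) (odd k))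
  value-formula m%4 n%4 i cop = χ-formula m (+ odd i) m%4 m/2 n%4 ∙ (if-cop' {N} {odd i} ∣ + 4 * m ∣ D≡ cop)

setting-2a : ∀ i₀ → Setting (- (+ 2 * + odd (odd i₀)))
setting-2a i₀ = EvenSetting.even-setting 2 k w' (+ 2) w≡ (- (+ 2 * + i₀ + + 2)) (inj₁ (lem₁ (+ i₀))) (cong ∣_∣ (discriminant-formula m m%4) ∙ D≡) cop-odd-2 cop-odd-neg2
  (λ i cop → value-formula m%4 n%4 i cop ∙ cong₂ _*_ (χ₈-odd i) (jacobi-n i cop))
  shift₂ (cong₂ _*_ top₂ (symbol-neg1 k ∙ sgn-odd i₀))
  (λ i → cong (symbol i (+ 2) *_) (cong sgn (ℕ.*-comm i k) ∙ sgn-odd-* i₀ i ∙ sym (symbol-neg1 i)) ∙ *-comm (symbol i (+ 2)) (symbol i -1ℤ) ∙ sym (symbol-neg2 i))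
  where
  k : ℕ
  k = odd i₀
  open TwiceOdd k
  lem₁ : ∀ i → - (+ 2 * (1ℤ + (1ℤ + (i + i) + (1ℤ + (i + i))))) ≡ + 4 * - (+ 2 * i + + 2) + + 2
  lem₁ = ring
  lem₂ : ∀ i → - (+ 2 * (1ℤ + (1ℤ + (i + i) + (1ℤ + (i + i))))) ≡ + 2 + - (+ 2 * i + + 2) * + 4
  lem₂ = ring
  lem₃ : ∀ i → - (1ℤ + (1ℤ + (i + i) + (1ℤ + (i + i)))) ≡ + 1 + - (1ℤ + i) * + 4
  lem₃ = ring
  m%4 : m %ℕ 4 ≡ 2
  m%4 = proj₁ (divmod-unique m 4 (- (+ 2 * + i₀ + + 2)) 2 (s≤s (s≤s (s≤s z≤n))) (lem₂ (+ i₀)))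
  n%4 : (- + odd k) %ℕ 4 ≡ 1
  n%4 = proj₁ (divmod-unique (- + odd k) 4 (- (1ℤ + + i₀)) 1 (s≤s (s≤s z≤n)) (lem₃ (+ i₀)))

setting-2b : ∀ i₀ → Setting (- (+ 2 * + odd (i₀ ℕ.+ i₀)))
setting-2b i₀ = EvenSetting.even-setting 2 k w' (- + 2) w≡ (- (+ 2 * + i₀ + 1ℤ)) (inj₁ (lem₁ (+ i₀))) (cong ∣_∣ (discriminant-formula m m%4) ∙ D≡) cop-odd-neg2 cop-odd-neg2
  (λ i cop → value-formula m%4 n%4 i cop ∙ cong₂ _*_ (cong₂ _*_ (χ₄-odd i) (χ₈-odd i) ∙ sym (symbol-neg2 i)) (jacobi-n i cop))
  (λ i → symbol-neg2 (i ℕ.+ w) ∙ cong₂ _*_ (shift₁ i) (shift₂ i) ∙ sym (symbol-neg2 i))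
  (cong₂ _*_ (symbol-neg2 w' ∙ cong₂ _*_ top₁ top₂) (symbol-neg1 k ∙ sgn-even i₀))
  (λ i → cong (symbol i (- + 2) *_) (sgn-even-* i i₀) ∙ *-identityʳ (symbol i (- + 2)))
  where
  k : ℕ
  k = i₀ ℕ.+ i₀
  open TwiceOdd k
  lem₁ : ∀ i → - (+ 2 * (1ℤ + (i + i + (i + i)))) ≡ + 4 * - (+ 2 * i + 1ℤ) + + 2
  lem₁ = ring
  lem₂ : ∀ i → - (+ 2 * (1ℤ + (i + i + (i + i)))) ≡ + 2 + - (+ 2 * i + 1ℤ) * + 4
  lem₂ = ring
  lem₃ : ∀ i → - (1ℤ + (i + i + (i + i))) ≡ + 3 + - (1ℤ + i) * + 4
  lem₃ = ring
  m%4 : m %ℕ 4 ≡ 2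
  m%4 = proj₁ (divmod-unique m 4 (- (+ 2 * + i₀ + 1ℤ)) 2 (s≤s (s≤s (s≤s z≤n))) (lem₂ (+ i₀)))
  n%4 : (- + odd k) %ℕ 4 ≡ 3
  n%4 = proj₁ (divmod-unique (- + odd k) 4 (- (1ℤ + + i₀)) 3 (s≤s (s≤s (s≤s (s≤s z≤n)))) (lem₃ (+ i₀)))

setting : ∀ m → m < 0ℤ → SquareFree m → Setting m
setting (+ n) (+<+ ()) sf
setting -[1+ n ] _ sf = by-parity (even⊎odd (suc n))
  where
  double : ∀ u → + (u ℕ.+ u) ≡ + 2 * + u
  double u = +-double (+ u)
  by-k : ∀ k → suc n ≡ odd k → (∃[ i ] k ≡ i ℕ.+ i) ⊎ (∃[ i ] k ≡ odd i) → Setting -[1+ n ]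
  by-k k e (inj₁ (l , k≡)) = subst Setting (cong -_ (*-identityˡ (+ odd (l ℕ.+ l)) ∙ cong +_ (sym (e ∙ cong odd k≡)))) (setting-3 l)
  by-k k e (inj₂ (l , k≡)) = subst Setting (cong (λ z → - + z) (sym (e ∙ cong odd k≡))) (setting-1 l)
  twice : ∀ u k → suc n ≡ u ℕ.+ u → u ≡ odd k → (∃[ i ] k ≡ i ℕ.+ i) ⊎ (∃[ i ] k ≡ odd i) → Setting -[1+ n ]
  twice u k e u≡ (inj₁ (i , k≡)) = subst Setting (cong -_ (sym (cong +_ e ∙ double u ∙ cong (λ z → + 2 * + z) (u≡ ∙ cong odd k≡)))) (setting-2b i)
  twice u k e u≡ (inj₂ (i , k≡)) = subst Setting (cong -_ (sym (cong +_ e ∙ double u ∙ cong (λ z → + 2 * + z) (u≡ ∙ cong odd k≡)))) (setting-2a i)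
  by-half : ∀ u → suc n ≡ u ℕ.+ u → (∃[ v ] u ≡ v ℕ.+ v) ⊎ (∃[ k ] u ≡ odd k) → Setting -[1+ n ]
  by-half u e (inj₁ (v , u≡)) = contradiction (sf (+ 2) (divides (- + v) (cong (λ z → - + z) (e ∙ cong₂ ℕ._+_ u≡ u≡) ∙ lem (+ v)))) (2∤odd 0ℤ)
    where lem : ∀ v → - (v + v + (v + v)) ≡ - v * (+ 2 * + 2)
          lem = ring
  by-half u e (inj₂ (k , u≡)) = twice u k e u≡ (even⊎odd k)
  by-parity : (∃[ u ] suc n ≡ u ℕ.+ u) ⊎ (∃[ k ] suc n ≡ odd k) → Setting -[1+ n ]
  by-parity (inj₁ (u , e)) = by-half u e (even⊎odd u)
  by-parity (inj₂ (k , e)) = by-k k e (even⊎odd k)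

-- Σ_{g² ∣ n} ρ(n / g²) = Σ_{e ∣ n} χ(e)

∑₊ : ℕ → (ℕ → ℤ) → ℤ
∑₊ n f = ∑< n (f ∘ suc)

∑₊-cong : ∀ n {f g} → (∀ i → 0 ℕ.< i → i ℕ.≤ n → f i ≡ g i) → ∑₊ n f ≡ ∑₊ n g
∑₊-cong n h = ∑<-cong n (λ {i} i<n → h (suc i) (s≤s z≤n) i<n)

∑₊-extend : ∀ {m n} f → m ℕ.≤ n → (∀ i → m ℕ.< i → f i ≡ 0ℤ) → ∑₊ n f ≡ ∑₊ m f
∑₊-extend f m≤n h = ∑<-extend (f ∘ suc) m≤n (λ {i} m≤i → h (suc i) (s≤s m≤i))

∑₊-+ : ∀ n f g → ∑₊ n (λ i → f i + g i) ≡ ∑₊ n f + ∑₊ n g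
∑₊-+ n f g = ∑<-+' n (f ∘ suc) (g ∘ suc)

∑<-*ˡ : ∀ n c f → ∑< n (λ i → c * f i) ≡ c * ∑< n f
∑<-*ˡ n c f = ∑<≡∑ n _ ∙ ∑-*ˡ (upTo n) c f ∙ cong (c *_) (sym (∑<≡∑ n f))

∑<-*ʳ : ∀ n c f → ∑< n (λ i → f i * c) ≡ ∑< n f * c
∑<-*ʳ n c f = ∑<≡∑ n _ ∙ ∑-*ʳ (upTo n) c f ∙ cong (_* c) (sym (∑<≡∑ n f))

∑<-swap : ∀ m n (f : ℕ → ℕ → ℤ) → ∑< m (λ i → ∑< n (f i)) ≡ ∑< n (λ j → ∑< m (λ i → f i j))
∑<-swap m n f = ∑<≡∑ m _ ∙ ∑-cong (upTo m) (λ {i} _ → ∑<≡∑ n (f i)) ∙ ∑-swap (upTo m) (upTo n) f ∙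
  sym (∑<≡∑ n _ ∙ ∑-cong (upTo n) (λ {j} _ → ∑<≡∑ m (λ i → f i j)))

∑₊-multiples : ∀ d .{{_ : NonZero d}} M f → (∀ n → ¬ (d ∣ₙ n) → f n ≡ 0ℤ) → ∑₊ (M · d) f ≡ ∑₊ M (λ a → f (a · d))
∑₊-multiples d@(suc d') M f h = ∑<-blocks M d (f ∘ suc) ∙ ∑<-cong M (λ {k} _ → ∑<-single d {d'} _ (ℕ.n<1+n d') (λ {i} i<d i≢ → h _ (not-multiple' k i i<d i≢)) ∙ cong f (last k))
  where
  last : ∀ k → suc (k · d ℕ.+ d') ≡ suc k · d
  last k = sym (+-suc (k · d) d') ∙ +-comm (k · d) d
  not-multiple' : ∀ k i → i ℕ.< d → i ≢ d' → ¬ (d ∣ₙ suc (k · d ℕ.+ i))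
  not-multiple' k i i<d i≢ dv = contradiction (ℕ∣.∣⇒≤ (ℕ∣.∣m+n∣m⇒∣n (subst (d ∣ₙ_) (sym (+-suc (k · d) i)) dv) (ℕ∣.n∣m*n k))) (ℕ.<⇒≱ (s≤s (ℕ.≤∧≢⇒< (ℕ.s≤s⁻¹ i<d) i≢)))

prime-cop : ∀ {p} → Prime p → ∀ z → ¬ (+ p ∣ z) → Cop (+ p) z
prime-cop {p} pr z p∤z = go (bézout-ℤ (+ p) z)
  where
  go : Bézout (+ p) z → Cop (+ p) z
  go b@(bézout {g} {r} {v} p≡ z≡ _) = by-divisor (ℕ.prime⇒irreducible pr (∣⇒∣ᵤ {g} {+ p} (divides r (p≡ ∙ *-comm g r))))
    where
    by-divisor : ∣ g ∣ ≡ 1 ⊎ ∣ g ∣ ≡ p → Cop (+ p) z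
    by-divisor (inj₁ e) = bézout-unit b (∣1⇒unit e)
    by-divisor (inj₂ e) = contradiction (subst (λ q → + q ∣ z) e (∣ᵤ⇒∣ {+ ∣ g ∣} {z} (∣⇒∣ᵤ {g} {z} (divides v (z≡ ∙ *-comm g v))))) p∤z

cop-inverse : ∀ {n a} → Cop n a → ∃[ a' ] n ∣ a * a' - 1ℤ
cop-inverse {n} {a} (x , y , one) = y , divides (- x) (cong (λ w → a * y - w) (sym one) ∙ lem x y n a)
  where lem : ∀ x y n a → a * y - (x * n + y * a) ≡ - x * n
        lem = ring

linear-roots : ∀ {p} → Prime p → ∀ a b → ¬ (+ p ∣ a) → ∑< p (λ s → ⟦ + p ∣? (b + a * + s) ⟧) ≡ 1ℤ
linear-roots {p} pr a b p∤a = go (cop-inverse (prime-cop pr a p∤a))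
  where
  instance
    _ = prime⇒nonZero pr
  linear-Mod : Mod p (λ z → ⟦ + p ∣? z ⟧)
  linear-Mod {u} {v} d = ⟦⟧-cong (+ p ∣? u) (+ p ∣? v) (λ e → subst (+ p ∣_) (minus-involutive u v) (∣m∣n⇒∣m-n e d)) (λ e → subst (+ p ∣_) (+-minus-cancel v u) (∣m∣n⇒∣m+n e d))
  go : (∃[ a' ] + p ∣ a * a' - 1ℤ) → ∑< p (λ s → ⟦ + p ∣? (b + a * + s) ⟧) ≡ 1ℤ
  go (a' , inv) = ∑<-affine p a a' b {λ z → ⟦ + p ∣? z ⟧} (λ {u} {v} → linear-Mod {u} {v}) inv ∙
    trans (∑<-cong p (λ {s} s<p → ⟦⟧-cong (+ p ∣? + s) (s ℕ.≟ 0) (λ d → +-injective (small-∣⇒≡0 d s<p)) (λ e → subst (λ z → + p ∣ + z) (sym e) (divides 0ℤ (sym (*-zeroˡ (+ p)))))))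
      (∑<-indicator p (ℕ.>-nonZero⁻¹ p))

module RootCount (t n₀ : ℤ) (N : ℕ) (disc-N : + 4 * n₀ - t * t ≡ + N)
  (no-square : ∀ p → Prime p → + p ∣ + N → ∀ x → ¬ (+ p * + p ∣ x * x + t * x + n₀)) where

  ρ : ℕ → ℤ
  ρ = rootCount t n₀

  P : ℤ → ℤ
  P x = x * x + t * x + n₀

  root? : (q : ℕ) (z : ℤ) → Dec (+ q ∣ P z)
  root? q z = + q ∣? P z

  P-shift : ∀ x a s → P (x + a * s) ≡ P x + a * (s * (+ 2 * x + t) + a * (s * s))
  P-shift x a s = lem x a s t n₀
    where lem : ∀ x a s t n → (x + a * s) * (x + a * s) + t * (x + a * s) + n ≡ x * x + t * x + n + a * (s * (+ 2 * x + t) + a * (s * s))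
          lem = ring

  derivative : ∀ x → (+ 2 * x + t) * (+ 2 * x + t) ≡ + 4 * P x - + N
  derivative x = lem x t n₀ ∙ cong (λ z → + 4 * P x - z) disc-N
    where lem : ∀ x t n → (+ 2 * x + t) * (+ 2 * x + t) ≡ + 4 * (x * x + t * x + n) - (+ 4 * n - t * t)
          lem = ring

  root-Mod : ∀ q → Mod q (λ z → ⟦ root? q z ⟧)
  root-Mod q {x} {y} d = ⟦⟧-cong (root? q x) (root? q y)
    (λ e → subst (+ q ∣_) (poly-shift x t n₀ y) (∣m∣n⇒∣m-n e (∣m⇒∣m*n (x + y + t) d)))
    (λ e → subst (+ q ∣_) (lem' x y t n₀) (∣m∣n⇒∣m+n e (∣m⇒∣m*n (x + y + t) d)))
    where
    lem' : ∀ x y t n → y * y + t * y + n + (x - y) * (x + y + t) ≡ x * x + t * x + n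
    lem' = ring

  -- Lifting roots from modulus a to modulus p a: the residues x + a s above x.
  module Lift (p : ℕ) (pr : Prime p) (a : ℕ) where
    private
      instance
        _ = prime⇒nonZero pr

    fibre : ℤ → ℤ
    fibre x = ∑< p (λ s → ⟦ root? (p · a) (x + + a * + s) ⟧)

    ρ-fibres : ρ (p · a) ≡ ∑< a (λ x → fibre (+ x))
    ρ-fibres = begin
      ρ (p · a) ≡⟨ ∑<-blocks p a _ ⟩
      ∑< p (λ s → ∑< a (λ x → ⟦ root? (p · a) (+ (s · a ℕ.+ x)) ⟧)) ≡⟨ ∑<-swap p a _ ⟩
      ∑< a (λ x → ∑< p (λ s → ⟦ root? (p · a) (+ (s · a ℕ.+ x)) ⟧)) ≡⟨ ∑<-cong a (λ {x} _ → ∑<-cong p (λ {s} _ → cong (λ z → ⟦ root? (p · a) z ⟧) (cong (_+ + x) (pos-* s a) ∙ lem (+ s) (+ a) (+ x)))) ⟩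
      ∑< a (λ x → fibre (+ x)) ∎
      where lem : ∀ s a x → s * a + x ≡ x + a * s
            lem = ring

    a∣pa : + a ∣ + (p · a)
    a∣pa = divides (+ p) (pos-* p a)

    p∣pa : + p ∣ + (p · a)
    p∣pa = divides (+ a) (pos-* p a ∙ *-comm (+ p) (+ a))

    fibre-empty : ∀ x → ¬ (+ a ∣ P x) → fibre x ≡ 0ℤ
    fibre-empty x a∤ = ∑<-zero p (λ {s} _ → ⟦⟧-no (root? (p · a) (x + + a * + s)) (λ d → a∤ (subst (+ a ∣_) (lem x (+ a) (+ s))
      (∣m∣n⇒∣m-n (∣-trans a∣pa d) (∣m⇒∣m*n (+ s * (+ 2 * x + t) + + a * (+ s * + s)) ∣-refl)))))
      where lem : ∀ x a s → P (x + a * s) - a * (s * (+ 2 * x + t) + a * (s * s)) ≡ P x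
            lem x a s = cong (_- a * (s * (+ 2 * x + t) + a * (s * s))) (P-shift x a s) ∙ +-minus (P x) (a * (s * (+ 2 * x + t) + a * (s * s)))


    weighted : ∀ c → (∀ x → + a ∣ P x → fibre x ≡ c) → ρ (p · a) ≡ c * ρ a
    weighted c h = ρ-fibres ∙ ∑<-cong a (λ {x} _ → by-root (+ x) (root? a (+ x))) ∙ ∑<-*ˡ a c _
      where
      by-root : ∀ x → Dec (+ a ∣ P x) → fibre x ≡ c * ⟦ root? a x ⟧
      by-root x (yes d) = h x d ∙ sym (cong (c *_) (⟦⟧-yes (root? a x) d) ∙ *-identityʳ c)
      by-root x (no ∤) = fibre-empty x ∤ ∙ sym (cong (c *_) (⟦⟧-no (root? a x) ∤) ∙ *-zeroʳ c)

    ρ-coprime : ¬ (+ p ∣ + a) → ρ (p · a) ≡ ρ p * ρ a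
    ρ-coprime p∤a = weighted (ρ p) λ x a∣P → ∑<-cong p (λ {s} _ → ⟦⟧-cong (root? (p · a) (x + + a * + s)) (root? p (x + + a * + s)) (∣-trans p∣pa) (both x s a∣P)) ∙
      go x (cop-inverse cop)
      where
      cop : Cop (+ p) (+ a)
      cop = prime-cop pr (+ a) p∤a
      go : ∀ x → (∃[ a' ] + p ∣ + a * a' - 1ℤ) → ∑< p (λ s → ⟦ root? p (x + + a * + s) ⟧) ≡ ρ p
      go x (a' , inv) = ∑<-affine p (+ a) a' x {λ z → ⟦ root? p z ⟧} (λ {u} {v} → root-Mod p {u} {v}) inv
      both : ∀ x s → + a ∣ P x → + p ∣ P (x + + a * + s) → + (p · a) ∣ P (x + + a * + s)
      both x s a∣P p∣ = merge (subst (+ a ∣_) (sym (P-shift x (+ a) (+ s))) (∣m∣n⇒∣m+n a∣P (∣m⇒∣m*n _ ∣-refl)))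
        where
        merge : + a ∣ P (x + + a * + s) → + (p · a) ∣ P (x + + a * + s)
        merge (divides c e) = finish (cop-∣ cop (subst (+ p ∣_) (e ∙ *-comm c (+ a)) p∣))
          where
          finish : + p ∣ c → + (p · a) ∣ P (x + + a * + s)
          finish (divides b c≡) = divides b (e ∙ cong (_* + a) c≡ ∙ *-assoc b (+ p) (+ a) ∙ cong (b *_) (sym (pos-* p a)))

    p∤derivative : + p ∣ + a → ¬ (+ p ∣ + N) → ∀ x → + a ∣ P x → ¬ (+ p ∣ + 2 * x + t)
    p∤derivative p∣a p∤N x a∣P d = p∤N (subst (+ p ∣_) (lem (P x) (+ N)) (∣m∣n⇒∣m-n (∣n⇒∣m*n (+ 4) (∣-trans p∣a a∣P)) (subst (+ p ∣_) (derivative x) (∣m⇒∣m*n (+ 2 * x + t) d))))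
      where lem : ∀ u n → + 4 * u - (+ 4 * u - n) ≡ n
            lem = ring

    ρ-unramified : .{{_ : NonZero a}} → + p ∣ + a → ¬ (+ p ∣ + N) → ρ (p · a) ≡ ρ a
    ρ-unramified p∣a p∤N = weighted 1ℤ one-lift ∙ *-identityˡ (ρ a)
      where
      a≢0 : + a ≢ 0ℤ
      a≢0 e = ℕ.≢-nonZero⁻¹ a (+-injective e)
      one-lift : ∀ x → + a ∣ P x → fibre x ≡ 1ℤ
      one-lift x a∣P@(divides c Px≡) = ∑<-cong p (λ {s} _ → ⟦⟧-cong (root? (p · a) (x + + a * + s)) (+ p ∣? (c + (+ 2 * x + t) * + s)) (to s) (from s)) ∙ linear-roots pr (+ 2 * x + t) c (p∤derivative p∣a p∤N x a∣P)
        where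
        value : ∀ s → P (x + + a * + s) ≡ + a * (c + (+ 2 * x + t) * + s + + a * (+ s * + s))
        value s = P-shift x (+ a) (+ s) ∙ cong (_+ + a * (+ s * (+ 2 * x + t) + + a * (+ s * + s))) Px≡ ∙ lem c (+ a) (+ s) (+ 2 * x + t)
          where lem : ∀ c a s d → c * a + a * (s * d + a * (s * s)) ≡ a * (c + d * s + a * (s * s))
                lem = ring
        to : ∀ s → + (p · a) ∣ P (x + + a * + s) → + p ∣ c + (+ 2 * x + t) * + s
        to s d = subst (+ p ∣_) (+-minus (c + (+ 2 * x + t) * + s) (+ a * (+ s * + s))) (∣m∣n⇒∣m-n (∣-*-cancelˡ (+ a) a≢0 (subst₂ _∣_ (pos-* p a ∙ *-comm (+ p) (+ a)) (value s) d)) (∣m⇒∣m*n (+ s * + s) p∣a))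
        from : ∀ s → + p ∣ c + (+ 2 * x + t) * + s → + (p · a) ∣ P (x + + a * + s)
        from s d = combine (∣m∣n⇒∣m+n d (∣m⇒∣m*n (+ s * + s) p∣a))
          where
          combine : + p ∣ c + (+ 2 * x + t) * + s + + a * (+ s * + s) → + (p · a) ∣ P (x + + a * + s)
          combine (divides b e) = divides b (value s ∙ cong (+ a *_) e ∙ *-rotate (+ a) b (+ p) ∙ cong (b *_) (sym (pos-* p a)))


    ρ-ramified : + p ∣ + a → + p ∣ + N → ρ (p · a) ≡ 0ℤ
    ρ-ramified p∣a@(divides b a≡) p∣N = ∑<-zero (p · a) (λ {x} _ → ⟦⟧-no (root? (p · a) (+ x)) (λ d → no-square p pr p∣N (+ x) (∣-trans (divides b (pos-* p a ∙ cong (+ p *_) a≡ ∙ lem (+ p) b)) d)))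
      where lem : ∀ p b → p * (b * p) ≡ b * (p * p)
            lem = ring

prime-divisor : ∀ n → 1 ℕ.< n → ∃[ p ] Prime p × p ∣ₙ n
prime-divisor n@(suc _) n>1 = go (PrimeFactorisation.factors F) (PrimeFactorisation.isFactorisation F) (PrimeFactorisation.factorsPrime F)
  where
  F : PrimeFactorisation n
  F = factorise n
  go : ∀ ps → n ≡ product ps → All Prime ps → ∃[ p ] Prime p × p ∣ₙ n
  go [] e _ = contradiction (sym e) (ℕ.<⇒≢ n>1)
  go (p ∷ ps) e (pr ∷ _) = p , pr , dividesₙ (product ps) (e ∙ ℕ.*-comm p (product ps))

∣ₙ-cancelʳ : ∀ {a b} p .{{_ : NonZero p}} → a · p ∣ₙ b · p → a ∣ₙ b
∣ₙ-cancelʳ {a} {b} p d = ℕ∣.*-cancelʳ-∣ p d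

module _ (p : ℕ) where
  prime-to : (ℕ → ℤ) → ℕ → ℤ
  prime-to f e = ⟦ ¬? (p ℕ∣.∣? e) ⟧ * f e

  prime-to-yes : ∀ f e → ¬ (p ∣ₙ e) → prime-to f e ≡ f e
  prime-to-yes f e p∤e = cong (_* f e) (⟦⟧-yes (¬? (p ℕ∣.∣? e)) p∤e) ∙ *-identityˡ (f e)

  prime-to-no : ∀ f e → p ∣ₙ e → prime-to f e ≡ 0ℤ
  prime-to-no f e p∣e = cong (_* f e) (⟦⟧-no (¬? (p ℕ∣.∣? e)) (λ n → n p∣e)) ∙ *-zeroˡ (f e)

  prime-to-cong : ∀ f g e → (¬ (p ∣ₙ e) → f e ≡ g e) → prime-to f e ≡ prime-to g e
  prime-to-cong f g e h = by-dec (p ℕ∣.∣? e)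
    where
    by-dec : Dec (p ∣ₙ e) → prime-to f e ≡ prime-to g e
    by-dec (yes d) = prime-to-no f e d ∙ sym (prime-to-no g e d)
    by-dec (no ∤) = prime-to-yes f e ∤ ∙ h ∤ ∙ sym (prime-to-yes g e ∤)

  prime-to-zero : ∀ f e → f e ≡ 0ℤ → prime-to f e ≡ 0ℤ
  prime-to-zero f e z = cong (⟦ ¬? (p ℕ∣.∣? e) ⟧ *_) z ∙ *-zeroʳ ⟦ ¬? (p ℕ∣.∣? e) ⟧

  ∑₊-split : .{{_ : NonZero p}} → ∀ M f → ∑₊ (M · p) f ≡ ∑₊ (M · p) (prime-to f) + ∑₊ M (λ a → f (a · p))
  ∑₊-split M f = ∑₊-cong (M · p) {f} {λ e → prime-to f e + multiple e} (λ e _ _ → separate e) ∙ ∑₊-+ (M · p) (prime-to f) multiple ∙ cong (λ z → ∑₊ (M · p) (prime-to f) + z)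
    (∑₊-multiples p M multiple (λ e ∤ → cong (_* f e) (⟦⟧-no (p ℕ∣.∣? e) ∤) ∙ *-zeroˡ (f e)) ∙
      ∑₊-cong M {λ a → multiple (a · p)} {λ a → f (a · p)} (λ a _ _ → cong (_* f (a · p)) (⟦⟧-yes (p ℕ∣.∣? (a · p)) (dividesₙ a refl)) ∙ *-identityˡ (f (a · p))))
    where
    multiple : ℕ → ℤ
    multiple e = ⟦ p ℕ∣.∣? e ⟧ * f e
    separate : ∀ e → f e ≡ prime-to f e + multiple e
    separate e = by-dec (p ℕ∣.∣? e)
      where
      by-dec : Dec (p ∣ₙ e) → f e ≡ prime-to f e + multiple e
      by-dec (yes d) = sym (cong₂ _+_ (prime-to-no f e d) (cong (_* f e) (⟦⟧-yes (p ℕ∣.∣? e) d) ∙ *-identityˡ (f e)) ∙ +-identityˡ (f e))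
      by-dec (no ∤) = sym (cong₂ _+_ (prime-to-yes f e ∤) (cong (_* f e) (⟦⟧-no (p ℕ∣.∣? e) ∤) ∙ *-zeroˡ (f e)) ∙ ℤ.+-identityʳ (f e))

∣ₙ⇒∣ : ∀ {m n} → m ∣ₙ n → + m ∣ + n
∣ₙ⇒∣ = ∣ᵤ⇒∣

∣⇒∣ₙ : ∀ {m n} → + m ∣ + n → m ∣ₙ n
∣⇒∣ₙ = ∣⇒∣ᵤ

coprime-∣ : ∀ {p e} → Prime p → ¬ (p ∣ₙ e) → ∀ n → e ∣ₙ n · p → e ∣ₙ n
coprime-∣ {p} {e} pr p∤e n d = ∣⇒∣ₙ (cop-∣ (cop-sym (prime-cop pr (+ e) (p∤e ∘ ∣⇒∣ₙ))) (subst (+ e ∣_) (cong +_ (ℕ.*-comm n p) ∙ pos-* p n) (∣ₙ⇒∣ d)))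

∤-* : ∀ {p} → Prime p → ∀ a b → ¬ (p ∣ₙ a) → ¬ (p ∣ₙ b) → ¬ (p ∣ₙ a · b)
∤-* pr a b p∤a p∤b d = [ p∤a , p∤b ]′ (euclidsLemma a b pr d)

module Convolution (t n₀ : ℤ) (N : ℕ) (disc-N : + 4 * n₀ - t * t ≡ + N)
  (no-square : ∀ p → Prime p → + p ∣ + N → ∀ x → ¬ (+ p * + p ∣ x * x + t * x + n₀))
  (ch : ℕ → ℤ) (character : Character N ch) (roots : ∀ q → Prime q → rootCount t n₀ q ≡ 1ℤ + ch q) where
  open RootCount t n₀ N disc-N no-square
  open Character character

  ch-1 : ch 1 ≡ 1ℤ
  ch-1 = [ id , (λ e → contradiction (sym e ∙ mult 1 1 ∙ cong₂ _*_ e e) (λ ())) ]′ (units 1 (0ℤ , 1ℤ , cong (_+ 1ℤ) (*-zeroˡ (+ N)) ∙ refl))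

  ρ-1 : ρ 1 ≡ 1ℤ
  ρ-1 = ∑<-suc 0 _ ∙ cong (_+ ⟦ root? 1 (+ 0) ⟧) (∑<-0 _) ∙ +-identityˡ ⟦ root? 1 (+ 0) ⟧ ∙ ⟦⟧-yes (root? 1 (+ 0)) (divides (P (+ 0)) (sym (*-identityʳ (P (+ 0)))))

  δ : ℕ → ℕ → ℤ
  δ n e = ⟦ e ℕ∣.∣? n ⟧ * ch e

  D : ℕ → ℤ
  D n = ∑₊ n (δ n)

  δ-no : ∀ n e → ¬ (e ∣ₙ n) → δ n e ≡ 0ℤ
  δ-no n e ∤ = cong (_* ch e) (⟦⟧-no (e ℕ∣.∣? n) ∤) ∙ *-zeroˡ (ch e)

  δ-cong : ∀ n n' e → (e ∣ₙ n → e ∣ₙ n') → (e ∣ₙ n' → e ∣ₙ n) → δ n e ≡ δ n' e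
  δ-cong n n' e f g = cong (_* ch e) (⟦⟧-cong (e ℕ∣.∣? n) (e ℕ∣.∣? n') f g)

  δ-large : ∀ n .{{_ : NonZero n}} e → n ℕ.< e → δ n e ≡ 0ℤ
  δ-large n e n<e = δ-no n e (λ d → ℕ.<⇒≱ n<e (ℕ∣.∣⇒≤ d))

  quotient-ρ : ∀ {m n} → Dec (m ∣ₙ n) → ℤ
  quotient-ρ (yes (dividesₙ b _)) = ρ b
  quotient-ρ (no _) = 0ℤ

  τ : ℕ → ℕ → ℤ
  τ n g = quotient-ρ (g · g ℕ∣.∣? n)

  F : ℕ → ℤ
  F n = ∑₊ n (τ n)

  quotient-ρ-yes : ∀ {m n} .{{_ : NonZero m}} b → n ≡ b · m → (d : Dec (m ∣ₙ n)) → quotient-ρ d ≡ ρ b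
  quotient-ρ-yes {m} b e (yes (dividesₙ c e')) = cong ρ (ℕ.*-cancelʳ-≡ c b m (sym e' ∙ e))
  quotient-ρ-yes {m} b e (no ∤) = contradiction (dividesₙ b e) ∤

  quotient-ρ-no : ∀ {m n} → ¬ (m ∣ₙ n) → (d : Dec (m ∣ₙ n)) → quotient-ρ d ≡ 0ℤ
  quotient-ρ-no ∤ (yes d) = contradiction d ∤
  quotient-ρ-no ∤ (no _) = refl

  τ-yes : ∀ n g b → 0 ℕ.< g → n ≡ b · (g · g) → τ n g ≡ ρ b
  τ-yes n (suc g) b _ e = quotient-ρ-yes b e (suc g · suc g ℕ∣.∣? n)

  τ-no : ∀ n g → ¬ (g · g ∣ₙ n) → τ n g ≡ 0ℤ
  τ-no n g ∤ = quotient-ρ-no ∤ (g · g ℕ∣.∣? n)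

  τ-large : ∀ n .{{_ : NonZero n}} g → n ℕ.< g → τ n g ≡ 0ℤ
  τ-large n (suc g) n<g = τ-no n (suc g) (λ d → ℕ.<⇒≱ n<g (≤-trans (m≤m*n (suc g) (suc g)) (ℕ∣.∣⇒≤ d)))

  data Square∣ (g n : ℕ) : Set where
    square∣ : ∀ b → n ≡ b · (g · g) → Square∣ g n
    square∤ : ¬ (g · g ∣ₙ n) → Square∣ g n

  square-view : ∀ g n → Square∣ g n
  square-view g n = go (g · g ℕ∣.∣? n)
    where
    go : Dec (g · g ∣ₙ n) → Square∣ g n
    go (yes (dividesₙ b e)) = square∣ b e
    go (no ∤) = square∤ ∤

  module AtPrime (p : ℕ) (pr : Prime p) where
    instance
      p≢0 : NonZero p
      p≢0 = prime⇒nonZero pr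

    D° F° : ℕ → ℤ
    D° n = ∑₊ n (prime-to p (δ n))
    F° n = ∑₊ n (prime-to p (τ n))

    prime-to-δ : ∀ n e → prime-to p (δ (n · p)) e ≡ prime-to p (δ n) e
    prime-to-δ n e = prime-to-cong p (δ (n · p)) (δ n) e (λ p∤e → δ-cong (n · p) n e (coprime-∣ pr p∤e n) (ℕ∣.∣m⇒∣m*n p))

    D°-step : ∀ n .{{_ : NonZero n}} → D° (n · p) ≡ D° n
    D°-step n = ∑₊-cong (n · p) {prime-to p (δ (n · p))} {prime-to p (δ n)} (λ e _ _ → prime-to-δ n e) ∙
      ∑₊-extend (prime-to p (δ n)) (m≤m*n n p) (λ e n<e → prime-to-zero p (δ n) e (δ-large n e n<e))

    D-step : ∀ n .{{_ : NonZero n}} → D (n · p) ≡ D° n + ch p * D n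
    D-step n = ∑₊-split p n (δ (n · p)) ∙ cong₂ _+_ (D°-step n) (∑₊-cong n {λ a → δ (n · p) (a · p)} {λ a → ch p * δ n a} (λ a _ _ → multiple a) ∙ ∑<-*ˡ n (ch p) (δ n ∘ suc))
      where
      lem : ∀ i a c → i * (a * c) ≡ c * (i * a)
      lem = ring
      multiple : ∀ a → δ (n · p) (a · p) ≡ ch p * δ n a
      multiple a = cong₂ _*_ (⟦⟧-cong (a · p ℕ∣.∣? n · p) (a ℕ∣.∣? n) (∣ₙ-cancelʳ p) (ℕ∣.*-monoˡ-∣ p)) (mult a p) ∙ lem ⟦ a ℕ∣.∣? n ⟧ (ch a) (ch p)

    D-coprime : ∀ n → ¬ (p ∣ₙ n) → D n ≡ D° n
    D-coprime n p∤n = ∑₊-cong n {δ n} {prime-to p (δ n)} (λ e _ _ → by-divisor e (p ℕ∣.∣? e))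
      where
      by-divisor : ∀ e → Dec (p ∣ₙ e) → δ n e ≡ prime-to p (δ n) e
      by-divisor e (yes p∣e) = δ-no n e (λ d → p∤n (ℕ∣.∣-trans p∣e d)) ∙ sym (prime-to-no p (δ n) e p∣e)
      by-divisor e (no ∤) = sym (prime-to-yes p (δ n) e ∤)

    F-step : ∀ n → F (n · p) ≡ F° (n · p) + ∑₊ n (λ g → τ (n · p) (g · p))
    F-step n = ∑₊-split p n (τ (n · p))

    square-* : ∀ g q → g · q · (g · q) ≡ g · g · q · q
    square-* = lem
      where lem : ∀ g q → g · q · (g · q) ≡ g · g · q · q
            lem = ringₙ

    multiples-coprime : ∀ n → ¬ (p ∣ₙ n) → ∑₊ n (λ g → τ (n · p) (g · p)) ≡ 0ℤ
    multiples-coprime n p∤n = ∑<-zero n (λ {g} _ → τ-no (n · p) (suc g · p) (λ d → p∤n (ℕ∣.∣-trans (dividesₙ (suc g · suc g) refl) (∣ₙ-cancelʳ p (subst (_∣ₙ n · p) (square-* (suc g) p) d)))))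

    multiples-divisible : ∀ n .{{_ : NonZero n}} → ∑₊ (n · p) (λ g → τ (n · p · p) (g · p)) ≡ F n
    multiples-divisible n = ∑₊-cong (n · p) {λ g → τ (n · p · p) (g · p)} {τ n} (λ g g>0 _ → same-quotient g g>0 (square-view g n)) ∙
      ∑₊-extend (τ n) (m≤m*n n p) (τ-large n)
      where
      lem : ∀ b g q → b · (g · g) · q · q ≡ b · (g · q · (g · q))
      lem = ringₙ
      same-quotient : ∀ g → 0 ℕ.< g → Square∣ g n → τ (n · p · p) (g · p) ≡ τ n g
      same-quotient g g>0 (square∣ b e) = τ-yes (n · p · p) (g · p) b (*-mono-≤ g>0 (ℕ.>-nonZero⁻¹ p)) (cong (λ z → z · p · p) e ∙ lem b g p) ∙ sym (τ-yes n g b g>0 e)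
      same-quotient g g>0 (square∤ ∤) = τ-no (n · p · p) (g · p) (λ d → ∤ (∣ₙ-cancelʳ p (∣ₙ-cancelʳ p (subst (_∣ₙ n · p · p) (square-* g p) d)))) ∙ sym (τ-no n g ∤)

    F°-weighted : ∀ n .{{_ : NonZero n}} c (f : ℕ → ℤ) → (∀ g → n ℕ.< g → f g ≡ 0ℤ) →
      (∀ g b → ¬ (p ∣ₙ g) → 0 ℕ.< g → n ≡ b · (g · g) → ρ (p · b) ≡ c * ρ b) →
      (∀ g → ¬ (p ∣ₙ g) → f g ≡ τ n g) → (∀ g → p ∣ₙ g → f g ≡ 0ℤ) → F° (n · p) ≡ c * ∑₊ n f
    F°-weighted n c f large step on off = ∑₊-cong (n · p) {prime-to p (τ (n · p))} {λ g → c * f g} (λ g g>0 _ → by-divisor g g>0 (p ℕ∣.∣? g)) ∙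
      trans (∑<-*ˡ (n · p) c (f ∘ suc)) (cong (c *_) (∑₊-extend f (m≤m*n n p) large))
      where
      lem : ∀ b g q → b · (g · g) · q ≡ q · b · (g · g)
      lem = ringₙ
      by-divisor : ∀ g → 0 ℕ.< g → Dec (p ∣ₙ g) → prime-to p (τ (n · p)) g ≡ c * f g
      by-divisor g g>0 (yes d) = prime-to-no p (τ (n · p)) g d ∙ sym (cong (c *_) (off g d) ∙ *-zeroʳ c)
      by-divisor g g>0 (no ∤) = prime-to-yes p (τ (n · p)) g ∤ ∙ by-square (square-view g n) ∙ cong (c *_) (sym (on g ∤))
        where
        by-square : Square∣ g n → τ (n · p) g ≡ c * τ n g
        by-square (square∣ b e) = τ-yes (n · p) g (p · b) g>0 (cong (_· p) e ∙ lem b g p) ∙ step g b ∤ g>0 e ∙ cong (c *_) (sym (τ-yes n g b g>0 e))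
        by-square (square∤ ∤²) = τ-no (n · p) g (λ d → ∤² (coprime-∣ {e = g · g} pr (∤-* pr g g ∤ ∤) n d)) ∙ sym (cong (c *_) (τ-no n g ∤²) ∙ *-zeroʳ c)

    F°-coprime : ∀ n .{{_ : NonZero n}} → ¬ (p ∣ₙ n) → F° (n · p) ≡ (1ℤ + ch p) * F n
    F°-coprime n p∤n = F°-weighted n (ρ p) (τ n) (τ-large n)
      (λ g b _ _ e → Lift.ρ-coprime p pr b (λ d → p∤n (subst (p ∣ₙ_) (sym e) (ℕ∣.∣m⇒∣m*n (g · g) (∣⇒∣ₙ d))))) (λ _ _ → refl)
      (λ g p∣g → τ-no n g (λ d → p∤n (ℕ∣.∣-trans (ℕ∣.∣-trans p∣g (dividesₙ g refl)) d))) ∙ cong (_* F n) (roots p pr)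

    F°-divisible : ∀ n .{{_ : NonZero n}} ε → (∀ b .{{_ : NonZero b}} → + p ∣ + b → ρ (p · b) ≡ ε * ρ b) → F° (n · p · p) ≡ ε * F° (n · p)
    F°-divisible n ε step = F°-weighted (n · p) {{np≢0}} ε (prime-to p (τ (n · p))) (λ g lt → prime-to-zero p (τ (n · p)) g (τ-large (n · p) {{np≢0}} g lt))
      (λ g b p∤g _ e → step b {{ℕ.≢-nonZero (λ b≡0 → ℕ.≢-nonZero⁻¹ (n · p) {{np≢0}} (e ∙ cong (_· (g · g)) b≡0))}}
        (∣ₙ⇒∣ ([ id , (λ d → contradiction d (∤-* pr g g p∤g p∤g)) ]′ (euclidsLemma b (g · g) pr (subst (p ∣ₙ_) e (dividesₙ n refl))))))
      (λ g ∤ → prime-to-yes p (τ (n · p)) g ∤) (λ g d → prime-to-no p (τ (n · p)) g d)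
      where
      np≢0 : NonZero (n · p)
      np≢0 = m*n≢0 n p

    convolution-coprime : ∀ n .{{_ : NonZero n}} → ¬ (p ∣ₙ n) → F n ≡ D n → F (n · p) ≡ D (n · p)
    convolution-coprime n p∤n ih = begin
      F (n · p) ≡⟨ F-step n ⟩
      F° (n · p) + ∑₊ n (λ g → τ (n · p) (g · p)) ≡⟨ cong₂ _+_ (F°-coprime n p∤n) (multiples-coprime n p∤n) ⟩
      (1ℤ + ch p) * F n + 0ℤ ≡⟨ cong (λ z → (1ℤ + ch p) * z + 0ℤ) ih ⟩
      (1ℤ + ch p) * D n + 0ℤ ≡⟨ lem (ch p) (D n) ⟩
      D n + ch p * D n ≡⟨ cong (_+ ch p * D n) (D-coprime n p∤n) ⟩
      D° n + ch p * D n ≡⟨ D-step n ⟨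
      D (n · p) ∎
      where lem : ∀ c d → (1ℤ + c) * d + 0ℤ ≡ d + c * d
            lem = ring

    module Divisible (n : ℕ) {{n≢0 : NonZero n}} (ih : F n ≡ D n) (ih' : F (n · p) ≡ D (n · p)) (e : ℤ)
      (F-split : F (n · p) ≡ F° (n · p) + e) (D-split : D n ≡ D° n + ch p * e) where

      np≢0 : NonZero (n · p)
      np≢0 = m*n≢0 n p

      D-twice : D (n · p · p) ≡ D° n + ch p * (D° n + ch p * D n)
      D-twice = D-step (n · p) {{np≢0}} ∙ cong₂ (λ x y → x + ch p * y) (D°-step n) (D-step n)

      F°≡ : F° (n · p) ≡ D° n + ch p * (D° n + ch p * e) - e
      F°≡ = lem (F° (n · p)) e ∙ cong (_- e) (sym F-split ∙ ih' ∙ D-step n ∙ cong (λ z → D° n + ch p * z) D-split)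
        where lem : ∀ x e → x ≡ x + e - e
              lem = ring

      F-twice : ∀ ε → (∀ b .{{_ : NonZero b}} → + p ∣ + b → ρ (p · b) ≡ ε * ρ b) →
        F (n · p · p) ≡ ε * (D° n + ch p * (D° n + ch p * e) - e) + (D° n + ch p * e)
      F-twice ε step = F-step (n · p) ∙ cong₂ _+_ (F°-divisible n ε step ∙ cong (ε *_) F°≡) (multiples-divisible n ∙ ih ∙ D-split)

      compare : ∀ ε c → ch p ≡ c → (∀ b .{{_ : NonZero b}} → + p ∣ + b → ρ (p · b) ≡ ε * ρ b) →
        (∀ d e → ε * (d + c * (d + c * e) - e) + (d + c * e) ≡ d + c * (d + c * (d + c * e))) → F (n · p · p) ≡ D (n · p · p)
      compare ε c c≡ step identity = F-twice ε step ∙ cong (λ z → ε * (D° n + z * (D° n + z * e) - e) + (D° n + z * e)) c≡ ∙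
        trans (identity (D° n) e) (sym (D-twice ∙ cong (λ z → D° n + ch p * (D° n + ch p * z)) D-split ∙ cong (λ z → D° n + z * (D° n + z * (D° n + z * e))) c≡))

      convolution-divisible : F (n · p · p) ≡ D (n · p · p)
      convolution-divisible = by-ramification (+ p ∣? + N)
        where
        by-ramification : Dec (+ p ∣ + N) → F (n · p · p) ≡ D (n · p · p)
        by-ramification (yes p∣N) = compare 0ℤ 0ℤ (zeros p (λ c → cop⇒∤ pr (cop-sym c) p∣N)) (λ b p∣b → Lift.ρ-ramified p pr b p∣b p∣N ∙ sym (*-zeroˡ (ρ b))) lem
          where lem : ∀ d e → 0ℤ * (d + 0ℤ * (d + 0ℤ * e) - e) + (d + 0ℤ * e) ≡ d + 0ℤ * (d + 0ℤ * (d + 0ℤ * e))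
                lem = ring
        by-ramification (no p∤N) = [ (λ c → compare 1ℤ 1ℤ c step lem₁) , (λ c → compare 1ℤ -1ℤ c step lem₂) ]′ (units p (cop-sym (prime-cop pr (+ N) p∤N)))
          where
          step : ∀ b .{{_ : NonZero b}} → + p ∣ + b → ρ (p · b) ≡ 1ℤ * ρ b
          step b p∣b = Lift.ρ-unramified p pr b p∣b p∤N ∙ sym (*-identityˡ (ρ b))
          lem₁ : ∀ d e → 1ℤ * (d + 1ℤ * (d + 1ℤ * e) - e) + (d + 1ℤ * e) ≡ d + 1ℤ * (d + 1ℤ * (d + 1ℤ * e))
          lem₁ = ring
          lem₂ : ∀ d e → 1ℤ * (d + -1ℤ * (d + -1ℤ * e) - e) + (d + -1ℤ * e) ≡ d + -1ℤ * (d + -1ℤ * (d + -1ℤ * e))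
          lem₂ = ring

    convolution-step : ∀ n .{{_ : NonZero n}} → (∀ k .{{_ : NonZero k}} → k ℕ.< n · p → F k ≡ D k) → F (n · p) ≡ D (n · p)
    convolution-step n rec = by-divisor (p ℕ∣.∣? n)
      where
      p>1 : 1 ℕ.< p
      p>1 = ℕ.nonTrivial⇒n>1 p {{ℕ.prime⇒nonTrivial pr}}
      n<np : ∀ n .{{_ : NonZero n}} → n ℕ.< n · p
      n<np n = ℕ.m<m*n n p p>1
      by-divisor : Dec (p ∣ₙ n) → F (n · p) ≡ D (n · p)
      by-divisor (no p∤n) = convolution-coprime n p∤n (rec n (n<np n))
      by-divisor (yes (dividesₙ n₁ n≡)) = subst (λ z → F (z · p) ≡ D (z · p)) (sym n≡) (by-divisor₁ (p ℕ∣.∣? n₁))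
        where
        instance
          n₁≢0 : NonZero n₁
          n₁≢0 = ℕ.≢-nonZero (λ z → ℕ.≢-nonZero⁻¹ n (n≡ ∙ cong (_· p) z))
          n₁p≢0 : NonZero (n₁ · p)
          n₁p≢0 = m*n≢0 n₁ p
        n₁p<np : n₁ · p ℕ.< n · p
        n₁p<np = subst (ℕ._< n · p) n≡ (n<np n)
        ih : F n₁ ≡ D n₁
        ih = rec n₁ (<-trans (n<np n₁) n₁p<np)
        ih' : F (n₁ · p) ≡ D (n₁ · p)
        ih' = rec (n₁ · p) n₁p<np
        by-divisor₁ : Dec (p ∣ₙ n₁) → F (n₁ · p · p) ≡ D (n₁ · p · p)
        by-divisor₁ (no p∤n₁) = Divisible.convolution-divisible n₁ ih ih' 0ℤ (F-step n₁ ∙ cong (λ z → F° (n₁ · p) + z) (multiples-coprime n₁ p∤n₁))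
          (D-coprime n₁ p∤n₁ ∙ lem (D° n₁) (ch p))
          where lem : ∀ d c → d ≡ d + c * 0ℤ
                lem = ring
        by-divisor₁ (yes (dividesₙ n₂ n₁≡)) = Divisible.convolution-divisible n₁ ih ih' (D n₂)
          (subst (λ z → F (z · p) ≡ F° (z · p) + D n₂) (sym n₁≡) (F-step (n₂ · p) ∙ cong (λ z → F° (n₂ · p · p) + z) (multiples-divisible n₂ ∙ ih₂)))
          (subst (λ z → D z ≡ D° z + ch p * D n₂) (sym n₁≡) (D-step n₂ ∙ cong (_+ ch p * D n₂) (sym (D°-step n₂))))
          where
          instance
            n₂≢0 : NonZero n₂
            n₂≢0 = ℕ.≢-nonZero (λ z → ℕ.≢-nonZero⁻¹ n₁ (n₁≡ ∙ cong (_· p) z))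
          ih₂ : F n₂ ≡ D n₂
          ih₂ = rec n₂ (<-trans (<-trans (subst (n₂ ℕ.<_) (sym n₁≡) (n<np n₂)) (n<np n₁)) n₁p<np)

  convolution : ∀ n .{{_ : NonZero n}} → F n ≡ D n
  convolution n = <-rec (λ n → NonZero n → F n ≡ D n) step n (ℕ.≢-nonZero (ℕ.≢-nonZero⁻¹ n))
    where
    step : ∀ n → (∀ {k} → k ℕ.< n → NonZero k → F k ≡ D k) → NonZero n → F n ≡ D n
    step 1 rec _ = begin
      F 1 ≡⟨ ∑<-suc 0 _ ∙ cong (_+ τ 1 1) (∑<-0 _) ∙ +-identityˡ (τ 1 1) ⟩
      τ 1 1 ≡⟨ τ-yes 1 1 1 (s≤s z≤n) refl ∙ ρ-1 ⟩
      1ℤ ≡⟨ cong (_* ch 1) (⟦⟧-yes (1 ℕ∣.∣? 1) ℕ∣.∣-refl) ∙ *-identityˡ (ch 1) ∙ ch-1 ⟨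
      δ 1 1 ≡⟨ ∑<-suc 0 _ ∙ cong (_+ δ 1 1) (∑<-0 _) ∙ +-identityˡ (δ 1 1) ⟨
      D 1 ∎
    step n@(suc (suc _)) rec _ = go (prime-divisor n (s≤s (s≤s z≤n)))
      where
      go : (∃[ p ] Prime p × p ∣ₙ n) → F n ≡ D n
      go (p , pr , dividesₙ n' n≡) = subst (λ z → F z ≡ D z) (sym n≡) (AtPrime.convolution-step p pr n' {{n'≢0}} (λ k {{k≢0}} k< → rec (subst (k ℕ.<_) (sym n≡) k<) (ℕ.≢-nonZero (ℕ.≢-nonZero⁻¹ k))))
        where n'≢0 : NonZero n'
              n'≢0 = ℕ.≢-nonZero (λ z → contradiction (n≡ ∙ cong (_· p) z) (λ ()))

-- Abel summation against periodic functions of mean zero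

Δ : (ℕ → ℤ) → ℕ → ℤ
Δ F i = F (suc i) - F i

record Periodic (q : ℕ) (u : ℕ → ℤ) : Set where
  field
    period : ∀ i → u (i ℕ.+ q) ≡ u i
    mean : ∑< q u ≡ 0ℤ

-- A discrete primitive of q u, normalised to have mean zero.
integral : ℕ → (ℕ → ℤ) → ℕ → ℤ
integral q u i = + q * ∑< i u - ∑< q (λ j → ∑< j u)

integral-suc : ∀ q u i → integral q u (suc i) ≡ integral q u i + + q * u i
integral-suc q u i = cong (λ s → + q * s - c) (∑<-suc i u) ∙ lem (+ q) (∑< i u) (u i) c
  where
  c = ∑< q (λ j → ∑< j u)
  lem : ∀ q s u c → q * (s + u) - c ≡ q * s - c + q * u
  lem = ring

period-* : ∀ q {v : ℕ → ℤ} → (∀ i → v (i ℕ.+ q) ≡ v i) → ∀ k i → v (i ℕ.+ k · q) ≡ v i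
period-* q {v} per zero i = cong v (+-identityʳ i)
period-* q {v} per (suc k) i = cong v (cong (i ℕ.+_) (+-comm q (k · q)) ∙ sym (+-assoc i (k · q) q)) ∙ per _ ∙ period-* q per k i

period-% : ∀ q .{{_ : NonZero q}} {v : ℕ → ℤ} → (∀ i → v (i ℕ.+ q) ≡ v i) → ∀ i → v i ≡ v (i ℕ.% q)
period-% q {v} per i = cong v (m≡m%n+[m/n]*n i q) ∙ period-* q per (i ℕ./ q) (i ℕ.% q)

double-sum : ∀ n u → ∑< n (λ i → ∑< i u) ≡ + n * ∑< n u - ∑< n u - ∑< n (λ i → + i * u i)
double-sum zero u = ∑<-0 _ ∙ sym (cong₂ _-_ (cong₂ _-_ (*-zeroˡ (∑< 0 u)) (∑<-0 u) ∙ refl) (∑<-0 (λ i → + i * u i)))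
double-sum (suc n) u = begin
  ∑< (suc n) (λ i → ∑< i u) ≡⟨ ∑<-suc n _ ⟩
  ∑< n (λ i → ∑< i u) + s ≡⟨ cong (_+ s) (double-sum n u) ⟩
  + n * s - s - m + s ≡⟨ lem (+ n) s m (u n) ⟩
  (1ℤ + + n) * (s + u n) - (s + u n) - (m + + n * u n)
    ≡⟨ cong₂ (λ x y → + suc n * x - x - y) (∑<-suc n u) (∑<-suc n (λ i → + i * u i)) ⟨
  + suc n * ∑< (suc n) u - ∑< (suc n) u - ∑< (suc n) (λ i → + i * u i) ∎
  where
  s = ∑< n u
  m = ∑< n (λ i → + i * u i)
  lem : ∀ n s m u → n * s - s - m + s ≡ (1ℤ + n) * (s + u) - (s + u) - (m + n * u)
  lem = ring

-- The boundary constant of the summation formula, - L(0) up to the factor q.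
moment : ℕ → (ℕ → ℤ) → ℤ
moment q u = ∑< q (λ i → + i * u i)

module _ {q : ℕ} {u : ℕ → ℤ} (per : Periodic q u) where
  open Periodic per

  integral-0 : integral q u 0 ≡ moment q u
  integral-0 = cong₂ (λ x y → + q * x - y) (∑<-0 u) (double-sum q u) ∙ cong (λ s → + q * 0ℤ - (+ q * s - s - moment q u)) mean ∙ lem (+ q) (moment q u)
    where lem : ∀ q m → q * 0ℤ - (q * 0ℤ - 0ℤ - m) ≡ m
          lem = ring

  integral-periodic : Periodic q (integral q u ∘ suc)
  integral-periodic = record { period = λ i → cong (λ s → + q * s - ∑< q (λ j → ∑< j u)) (window (suc i)) ; mean = mean' }
    where
    window : ∀ i → ∑< (i ℕ.+ q) u ≡ ∑< i u
    window zero = mean ∙ sym (∑<-0 u)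
    window (suc i) = ∑<-suc (i ℕ.+ q) u ∙ cong₂ _+_ (window i) (period i) ∙ sym (∑<-suc i u)
    v = integral q u
    c = ∑< q (λ j → ∑< j u)
    mean' : ∑< q (v ∘ suc) ≡ 0ℤ
    mean' = begin
      ∑< q (v ∘ suc) ≡⟨ ∑<-cong q (λ {i} _ → integral-suc q u i) ⟩
      ∑< q (λ i → v i + + q * u i) ≡⟨ ∑<-+' q v (λ i → + q * u i) ⟩
      ∑< q v + ∑< q (λ i → + q * u i) ≡⟨ cong₂ _+_ (∑<-+' q (λ i → + q * ∑< i u) (λ _ → - c)) (∑<-*ˡ q (+ q) u ∙ cong (+ q *_) mean) ⟩
      ∑< q (λ i → + q * ∑< i u) + ∑< q (λ _ → - c) + + q * 0ℤ
        ≡⟨ cong (_+ + q * 0ℤ) (cong₂ _+_ (∑<-*ˡ q (+ q) (λ i → ∑< i u)) (∑<-const q (- c))) ⟩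
      + q * c + + q * - c + + q * 0ℤ ≡⟨ lem (+ q) c ⟩
      0ℤ ∎
      where
      lem : ∀ q c → q * c + q * - c + q * 0ℤ ≡ 0ℤ
      lem = ring

  integral-bound : .{{_ : NonZero q}} → ∀ {b} → (∀ i → ∣ u i ∣ ℕ.≤ b) → ∀ i → ∣ integral q u (suc i) ∣ ℕ.≤ q · (q · b) ℕ.+ q · (q · b)
  integral-bound {b} h i = subst (λ z → ∣ z ∣ ℕ.≤ _) (sym (period-% q (λ j → cong (λ s → + q * s - ∑< q (λ j → ∑< j u)) (shifted j)) i)) (small (i ℕ.% q) (m%n<n i q))
    where
    shifted : ∀ j → ∑< (suc j ℕ.+ q) u ≡ ∑< (suc j) u
    shifted zero = ∑<-suc q u ∙ cong (_+ u q) mean ∙ +-identityˡ (u q) ∙ period 0 ∙ sym (∑<-suc 0 u ∙ cong (_+ u 0) (∑<-0 u) ∙ +-identityˡ (u 0))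
    shifted (suc j) = ∑<-suc (suc j ℕ.+ q) u ∙ cong₂ _+_ (shifted j) (period (suc j)) ∙ sym (∑<-suc (suc j) u)
    partial : ∀ j → j ℕ.≤ q → ∣ ∑< j u ∣ ℕ.≤ q · b
    partial j j≤q = ≤-trans (∣∑<∣≤ j u b (λ {k} _ → h k)) (*-monoˡ-≤ b j≤q)
    small : ∀ r → r ℕ.< q → ∣ integral q u (suc r) ∣ ℕ.≤ q · (q · b) ℕ.+ q · (q · b)
    small r r<q = ≤-trans (ℤ.∣i-j∣≤∣i∣+∣j∣ (+ q * ∑< (suc r) u) _) (+-mono-≤
      (subst (ℕ._≤ q · (q · b)) (sym (abs-* (+ q) _)) (*-monoʳ-≤ q (partial (suc r) r<q)))
      (∣∑<∣≤ q (λ j → ∑< j u) (q · b) (λ {j} j<q → partial j (ℕ.<⇒≤ j<q))))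

abel : ∀ q u F n → + q * ∑< n (λ i → u i * F i) ≡
       integral q u n * F n - integral q u 0 * F 0 - ∑< n (λ i → integral q u (suc i) * Δ F i)
abel q u F zero = cong (+ q *_) (∑<-0 _) ∙ lem (+ q) (v 0 * F 0) ∙ cong (λ s → v 0 * F 0 - v 0 * F 0 - s) (sym (∑<-0 _))
  where
  v = integral q u
  lem : ∀ q x → q * 0ℤ ≡ x - x - 0ℤ
  lem = ring
abel q u F (suc n) = begin
  + q * ∑< (suc n) (λ i → u i * F i) ≡⟨ cong (+ q *_) (∑<-suc n _) ⟩
  + q * (s + u n * F n) ≡⟨ ℤ.*-distribˡ-+ (+ q) s (u n * F n) ⟩
  + q * s + + q * (u n * F n) ≡⟨ cong (_+ + q * (u n * F n)) (abel q u F n) ⟩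
  v n * F n - v 0 * F 0 - r + + q * (u n * F n) ≡⟨ lem (+ q) (v n) (F n) (v 0 * F 0) r (u n) (F (suc n)) ⟩
  (v n + + q * u n) * F (suc n) - v 0 * F 0 - (r + (v n + + q * u n) * Δ F n)
    ≡⟨ cong₂ (λ x y → x * F (suc n) - v 0 * F 0 - y) (integral-suc q u n) (∑<-suc n _ ∙ cong (λ x → r + x * Δ F n) (integral-suc q u n)) ⟨
  v (suc n) * F (suc n) - v 0 * F 0 - ∑< (suc n) (λ i → v (suc i) * Δ F i) ∎
  where
  v = integral q u
  s = ∑< n (λ i → u i * F i)
  r = ∑< n (λ i → v (suc i) * Δ F i)
  lem : ∀ q v F c r u G → v * F - c - r + q * (u * F) ≡ (v + q * u) * G - c - (r + (v + q * u) * (G - F))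
  lem = ring

iterate : ℕ → ℕ → (ℕ → ℤ) → ℕ → ℤ
iterate q zero u = u
iterate q (suc k) u = integral q (iterate q k u) ∘ suc

iterate-periodic : ∀ {q u} → Periodic q u → ∀ k → Periodic q (iterate q k u)
iterate-periodic per zero = per
iterate-periodic per (suc k) = integral-periodic (iterate-periodic per k)

iterate-bound : ∀ q .{{_ : NonZero q}} k b → ∃[ c ] (∀ {u} → Periodic q u → (∀ i → ∣ u i ∣ ℕ.≤ b) → ∀ i → ∣ iterate q k u i ∣ ℕ.≤ c)
iterate-bound q zero b = b , λ _ h → h
iterate-bound q (suc k) b = _ , λ per h → integral-bound (iterate-periodic per k) (proj₂ (iterate-bound q k b) per h)

abel³ : ∀ {q u} → Periodic q u → ∀ F n → (∀ i → n ℕ.≤ i → F i ≡ 0ℤ) →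
  + q * (+ q * (+ q * ∑< n (λ i → u i * F i))) ≡
  - (+ q * + q * moment q u) * F 0 + + q * integral q (iterate q 1 u) 0 * Δ F 0
    - integral q (iterate q 2 u) 0 * Δ (Δ F) 0 - ∑< n (λ i → iterate q 3 u i * Δ (Δ (Δ F)) i)
abel³ {q} {u} per F n F≡0 = begin
  + q * (+ q * (+ q * S u F)) ≡⟨ cong (λ z → + q * (+ q * z)) (step u F F≡0) ⟩
  + q * (+ q * (- (v₁ * F 0) - S (it 1) (Δ F))) ≡⟨ lem₁ (+ q) (v₁ * F 0) (S (it 1) (Δ F)) ⟩
  - (+ q * + q * (v₁ * F 0)) - + q * (+ q * S (it 1) (Δ F)) ≡⟨ cong (λ z → - (+ q * + q * (v₁ * F 0)) - + q * z) (step (it 1) (Δ F) Δ≡0) ⟩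
  - (+ q * + q * (v₁ * F 0)) - + q * (- (v₂ * Δ F 0) - S (it 2) (Δ (Δ F)))
    ≡⟨ lem₂ (+ q) (+ q * + q * (v₁ * F 0)) (v₂ * Δ F 0) (S (it 2) (Δ (Δ F))) ⟩
  - (+ q * + q * (v₁ * F 0)) + + q * (v₂ * Δ F 0) + + q * S (it 2) (Δ (Δ F))
    ≡⟨ cong (λ z → - (+ q * + q * (v₁ * F 0)) + + q * (v₂ * Δ F 0) + z) (step (it 2) (Δ (Δ F)) ΔΔ≡0) ⟩
  - (+ q * + q * (v₁ * F 0)) + + q * (v₂ * Δ F 0) + (- (v₃ * Δ (Δ F) 0) - S (it 3) (Δ (Δ (Δ F))))
    ≡⟨ cong (λ v → - (+ q * + q * (v * F 0)) + + q * (v₂ * Δ F 0) + (- (v₃ * Δ (Δ F) 0) - S (it 3) (Δ (Δ (Δ F))))) (integral-0 per) ⟩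
  - (+ q * + q * (moment q u * F 0)) + + q * (v₂ * Δ F 0) + (- (v₃ * Δ (Δ F) 0) - S (it 3) (Δ (Δ (Δ F))))
    ≡⟨ lem₃ (+ q) (moment q u) (F 0) v₂ (Δ F 0) (v₃ * Δ (Δ F) 0) (S (it 3) (Δ (Δ (Δ F)))) ⟩
  - (+ q * + q * moment q u) * F 0 + + q * v₂ * Δ F 0 - v₃ * Δ (Δ F) 0 - S (it 3) (Δ (Δ (Δ F))) ∎
  where
  it : ℕ → ℕ → ℤ
  it k = iterate q k u
  S : (ℕ → ℤ) → (ℕ → ℤ) → ℤ
  S v G = ∑< n (λ i → v i * G i)
  v₁ v₂ v₃ : ℤ
  v₁ = integral q u 0
  v₂ = integral q (it 1) 0
  v₃ = integral q (it 2) 0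
  vanishing : ∀ G → (∀ i → n ℕ.≤ i → G i ≡ 0ℤ) → ∀ i → n ℕ.≤ i → Δ G i ≡ 0ℤ
  vanishing G h i n≤i = cong₂ _-_ (h (suc i) (ℕ.m≤n⇒m≤1+n n≤i)) (h i n≤i)
  Δ≡0 : ∀ i → n ℕ.≤ i → Δ F i ≡ 0ℤ
  Δ≡0 = vanishing F F≡0
  ΔΔ≡0 : ∀ i → n ℕ.≤ i → Δ (Δ F) i ≡ 0ℤ
  ΔΔ≡0 = vanishing (Δ F) Δ≡0
  step : ∀ v G → (∀ i → n ℕ.≤ i → G i ≡ 0ℤ) → + q * S v G ≡ - (integral q v 0 * G 0) - S (integral q v ∘ suc) (Δ G)
  step v G h = abel q v G n ∙ cong (_- S (integral q v ∘ suc) (Δ G)) (cong (λ z → integral q v n * z - integral q v 0 * G 0) (h n ≤-refl) ∙ lem (integral q v n) (integral q v 0 * G 0))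
    where lem : ∀ x y → x * 0ℤ - y ≡ - y
          lem = ring
  lem₁ : ∀ q x s → q * (q * (- x - s)) ≡ - (q * q * x) - q * (q * s)
  lem₁ = ring
  lem₂ : ∀ q x y s → - x - q * (- y - s) ≡ - x + q * y + q * s
  lem₂ = ring
  lem₃ : ∀ q m f v d x s → - (q * q * (m * f)) + q * (v * d) + (- x - s) ≡ - (q * q * m) * f + q * v * d - x - s
  lem₃ = ring

-- Orders of growth

infix 4 _≪_

record _≪_ {I : Set} (f : I → ℤ) (g : I → ℕ) : Set where
  constructor bounded-by
  field
    factor : ℕ
    bound : ∀ i → ∣ f i ∣ ℕ.≤ factor · g i

≪-≡ : ∀ {I : Set} {f f' : I → ℤ} {g} → (∀ i → f i ≡ f' i) → f ≪ g → f' ≪ g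
≪-≡ {g = g} eq (bounded-by c h) = bounded-by c (λ i → subst (λ z → ∣ z ∣ ℕ.≤ c · g i) (eq i) (h i))

≪-+ : ∀ {I : Set} {f f' : I → ℤ} {g} → f ≪ g → f' ≪ g → (λ i → f i + f' i) ≪ g
≪-+ {f = f} {f'} {g} (bounded-by c h) (bounded-by c' h') = bounded-by (c ℕ.+ c') (λ i →
  ≤-trans (ℤ.∣i+j∣≤∣i∣+∣j∣ (f i) (f' i)) (≤-trans (+-mono-≤ (h i) (h' i)) (≤-reflexive (sym (ℕ.*-distribʳ-+ (g i) c c')))))

≪-neg : ∀ {I : Set} {f : I → ℤ} {g} → f ≪ g → (λ i → - f i) ≪ g
≪-neg {f = f} {g} (bounded-by c h) = bounded-by c (λ i → subst (ℕ._≤ c · g i) (sym (∣-i∣≡∣i∣ (f i))) (h i))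

≪-* : ∀ {I : Set} {f f' : I → ℤ} {g g'} → f ≪ g → f' ≪ g' → (λ i → f i * f' i) ≪ (λ i → g i · g' i)
≪-* {f = f} {f'} {g} {g'} (bounded-by c h) (bounded-by c' h') = bounded-by (c · c') (λ i →
  ≤-trans (≤-reflexive (abs-* (f i) (f' i))) (≤-trans (*-mono-≤ (h i) (h' i)) (≤-reflexive (lem c c' (g i) (g' i)))))
  where lem : ∀ a b c d → a · c · (b · d) ≡ a · b · (c · d)
        lem = ringₙ

≪-trans : ∀ {I : Set} {f : I → ℤ} {g g'} → f ≪ g → (∃[ c ] (∀ i → g i ℕ.≤ c · g' i)) → f ≪ g'
≪-trans {g = g} {g'} (bounded-by c h) (d , e) = bounded-by (c · d) (λ i →
  ≤-trans (h i) (≤-trans (*-monoʳ-≤ c (e i)) (≤-reflexive (sym (ℕ.*-assoc c d (g' i))))))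

≪-∑< : ∀ {I : Set} {n : I → ℕ} {f : I → ℕ → ℤ} {g : I → ℕ} →
       _≪_ {I = Σ[ i ∈ I ] Σ[ k ∈ ℕ ] k ℕ.< n i} (λ (i , k , _) → f i k) (λ (i , _) → g i) →
       (λ i → ∑< (n i) (f i)) ≪ (λ i → n i · g i)
≪-∑< {n = n} {f} {g} (bounded-by c h) = bounded-by c (λ i →
  ≤-trans (∣∑<∣≤ (n i) (f i) (c · g i) (λ {k} k<n → h (i , k , k<n))) (≤-reflexive (lem (n i) c (g i))))
  where lem : ∀ n c g → n · (c · g) ≡ c · (n · g)
        lem = ringₙ

-- The truncated cube

opaque
  pos : ℤ → ℤ
  pos (+ n) = + n
  pos -[1+ _ ] = 0ℤ

  pos-nonneg : ∀ {z} → 0ℤ ≤ z → pos z ≡ z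
  pos-nonneg (+≤+ _) = refl

  pos-nonpos : ∀ {z} → z ≤ 0ℤ → pos z ≡ 0ℤ
  pos-nonpos (+≤+ z≤n) = refl
  pos-nonpos -≤+ = refl

  ∣pos∣≤ : ∀ {z n} → z ≤ + n → ∣ pos z ∣ ℕ.≤ n
  ∣pos∣≤ (+≤+ h) = h
  ∣pos∣≤ -≤+ = z≤n

cube : ℤ → ℤ
cube z = z * z * z

U : ℤ → ℤ
U z = cube (pos z)

U-nonpos : ∀ {z} → z ≤ 0ℤ → U z ≡ 0ℤ
U-nonpos h = cong cube (pos-nonpos h)

U-nonneg : ∀ {z} → 0ℤ ≤ z → U z ≡ cube z
U-nonneg h = cong cube (pos-nonneg h)

remainder : ℤ → ℤ → ℤ
remainder n s = U (n + s) - U n - + 3 * s * (pos n * pos n) - + 3 * (s * s) * pos n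

∣cube∣ : ∀ z → ∣ cube z ∣ ≡ ∣ z ∣ ℕ.^ 3
∣cube∣ z = abs-* (z * z) z ∙ cong (_· ∣ z ∣) (abs-* z z) ∙ lem ∣ z ∣
  where lem : ∀ a → a · a · a ≡ a · (a · (a · 1))
        lem = ringₙ

∣remainder∣≤ : ∀ n s → ∣ remainder n s ∣ ℕ.≤ 2 · ∣ s ∣ ℕ.^ 3
∣remainder∣≤ n s = go (ℤ.≤-total 0ℤ n) (ℤ.≤-total 0ℤ (n + s))
  where
  goal : ℤ → Set
  goal r = ∣ r ∣ ℕ.≤ 2 · ∣ s ∣ ℕ.^ 3
  cube-mono : ∀ {z} → ∣ z ∣ ℕ.≤ ∣ s ∣ → ∣ cube z ∣ ℕ.≤ ∣ s ∣ ℕ.^ 3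
  cube-mono {z} h = subst (ℕ._≤ ∣ s ∣ ℕ.^ 3) (sym (∣cube∣ z)) (^-monoˡ-≤ 3 h)
  one≤two : ∀ {z} → ∣ cube z ∣ ℕ.≤ ∣ s ∣ ℕ.^ 3 → goal (cube z)
  one≤two h = ≤-trans h (m≤m+n _ _)
  value : ∀ {x y} → pos (n + s) ≡ x → pos n ≡ y → remainder n s ≡ cube x - cube y - + 3 * s * (y * y) - + 3 * (s * s) * y
  value {x} {y} e f = cong₂ (λ x y → cube x - cube y - + 3 * s * (y * y) - + 3 * (s * s) * y) e f
  go : 0ℤ ≤ n ⊎ n ≤ 0ℤ → 0ℤ ≤ n + s ⊎ n + s ≤ 0ℤ → goal (remainder n s)
  go (inj₂ n≤0) (inj₂ m≤0) = subst goal (sym (value (pos-nonpos m≤0) (pos-nonpos n≤0) ∙ lem s)) z≤n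
    where lem : ∀ s → 0ℤ * 0ℤ * 0ℤ - 0ℤ * 0ℤ * 0ℤ - + 3 * s * (0ℤ * 0ℤ) - + 3 * (s * s) * 0ℤ ≡ 0ℤ
          lem = ring
  go (inj₂ n≤0) (inj₁ 0≤m) = subst goal (sym (value (pos-nonneg 0≤m) (pos-nonpos n≤0) ∙ lem s (n + s))) (one≤two {n + s} (cube-mono {n + s} (ℕ-mono 0≤m (ℤ.≤-trans (ℤ.+-monoˡ-≤ s n≤0) (ℤ.≤-reflexive (+-identityˡ s))))))
    where
    lem : ∀ s x → x * x * x - 0ℤ * 0ℤ * 0ℤ - + 3 * s * (0ℤ * 0ℤ) - + 3 * (s * s) * 0ℤ ≡ x * x * x
    lem = ring
    ℕ-mono : ∀ {x y} → 0ℤ ≤ x → x ≤ y → ∣ x ∣ ℕ.≤ ∣ y ∣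
    ℕ-mono (+≤+ _) (+≤+ h) = h
  go (inj₁ 0≤n) (inj₁ 0≤m) = subst goal (sym (value (pos-nonneg 0≤m) (pos-nonneg 0≤n) ∙ lem n s)) (one≤two {s} (cube-mono {s} ≤-refl))
    where lem : ∀ n s → (n + s) * (n + s) * (n + s) - n * n * n - + 3 * s * (n * n) - + 3 * (s * s) * n ≡ s * s * s
          lem = ring
  go (inj₁ 0≤n) (inj₂ m≤0) = subst goal (sym (value (pos-nonpos m≤0) (pos-nonneg 0≤n) ∙ lem n s))
    (≤-trans (ℤ.∣i-j∣≤∣i∣+∣j∣ (cube s) (cube (n + s))) (+-mono-≤ (cube-mono {s} ≤-refl) (≤-trans (cube-mono {n + s} (ℕ-mono m≤0 s≤m)) (≤-reflexive (sym (+-identityʳ _))))))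
    where
    lem : ∀ n s → 0ℤ * 0ℤ * 0ℤ - n * n * n - + 3 * s * (n * n) - + 3 * (s * s) * n ≡ s * s * s - (n + s) * (n + s) * (n + s)
    lem = ring
    s≤m : s ≤ n + s
    s≤m = ℤ.≤-trans (ℤ.≤-reflexive (sym (+-identityˡ s))) (ℤ.+-monoˡ-≤ s 0≤n)
    ℕ-mono : ∀ {x y} → x ≤ 0ℤ → y ≤ x → ∣ x ∣ ℕ.≤ ∣ y ∣
    ℕ-mono (+≤+ z≤n) _ = z≤n
    ℕ-mono -≤+ (-≤- h) = s≤s h

-- The scale is suc ∘ z, so that it is never zero.
record O {I : Set} (z : I → ℕ) (k : ℕ) (f : I → ℤ) : Set where
  constructor of-order
  field
    constant : ℕ
    within : ∀ i → ∣ f i ∣ ℕ.≤ constant · suc (z i) ℕ.^ k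

module _ {I : Set} {z : I → ℕ} where

  private
    direct : ∀ {k f} → f ≪ (λ i → suc (z i) ℕ.^ k) → O z k f
    direct (bounded-by c h) = of-order c h

  ≪⇒O : ∀ {k f g} → f ≪ g → (∃[ c ] (∀ i → g i ℕ.≤ c · suc (z i) ℕ.^ k)) → O z k f
  ≪⇒O f≪g g≤ = direct (≪-trans f≪g g≤)

  O⇒≪ : ∀ {k f} → O z k f → f ≪ (λ i → suc (z i) ℕ.^ k)
  O⇒≪ (of-order c h) = bounded-by c h

  O-≡ : ∀ {k f f'} → (∀ i → f i ≡ f' i) → O z k f → O z k f'
  O-≡ eq o = direct (≪-≡ eq (O⇒≪ o))

  O-+ : ∀ {k f f'} → O z k f → O z k f' → O z k (λ i → f i + f' i)
  O-+ a b = direct (≪-+ (O⇒≪ a) (O⇒≪ b))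

  O-neg : ∀ {k f} → O z k f → O z k (λ i → - f i)
  O-neg a = direct (≪-neg (O⇒≪ a))

  O-- : ∀ {k f f'} → O z k f → O z k f' → O z k (λ i → f i - f' i)
  O-- a b = O-+ a (O-neg b)

  O-≤ : ∀ {k l f} → k ℕ.≤ l → O z k f → O z l f
  O-≤ k≤l o = ≪⇒O (O⇒≪ o) (1 , λ i → ≤-trans (ℕ.^-monoʳ-≤ (suc (z i)) k≤l) (≤-reflexive (sym (ℕ.*-identityˡ _))))

  O-* : ∀ {k l f f'} → O z k f → O z l f' → O z (k ℕ.+ l) (λ i → f i * f' i)
  O-* {k} {l} a b = ≪⇒O (≪-* (O⇒≪ a) (O⇒≪ b)) (1 , λ i → ≤-reflexive (sym (ℕ.^-distribˡ-+-* (suc (z i)) k l) ∙ sym (ℕ.*-identityˡ _)))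

  O-const : ∀ {k} c → O z k (λ _ → c)
  O-const c = O-≤ z≤n (of-order {k = 0} ∣ c ∣ (λ _ → ≤-reflexive (sym (ℕ.*-identityʳ ∣ c ∣))))

  O-scale : ∀ {k} c {f} → O z k f → O z k (λ i → c * f i)
  O-scale c o = O-* {0} (O-const c) o

  O-remainder : ∀ {n s : I → ℤ} → O z 1 s → O z 3 (λ i → remainder (n i) (s i))
  O-remainder {n} {s} (of-order c h) = of-order (2 · c ℕ.^ 3) (λ i → ≤-trans (∣remainder∣≤ (n i) (s i)) (≤-trans (*-monoʳ-≤ 2 (^-monoˡ-≤ 3 (h i))) (≤-reflexive (lem c (suc (z i))))))
    where lem : ∀ c z → 2 · (c · (z · 1)) ℕ.^ 3 ≡ 2 · c ℕ.^ 3 · z ℕ.^ 3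
          lem c z = cong (λ w → 2 · (c · w) ℕ.^ 3) (ℕ.*-identityʳ z) ∙ lem' c z
            where lem' : ∀ c z → 2 · (c · z · (c · z · (c · z · 1))) ≡ 2 · (c · (c · (c · 1))) · (z · (z · (z · 1)))
                  lem' = ringₙ

  O-cancel : ∀ {k} q .{{_ : NonZero q}} {f} → O z k (λ i → + q * f i) → O z k f
  O-cancel q {f} (of-order c h) = of-order c (λ i → ≤-trans (m≤n*m ∣ f i ∣ q) (≤-trans (≤-reflexive (sym (abs-* (+ q) (f i)))) (h i)))

  O-∑< : ∀ {l k} {n : I → ℕ} {f : I → ℕ → ℤ} → O z l (λ i → + n i) →
         O {Σ[ i ∈ I ] Σ[ k ∈ ℕ ] k ℕ.< n i} (λ (i , _) → z i) k (λ (i , k , _) → f i k) →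
         O z (l ℕ.+ k) (λ i → ∑< (n i) (f i))
  O-∑< {l} {k} {n} {f} (of-order d e) o = ≪⇒O (≪-∑< {n = n} {f} {λ i → suc (z i) ℕ.^ k} (bounded-by (O.constant o) (O.within o))) (d , λ i → ≤-trans (*-monoˡ-≤ (suc (z i) ℕ.^ k) (e i))
    (≤-reflexive (ℕ.*-assoc d _ _ ∙ cong (d ·_) (sym (ℕ.^-distribˡ-+-* (suc (z i)) l k)))))

  O-∑ : ∀ {A : Set} {k} (xs : List A) {f : A → I → ℤ} → (∀ x → O z k (f x)) → O z k (λ i → ∑ xs (λ x → f x i))
  O-∑ [] h = O-≡ (λ i → sym (∑-zero [] (λ ()))) (O-const 0ℤ)
  O-∑ (x ∷ xs) {f} h = O-≡ (λ i → sym (∑-++ (x ∷ []) xs (λ y → f y i) ∙ cong (_+ ∑ xs (λ y → f y i)) (∑-single (λ y → f y i) ([] ∷ []) (here refl) (λ { (here refl) e → contradiction refl e })))) (O-+ (h x) (O-∑ xs h))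

O-∘ : ∀ {I J : Set} {z : I → ℕ} {k f} (φ : J → I) → O z k f → O (z ∘ φ) k (f ∘ φ)
O-∘ φ (of-order c h) = of-order c (h ∘ φ)

U-Δ³ : ∀ (g : ℕ → ℤ) i → Δ (Δ (Δ g)) i ≡ 0ℤ →
  let s = λ j → g (j ℕ.+ i) - g i in
  Δ (Δ (Δ (U ∘ g))) i ≡ + 3 * pos (g i) * (s 3 * s 3 - + 3 * (s 2 * s 2) + + 3 * (s 1 * s 1))
    + (remainder (g i) (s 3) - + 3 * remainder (g i) (s 2) + + 3 * remainder (g i) (s 1))
U-Δ³ g i Δ³≡0 = expand (U (g (3 ℕ.+ i))) (U (g (2 ℕ.+ i))) (U (g (1 ℕ.+ i))) (U (g i)) (s 3) (s 2) (s 1) (pos (g i)) ∙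
  trans (cong (λ w → + 3 * pos (g i) * Q + T + - (+ 3 * pos (g i) * pos (g i)) * w) linear)
  (drop (+ 3 * pos (g i) * Q + T) (- (+ 3 * pos (g i) * pos (g i))) ∙ cong (λ w → + 3 * pos (g i) * Q + w)
    (cong₂ _+_ (cong₂ (λ x y → x - + 3 * y) (at 3) (at 2)) (cong (+ 3 *_) (at 1))))
  where
  s : ℕ → ℤ
  s j = g (j ℕ.+ i) - g i
  a₀ : ℕ → ℤ
  a₀ j = U (g (j ℕ.+ i)) - U (g i) - + 3 * s j * (pos (g i) * pos (g i)) - + 3 * (s j * s j) * pos (g i)
  Q T : ℤ
  Q = s 3 * s 3 - + 3 * (s 2 * s 2) + + 3 * (s 1 * s 1)
  T = a₀ 3 - + 3 * a₀ 2 + + 3 * a₀ 1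
  drop : ∀ x y → x + y * 0ℤ ≡ x
  drop = ring
  at : ∀ j → U (g (j ℕ.+ i)) - U (g i) - + 3 * s j * (pos (g i) * pos (g i)) - + 3 * (s j * s j) * pos (g i) ≡ remainder (g i) (s j)
  at j = cong (λ z → U z - U (g i) - + 3 * s j * (pos (g i) * pos (g i)) - + 3 * (s j * s j) * pos (g i)) (split-off (g (j ℕ.+ i)) (g i))
  linear : + 3 * s 2 - s 3 - + 3 * s 1 ≡ 0ℤ
  linear = lem (g (3 ℕ.+ i)) (g (2 ℕ.+ i)) (g (1 ℕ.+ i)) (g i) ∙ cong -_ Δ³≡0
    where lem : ∀ a b c d → + 3 * (b - d) - (a - d) - + 3 * (c - d) ≡ - (((a - b) - (b - c)) - ((b - c) - (c - d)))
          lem = ring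
  expand : ∀ a b c d x y z p → ((a - b) - (b - c)) - ((b - c) - (c - d)) ≡
    + 3 * p * (x * x - + 3 * (y * y) + + 3 * (z * z))
      + ((a - d - + 3 * x * (p * p) - + 3 * (x * x) * p) - + 3 * (b - d - + 3 * y * (p * p) - + 3 * (y * y) * p)
        + + 3 * (c - d - + 3 * z * (p * p) - + 3 * (z * z) * p))
      + - (+ 3 * p * p) * (+ 3 * y - x - + 3 * z)
  expand = ring

∑₊-collect : ∀ Y (W : ℕ → ℤ) → (∀ n → Y ℕ.< n → W n ≡ 0ℤ) → (κ r : ℕ → ℕ → ℤ) (size : ℕ → ℕ) →
  (∀ g → 0 ℕ.< g → 0 ℕ.< size g) → (∀ g a → 0 ℕ.< g → κ (a · size g) g ≡ r g a) →
  (∀ n g → ¬ (size g ∣ₙ n) → κ n g ≡ 0ℤ) → (∀ n g → 0 ℕ.< n → n ℕ.< g → κ n g ≡ 0ℤ) →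
  ∑₊ Y (λ g → ∑₊ Y (λ a → r g a * W (size g · a))) ≡ ∑₊ Y (λ n → ∑₊ n (κ n) * W n)
∑₊-collect Y W vanish κ r size size>0 hit miss large = begin
  ∑₊ Y (λ g → ∑₊ Y (λ a → r g a * W (size g · a))) ≡⟨ ∑₊-cong Y (λ g g>0 _ → fixed g g>0) ⟩
  ∑₊ Y (λ g → ∑₊ Y (λ n → κ n g * W n)) ≡⟨ ∑<-swap Y Y (λ g n → κ (suc n) (suc g) * W (suc n)) ⟩
  ∑₊ Y (λ n → ∑₊ Y (λ g → κ n g * W n)) ≡⟨ ∑₊-cong Y (λ n n>0 n≤Y → ∑<-*ʳ Y (W n) (κ n ∘ suc) ∙ cong (_* W n) (∑₊-extend (κ n) n≤Y (λ g → large n g n>0))) ⟩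
  ∑₊ Y (λ n → ∑₊ n (κ n) * W n) ∎
  where
  fixed : ∀ g → 0 ℕ.< g → ∑₊ Y (λ a → r g a * W (size g · a)) ≡ ∑₊ Y (λ n → κ n g * W n)
  fixed g g>0 = begin
    ∑₊ Y (λ a → r g a * W (size g · a)) ≡⟨ ∑₊-cong Y (λ a _ _ → cong₂ _*_ (hit g a g>0) (cong W (ℕ.*-comm a (size g)))) ⟨
    ∑₊ Y (λ a → κ (a · size g) g * W (a · size g))
      ≡⟨ ∑₊-multiples (size g) {{ℕ.>-nonZero (size>0 g g>0)}} Y (λ n → κ n g * W n) (λ n ∤ → cong (_* W n) (miss n g ∤) ∙ *-zeroˡ (W n)) ⟨
    ∑₊ (Y · size g) (λ n → κ n g * W n)
      ≡⟨ ∑₊-extend (λ n → κ n g * W n) (m≤m*n Y (size g) {{ℕ.>-nonZero (size>0 g g>0)}}) (λ n Y<n → cong (κ n g *_) (vanish n Y<n) ∙ *-zeroʳ (κ n g)) ⟩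
    ∑₊ Y (λ n → κ n g * W n) ∎

module DivisorSums (t n₀ : ℤ) (N : ℕ) (disc-N : + 4 * n₀ - t * t ≡ + N)
  (no-square : ∀ p → Prime p → + p ∣ + N → ∀ x → ¬ (+ p * + p ∣ x * x + t * x + n₀))
  (ch : ℕ → ℤ) (character : Character N ch) (roots : ∀ q → Prime q → rootCount t n₀ q ≡ 1ℤ + ch q) where
  open RootCount t n₀ N disc-N no-square using (ρ)
  open Convolution t n₀ N disc-N no-square ch character roots

  root-sum≡character-sum : ∀ Y (W : ℕ → ℤ) → (∀ n → Y ℕ.< n → W n ≡ 0ℤ) →
    ∑₊ Y (λ g → ∑₊ Y (λ a → ρ a * W (g · g · a))) ≡ ∑₊ Y (λ e → ∑₊ Y (λ j → ch e * W (e · j)))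
  root-sum≡character-sum Y W vanish = trans
    (∑₊-collect Y W vanish τ (λ _ → ρ) (λ g → g · g) (λ { (suc g) _ → s≤s z≤n }) (λ g a g>0 → τ-yes (a · (g · g)) g a g>0 refl) τ-no (λ n g n>0 → τ-large n {{ℕ.>-nonZero n>0}} g))
    (∑₊-cong Y (λ n n>0 _ → cong (_* W n) (convolution n {{ℕ.>-nonZero n>0}})) ∙
    sym (∑₊-collect Y W vanish δ (λ e _ → ch e) id (λ _ → id) (λ e a _ → cong (_* ch e) (⟦⟧-yes (e ℕ∣.∣? (a · e)) (dividesₙ a refl)) ∙ *-identityˡ (ch e)) δ-no (λ n e n>0 → δ-large n {{ℕ.>-nonZero n>0}} e)))

module _ (𝓞 : QuadraticOrder) where
  open QuadraticForms 𝓞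

  ramified-no-square : ∀ p → Prime p → + p ∣ + N → ∀ x → ¬ (+ p * + p ∣ x * x + t * x + n₀)
  ramified-no-square p pr p∣N x p²∣P = prime-∤1 pr (proj₂ (divide (+ p) x 1ℤ p≢0 (subst (+ p * + p ∣_) (lem₁ x t n₀) p²∣P) ([ id , id ]′ (prime-∣-* pr (+ 2 * x + t * 1ℤ) (+ 2 * x + t * 1ℤ) square))))
    where
    p≢0 : + p ≢ 0ℤ
    p≢0 e = ℕ.≢-nonZero⁻¹ p {{prime⇒nonZero pr}} (+-injective e)
    lem₁ : ∀ x t n → x * x + t * x + n ≡ x * x + t * x * 1ℤ + n * 1ℤ * 1ℤ
    lem₁ = ring
    lem₂ : ∀ x t n → + 4 * (x * x + t * x + n) - (+ 4 * n - t * t) ≡ (+ 2 * x + t * 1ℤ) * (+ 2 * x + t * 1ℤ)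
    lem₂ = ring
    square : + p ∣ (+ 2 * x + t * 1ℤ) * (+ 2 * x + t * 1ℤ)
    square = subst (+ p ∣_) (cong (λ w → + 4 * (x * x + t * x + n₀) - w) (sym disc-N) ∙ lem₂ x t n₀) (∣m∣n⇒∣m-n (∣n⇒∣m*n (+ 4) (∣-trans (∣m⇒∣m*n (+ p) ∣-refl) p²∣P)) p∣N)

-- Weighted sums over the values of a quadratic form

∑-interval : ∀ S f → ∑ (interval S) f ≡ ∑< (suc (S ℕ.+ S)) (λ k → f (+ k - + S))
∑-interval S f = ∑-map (λ i → + i - + S) (upTo (suc (S ℕ.+ S))) f ∙ sym (∑<≡∑ _ _)

module Weight (p : ℕ) where
  weight : ℤ → ℤ
  weight z = 1ℤ - + p * ⟦ + p ∣? z ⟧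

  weight-yes : ∀ {z} → + p ∣ z → weight z ≡ 1ℤ - + p
  weight-yes {z} d = cong (λ w → 1ℤ - + p * w) (⟦⟧-yes (+ p ∣? z) d) ∙ cong (λ w → 1ℤ - w) (*-identityʳ (+ p))

  weight-no : ∀ {z} → ¬ (+ p ∣ z) → weight z ≡ 1ℤ
  weight-no {z} ∤ = cong (λ w → 1ℤ - + p * w) (⟦⟧-no (+ p ∣? z) ∤) ∙ cong (λ w → 1ℤ - w) (*-zeroʳ (+ p))

  weight-cong : ∀ x y → (+ p ∣ x → + p ∣ y) → (+ p ∣ y → + p ∣ x) → weight x ≡ weight y
  weight-cong x y f g = cong (λ w → 1ℤ - + p * w) (⟦⟧-cong (+ p ∣? x) (+ p ∣? y) f g)

  weight-Mod : Mod p weight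
  weight-Mod {x} {y} d = weight-cong x y (λ e → subst (+ p ∣_) (minus-involutive x y) (∣m∣n⇒∣m-n e d)) (λ e → subst (+ p ∣_) (+-minus-cancel y x) (∣m∣n⇒∣m+n e d))


  ∣weight∣≤ : ∀ z → ∣ weight z ∣ ℕ.≤ suc p
  ∣weight∣≤ z = go (+ p ∣? z)
    where
    go : Dec (+ p ∣ z) → ∣ weight z ∣ ℕ.≤ suc p
    go (yes d) = subst (λ w → ∣ w ∣ ℕ.≤ suc p) (sym (weight-yes d)) (ℤ.∣i-j∣≤∣i∣+∣j∣ 1ℤ (+ p))
    go (no ∤) = subst (λ w → ∣ w ∣ ℕ.≤ suc p) (sym (weight-no ∤)) (s≤s z≤n)

  weight-mean : .{{_ : NonZero p}} → ∀ {g} → ∑< p (λ i → ⟦ + p ∣? g i ⟧) ≡ 1ℤ → ∑< p (weight ∘ g) ≡ 0ℤ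
  weight-mean {g} one = ∑<-+' p (λ _ → 1ℤ) (λ i → - (+ p * ⟦ + p ∣? g i ⟧)) ∙ cong₂ _+_ (∑<-const p 1ℤ) (∑<-cong p (λ {i} _ → ℤ.neg-distribˡ-* (+ p) ⟦ + p ∣? g i ⟧) ∙ ∑<-*ˡ p (- + p) (λ i → ⟦ + p ∣? g i ⟧) ∙ cong (λ w → - + p * w) one) ∙ lem (+ p)
    where lem : ∀ p → p * 1ℤ + - p * 1ℤ ≡ 0ℤ
          lem = ring

-- p ramifies: a f(x,y) ≡ (a x + l y)² modulo p, so that on every line y = const
-- exactly one residue class of x gives values divisible by p.
module QuadraticSum (p : ℕ) (pr : Prime p) (a b c l : ℤ) (p∣b-2l : + p ∣ b - + 2 * l) (p∣ll-ac : + p ∣ l * l - a * c) (p∤a : ¬ (+ p ∣ a)) where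
  open Weight p
  private
    instance
      _ = prime⇒nonZero pr

  f : ℤ → ℤ → ℤ
  f x y = a * x * x + b * x * y + c * y * y

  module _ (S : ℕ) (y : ℤ) where
    at : ℕ → ℤ
    at k = + k - + S

    line : ℕ → ℤ
    line k = weight (f (at k) y)

    line-periodic : Periodic p line
    line-periodic = record { period = λ k → weight-Mod {f (at (k ℕ.+ p)) y} {f (at k) y} (divides (a * (+ 2 * at k + + p) + b * y) (lem₁ a b c (+ k) (+ S) (+ p) y))
      ; mean = weight-mean {λ k → f (at k) y} (∑<-cong p (λ {k} _ → ⟦⟧-cong (+ p ∣? f (at k) y) (+ p ∣? (l * y - a * + S + a * + k)) (to k) (from k)) ∙ linear-roots pr a (l * y - a * + S) p∤a) }
      where
      lem₁ : ∀ a b c k s p y → a * (k + p - s) * (k + p - s) + b * (k + p - s) * y + c * y * y - (a * (k - s) * (k - s) + b * (k - s) * y + c * y * y) ≡ (a * (+ 2 * (k - s) + p) + b * y) * p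
      lem₁ = ring
      root : ∀ k → ℤ
      root k = l * y - a * + S + a * + k
      correction : ∀ k → + p ∣ at k * y * a * (b - + 2 * l) - y * y * (l * l - a * c)
      correction k = ∣m∣n⇒∣m-n (∣n⇒∣m*n (at k * y * a) p∣b-2l) (∣n⇒∣m*n (y * y) p∣ll-ac)
      to : ∀ k → + p ∣ f (at k) y → + p ∣ root k
      to k d = [ id , id ]′ (prime-∣-* pr (root k) (root k) (subst (+ p ∣_) (lem a b c l (+ k) (+ S) y) (∣m∣n⇒∣m-n (∣n⇒∣m*n a d) (correction k))))
        where lem : ∀ a b c l k s y → a * (a * (k - s) * (k - s) + b * (k - s) * y + c * y * y) - ((k - s) * y * a * (b - + 2 * l) - y * y * (l * l - a * c)) ≡ (l * y - a * s + a * k) * (l * y - a * s + a * k)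
              lem = ring
      from : ∀ k → + p ∣ root k → + p ∣ f (at k) y
      from k d = [ (λ e → contradiction e p∤a) , id ]′ (prime-∣-* pr a (f (at k) y) (subst (+ p ∣_) (lem a b c l (+ k) (+ S) y) (∣m∣n⇒∣m+n (∣n⇒∣m*n (root k) d) (correction k))))
        where lem : ∀ a b c l k s y → (l * y - a * s + a * k) * (l * y - a * s + a * k) + ((k - s) * y * a * (b - + 2 * l) - y * y * (l * l - a * c)) ≡ a * (a * (k - s) * (k - s) + b * (k - s) * y + c * y * y)
              lem = ring

  module Estimate {I : Set} (z : I → ℕ) (S Y : I → ℕ) (S-O : O z 1 (λ i → + S i)) (Y-O : O z 2 (λ i → + Y i))
    (f≥0 : ∀ x y → 0ℤ ≤ f x y) (outside : ∀ i x y → S i ℕ.≤ 2 ℕ.+ ∣ x ∣ → + Y i ≤ f x y) where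

    n : I → ℕ
    n i = suc (S i ℕ.+ S i)

    n-O : O z 1 (λ i → + n i)
    n-O = O-+ {f = λ _ → 1ℤ} (O-const 1ℤ) (O-+ S-O S-O)

    Row Point : Set
    Row = Σ[ i ∈ I ] Σ[ k ∈ ℕ ] k ℕ.< n i
    Point = Σ[ r ∈ Row ] Σ[ k ∈ ℕ ] k ℕ.< n (proj₁ r)

    coordinate : ∀ {J : Set} (φ : J → I) (k : J → ℕ) → (∀ j → k j ℕ.< n (φ j)) → O (z ∘ φ) 1 (λ j → at (S (φ j)) 0ℤ (k j))
    coordinate φ k k<n = O-- (below (O-∘ φ n-O)) (O-∘ φ S-O)
      where
      below : O (z ∘ φ) 1 (λ j → + n (φ j)) → O (z ∘ φ) 1 (λ j → + k j)
      below (of-order c h) = of-order c (λ j → ≤-trans (ℕ.<⇒≤ (k<n j)) (h j))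

    y-of : Row → ℤ
    y-of (i , k , _) = + k - + S i

    g : Row → ℕ → ℤ
    g r k = + Y (proj₁ r) - f (at (S (proj₁ r)) (y-of r) k) (y-of r)

    slope : Point → ℤ
    slope (r , k , _) = - (+ 2 * a * (+ k - + S (proj₁ r)) + b * y-of r)

    scale : Point → ℕ
    scale (r , _) = z (proj₁ r)

    y-O : O (z ∘ proj₁) 1 y-of
    y-O = coordinate proj₁ (λ (_ , k , _) → k) (λ (_ , _ , k<) → k<)

    slope-O : O scale 1 slope
    slope-O = O-neg (O-+ (O-scale (+ 2 * a) (coordinate (proj₁ ∘ proj₁) (λ (_ , k , _) → k) (λ (_ , _ , k<) → k<))) (O-scale b (O-∘ {f = y-of} proj₁ y-O)))

    step : ℕ → Point → ℤ
    step j (r , k , _) = g r (j ℕ.+ k) - g r k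

    step≡ : ∀ j π → step j π ≡ + j * slope π - + j * + j * a
    step≡ j (r , k , _) = lem (+ j) (+ k) (+ S (proj₁ r)) a b c (y-of r) (+ Y (proj₁ r))
      where lem : ∀ j k s a b c y Y → Y - (a * (j + k - s) * (j + k - s) + b * (j + k - s) * y + c * y * y) - (Y - (a * (k - s) * (k - s) + b * (k - s) * y + c * y * y)) ≡ j * - (+ 2 * a * (k - s) + b * y) - j * j * a
            lem = ring

    step-O : ∀ j → O scale 1 (step j)
    step-O j = O-≡ (λ π → sym (step≡ j π)) (O-- (O-scale (+ j) slope-O) (O-const (+ j * + j * a)))

    Δ³-O : O scale 3 (λ (r , k , _) → Δ (Δ (Δ (U ∘ g r))) k)
    Δ³-O = O-≡ {f = λ π@(r , k , _) → + 3 * pos (g r k) * (step 3 π * step 3 π - + 3 * (step 2 π * step 2 π) + + 3 * (step 1 π * step 1 π))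
                  + (remainder (g r k) (step 3 π) - + 3 * remainder (g r k) (step 2 π) + + 3 * remainder (g r k) (step 1 π))}
        (λ (r , k , _) → sym (U-Δ³ (g r) k (Δ³g (+ k) (+ S (proj₁ r)) a b c (y-of r) (+ Y (proj₁ r)))))
        (O-+ (O-* (O-scale (+ 3) pos-O) squares-O)
          (O-+ (O-- (O-remainder (step-O 3)) (O-scale (+ 3) (O-remainder (step-O 2)))) (O-scale (+ 3) (O-remainder (step-O 1)))))
      where
      Δ³g : ∀ k s a b c y Y →
        let g = λ k → Y - (a * (k - s) * (k - s) + b * (k - s) * y + c * y * y) in
        ((g (+ 3 + k) - g (+ 2 + k)) - (g (+ 2 + k) - g (1ℤ + k))) - ((g (+ 2 + k) - g (1ℤ + k)) - (g (1ℤ + k) - g k)) ≡ 0ℤ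
      Δ³g = ring
      squares-O : O scale 1 (λ π → step 3 π * step 3 π - + 3 * (step 2 π * step 2 π) + + 3 * (step 1 π * step 1 π))
      squares-O = O-≡ (λ π → sym (cong₂ _+_ (cong₂ (λ x y → x * x - + 3 * (y * y)) (step≡ 3 π) (step≡ 2 π)) (cong (λ x → + 3 * (x * x)) (step≡ 1 π)) ∙ lem (slope π) a))
          (O-- (O-const (+ 36 * (a * a))) (O-scale (+ 12 * a) slope-O))
        where lem : ∀ s a → (+ 3 * s - + 3 * + 3 * a) * (+ 3 * s - + 3 * + 3 * a) - + 3 * ((+ 2 * s - + 2 * + 2 * a) * (+ 2 * s - + 2 * + 2 * a)) + + 3 * ((1ℤ * s - 1ℤ * 1ℤ * a) * (1ℤ * s - 1ℤ * 1ℤ * a)) ≡ + 36 * (a * a) - + 12 * a * s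
              lem = ring
      pos-O : O scale 2 (λ (r , k , _) → pos (g r k))
      pos-O = of-order (O.constant Y-O) (λ (r , k , _) → ≤-trans (∣pos∣≤ (≤-minus (+ Y (proj₁ r)) (f≥0 (at (S (proj₁ r)) (y-of r) k) (y-of r)))) (O.within Y-O (proj₁ r)))
        where
        ≤-minus : ∀ y {x} → 0ℤ ≤ x → y - x ≤ y
        ≤-minus y {x} h = ℤ.≤-trans (ℤ.+-monoʳ-≤ y (ℤ.neg-mono-≤ h)) (ℤ.≤-reflexive (ℤ.+-identityʳ y))

    row-sum : Row → ℤ
    row-sum r = ∑< (n (proj₁ r)) (λ k → line (S (proj₁ r)) (y-of r) k * U (g r k))

    U-outside : ∀ r k → S (proj₁ r) ℕ.≤ 2 ℕ.+ ∣ + k - + S (proj₁ r) ∣ → U (g r k) ≡ 0ℤ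
    U-outside r k h = U-nonpos (ℤ.≤-trans (ℤ.+-monoʳ-≤ (+ Y (proj₁ r)) (ℤ.neg-mono-≤ (outside (proj₁ r) (at (S (proj₁ r)) (y-of r) k) (y-of r) h))) (ℤ.≤-reflexive (+-inverseʳ (+ Y (proj₁ r)))))

    beginning : ∀ r k → k ℕ.≤ 2 → U (g r k) ≡ 0ℤ
    beginning r k k≤2 = U-outside r k (≤-trans (≤-trans (≤-reflexive (cong ∣_∣ (lem (+ k) (+ s)))) (ℤ.∣i-j∣≤∣i∣+∣j∣ (+ k) (+ k - + s))) (+-monoˡ-≤ _ k≤2))
      where
      s = S (proj₁ r)
      lem : ∀ k s → s ≡ k - (k - s)
      lem = ring

    end : ∀ r k → n (proj₁ r) ℕ.≤ k → U (g r k) ≡ 0ℤ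
    end r k n≤k = U-outside r k (≤-trans (ℕ.+-cancelˡ-≤ s s ∣ + k - + s ∣ (≤-trans (ℕ.<⇒≤ n≤k) (≤-trans (≤-reflexive (cong ∣_∣ (split-off (+ k) (+ s)))) (ℤ.∣i+j∣≤∣i∣+∣j∣ (+ s) (+ k - + s))))) (m≤n+m _ 2))
      where
      s = S (proj₁ r)


    row-O : O (z ∘ proj₁) 4 row-sum
    row-O = O-cancel p (O-cancel p (O-cancel p (O-≡ (λ r → sym (summed r)) (O-neg (O-∑< (O-∘ {f = λ i → + n i} proj₁ n-O) (O-* iterate-O Δ³-O))))))
      where
      it : Row → ℕ → ℕ → ℤ
      it r j = iterate p j (line (S (proj₁ r)) (y-of r))
      constant = iterate-bound p 3 (suc p)
      iterate-O : O scale 0 (λ (r , k , _) → it r 3 k)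
      iterate-O = of-order (proj₁ constant) (λ (r , k , _) → ≤-trans (proj₂ constant (line-periodic (S (proj₁ r)) (y-of r)) (λ j → ∣weight∣≤ (f (at (S (proj₁ r)) (y-of r) j) (y-of r))) k) (≤-reflexive (sym (ℕ.*-identityʳ _))))
      summed : ∀ r → + p * (+ p * (+ p * row-sum r)) ≡ - ∑< (n (proj₁ r)) (λ k → it r 3 k * Δ (Δ (Δ (U ∘ g r))) k)
      summed r = abel³ (line-periodic (S (proj₁ r)) (y-of r)) (U ∘ g r) (n (proj₁ r)) (end r) ∙
        trans (cong₂ (λ x y → A * x + B * y - C * Δ (Δ (U ∘ g r)) 0 - T) (beginning r 0 z≤n) (cong₂ _-_ (beginning r 1 (s≤s z≤n)) (beginning r 0 z≤n)))
        (cong (λ x → A * 0ℤ + B * 0ℤ - C * x - T) (cong₂ _-_ (cong₂ _-_ (beginning r 2 ≤-refl) (beginning r 1 (s≤s z≤n))) (cong₂ _-_ (beginning r 1 (s≤s z≤n)) (beginning r 0 z≤n))) ∙ lem A B C T)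
        where
        A B C T : ℤ
        A = - (+ p * + p * moment p (it r 0))
        B = + p * integral p (it r 1) 0
        C = integral p (it r 2) 0
        T = ∑< (n (proj₁ r)) (λ k → it r 3 k * Δ (Δ (Δ (U ∘ g r))) k)
        lem : ∀ a b c t → a * 0ℤ + b * 0ℤ - c * 0ℤ - t ≡ - t
        lem = ring

    estimate : O z 5 (λ i → ∑ (interval (S i)) (λ y → ∑ (interval (S i)) (λ x → weight (f x y) * U (+ Y i - f x y))))
    estimate = O-≡ (λ i → sym (∑-interval (S i) _ ∙ ∑<-cong (n i) (λ _ → ∑-interval (S i) _))) (O-∑< n-O row-O)

module _ {m t f n₀ : ℤ} (disc : f * f * m + + 4 * n₀ ≡ t * t) where

  -- l is the root of P' modulo p, i.e. the double root of P.
  double-root : Kind m t f → ∀ p → Prime p → + p ∣ m → ∀ k →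
    ∃[ l ] (+ p ∣ (+ 2 * k + t) - + 2 * l) × (+ p ∣ l * l - (k * k + t * k + n₀))
  double-root (even-disc _ t≡ f≡ _) p pr p∣m k = k ,
    subst (+ p ∣_) (lem₁ k ∙ cong (λ t → (+ 2 * k + t) - + 2 * k) (sym t≡)) (divides 0ℤ (sym (*-zeroˡ (+ p)))) ,
    subst (+ p ∣_) (*-cancelˡ (+ 4) (λ ()) four) p∣m
    where
    lem₁ : ∀ k → 0ℤ ≡ (+ 2 * k + 0ℤ) - + 2 * k
    lem₁ = ring
    lem₂ : ∀ m k t n → + 4 * m - (+ 2 * + 2 * m + + 4 * n - t * t) ≡ + 4 * (k * k - (k * k + t * k + n)) + t * (+ 4 * k + t)
    lem₂ = ring
    lem₃ : ∀ x → + 4 * x - 0ℤ ≡ + 4 * x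
    lem₃ = ring
    lem₄ : ∀ x y → x + 0ℤ * y ≡ x
    lem₄ = ring
    four : + 4 * m ≡ + 4 * (k * k - (k * k + t * k + n₀))
    four = sym (lem₃ m) ∙ cong (λ w → + 4 * m - w) (sym (cong (_- t * t) (subst (λ f → f * f * m + + 4 * n₀ ≡ t * t) f≡ disc) ∙ +-inverseʳ (t * t))) ∙
      trans (lem₂ m k t n₀) (cong (λ w → + 4 * (k * k - (k * k + t * k + n₀)) + w * (+ 4 * k + t)) t≡ ∙ lem₄ (+ 4 * (k * k - (k * k + t * k + n₀))) (+ 4 * k + t))
  double-root (odd-disc t≡ f≡) p pr p∣m k = go (even⊎odd p)
    where
    m≡ : m ≡ 1ℤ - + 4 * n₀
    m≡ = lem m (+ 4 * n₀) ∙ cong (_- + 4 * n₀) (cong (λ f → f * f * m + + 4 * n₀) (sym f≡) ∙ disc ∙ cong (λ t → t * t) t≡)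
      where lem : ∀ m n → m ≡ 1ℤ * 1ℤ * m + n - n
            lem = ring
    go : (∃[ j ] p ≡ j ℕ.+ j) ⊎ (∃[ i ] p ≡ odd i) → _
    go (inj₁ (j , e)) = contradiction (subst (+ p ∣_) one (∣m∣n⇒∣m+n (subst (+ p ∣_) m≡ p∣m) (∣m⇒∣m*n (+ 2 * n₀) (subst (λ q → + p ∣ + q) (prime-even {j = j} pr e) ∣-refl)))) (prime-∤1 pr)
      where one : 1ℤ - + 4 * n₀ + + 2 * (+ 2 * n₀) ≡ 1ℤ
            one = lem n₀
              where lem : ∀ n → 1ℤ - + 4 * n + + 2 * (+ 2 * n) ≡ 1ℤ
                    lem = ring
    go (inj₂ (i , e)) = k + + suc i ,
      subst (+ p ∣_) (cong (λ q → - + q) e ∙ lem₁ k (+ i) ∙ cong (λ t → (+ 2 * k + t) - + 2 * (k + + suc i)) (sym t≡)) (∣m⇒∣-m (∣-refl {+ p})) ,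
      subst (+ p ∣_) (lem₃ k (+ i) n₀ ∙ cong (λ t → (k + + suc i) * (k + + suc i) - (k * k + t * k + n₀)) (sym t≡))
        (∣m∣n⇒∣m+n (∣m⇒∣m*n (k + (1ℤ - (+ i + + i)) * V) odd∣) (∣n⇒∣m*n (+ i * + i) (subst (+ p ∣_) (cong (λ m → (1ℤ + (+ i + + i)) * (+ 3 + (+ i + + i)) + m) m≡ ∙ lem₂ (+ i) n₀) (∣m∣n⇒∣m+n (∣m⇒∣m*n (+ 3 + (+ i + + i)) odd∣) p∣m))))
      where
      V : ℤ
      V = + suc i * + suc i - n₀
      odd∣ : + p ∣ 1ℤ + (+ i + + i)
      odd∣ = subst (λ q → + p ∣ + q) e ∣-refl
      lem₁ : ∀ k i → - (1ℤ + (i + i)) ≡ (+ 2 * k + 1ℤ) - + 2 * (k + (1ℤ + i))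
      lem₁ = ring
      lem₂ : ∀ i n → (1ℤ + (i + i)) * (+ 3 + (i + i)) + (1ℤ - + 4 * n) ≡ + 4 * ((1ℤ + i) * (1ℤ + i) - n)
      lem₂ = ring
      -- 1 = (2i + 1) - 2i makes the factor 4 invertible modulo p = 2i + 1.
      lem₃ : ∀ k i n → (1ℤ + (i + i)) * (k + (1ℤ - (i + i)) * ((1ℤ + i) * (1ℤ + i) - n)) + i * i * (+ 4 * ((1ℤ + i) * (1ℤ + i) - n)) ≡ (k + (1ℤ + i)) * (k + (1ℤ + i)) - (k * k + 1ℤ * k + n)
      lem₃ = ring

quadratic-large : ∀ N K Z (a y s F : ℤ) → 4 ℕ.≤ N → 0ℤ < a → ∣ a ∣ ℕ.≤ K → + 4 * (a * F) ≡ s * s + + N * (y * y) → K · Z ℕ.≤ ∣ y ∣ → + (Z · Z) ≤ F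
quadratic-large N K Z (+ suc a) y s F N≥4 _ a≤K e KZ≤y = ℤ.*-cancelˡ-≤-pos (+ (Z · Z)) F (+ suc a) (ℤ.*-cancelˡ-≤-pos (+ suc a * + (Z · Z)) (+ suc a * F) (+ 4)
  (subst₂ _≤_ (sym (cong (+ 4 *_) (sym (pos-* (suc a) (Z · Z))) ∙ sym (pos-* 4 (suc a · (Z · Z))))) (sym e)
    (ℤ.≤-trans (+≤+ (*-mono-≤ N≥4 (≤-trans (*-monoˡ-≤ (Z · Z) (≤-trans a≤K (m≤m*n K K {{ℕ.>-nonZero (≤-trans (s≤s z≤n) a≤K)}}))) (≤-trans (≤-reflexive (lem K Z)) (*-mono-≤ KZ≤y KZ≤y)))))
      (ℤ.≤-trans (ℤ.≤-reflexive (pos-* N _ ∙ cong (+ N *_) (sym (square-ℕ y)) ∙ sym (+-identityˡ _))) (ℤ.+-monoˡ-≤ (+ N * (y * y)) (subst (0ℤ ≤_) (sym (square-ℕ s)) (+≤+ z≤n)))))))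
  where
  lem : ∀ K Z → K · K · (Z · Z) ≡ K · Z · (K · Z)
  lem = ringₙ
quadratic-large _ _ _ (+ zero) _ _ _ _ (+<+ ()) _ _ _

fin-bound : ∀ {h} (g : Fin h → ℕ) → ∃[ c ] (∀ i → g i ℕ.≤ c)
fin-bound g = go (allFin _) , λ i → ≤go (∈-allFin i)
  where
  go : List (Fin _) → ℕ
  go [] = 0
  go (i ∷ is) = g i ℕ.+ go is
  ≤go : ∀ {i is} → i ∈ is → g i ℕ.≤ go is
  ≤go (here refl) = m≤m+n _ _
  ≤go {is = j ∷ _} (there i∈) = ≤-trans (≤go i∈) (m≤n+m _ (g j))

module LatticeSums (𝓞 : QuadraticOrder) (h : ℕ) (order : HasOrder (ClassGroup (QuadraticOrder.m 𝓞)) h)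
  (p : ℕ) (pr : Prime p) (p∣m : + p ∣ QuadraticOrder.m 𝓞) (p∣N : + p ∣ + QuadraticOrder.N 𝓞) where
  open Representations 𝓞 h order public
  open Weight p public

  Z Y S : ℕ → ℕ
  Z s = N · suc s
  Y s = Z s · Z s
  R : ℕ
  R = proj₁ (fin-bound (λ i → ∣ Form.a (rep i) ∣ ℕ.+ ∣ Form.c (rep i) ∣))
  S s = 2 ℕ.+ R · Z s

  W : ℕ → ℤ → ℤ
  W s z = weight z * U (+ Y s - z)

  ≤R : ∀ i → ∣ Form.a (rep i) ∣ ℕ.+ ∣ Form.c (rep i) ∣ ℕ.≤ R
  ≤R = proj₂ (fin-bound (λ i → ∣ Form.a (rep i) ∣ ℕ.+ ∣ Form.c (rep i) ∣))

  Z-O : O Z 1 (λ s → + Z s)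
  Z-O = of-order 1 (λ s → ≤-trans (n≤1+n (Z s)) (≤-reflexive (sym (ℕ.^-identityʳ _) ∙ sym (ℕ.*-identityˡ _))))

  Y-O : O Z 2 (λ s → + Y s)
  Y-O = O-≡ (λ s → sym (pos-* (Z s) (Z s))) (O-* Z-O Z-O)

  S-O : O Z 1 (λ s → + S s)
  S-O = O-≡ (λ s → cong (λ w → + 2 + w) (sym (pos-* R (Z s)))) (O-+ {f = λ _ → + 2} (O-const (+ 2)) (O-scale (+ R) Z-O))

  module _ (i : Fin h) where
    open Form (rep i)

    value≥0 : ∀ x y → 0ℤ ≤ eval x y
    value≥0 x y = go ((x ℤ.≟ 0ℤ) ×-dec (y ℤ.≟ 0ℤ))
      where
      go : Dec (x ≡ 0ℤ × y ≡ 0ℤ) → 0ℤ ≤ eval x y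
      go (yes (refl , refl)) = ℤ.≤-reflexive (sym (value-0 i))
      go (no nz) = ℤ.<⇒≤ (eval>0 (rep i) x y nz)

    c>0 : 0ℤ < c
    c>0 = subst (0ℤ <_) (lem a k c t) (eval>0 (rep i) 0ℤ 1ℤ (λ ()))
      where lem : ∀ a k c t → a * 0ℤ * 0ℤ + (+ 2 * k + t) * 0ℤ * 1ℤ + c * 1ℤ * 1ℤ ≡ c
            lem = ring

    discriminant-form : + 4 * (a * c) - (+ 2 * k + t) * (+ 2 * k + t) ≡ + N
    discriminant-form = cong (λ w → + 4 * w - (+ 2 * k + t) * (+ 2 * k + t)) ac≡ ∙ lem k t n₀ ∙ disc-N
      where lem : ∀ k t n → + 4 * (k * k + t * k + n) - (+ 2 * k + t) * (+ 2 * k + t) ≡ + 4 * n - t * t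
            lem = ring

    far : ∀ s {z} → S s ℕ.≤ 2 ℕ.+ ∣ z ∣ → R · Z s ℕ.≤ ∣ z ∣
    far s = ℕ.+-cancelˡ-≤ 2 _ _

    tall : ∀ s x y → S s ℕ.≤ 2 ℕ.+ ∣ y ∣ → + Y s ≤ eval x y
    tall s x y large = quadratic-large N R (Z s) a y (+ 2 * a * x + (+ 2 * k + t) * y) (eval x y) (ℕ.<⇒≤ N>4) a>0 (≤-trans (m≤m+n _ _) (≤R i))
      (lem a (+ 2 * k + t) c x y ∙ cong (λ D → (+ 2 * a * x + (+ 2 * k + t) * y) * (+ 2 * a * x + (+ 2 * k + t) * y) + D * (y * y)) discriminant-form) (far s {y} large)
      where lem : ∀ a b c x y → + 4 * (a * (a * x * x + b * x * y + c * y * y)) ≡ (+ 2 * a * x + b * y) * (+ 2 * a * x + b * y) + (+ 4 * (a * c) - b * b) * (y * y)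
            lem = ring

    wide : ∀ s x y → S s ℕ.≤ 2 ℕ.+ ∣ x ∣ → + Y s ≤ eval x y
    wide s x y large = quadratic-large N R (Z s) c x (+ 2 * c * y + (+ 2 * k + t) * x) (eval x y) (ℕ.<⇒≤ N>4) c>0 (≤-trans (m≤n+m _ ∣ a ∣) (≤R i))
      (lem a (+ 2 * k + t) c x y ∙ cong (λ D → (+ 2 * c * y + (+ 2 * k + t) * x) * (+ 2 * c * y + (+ 2 * k + t) * x) + D * (x * x)) discriminant-form) (far s {x} large)
      where lem : ∀ a b c x y → + 4 * (c * (a * x * x + b * x * y + c * y * y)) ≡ (+ 2 * c * y + b * x) * (+ 2 * c * y + b * x) + (+ 4 * (a * c) - b * b) * (x * x)
            lem = ring

    form-O : O Z 5 (λ s → ∑ (interval (S s)) (λ x → ∑ (interval (S s)) (λ y → W s (eval x y))))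
    form-O = go (double-root disc kind p pr p∣m k)
      where
      go : ∃[ l ] (+ p ∣ (+ 2 * k + t) - + 2 * l) × (+ p ∣ l * l - P k) → O Z 5 (λ s → ∑ (interval (S s)) (λ x → ∑ (interval (S s)) (λ y → W s (eval x y))))
      go (l , b∣ , P∣) = by-divisor (+ p ∣? a) (+ p ∣? c)
        where
        ll-ac : + p ∣ l * l - a * c
        ll-ac = subst (λ w → + p ∣ l * l - w) (sym ac≡) P∣
        by-divisor : Dec (+ p ∣ a) → Dec (+ p ∣ c) → O Z 5 (λ s → ∑ (interval (S s)) (λ x → ∑ (interval (S s)) (λ y → W s (eval x y))))
        by-divisor (no p∤a) _ = O-≡ (λ s → ∑-swap (interval (S s)) (interval (S s)) (λ y x → W s (eval x y)))
          (QuadraticSum.Estimate.estimate p pr a (+ 2 * k + t) c l b∣ ll-ac p∤a Z S Y S-O Y-O value≥0 wide)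
        by-divisor (yes _) (no p∤c) = O-≡ (λ s → ∑-cong (interval (S s)) (λ {x} _ → ∑-cong (interval (S s)) (λ {y} _ → cong (W s) (sym (flip x y)))))
          (QuadraticSum.Estimate.estimate p pr c (+ 2 * k + t) a l b∣ (subst (λ w → + p ∣ l * l - w) (*-comm a c) ll-ac) p∤c Z S Y S-O Y-O
            (λ y x → subst (0ℤ ≤_) (flip x y) (value≥0 x y)) (λ s y x large → subst (+ Y s ≤_) (flip x y) (tall s x y large)))
          where
          flip : ∀ x y → eval x y ≡ c * y * y + (+ 2 * k + t) * y * x + a * x * x
          flip x y = lem a (+ 2 * k + t) c x y
            where lem : ∀ a b c x y → a * x * x + b * x * y + c * y * y ≡ c * y * y + b * y * x + a * x * x
                  lem = ring
        by-divisor (yes (divides a' a≡)) (yes (divides c' c≡)) = contradiction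
          (divides (a' * c') (sym ac≡ ∙ cong₂ _*_ a≡ c≡ ∙ lem a' c' (+ p))) (ramified-no-square 𝓞 p pr p∣N k)
          where lem : ∀ a c p → a * p * (c * p) ≡ a * c * (p * p)
                lem = ring

  lattice-O : O Z 5 (λ s → ∑ (allFin h) (λ i → ∑ (interval (S s)) (λ x → ∑ (interval (S s)) (λ y → W s (value i x y)))))
  lattice-O = O-∑ (allFin h) form-O

-- Twisted divisor sums

δ₁ δ₂ : ℤ → ℤ → ℤ
δ₁ n d = U (n - d) - U n
δ₂ n d = U (n - + 2 * d) - U (n - d) - U (n - d) + U n

module _ {I : Set} {z : I → ℕ} {n : I → ℤ} (n-O : O z 2 (λ i → pos (n i))) where

  O-U₁ : ∀ {k s} → O z k s → O z 1 s → O z (k ℕ.+ 4) (λ i → U (n i + s i) - U (n i))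
  O-U₁ {k} {s} s-O s-O₁ = O-≡ (λ i → lem (U (n i + s i)) (U (n i)) (s i) (pos (n i)))
    (O-+ {f = λ i → + 3 * s i * (pos (n i) * pos (n i))} (O-* (O-scale (+ 3) s-O) (O-* n-O n-O))
      (O-≤ (m≤n+m 4 k) (O-+ {f = λ i → + 3 * (s i * s i) * pos (n i)} (O-* (O-scale (+ 3) (O-* s-O₁ s-O₁)) n-O) (O-≤ {k = 3} (n≤1+n 3) (O-remainder {n = n} s-O₁)))))
    where lem : ∀ a b s p → + 3 * s * (p * p) + (+ 3 * (s * s) * p + (a - b - + 3 * s * (p * p) - + 3 * (s * s) * p)) ≡ a - b
          lem = ring

  O-U₂ : ∀ {s s' s″} → O z 1 s → O z 1 s' → O z 1 s″ → O z 0 (λ i → s i - s' i - s″ i) →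
         O z 4 (λ i → U (n i + s i) - U (n i + s' i) - U (n i + s″ i) + U (n i))
  O-U₂ {s} {s'} {s″} s-O s'-O s″-O linear-O = O-≡ (λ i → lem (U (n i + s i)) (U (n i + s' i)) (U (n i + s″ i)) (U (n i)) (s i) (s' i) (s″ i) (pos (n i)))
    (O-+ {f = λ i → + 3 * (s i - s' i - s″ i) * (pos (n i) * pos (n i)) + + 3 * (s i * s i - s' i * s' i - s″ i * s″ i) * pos (n i)}
      (O-+ {f = λ i → + 3 * (s i - s' i - s″ i) * (pos (n i) * pos (n i))} (O-* (O-scale (+ 3) linear-O) (O-* n-O n-O)) (O-* (O-scale (+ 3) (O-- (O-- (O-* s-O s-O) (O-* s'-O s'-O)) (O-* s″-O s″-O))) n-O))
      (O-≤ {k = 3} (n≤1+n 3) (O-- (O-- (O-remainder {n = n} s-O) (O-remainder {n = n} s'-O)) (O-remainder {n = n} s″-O))))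
    where lem : ∀ a b c d x y w p → + 3 * (x - y - w) * (p * p) + + 3 * (x * x - y * y - w * w) * p
                + ((a - d - + 3 * x * (p * p) - + 3 * (x * x) * p) - (b - d - + 3 * y * (p * p) - + 3 * (y * y) * p) - (c - d - + 3 * w * (p * p) - + 3 * (w * w) * p)) ≡ a - b - c + d
          lem = ring

  O-δ₁ : ∀ {d} → O z 1 d → O z 5 (λ i → δ₁ (n i) (d i))
  O-δ₁ d-O = O-U₁ (O-neg d-O) (O-neg d-O)

  O-δ₂ : ∀ {d} → O z 1 d → O z 4 (λ i → δ₂ (n i) (d i))
  O-δ₂ {d} d-O = O-U₂ (O-neg (O-scale (+ 2) d-O)) (O-neg d-O) (O-neg d-O) (O-≡ (λ i → sym (lem (d i))) (O-const 0ℤ))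
    where lem : ∀ d → - (+ 2 * d) - - d - - d ≡ 0ℤ
          lem = ring

module PeriodicSum {q : ℕ} .{{_ : NonZero q}} {u : ℕ → ℤ} (per : Periodic q u) {b : ℕ} (u≤ : ∀ i → ∣ u i ∣ ℕ.≤ b) where

  periodic-sum : ∀ k → ∑< (k · q) u ≡ 0ℤ
  periodic-sum k = ∑<-blocks k q u ∙ ∑<-zero k (λ {i} _ → ∑<-cong q (λ {r} _ → cong u (+-comm (i · q) r) ∙ period-* q (Periodic.period per) i r) ∙ Periodic.mean per)

  O-u : ∀ {J : Set} {z k : J → ℕ} → O z 0 (λ j → u (k j))
  O-u {k = k} = of-order b (λ j → ≤-trans (u≤ (k j)) (≤-reflexive (sym (ℕ.*-identityʳ b))))

  abel-O : ∀ {J : Set} {z n : J → ℕ} {G : J → ℕ → ℤ} → O z 1 (λ j → + n j) → O z 5 (λ j → G j (n j)) → (∀ j → G j 0 ≡ 0ℤ) →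
    O {Σ[ j ∈ J ] Σ[ k ∈ ℕ ] k ℕ.< n j} (λ (j , _) → z j) 4 (λ (j , k , _) → Δ (G j) k) →
    O z 5 (λ j → ∑< (n j) (λ k → u k * G j k))
  abel-O {J} {z} {n} {G} n-O end-O start Δ-O = O-cancel q (O-≡ (λ j → sym (abel q u (G j) (n j) ∙ cong (λ x → integral q u (n j) * G j (n j) - integral q u 0 * x - T j) (start j) ∙ lem (integral q u (n j) * G j (n j)) (integral q u 0) (T j)))
      (O-- (O-* (O-integral n) end-O) (O-∑< {n = n} {f = λ j k → integral q u (suc k) * Δ (G j) k} n-O (O-* (O-integral (λ (_ , k , _) → suc k)) Δ-O))))
    where
    T : J → ℤ
    T j = ∑< (n j) (λ k → integral q u (suc k) * Δ (G j) k)
    lem : ∀ a b t → a - b * 0ℤ - t ≡ a - t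
    lem = ring
    O-integral : ∀ {J : Set} {z : J → ℕ} (k : J → ℕ) → O z 0 (λ j → integral q u (k j))
    O-integral k = of-order (∣ integral q u 0 ∣ ℕ.+ (q · (q · b) ℕ.+ q · (q · b))) (λ j → ≤-trans (all (k j)) (≤-reflexive (sym (ℕ.*-identityʳ _))))
      where
      all : ∀ i → ∣ integral q u i ∣ ℕ.≤ ∣ integral q u 0 ∣ ℕ.+ (q · (q · b) ℕ.+ q · (q · b))
      all zero = m≤m+n _ _
      all (suc i) = ≤-trans (integral-bound per u≤ i) (m≤n+m _ ∣ integral q u 0 ∣)

  c₁ c₂ : ℤ
  c₁ = + q * integral q (iterate q 1 u) 0
  c₂ = integral q (iterate q 2 u) 0

  main : ℤ → ℤ → ℤ
  main n d = - (+ q * + q * moment q u) * U n + c₁ * δ₁ n d - c₂ * δ₂ n d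

  module _ {J : Set} {z : J → ℕ} (y d n : J → ℕ) (y-O : O z 2 (λ j → + y j)) (d-O : O z 1 (λ j → + d j)) (d>0 : ∀ j → 0 ℕ.< d j) (y≤dn : ∀ j → y j ℕ.≤ d j · n j) where
    private
      F : J → ℕ → ℤ
      F j k = U (+ y j - + d j * + k)

      n₀ : J → ℕ
      n₀ j = suc (ℕ._/_ (y j) (d j) {{ℕ.>-nonZero (d>0 j)}})

      y≤dn₀ : ∀ j → y j ℕ.≤ d j · n₀ j
      y≤dn₀ j = ≤-trans (≤-reflexive (m≡m%n+[m/n]*n (y j) (d j))) (≤-trans (+-monoˡ-≤ _ (ℕ.<⇒≤ (m%n<n (y j) (d j)))) (≤-reflexive (ℕ.*-comm (n₀ j) (d j))))
        where instance _ = ℕ.>-nonZero (d>0 j)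

      n₀d≤ : ∀ j → n₀ j · d j ℕ.≤ d j ℕ.+ y j
      n₀d≤ j = ℕ.+-monoʳ-≤ (d j) (≤-trans (m≤n+m _ (y j ℕ.% d j)) (≤-reflexive (sym (m≡m%n+[m/n]*n (y j) (d j)))))
        where instance _ = ℕ.>-nonZero (d>0 j)

      vanish : ∀ j m → y j ℕ.≤ d j · m → ∀ k → m ℕ.≤ k → F j k ≡ 0ℤ
      vanish j m h k m≤k = U-nonpos (ℤ.≤-trans (ℤ.+-monoˡ-≤ (- (+ d j * + k)) (+≤+ (≤-trans h (*-monoʳ-≤ (d j) m≤k)))) (ℤ.≤-reflexive (cong (_- + d j * + k) (pos-* (d j) k) ∙ +-inverseʳ (+ d j * + k))))

      same-sum : ∀ j m m' → y j ℕ.≤ d j · m → y j ℕ.≤ d j · m' → ∑< m (λ k → u k * F j k) ≡ ∑< m' (λ k → u k * F j k)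
      same-sum j m m' h h' = sym (∑<-extend _ (m≤m+n m m') (vanish' m h)) ∙ ∑<-extend _ (m≤n+m m' m) (vanish' m' h')
        where
        vanish' : ∀ m → y j ℕ.≤ d j · m → ∀ {k} → m ℕ.≤ k → u k * F j k ≡ 0ℤ
        vanish' m h {k} m≤k = cong (u k *_) (vanish j m h k m≤k) ∙ *-zeroʳ (u k)

      Term : Set
      Term = Σ[ j ∈ J ] Σ[ k ∈ ℕ ] k ℕ.< n₀ j

      R : ℕ → Term → ℤ
      R i (j , k , _) = remainder (+ y j - + d j * + k) (+ y j - + d j * + (i ℕ.+ k) - (+ y j - + d j * + k))

      R-O : ∀ i → O (d ∘ proj₁) 3 (R i)
      R-O i = O-remainder (O-≡ (λ (j , k , _) → sym (lem (+ y j) (+ d j) (+ k) (+ i))) (O-scale (- + i) (of-order {f = λ (j , _) → + d j} 1 (λ (j , _) → ≤-trans (n≤1+n (d j)) (≤-reflexive (sym (ℕ.^-identityʳ _) ∙ sym (ℕ.*-identityˡ _)))))))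
        where lem : ∀ y d k i → y - d * (i + k) - (y - d * k) ≡ - i * d
              lem = ring

      Δ³-O : O (d ∘ proj₁) 3 (λ (j , k , _) → Δ (Δ (Δ (F j))) k)
      Δ³-O = O-≡ (λ (j , k , k<) → sym (U-Δ³ (λ k → + y j - + d j * + k) k (lem₁ (+ y j) (+ d j) (+ k)) ∙ lem₂ (+ y j) (+ d j) (+ k) (pos (+ y j - + d j * + k)) (R 3 (j , k , k<) - + 3 * R 2 (j , k , k<) + + 3 * R 1 (j , k , k<))))
        (O-+ (O-- (R-O 3) (O-scale (+ 3) (R-O 2))) (O-scale (+ 3) (R-O 1)))
        where
        lem₁ : ∀ y d k → let g = λ k → y - d * k in
          ((g (+ 3 + k) - g (+ 2 + k)) - (g (+ 2 + k) - g (1ℤ + k))) - ((g (+ 2 + k) - g (1ℤ + k)) - (g (1ℤ + k) - g k)) ≡ 0ℤ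
        lem₁ = ring
        lem₂ : ∀ y d k p r → let s = λ i → y - d * (i + k) - (y - d * k) in
          + 3 * p * (s (+ 3) * s (+ 3) - + 3 * (s (+ 2) * s (+ 2)) + + 3 * (s 1ℤ * s 1ℤ)) + r ≡ r
        lem₂ = ring

      tail : J → ℤ
      tail j = ∑< (n₀ j) (λ k → iterate q 3 u k * Δ (Δ (Δ (F j))) k)

      -- There are about y / d terms, each of order d³.
      tail-O : O z 4 tail
      tail-O = ≪⇒O (≪-∑< {n = n₀} {g = λ j → suc (d j) ℕ.^ 3} (O⇒≪ (O-* (of-order {k = 0} {f = λ (_ , k , _) → iterate q 3 u k} (proj₁ constant) (λ (_ , k , _) → ≤-trans (proj₂ constant per u≤ k) (≤-reflexive (sym (ℕ.*-identityʳ _))))) Δ³-O)))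
          (8 · O.constant size-O , λ j → ≤-trans (*-monoʳ-≤ (n₀ j) (≤-trans (^-monoˡ-≤ 3 (suc≤2 (d>0 j))) (≤-reflexive (lem₁ (d j))))) (≤-trans (≤-reflexive (lem₂ (n₀ j) (d j)))
            (≤-trans (*-monoʳ-≤ 8 (≤-trans (*-monoˡ-≤ (d j · d j) (n₀d≤ j)) (≤-trans (≤-reflexive (sym (∣size∣ j))) (O.within size-O j)))) (≤-reflexive (sym (ℕ.*-assoc 8 (O.constant size-O) (suc (z j) ℕ.^ 4)))))))
        where
        constant = iterate-bound q 3 b
        size-O : O z 4 (λ j → (+ d j + + y j) * (+ d j * + d j))
        size-O = O-* (O-+ (O-≤ {k = 1} (s≤s z≤n) d-O) y-O) (O-* d-O d-O)
        ∣size∣ : ∀ j → ∣ (+ d j + + y j) * (+ d j * + d j) ∣ ≡ (d j ℕ.+ y j) · (d j · d j)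
        ∣size∣ j = abs-* (+ d j + + y j) (+ d j * + d j) ∙ cong ((d j ℕ.+ y j) ·_) (abs-* (+ d j) (+ d j))
        suc≤2 : ∀ {m} → 0 ℕ.< m → suc m ℕ.≤ 2 · m
        suc≤2 {m} h = ≤-trans (+-monoˡ-≤ m h) (≤-reflexive (cong (m ℕ.+_) (sym (+-identityʳ m))))
        lem₁ : ∀ d → 2 · d · (2 · d · (2 · d · 1)) ≡ 8 · (d · (d · d))
        lem₁ = ringₙ
        lem₂ : ∀ n d → n · (8 · (d · (d · d))) ≡ 8 · (n · d · (d · d))
        lem₂ = ringₙ

    linear-O : O z 4 (λ j → + q * (+ q * (+ q * ∑< (n j) (λ k → u k * U (+ y j - + d j * + k)))) - main (+ y j) (+ d j))
    linear-O = O-≡ (λ j → sym (cong (λ s → + q * (+ q * (+ q * s)) - main (+ y j) (+ d j)) (same-sum j (n j) (n₀ j) (y≤dn j) (y≤dn₀ j)) ∙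
      trans (cong (_- main (+ y j) (+ d j)) (abel³ per (F j) (n₀ j) (vanish j (n₀ j) (y≤dn₀ j)) ∙ cong₂ (λ x y → x - y) (expand j) refl)) (minus-cancel (main (+ y j) (+ d j)) (tail j)))) (O-neg tail-O)
      where
      expand : ∀ j → - (+ q * + q * moment q u) * F j 0 + c₁ * Δ (F j) 0 - c₂ * Δ (Δ (F j)) 0 ≡ main (+ y j) (+ d j)
      expand j = cong₂ _-_ (cong₂ (λ v w → - (+ q * + q * moment q u) * U v + c₁ * (U w - U v)) (at₀ (+ y j) (+ d j)) (at₁ (+ y j) (+ d j)))
        (cong (c₂ *_) (cong₂ (λ v w → (U (+ y j - + d j * + 2) - U w) - (U w - U v)) (at₀ (+ y j) (+ d j)) (at₁ (+ y j) (+ d j)) ∙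
          trans (cong (λ x → (U (+ y j - x) - U (+ y j - + d j)) - (U (+ y j - + d j) - U (+ y j))) (*-comm (+ d j) (+ 2))) (lem' (U (+ y j - + 2 * + d j)) (U (+ y j - + d j)) (U (+ y j)))))
        where
        at₀ : ∀ y d → y - d * 0ℤ ≡ y
        at₀ = ring
        at₁ : ∀ y d → y - d * 1ℤ ≡ y - d
        at₁ = ring
        lem' : ∀ a b c → (a - b) - (b - c) ≡ a - b - b + c
        lem' = ring

cubed : ℕ → ℤ → ℤ
cubed q x = + q * (+ q * (+ q * x))

O-cubed : ∀ {I : Set} {z k} q {f : I → ℤ} → O z k f → O z k (λ i → cubed q (f i))
O-cubed q o = O-scale (+ q) (O-scale (+ q) (O-scale (+ q) o))

∑<-spread : ∀ n q (v S x d e : ℕ → ℤ) a c₁ c₂ → cubed q (∑< n (λ i → v i * S i)) ≡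
  - a * ∑< n (λ i → v i * x i) + c₁ * ∑< n (λ i → v i * d i) - c₂ * ∑< n (λ i → v i * e i)
    + ∑< n (λ i → v i * (cubed q (S i) - (- a * x i + c₁ * d i - c₂ * e i)))
∑<-spread zero q v S x d e a c₁ c₂ = cong (cubed q) (∑<-0 _) ∙ lem (+ q) a c₁ c₂ ∙
    sym (cong₂ _+_ (cong₂ _-_ (cong₂ (λ y z → - a * y + c₁ * z) (∑<-0 _) (∑<-0 _)) (cong (c₂ *_) (∑<-0 _))) (∑<-0 _))
  where lem : ∀ q a b c → q * (q * (q * 0ℤ)) ≡ - a * 0ℤ + b * 0ℤ - c * 0ℤ + 0ℤ
        lem = ring
∑<-spread (suc n) q v S x d e a c₁ c₂ = cong (cubed q) (∑<-suc n _) ∙ lem₁ (+ q) (∑< n (λ i → v i * S i)) (v n * S n) ∙ cong (_+ cubed q (v n * S n)) (∑<-spread n q v S x d e a c₁ c₂) ∙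
  trans (lem₂ (+ q) a c₁ c₂ (∑< n (λ i → v i * x i)) (∑< n (λ i → v i * d i)) (∑< n (λ i → v i * e i)) (∑< n _) (v n) (S n) (x n) (d n) (e n))
    (sym (cong₂ _+_ (cong₂ _-_ (cong₂ (λ y z → - a * y + c₁ * z) (∑<-suc n (λ i → v i * x i)) (∑<-suc n (λ i → v i * d i))) (cong (c₂ *_) (∑<-suc n (λ i → v i * e i)))) (∑<-suc n _)))
  where
  lem₁ : ∀ q s t → q * (q * (q * (s + t))) ≡ q * (q * (q * s)) + q * (q * (q * t))
  lem₁ = ring
  lem₂ : ∀ q a b c X D E T v s x d e → - a * X + b * D - c * E + T + q * (q * (q * (v * s))) ≡
    - a * (X + v * x) + b * (D + v * d) - c * (E + v * e) + (T + v * (q * (q * (q * s)) - (- a * x + b * d - c * e)))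
  lem₂ = ring

module TwistedSums (N p : ℕ) .{{_ : NonZero N}} .{{_ : NonZero p}} {ch w : ℕ → ℤ} (ch-per : Periodic N ch) (w-per : Periodic p w)
  {b b' : ℕ} (ch≤ : ∀ i → ∣ ch i ∣ ℕ.≤ b) (w≤ : ∀ i → ∣ w i ∣ ℕ.≤ b') (ch-0 : ch 0 ≡ 0ℤ) (p∣N : p ∣ₙ N) where
  module Ch = PeriodicSum ch-per ch≤
  module Wt = PeriodicSum w-per w≤

  Z Y Z⁻ : ℕ → ℕ
  Z s = N · suc s
  Y s = Z s · Z s
  Z⁻ s = ℕ.pred (Z s)

  Z-suc : ∀ s → suc (Z⁻ s) ≡ Z s
  Z-suc s = suc-pred (Z s) {{m*n≢0 N (suc s)}}

  U-Y : ℕ → ℤ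
  U-Y s = U (+ Y s)

  Below : Set
  Below = Σ[ s ∈ ℕ ] Σ[ k ∈ ℕ ] k ℕ.< Z s

  Below⁻ : Set
  Below⁻ = Σ[ s ∈ ℕ ] Σ[ k ∈ ℕ ] k ℕ.< Z⁻ s

  O-at-most : ∀ {J : Set} (φ : J → ℕ) (k : J → ℕ) → (∀ j → k j ℕ.≤ Z (φ j)) → O (Z ∘ φ) 1 (λ j → + k j)
  O-at-most φ k h = of-order 1 (λ j → ≤-trans (h j) (≤-trans (n≤1+n (Z (φ j))) (≤-reflexive (sym (ℕ.^-identityʳ _) ∙ sym (ℕ.*-identityˡ _)))))

  O-at-most² : ∀ {J : Set} (φ : J → ℕ) (k : J → ℕ) → (∀ j → k j ℕ.≤ Y (φ j)) → O (Z ∘ φ) 2 (λ j → + k j)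
  O-at-most² φ k h = below (O-* (O-at-most φ (Z ∘ φ) (λ _ → ≤-refl)) (O-at-most φ (Z ∘ φ) (λ _ → ≤-refl)))
    where
    below : O (Z ∘ φ) 2 (λ j → + Z (φ j) * + Z (φ j)) → O (Z ∘ φ) 2 (λ j → + k j)
    below (of-order c e) = of-order c (λ j → ≤-trans (h j) (≤-trans (≤-reflexive (sym (abs-* (+ Z (φ j)) (+ Z (φ j))))) (e j)))

  O-pos : ∀ {J : Set} {z k : J → ℕ} → O z 2 (λ j → + k j) → O z 2 (λ j → pos (+ k j))
  O-pos {k = k} = O-≡ (λ j → sym (pos-nonneg {+ k j} (+≤+ z≤n)))

  δ₁-0 : ∀ n → δ₁ n 0ℤ ≡ 0ℤ
  δ₁-0 n = cong (λ m → U m - U n) (ℤ.+-identityʳ n) ∙ +-inverseʳ (U n)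

  Z-O : O Z 1 (λ s → + Z s)
  Z-O = O-at-most id Z (λ _ → ≤-refl)

  Z⁻-O : O Z 1 (λ s → + Z⁻ s)
  Z⁻-O = O-at-most id Z⁻ (λ s → pred[n]≤n)

  below-O : ∀ {J : Set} (φ : J → ℕ) (k : J → ℕ) → (∀ j → k j ℕ.< Z⁻ (φ j)) → O (Z ∘ φ) 1 (λ j → + suc (k j))
  below-O φ k h = O-at-most φ (suc ∘ k) (λ j → ≤-trans (h j) pred[n]≤n)

  positive-sum : ∀ s (f : ℕ → ℤ) → f 0 ≡ 0ℤ → ∑< (Z s) f ≡ ∑₊ (Z⁻ s) f
  positive-sum s f f0 = cong (λ n → ∑< n f) (sym (Z-suc s)) ∙ ∑<-shift (Z⁻ s) f ∙ cong (_+ ∑₊ (Z⁻ s) f) f0 ∙ +-identityˡ _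

  NNM ppm : ℤ
  NNM = + N * + N * moment N ch
  ppm = + p * + p * moment p w

  innerA : ℕ → ℕ → ℤ
  innerA s j = ∑< (suc (Y s)) (λ e → ch e * U (+ Y s - + j * + e))

  A : ℕ → ℤ
  A s = ∑₊ (Z⁻ s) (λ j → w j * innerA s j)

  ∑₊-weights : ∀ s → ∑₊ (Z⁻ s) w ≡ - w 0
  ∑₊-weights s = from-zero (sym (∑<-shift (Z⁻ s) w) ∙ cong (λ n → ∑< n w) (Z-suc s) ∙ whole p∣N)
    where
    whole : p ∣ₙ N → ∑< (Z s) w ≡ 0ℤ
    whole (dividesₙ k e) = cong (λ n → ∑< n w) (cong (_· suc s) e ∙ lem k p (suc s)) ∙ Wt.periodic-sum (suc s · k)
      where lem : ∀ k p s → k · p · s ≡ s · k · p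
            lem = ringₙ
    from-zero : ∀ {a b} → a + b ≡ 0ℤ → b ≡ - a
    from-zero {a} {b} e = lem a b ∙ cong (λ x → - a + x) e ∙ ℤ.+-identityʳ (- a)
      where lem : ∀ a b → b ≡ - a + (a + b)
            lem = ring

  A-O : O Z 5 (λ s → cubed N (A s) - NNM * w 0 * U-Y s)
  A-O = O-≡ (λ s → sym (cong (_- NNM * w 0 * U-Y s) (∑<-spread (Z⁻ s) N (w ∘ suc) (innerA s ∘ suc) (λ _ → U-Y s) (λ j → δ₁ (+ Y s) (+ suc j)) (λ j → δ₂ (+ Y s) (+ suc j)) NNM Ch.c₁ Ch.c₂) ∙
      trans (cong (λ x → - NNM * x + Ch.c₁ * D s - Ch.c₂ * E₂ s + T s - NNM * w 0 * U-Y s) (∑<-*ʳ (Z⁻ s) (U-Y s) (w ∘ suc) ∙ cong (_* U-Y s) (∑₊-weights s))) (lem NNM (w 0) (U-Y s) (Ch.c₁ * D s) (Ch.c₂ * E₂ s) (T s))))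
    (O-+ (O-- (O-scale Ch.c₁ D-O) (O-scale Ch.c₂ (O-∑< {n = Z⁻} {f = λ s j → w (suc j) * δ₂ (+ Y s) (+ suc j)} Z⁻-O (O-* Wt.O-u (O-δ₂ (O-pos Y-O⁻) d-O)))))
      (O-∑< {n = Z⁻} {f = λ s j → w (suc j) * (cubed N (innerA s (suc j)) - Ch.main (+ Y s) (+ suc j))} Z⁻-O
        (O-* Wt.O-u (Ch.linear-O (Y ∘ proj₁) (λ (_ , k , _) → suc k) (λ (s , _) → suc (Y s)) Y-O⁻ d-O (λ _ → s≤s z≤n) (λ (s , k , _) → ≤-trans (n≤1+n (Y s)) (m≤n*m (suc (Y s)) (suc k)))))))
    where
    D E₂ T : ℕ → ℤ
    D s = ∑₊ (Z⁻ s) (λ j → w j * δ₁ (+ Y s) (+ j))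
    E₂ s = ∑₊ (Z⁻ s) (λ j → w j * δ₂ (+ Y s) (+ j))
    T s = ∑₊ (Z⁻ s) (λ j → w j * (cubed N (innerA s j) - Ch.main (+ Y s) (+ j)))
    lem : ∀ m w u d e t → - m * (- w * u) + d - e + t - m * w * u ≡ d - e + t
    lem = ring
    d-O : O {Below⁻} (Z ∘ proj₁) 1 (λ (_ , k , _) → + suc k)
    d-O = below-O proj₁ (λ (_ , k , _) → k) (λ (_ , _ , k<) → k<)
    Y-O⁻ : O {Below⁻} (Z ∘ proj₁) 2 (λ (s , _) → + Y s)
    Y-O⁻ = O-at-most² proj₁ (λ (s , _) → Y s) (λ _ → ≤-refl)
    Y-O : ∀ {J : Set} {φ : J → ℕ} → O (Z ∘ φ) 2 (λ j → + Y (φ j))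
    Y-O {φ = φ} = O-at-most² φ (Y ∘ φ) (λ _ → ≤-refl)
    D-O : O Z 5 D
    D-O = O-≡ (λ s → positive-sum s (λ j → w j * δ₁ (+ Y s) (+ j)) (cong (w 0 *_) (δ₁-0 (+ Y s)) ∙ *-zeroʳ (w 0)))
      (Wt.abel-O {G = λ s j → δ₁ (+ Y s) (+ j)} Z-O (O-δ₁ (O-pos Y-O) Z-O) (λ s → δ₁-0 (+ Y s))
        (O-≡ (λ (s , j , _) → cong (λ m → U m - U (+ Y s - + j)) (lem₁ (+ Y s) (+ j)) ∙ lem₂ (U (+ Y s - + suc j)) (U (+ Y s - + j)) (U (+ Y s)))
          (O-U₁ {n = λ (s , j , _) → + Y s - + j} (pos-O) (O-const {k = 0} -1ℤ) (O-const -1ℤ))))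
      where
      lem₁ : ∀ y j → y - j + -1ℤ ≡ y - (1ℤ + j)
      lem₁ = ring
      lem₂ : ∀ a b c → a - b ≡ a - c - (b - c)
      lem₂ = ring
      pos-O : O {Below} (Z ∘ proj₁) 2 (λ (s , j , _) → pos (+ Y s - + j))
      pos-O = below Y-O
        where
        below : O {Below} (Z ∘ proj₁) 2 (λ (s , j , _) → + Y s) → O {Below} (Z ∘ proj₁) 2 (λ (s , j , _) → pos (+ Y s - + j))
        below (of-order c h) = of-order c (λ i@(s , j , _) → ≤-trans (∣pos∣≤ (ℤ.i≤j⇒i-k≤j (+ j) ℤ.≤-refl)) (h i))

  y : ℕ → ℕ → ℕ
  y s e = (Z s ℕ.∸ e) · Z s

  y≤Y : ∀ s e → y s e ℕ.≤ Y s
  y≤Y s e = *-monoˡ-≤ (Z s) (ℕ.m∸n≤m (Z s) e)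

  y≡ : ∀ s e → e ℕ.≤ Z s → + y s e ≡ + Y s - + e * + Z s
  y≡ s e e≤Z = pos-* (Z s ℕ.∸ e) (Z s) ∙ cong (_* + Z s) (sym (ℤ.⊖-≥ e≤Z) ∙ sym (m-n≡m⊖n (Z s) e)) ∙ lem (+ Z s) (+ e) ∙ cong (_- + e * + Z s) (sym (pos-* (Z s) (Z s)))
    where lem : ∀ z e → (z - e) * z ≡ z * z - e * z
          lem = ring

  n₁ : ℕ → ℕ
  n₁ s = Y s ℕ.∸ Z⁻ s

  innerB : ℕ → ℕ → ℤ
  innerB s e = ∑< (n₁ s) (λ i → w i * U (+ y s e - + e * + i))

  B C : ℕ → ℤ
  B s = ∑< (Z s) (λ e → ch e * innerB s e)
  C s = ∑< (Z s) (λ e → ch e * U (+ y s e))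

  y-O : ∀ {J : Set} (φ e : J → ℕ) → O (Z ∘ φ) 2 (λ j → + y (φ j) (e j))
  y-O φ e = O-at-most² φ (λ j → y (φ j) (e j)) (λ j → y≤Y (φ j) (e j))

  C-O : O Z 5 (λ s → cubed N (C s) + NNM * U-Y s)
  C-O = O-≡ (λ s → lem (cubed N (C' s)) NNM (U-Y s) (Ch.c₁ * δ₁ (+ Y s) (+ Z s)) (Ch.c₂ * δ₂ (+ Y s) (+ Z s)) ∙ cong (λ x → cubed N x + NNM * U-Y s) (sym (C≡ s)))
    (O-+ (O-≤ (n≤1+n 4) (Ch.linear-O Y Z Z Y-O Z-O (λ s → ℕ.>-nonZero⁻¹ (Z s) {{m*n≢0 N (suc s)}}) (λ _ → ≤-refl)))
      (O-- (O-scale Ch.c₁ (O-δ₁ (O-pos Y-O) Z-O)) (O-≤ (n≤1+n 4) (O-scale Ch.c₂ (O-δ₂ (O-pos Y-O) Z-O)))))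
    where
    Y-O : O Z 2 (λ s → + Y s)
    Y-O = O-at-most² id Y (λ _ → ≤-refl)
    C' : ℕ → ℤ
    C' s = ∑< (Z s) (λ e → ch e * U (+ Y s - + Z s * + e))
    C≡ : ∀ s → C s ≡ C' s
    C≡ s = ∑<-cong (Z s) (λ {e} e<Z → cong (λ x → ch e * U x) (y≡ s e (ℕ.<⇒≤ e<Z) ∙ cong (λ x → + Y s - x) (*-comm (+ e) (+ Z s))))
    lem : ∀ c m u d e → c - (- m * u + d - e) + (d - e) ≡ c + m * u
    lem = ring

  B-O : O Z 5 (λ s → cubed p (B s) + ppm * C s)
  B-O = O-≡ (λ s → sym (cong (_+ ppm * C s) (∑<-spread (Z s) p ch (innerB s) (λ e → U (+ y s e)) (λ e → δ₁ (+ y s e) (+ e)) (λ e → δ₂ (+ y s e) (+ e)) ppm Wt.c₁ Wt.c₂) ∙ lem ppm (C s) (Wt.c₁ * D s) (Wt.c₂ * E₂ s) (T s)))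
    (O-+ (O-- (O-scale Wt.c₁ D-O) (O-scale Wt.c₂ (O-∑< {n = Z} {f = λ s e → ch e * δ₂ (+ y s e) (+ e)} Z-O (O-* Ch.O-u (O-δ₂ (O-pos (y-O proj₁ (λ (_ , k , _) → k))) e-O)))))
      (O-≡ (λ s → sym (positive-sum s (error s) (cong (_* error' s) ch-0 ∙ *-zeroˡ (error' s)))) (O-∑< {n = Z⁻} {f = λ s e → error s (suc e)} Z⁻-O
        (O-* Ch.O-u (Wt.linear-O (λ (s , k , _) → y s (suc k)) (λ (_ , k , _) → suc k) (n₁ ∘ proj₁) (y-O proj₁ (λ (_ , k , _) → suc k)) (below-O proj₁ (λ (_ , k , _) → k) (λ (_ , _ , k<) → k<)) (λ _ → s≤s z≤n) (λ (s , k , _) → long s k))))))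
    where
    error : ℕ → ℕ → ℤ
    error s e = ch e * (cubed p (innerB s e) - Wt.main (+ y s e) (+ e))
    error' : ℕ → ℤ
    error' s = cubed p (innerB s 0) - Wt.main (+ y s 0) (+ 0)
    D E₂ T : ℕ → ℤ
    D s = ∑< (Z s) (λ e → ch e * δ₁ (+ y s e) (+ e))
    E₂ s = ∑< (Z s) (λ e → ch e * δ₂ (+ y s e) (+ e))
    T s = ∑< (Z s) (error s)
    lem : ∀ m c d e t → - m * c + d - e + t + m * c ≡ d - e + t
    lem = ring
    e-O : O {Below} (Z ∘ proj₁) 1 (λ (_ , k , _) → + k)
    e-O = O-at-most proj₁ (λ (_ , k , _) → k) (λ (_ , _ , k<) → ℕ.<⇒≤ k<)
    long : ∀ s k → y s (suc k) ℕ.≤ suc k · n₁ s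
    long s k = ≤-trans (≤-trans (*-monoˡ-≤ (Z s) (ℕ.∸-monoʳ-≤ (Z s) (s≤s (z≤n {k})))) (≤-trans (≤-reflexive (*-distribʳ-∸ (Z s) (Z s) 1 ∙ cong (Y s ℕ.∸_) (ℕ.*-identityˡ (Z s)))) (ℕ.∸-monoʳ-≤ (Y s) (pred[n]≤n {Z s})))) (m≤n*m (n₁ s) (suc k))
    D-O : O Z 5 D
    D-O = Ch.abel-O {G = λ s e → δ₁ (+ y s e) (+ e)} Z-O (O-δ₁ (O-pos (y-O id Z)) Z-O) (λ s → δ₁-0 (+ y s 0))
      (O-≡ (λ (s , e , e<) → step s e e<)
        (O-U₂ (O-pos (y-O proj₁ (λ (_ , k , _) → k))) (O-- (O-neg (O-∘ {f = λ s → + Z s} proj₁ Z-O)) (O-+ {f = λ _ → 1ℤ} (O-const 1ℤ) e-O)) (O-neg (O-∘ {f = λ s → + Z s} proj₁ Z-O)) (O-neg e-O) (O-≡ (λ (s , e , _) → sym (linear (+ Z s) (+ e))) (O-const -1ℤ))))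
      where
      linear : ∀ z e → - z - (1ℤ + e) - - z - - e ≡ -1ℤ
      linear = ring
      step : ∀ s e → e ℕ.< Z s → U (+ y s e + (- + Z s - + suc e)) - U (+ y s e + - + Z s) - U (+ y s e + - + e) + U (+ y s e) ≡ Δ (λ e → δ₁ (+ y s e) (+ e)) e
      step s e e< = cong₂ (λ a b → U a - U b - U (+ y s e - + e) + U (+ y s e)) (sym (ℤ.+-assoc (+ y s e) (- + Z s) (- + suc e)) ∙ cong (_- + suc e) next) next ∙ lem' (U (+ y s (suc e) - + suc e)) (U (+ y s (suc e))) (U (+ y s e - + e)) (U (+ y s e))
        where
        next : + y s e - + Z s ≡ + y s (suc e)
        next = cong (_- + Z s) (y≡ s e (ℕ.<⇒≤ e<)) ∙ lem₁ (+ Y s) (+ e) (+ Z s) ∙ sym (y≡ s (suc e) e<)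
          where lem₁ : ∀ y e z → y - e * z - z ≡ y - (1ℤ + e) * z
                lem₁ = ring
        lem' : ∀ a b c d → a - b - c + d ≡ a - b - (c - d)
        lem' = ring

  total : ℕ → ℤ
  total s = ∑₊ (Y s) (λ e → ∑₊ (Y s) (λ j → ch e * (w j * U (+ Y s - + (e · j)))))

  total≡ : ∀ s → total s ≡ A s + B s
  total≡ s = begin
    ∑₊ Y' (λ e → ∑₊ Y' (T e)) ≡⟨ sym (+-identityˡ _) ∙ cong (_+ ∑₊ Y' (λ e → ∑₊ Y' (T e))) (sym (∑<-zero Y' (λ {j} _ → T-0 (suc j)))) ∙ sym (∑<-shift Y' (λ e → ∑₊ Y' (T e))) ⟩
    ∑< (suc Y') (λ e → ∑₊ Y' (T e)) ≡⟨ ∑<-swap (suc Y') Y' (λ e j → T e (suc j)) ⟩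
    ∑₊ Y' column ≡⟨ cong (λ n → ∑₊ n column) (ℕ.m+[n∸m]≡n Z⁻≤Y) ⟨
    ∑₊ (Z⁻ s ℕ.+ n₁ s) column ≡⟨ ∑<-+ (Z⁻ s) (n₁ s) (column ∘ suc) ⟩
    ∑₊ (Z⁻ s) column + ∑< (n₁ s) (λ i → column (suc (Z⁻ s) ℕ.+ i)) ≡⟨ cong₂ _+_ (∑<-cong (Z⁻ s) (λ {j} _ → column-A (suc j))) (cong (λ z → ∑< (n₁ s) (λ i → column (z ℕ.+ i))) (Z-suc s) ∙ rest) ⟩
    A s + B s ∎
    where
    Y' : ℕ
    Y' = Y s
    T : ℕ → ℕ → ℤ
    T e j = ch e * (w j * U (+ Y' - + (e · j)))
    T-0 : ∀ j → T 0 j ≡ 0ℤ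
    T-0 j = cong (_* (w j * U (+ Y' - 0ℤ))) ch-0 ∙ *-zeroˡ (w j * U (+ Y' - 0ℤ))
    column : ℕ → ℤ
    column j = ∑< (suc Y') (λ e → T e j)
    Z⁻≤Y : Z⁻ s ℕ.≤ Y'
    Z⁻≤Y = ≤-trans pred[n]≤n (m≤m*n (Z s) (Z s) {{m*n≢0 N (suc s)}})
    column-A : ∀ j → column j ≡ w j * innerA s j
    column-A j = ∑<-cong (suc Y') (λ {e} _ → *-left-swap (ch e) (w j) (U (+ Y' - + (e · j))) ∙ cong (λ x → w j * (ch e * U (+ Y' - x))) (pos-* e j ∙ *-comm (+ e) (+ j))) ∙ ∑<-*ˡ (suc Y') (w j) (λ e → ch e * U (+ Y' - + j * + e))
    shifted : ∀ i → w (Z s ℕ.+ i) ≡ w i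
    shifted i = go p∣N
      where
      go : p ∣ₙ N → w (Z s ℕ.+ i) ≡ w i
      go (dividesₙ k e) = cong w (+-comm (Z s) i) ∙ cong (λ z → w (i ℕ.+ z)) (cong (_· suc s) e ∙ lem k p (suc s)) ∙ period-* p (Periodic.period w-per) (suc s · k) i
        where
        lem : ∀ k p s → k · p · s ≡ s · k · p
        lem = ringₙ
    row : ∀ e → ∑< (n₁ s) (λ i → T e (Z s ℕ.+ i)) ≡ ch e * ∑< (n₁ s) (λ i → w i * U (+ Y' - + (e · (Z s ℕ.+ i))))
    row e = ∑<-cong (n₁ s) (λ {i} _ → cong (λ x → ch e * (x * U (+ Y' - + (e · (Z s ℕ.+ i))))) (shifted i)) ∙ ∑<-*ˡ (n₁ s) (ch e) _
    row-B : ∀ e → e ℕ.< Z s → ∑< (n₁ s) (λ i → T e (Z s ℕ.+ i)) ≡ ch e * innerB s e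
    row-B e e< = row e ∙ cong (ch e *_) (∑<-cong (n₁ s) (λ {i} _ → cong (λ x → w i * U x) (cong (λ x → + Y' - x) (pos-* e (Z s ℕ.+ i)) ∙ lem (+ Y') (+ e) (+ Z s) (+ i) ∙ cong (_- + e * + i) (sym (y≡ s e (ℕ.<⇒≤ e<))))))
      where lem : ∀ y e z i → y - e * (z + i) ≡ y - e * z - e * i
            lem = ring
    row-0 : ∀ {e} → Z s ℕ.≤ e → ∑< (n₁ s) (λ i → T e (Z s ℕ.+ i)) ≡ 0ℤ
    row-0 {e} Z≤e = ∑<-zero (n₁ s) (λ {i} _ → cong (λ x → ch e * (w (Z s ℕ.+ i) * x)) (U-nonpos (ℤ.≤-trans (ℤ.+-monoʳ-≤ (+ Y') (ℤ.neg-mono-≤ (+≤+ (*-mono-≤ Z≤e (m≤m+n (Z s) i))))) (ℤ.≤-reflexive (+-inverseʳ (+ Y'))))) ∙ cong (ch e *_) (*-zeroʳ (w (Z s ℕ.+ i))) ∙ *-zeroʳ (ch e))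
    rest : ∑< (n₁ s) (λ i → column (Z s ℕ.+ i)) ≡ B s
    rest = ∑<-swap (n₁ s) (suc Y') (λ i e → T e (Z s ℕ.+ i)) ∙
      trans (∑<-extend _ (≤-trans (m≤m*n (Z s) (Z s) {{m*n≢0 N (suc s)}}) (n≤1+n Y')) row-0) (∑<-cong (Z s) (λ {e} → row-B e))

  twisted-O : + 2 * moment p w ≡ + p * (+ p - 1ℤ) → w 0 ≡ 1ℤ - + p →
    O Z 5 (λ s → + 2 * cubed N (cubed p (total s)) + cubed p ((+ p - 1ℤ) * NNM) * U-Y s)
  twisted-O m≡ w0≡ = O-≡ (λ s → combine (+ N) (+ p) (A s) (B s) (C s) (moment N ch) (moment p w) (w 0) (U-Y s) ∙
      trans (cong₂ (λ m v → + 2 * cubed N (cubed p (A s + B s)) - + 2 * cubed p (NNM * v * U-Y s) - + p * + p * m * (NNM * U-Y s)) m≡ w0≡)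
      (cong (λ x → + 2 * cubed N (cubed p x) - + 2 * cubed p (NNM * (1ℤ - + p) * U-Y s) - + p * + p * (+ p * (+ p - 1ℤ)) * (NNM * U-Y s)) (sym (total≡ s)) ∙
        simplify (+ N) (+ p) (total s) (moment N ch) (U-Y s)))
    (O-- (O-+ (O-scale (+ 2) (O-cubed p A-O)) (O-scale (+ 2) (O-cubed N B-O))) (O-scale (+ 2 * ppm) C-O))
    where
    combine : ∀ N p A B C M m w u → let NNM = N * N * M; ppm = p * p * m in
      + 2 * (p * (p * (p * (N * (N * (N * A)) - NNM * w * u)))) + + 2 * (N * (N * (N * (p * (p * (p * B)) + ppm * C)))) - + 2 * ppm * (N * (N * (N * C)) + NNM * u) ≡
      + 2 * (N * (N * (N * (p * (p * (p * (A + B))))))) - + 2 * (p * (p * (p * (NNM * w * u)))) - p * p * (+ 2 * m) * (NNM * u)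
    combine = ring
    simplify : ∀ N p T M u → let NNM = N * N * M in
      + 2 * (N * (N * (N * (p * (p * (p * T)))))) - + 2 * (p * (p * (p * (NNM * (1ℤ - p) * u)))) - p * p * (p * (p - 1ℤ)) * (NNM * u) ≡
      + 2 * (N * (N * (N * (p * (p * (p * T)))))) + p * (p * (p * ((p - 1ℤ) * NNM))) * u
    simplify = ring

-- The class number formula

characters-opposite : ∀ {N ch} → Character N ch → ∀ x → 0 ℕ.< x → x ℕ.< N → ch (N ℕ.∸ x) ≡ - ch x
characters-opposite {N} {ch} character (suc x) _ x<N = begin
  ch (N ℕ.∸ suc x) ≡⟨ period-* N periodic x (N ℕ.∸ suc x) ⟨
  ch (N ℕ.∸ suc x ℕ.+ x · N) ≡⟨ cong ch congruent ⟩
  ch ((N ℕ.∸ 1) · suc x) ≡⟨ mult (N ℕ.∸ 1) (suc x) ⟩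
  ch (N ℕ.∸ 1) * ch (suc x) ≡⟨ cong (_* ch (suc x)) minus-one ⟩
  -1ℤ * ch (suc x) ≡⟨ -1*i≡-i (ch (suc x)) ⟩
  - ch (suc x) ∎
  where
  open Character character
  congruent : N ℕ.∸ suc x ℕ.+ x · N ≡ (N ℕ.∸ 1) · suc x
  congruent = sym (*-distribʳ-∸ (suc x) N 1 ∙ cong₂ ℕ._∸_ (ℕ.*-suc N x ∙ cong (N ℕ.+_) (ℕ.*-comm N x)) (+-identityʳ (suc x)) ∙ ℕ.+-∸-comm (x · N) (ℕ.<⇒≤ x<N))

self-opposite : ∀ {a} → a ≡ - a → a ≡ 0ℤ
self-opposite {a} e = *-cancelˡ (+ 2) (λ ()) (lem a ∙ cong (λ x → a + x) e ∙ +-inverseʳ a)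
  where lem : ∀ a → + 2 * a ≡ a + a
        lem = ring

character-0 : ∀ {N ch} → Character N ch → 1 ℕ.< N → ch 0 ≡ 0ℤ
character-0 {N} character N>1 = Character.zeros character 0 (λ (x , y , one) → contradiction (ℕ∣.∣1⇒≡1 (∣⇒∣ₙ (divides x (sym one ∙ lem x (+ N) y)))) (λ e → ℕ.<⇒≢ N>1 (sym e)))
  where lem : ∀ x n y → x * n + y * 0ℤ ≡ x * n
        lem = ring

character-periodic : ∀ {N ch} → Character N ch → 1 ℕ.< N → Periodic N ch
character-periodic {suc N'} {ch} character N>1 = record { period = Character.periodic character ; mean = trans (∑<-shift N' ch) (cong₂ _+_ (character-0 character N>1) (self-opposite odd-sum) ∙ refl) }
  where
  odd-sum : ∑< N' (ch ∘ suc) ≡ - ∑< N' (ch ∘ suc)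
  odd-sum = ∑<-reverse N' (ch ∘ suc) ∙ ∑<-cong N' (λ {i} i< → cong ch (sym (+-∸-assoc 1 i<)) ∙ characters-opposite character (suc i) (s≤s z≤n) (s≤s i<)) ∙
    trans (∑<-cong N' (λ {i} _ → sym (-1*i≡-i (ch (suc i))))) (∑<-*ˡ N' -1ℤ (ch ∘ suc) ∙ -1*i≡-i _)

character-bound : ∀ {N ch} → Character N ch → ∀ x → ∣ ch x ∣ ℕ.≤ 1
character-bound {N} {ch} character x = go (cop? N x)
  where
  go : Dec (Cop (+ N) (+ x)) → ∣ ch x ∣ ℕ.≤ 1
  go (yes c) = [ (λ e → ≤-reflexive (cong ∣_∣ e)) , (λ e → ≤-reflexive (cong ∣_∣ e)) ]′ (Character.units character x c)
  go (no ¬c) = subst (λ z → ∣ z ∣ ℕ.≤ 1) (sym (Character.zeros character x ¬c)) z≤n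

triangular : ∀ n → + 2 * ∑< n (λ i → + i) ≡ + n * (+ n - 1ℤ)
triangular zero = cong (+ 2 *_) (∑<-0 _) ∙ refl
triangular (suc n) = cong (+ 2 *_) (∑<-suc n _) ∙ lem₁ (∑< n (λ i → + i)) (+ n) ∙ cong (_+ + 2 * + n) (triangular n) ∙ lem₂ (+ n)
  where
  lem₁ : ∀ s n → + 2 * (s + n) ≡ + 2 * s + + 2 * n
  lem₁ = ring
  lem₂ : ∀ n → n * (n - 1ℤ) + + 2 * n ≡ (1ℤ + n) * ((1ℤ + n) - 1ℤ)
  lem₂ = ring

module _ {p : ℕ} (pr : Prime p) where
  open Weight p
  private instance
    _ = prime⇒nonZero pr

  weight-periodic : Periodic p (λ i → weight (+ i))
  weight-periodic = record { period = λ i → weight-Mod {+ (i ℕ.+ p)} {+ i} (divides 1ℤ (+-minusˡ (+ i) (+ p)))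
    ; mean = weight-mean {λ i → + i} (∑<-cong p (λ {i} _ → cong (λ z → ⟦ + p ∣? z ⟧) (lem' (+ i))) ∙ linear-roots pr 1ℤ 0ℤ (prime-∤1 pr)) }
    where
    lem' : ∀ i → i ≡ 0ℤ + 1ℤ * i
    lem' = ring

  weight-moment : + 2 * moment p (λ i → weight (+ i)) ≡ + p * (+ p - 1ℤ)
  weight-moment = cong (+ 2 *_) (∑<-cong p (λ {i} → term i)) ∙ triangular p
    where
    term : ∀ i → i ℕ.< p → + i * weight (+ i) ≡ + i
    term zero _ = refl
    term (suc i) i<p = cong (+ suc i *_) (weight-no {+ suc i} (λ d → contradiction (+-injective (small-∣⇒≡0 d i<p)) (λ ()))) ∙ *-identityʳ (+ suc i)

sixth-power : ∀ N .{{_ : NonZero N}} D → O (λ s → N · suc s) 5 (λ s → D * U (+ (N · suc s · (N · suc s)))) → D ≡ 0ℤ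
sixth-power N D (of-order c h) = go ∣ D ∣ refl
  where
  s Z : ℕ
  s = 32 · c
  Z = N · suc s
  Z>s : suc s ℕ.≤ Z
  Z>s = m≤n*m (suc s) N
  instance
    Z≢0 : NonZero Z
    Z≢0 = ℕ.>-nonZero (≤-trans (s≤s z≤n) Z>s)
  lem₁ : ∀ z → z · z · (z · z) · (z · z) ≡ z · (z · (z · (z · (z · (z · 1)))))
  lem₁ = ringₙ
  lem₂ : ∀ c z → c · (2 · z · (2 · z · (2 · z · (2 · z · (2 · z · 1))))) ≡ 32 · c · (z · (z · (z · (z · (z · 1)))))
  lem₂ = ringₙ
  U≡ : ∣ U (+ (Z · Z)) ∣ ≡ Z ℕ.^ 6
  U≡ = cong ∣_∣ (U-nonneg {+ (Z · Z)} (+≤+ z≤n)) ∙ abs-* (+ (Z · Z) * + (Z · Z)) (+ (Z · Z)) ∙ cong (_· (Z · Z)) (abs-* (+ (Z · Z)) (+ (Z · Z))) ∙ lem₁ Z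
  go : ∀ d → ∣ D ∣ ≡ d → D ≡ 0ℤ
  go zero e = ∣i∣≡0⇒i≡0 e
  go (suc d) e = contradiction (ℕ.*-cancelʳ-≤ Z s (Z ℕ.^ 5) {{ℕ.m^n≢0 Z 5}} (≤-trans (m≤m+n (Z ℕ.^ 6) _) (subst₂ ℕ._≤_ (abs-* D (U (+ (Z · Z))) ∙ cong₂ _·_ e U≡) (lem₂ c Z)
    (≤-trans (h s) (*-monoʳ-≤ c (^-monoˡ-≤ 5 {suc Z} {2 · Z} (≤-trans (+-monoˡ-≤ Z (ℕ.>-nonZero⁻¹ Z)) (≤-reflexive (cong (Z ℕ.+_) (sym (+-identityʳ Z))))))))))) (ℕ.<⇒≱ Z>s)

module ClassNumberFormula (𝓞 : QuadraticOrder) (h : ℕ) (order : HasOrder (ClassGroup (QuadraticOrder.m 𝓞)) h)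
  (ch : ℕ → ℤ) (character : Character (QuadraticOrder.N 𝓞) ch)
  (roots : ∀ q → Prime q → rootCount (QuadraticOrder.t 𝓞) (QuadraticOrder.n₀ 𝓞) q ≡ 1ℤ + ch q)
  (p : ℕ) (pr : Prime p) (p∣m : + p ∣ QuadraticOrder.m 𝓞) (p∣N : + p ∣ + QuadraticOrder.N 𝓞) where
  open LatticeSums 𝓞 h order p pr p∣m p∣N hiding (Z; Y)
  open DivisorSums t n₀ N disc-N (ramified-no-square 𝓞) ch character roots
  private
    instance
      N≢0 : NonZero N
      N≢0 = ℕ.>-nonZero (<-trans (s≤s z≤n) N>4)
      p≢0 : NonZero p
      p≢0 = prime⇒nonZero pr
    N>1 : 1 ℕ.< N
    N>1 = <-trans (s≤s (s≤s z≤n)) N>4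
  open TwistedSums N p (character-periodic character N>1) (weight-periodic pr) (character-bound character) (λ i → ∣weight∣≤ (+ i)) (character-0 character N>1) (∣⇒∣ₙ p∣N)

  weight-twist : ∀ e j z → ch e * (weight (+ (e · j)) * z) ≡ ch e * (weight (+ j) * z)
  weight-twist e j z = go (+ p ∣? + e)
    where
    go : Dec (+ p ∣ + e) → ch e * (weight (+ (e · j)) * z) ≡ ch e * (weight (+ j) * z)
    go (yes d) = vanish _ ∙ sym (vanish _)
      where
      vanish : ∀ y → ch e * y ≡ 0ℤ
      vanish y = cong (_* y) (Character.zeros character e (λ { (x , y , one) → prime-∤1 pr (subst (+ p ∣_) one (∣m∣n⇒∣m+n (∣n⇒∣m*n x p∣N) (∣n⇒∣m*n y d))) })) ∙ *-zeroˡ y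
    go (no ∤) = cong (λ w → ch e * (w * z)) (weight-cong (+ (e · j)) (+ j)
      (λ d → [ (λ d' → contradiction d' ∤) , id ]′ (prime-∣-* pr (+ e) (+ j) (subst (+ p ∣_) (pos-* e j) d)))
      (λ d → subst (+ p ∣_) (sym (pos-* e j)) (∣n⇒∣m*n (+ e) d)))

  lattice-sum : ℕ → ℤ
  lattice-sum s = ∑ (allFin h) (λ i → ∑ (interval (S s)) (λ x → ∑ (interval (S s)) (λ y → W s (value i x y))))

  lattice≡ : ∀ s → lattice-sum s ≡ + 2 * total s + + h * ((1ℤ - + p) * U-Y s)
  lattice≡ s = Sum.representation-sum (W s) (Y s) (S s) vanish bounded ∙
    cong₂ (λ x y → + 2 * x + + h * y)
      (root-sum≡character-sum (Y s) (λ n → W s (+ n)) (λ n Y<n → vanish n (ℕ.<⇒≤ Y<n)) ∙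
        ∑<-cong (Y s) (λ {e} _ → ∑<-cong (Y s) (λ {j} _ → weight-twist (suc e) (suc j) (U (+ Y s - + (suc e · suc j))))))
      (cong₂ _*_ (weight-yes {0ℤ} (divides 0ℤ (sym (*-zeroˡ (+ p))))) (cong U (ℤ.+-identityʳ (+ Y s))))
    where
    vanish : ∀ n → Y s ℕ.≤ n → W s (+ n) ≡ 0ℤ
    vanish n Y≤n = cong (weight (+ n) *_) (U-nonpos (ℤ.≤-trans (ℤ.+-monoˡ-≤ (- + n) (+≤+ Y≤n)) (ℤ.≤-reflexive (+-inverseʳ (+ n))))) ∙ *-zeroʳ (weight (+ n))
    bounded : ∀ i x y n → value i x y ≡ + n → n ℕ.< Y s → ∣ x ∣ ℕ.≤ S s × (∣_∣ y) ℕ.≤ S s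
    bounded i x y n e n<Y = within x (wide i s x y) , within y (tall i s x y)
      where
      within : ∀ z → (S s ℕ.≤ 2 ℕ.+ ∣ z ∣ → + Y s ≤ value i x y) → ∣ z ∣ ℕ.≤ S s
      within z large = ℕ.≮⇒≥ (λ S<z → contradiction (ℤ.drop‿+≤+ (subst (+ Y s ≤_) e (large (≤-trans (ℕ.<⇒≤ S<z) (m≤n+m _ 2))))) (ℕ.<⇒≱ n<Y))

  class-number-formula : + N * + h + moment N ch ≡ 0ℤ
  class-number-formula = *-cancelˡ (+ p * (+ p * (+ p * ((+ p - 1ℤ) * (+ N * + N))))) nonzero (sixth-power N _ (O-≡ (λ s → cong (λ x → + 2 * cubed N (cubed p (total s)) + cubed p ((+ p - 1ℤ) * NNM) * U-Y s - cubed N (cubed p x)) (lattice≡ s) ∙ lem (+ N) (+ p) (total s) (moment N ch) (+ h) (U-Y s))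
      (O-- (twisted-O (weight-moment pr) (weight-yes {0ℤ} (divides 0ℤ (sym (*-zeroˡ (+ p)))))) (O-cubed N (O-cubed p lattice-O)))) ∙ sym (*-zeroʳ (+ p * (+ p * (+ p * ((+ p - 1ℤ) * (+ N * + N)))))))
    where
    lem : ∀ N p T M h u → + 2 * (N * (N * (N * (p * (p * (p * T)))))) + p * (p * (p * ((p - 1ℤ) * (N * N * M)))) * u - N * (N * (N * (p * (p * (p * (+ 2 * T + h * ((1ℤ - p) * u))))))) ≡
      p * (p * (p * ((p - 1ℤ) * (N * N)))) * (N * h + M) * u
    lem = ring
    nonzero : + p * (+ p * (+ p * ((+ p - 1ℤ) * (+ N * + N)))) ≢ 0ℤ
    nonzero = i*j≢0 +p≢0 (i*j≢0 +p≢0 (i*j≢0 +p≢0 (i*j≢0 p-1≢0 (i*j≢0 +N≢0 +N≢0))))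
      where
      +p≢0 : + p ≢ 0ℤ
      +p≢0 e = ℕ.≢-nonZero⁻¹ p (+-injective e)
      +N≢0 : + N ≢ 0ℤ
      +N≢0 e = ℕ.≢-nonZero⁻¹ N (+-injective e)
      p-1≢0 : + p - 1ℤ ≢ 0ℤ
      p-1≢0 e = ℕ.¬prime[1] (subst Prime (+-injective (sym (lem' (+ p)) ∙ cong (_+ 1ℤ) e)) pr)
        where lem' : ∀ p → p - 1ℤ + 1ℤ ≡ p
              lem' = ring

-- Character sums over the intervals (kN/B , (k+1)N/B)

module Bands {N : ℕ} .{{_ : NonZero N}} {ch : ℕ → ℤ} (character : Character N ch) (N>1 : 1 ℕ.< N) where
  open Character character

  floor : ℕ → ℕ → ℕ
  floor B x = x · B ℕ./ N

  band : ℕ → ℕ → ℤ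
  band B k = ∑< N (λ x → ⟦ floor B x ℕ.≟ k ⟧ * ch x)

  not-divisible : ∀ {B x} → Cop (+ N) (+ B) → Cop (+ N) (+ x) → x · B ℕ.% N ≢ 0
  not-divisible {B} {x} cB cx e = contradiction (ℕ∣.∣1⇒≡1 (∣⇒∣ₙ (cop-∣ (cop-* cx cB) (subst (+ N ∣_) (pos-* x B ∙ sym (*-identityʳ (+ x * + B))) (∣ₙ⇒∣ (ℕ∣.m%n≡0⇒n∣m (x · B) N e)))))) (λ e → ℕ.<⇒≢ N>1 (sym e))

  on-units : ∀ x {f g} → (Cop (+ N) (+ x) → f ≡ g) → f * ch x ≡ g * ch x
  on-units x {f} {g} h = go (cop? N x)
    where
    go : Dec (Cop (+ N) (+ x)) → f * ch x ≡ g * ch x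
    go (yes c) = cong (_* ch x) (h c)
    go (no ¬c) = cong (f *_) (zeros x ¬c) ∙ *-zeroʳ f ∙ sym (cong (g *_) (zeros x ¬c) ∙ *-zeroʳ g)

  strictly-between⇒floor : ∀ {B x k} → k · N ℕ.< x · B × x · B ℕ.< suc k · N → floor B x ≡ k
  strictly-between⇒floor {B} {x} {k} (lower , upper) = ℕ.≤-antisym (ℕ.s≤s⁻¹ (ℕ.m<n*o⇒m/o<n upper)) (≤-trans (≤-reflexive (sym (ℕ.m*n/n≡m k N))) (ℕ./-monoˡ-≤ N (ℕ.<⇒≤ lower)))

  floor⇒strictly-between : ∀ {B x k} → x · B ℕ.% N ≢ 0 → floor B x ≡ k → k · N ℕ.< x · B × x · B ℕ.< suc k · N
  floor⇒strictly-between {B} {x} r≢0 refl =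
    ≤-trans (+-monoˡ-≤ _ (n≢0⇒n>0 r≢0)) (≤-reflexive (sym split)) , ≤-trans (s≤s (≤-reflexive split)) (+-monoˡ-≤ _ (m%n<n (x · B) N))
    where
    split : x · B ≡ x · B ℕ.% N ℕ.+ floor B x · N
    split = m≡m%n+[m/n]*n (x · B) N

  X-sum≡band : ∀ B k → Cop (+ N) (+ B) → sumℤ (map ch (X[ N ] B k)) ≡ band B k
  X-sum≡band B k cB = begin
    sumℤ (map ch (X[ N ] B k)) ≡⟨ ∑-def (X[ N ] B k) ch ⟨
    ∑ (X[ N ] B k) ch ≡⟨ ∑-filter in? (X N) ch ⟩
    ∑ (X N) (λ x → ⟦ in? x ⟧ * ch x) ≡⟨ ∑-filter (λ x → coprime? x N) (map suc (upTo N)) _ ⟩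
    ∑ (map suc (upTo N)) (λ x → ⟦ coprime? x N ⟧ * (⟦ in? x ⟧ * ch x)) ≡⟨ ∑-map suc (upTo N) _ ∙ sym (∑<≡∑ N _) ⟩
    ∑₊ N (λ x → ⟦ coprime? x N ⟧ * (⟦ in? x ⟧ * ch x)) ≡⟨ ∑<-cong N (λ {x} _ → sym (*-assoc ⟦ coprime? (suc x) N ⟧ _ (ch (suc x))) ∙ on-units (suc x) (λ c → cong (_* ⟦ in? (suc x) ⟧) (⟦⟧-yes (coprime? (suc x) N) (Coprimality.gcd≡1⇒coprime (cop⇒gcd N (suc x) c))) ∙
                                                                             trans (*-identityˡ ⟦ in? (suc x) ⟧) (⟦⟧-cong (in? (suc x)) (floor B (suc x) ℕ.≟ k) (strictly-between⇒floor {B} {suc x}) (floor⇒strictly-between {B} {suc x} (not-divisible cB c))))) ⟩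
    ∑₊ N term ≡⟨ cong (_+ ∑₊ N term) (vanish 0 (character-0 character N>1)) ∙ +-identityˡ (∑₊ N term) ⟨
    term 0 + ∑₊ N term ≡⟨ sym (∑<-shift N term) ∙ ∑<-suc N term ⟩
    band B k + term N ≡⟨ cong (λ z → band B k + z) (vanish N (periodic 0 ∙ character-0 character N>1)) ∙ ℤ.+-identityʳ (band B k) ⟩
    band B k ∎
    where
    in? : ∀ x → Dec (k · N ℕ.< x · B × x · B ℕ.< suc k · N)
    in? x = (k · N ℕ.<? x · B) ×-dec (x · B ℕ.<? suc k · N)
    term : ℕ → ℤ
    term x = ⟦ floor B x ℕ.≟ k ⟧ * ch x
    vanish : ∀ x → ch x ≡ 0ℤ → term x ≡ 0ℤ
    vanish x e = cong (⟦ floor B x ℕ.≟ k ⟧ *_) e ∙ *-zeroʳ ⟦ floor B x ℕ.≟ k ⟧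

  opposite-floor : ∀ {B x k} → Cop (+ N) (+ B) → Cop (+ N) (+ x) → x ℕ.< N → k ℕ.< B → floor B x ≡ k → floor B (N ℕ.∸ x) ≡ B ℕ.∸ suc k
  opposite-floor {B} {x} {k} cB cx x<N k<B e = strictly-between⇒floor {B} {N ℕ.∸ x} (reflect (floor⇒strictly-between {B} {x} (not-divisible cB cx) e))
    where
    total : ∀ j → N · B ℕ.∸ j · N ≡ (B ℕ.∸ j) · N
    total j = cong (ℕ._∸ j · N) (ℕ.*-comm N B) ∙ sym (*-distribʳ-∸ N B j)
    reflect : k · N ℕ.< x · B × x · B ℕ.< suc k · N → (B ℕ.∸ suc k) · N ℕ.< (N ℕ.∸ x) · B × (N ℕ.∸ x) · B ℕ.< suc (B ℕ.∸ suc k) · N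
    reflect (lower , upper) =
      subst₂ ℕ._<_ (total (suc k)) (sym (*-distribʳ-∸ B N x)) (∸-monoʳ-< upper (subst (suc k · N ℕ.≤_) (ℕ.*-comm B N) (*-monoˡ-≤ N k<B))) ,
      subst₂ ℕ._<_ (sym (*-distribʳ-∸ B N x)) (total k ∙ cong (_· N) (+-∸-assoc 1 k<B)) (∸-monoʳ-< lower (*-monoˡ-≤ B (ℕ.<⇒≤ x<N)))

  band-opposite : ∀ {B k} → Cop (+ N) (+ B) → k ℕ.< B → band B (B ℕ.∸ suc k) ≡ - band B k
  band-opposite {B} {k} cB k<B = begin
    band B (B ℕ.∸ suc k) ≡⟨ positive (B ℕ.∸ suc k) ⟩
    ∑₊ (ℕ.pred N) (term (B ℕ.∸ suc k)) ≡⟨ ∑<-reverse (ℕ.pred N) _ ⟩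
    ∑< (ℕ.pred N) (λ i → term (B ℕ.∸ suc k) (suc (ℕ.pred N ℕ.∸ suc i))) ≡⟨ ∑<-cong (ℕ.pred N) (λ {i} i< → flipped i i<) ⟩
    ∑₊ (ℕ.pred N) (λ x → -1ℤ * term k x) ≡⟨ ∑<-*ˡ (ℕ.pred N) -1ℤ (term k ∘ suc) ∙ -1*i≡-i _ ⟩
    - ∑₊ (ℕ.pred N) (term k) ≡⟨ cong -_ (positive k) ⟨
    - band B k ∎
    where
    term : ℕ → ℕ → ℤ
    term k x = ⟦ floor B x ℕ.≟ k ⟧ * ch x
    positive : ∀ k → band B k ≡ ∑₊ (ℕ.pred N) (term k)
    positive k = cong (λ n → ∑< n (term k)) (sym (suc-pred N)) ∙ ∑<-shift (ℕ.pred N) (term k) ∙ cong (_+ ∑₊ (ℕ.pred N) (term k)) (cong (⟦ floor B 0 ℕ.≟ k ⟧ *_) (character-0 character N>1) ∙ *-zeroʳ ⟦ floor B 0 ℕ.≟ k ⟧) ∙ +-identityˡ _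
    flipped : ∀ i → i ℕ.< ℕ.pred N → term (B ℕ.∸ suc k) (suc (ℕ.pred N ℕ.∸ suc i)) ≡ -1ℤ * term k (suc i)
    flipped i i< = begin
      term k' (suc (ℕ.pred N ℕ.∸ suc i)) ≡⟨ cong (term k') (sym (+-∸-assoc 1 i<) ∙ cong (ℕ._∸ x) (suc-pred N)) ⟩
      ⟦ floor B (N ℕ.∸ x) ℕ.≟ k' ⟧ * ch (N ℕ.∸ x) ≡⟨ cong (⟦ floor B (N ℕ.∸ x) ℕ.≟ k' ⟧ *_) (characters-opposite character x (s≤s z≤n) x<N) ⟩
      ⟦ floor B (N ℕ.∸ x) ℕ.≟ k' ⟧ * - ch x ≡⟨ lem ⟦ floor B (N ℕ.∸ x) ℕ.≟ k' ⟧ (ch x) ⟩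
      -1ℤ * (⟦ floor B (N ℕ.∸ x) ℕ.≟ k' ⟧ * ch x) ≡⟨ cong (-1ℤ *_) (on-units x (λ c → ⟦⟧-cong (floor B (N ℕ.∸ x) ℕ.≟ k') (floor B x ℕ.≟ k) (back c) (opposite-floor cB c x<N k<B))) ⟩
      -1ℤ * term k x ∎
      where
      k' x : ℕ
      k' = B ℕ.∸ suc k
      x = suc i
      x<N : x ℕ.< N
      x<N = subst (x ℕ.<_) (suc-pred N) (s≤s i<)
      lem : ∀ a b → a * - b ≡ -1ℤ * (a * b)
      lem = ring
      back : Cop (+ N) (+ x) → floor B (N ℕ.∸ x) ≡ k' → floor B x ≡ k
      back c e = cong (floor B) (sym (ℕ.m∸[m∸n]≡n (ℕ.<⇒≤ x<N))) ∙ opposite-floor cB (cop-mod' c) (∸-monoʳ-< {N} (s≤s z≤n) (ℕ.<⇒≤ x<N)) (∸-monoʳ-< {B} (s≤s z≤n) k<B) e ∙ unfold k<B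
        where
        unfold : ∀ {B k} → k ℕ.< B → B ℕ.∸ suc (B ℕ.∸ suc k) ≡ k
        unfold {suc B} {k} (s≤s k≤B) = ℕ.m∸[m∸n]≡n k≤B
        cop-mod' : Cop (+ N) (+ x) → Cop (+ N) (+ (N ℕ.∸ x))
        cop-mod' (a , b , one) = a + b , - b , cong (λ z → (a + b) * + N + - b * z) (sym (ℤ.⊖-≥ (ℕ.<⇒≤ x<N)) ∙ sym (m-n≡m⊖n N x)) ∙ lem' a b (+ N) (+ x) ∙ one
          where lem' : ∀ a b n x → (a + b) * n + - b * (n - x) ≡ a * n + b * x
                lem' = ring

  floor-< : ∀ {B x} → x ℕ.< N → 0 ℕ.< B → floor B x ℕ.< B
  floor-< {B} {x} x<N B>0 = ℕ.m<n*o⇒m/o<n (<-≤-trans (ℕ.*-monoˡ-< B {{ℕ.>-nonZero B>0}} x<N) (≤-reflexive (ℕ.*-comm N B)))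

  band-sum : ∀ B → 0 ℕ.< B → (g : ℕ → ℤ) → ∑< B (λ k → g k * band B k) ≡ ∑< N (λ x → g (floor B x) * ch x)
  band-sum B B>0 g = ∑<-cong B (λ {k} _ → sym (∑<-*ˡ N (g k) _)) ∙ ∑<-swap B N (λ k x → g k * (⟦ floor B x ℕ.≟ k ⟧ * ch x)) ∙
    ∑<-cong N (λ {x} x<N → ∑<-single B {floor B x} (λ k → g k * (⟦ floor B x ℕ.≟ k ⟧ * ch x)) (floor-< x<N B>0)
        (λ {k} _ k≢ → cong (λ z → g k * (z * ch x)) (⟦⟧-no (floor B x ℕ.≟ k) (λ e → k≢ (sym e))) ∙ cong (g k *_) (*-zeroˡ (ch x)) ∙ *-zeroʳ (g k)) ∙
      cong (g (floor B x) *_) (cong (_* ch x) (⟦⟧-yes (floor B x ℕ.≟ floor B x) refl) ∙ *-identityˡ (ch x)))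

  unit-square' : ∀ B → Cop (+ N) (+ B) → ch B * ch B ≡ 1ℤ
  unit-square' B cB = [ (λ e → cong₂ _*_ e e) , (λ e → cong₂ _*_ e e) ]′ (units B cB)

  floor-moment : ∀ B → Cop (+ N) (+ B) → + N * ∑< N (λ x → + floor B x * ch x) ≡ (+ B - ch B) * moment N ch
  floor-moment B cB = begin
    + N * ∑< N (λ x → + floor B x * ch x) ≡⟨ ∑<-*ˡ N (+ N) _ ⟨
    ∑< N (λ x → + N * (+ floor B x * ch x)) ≡⟨ ∑<-cong N (λ {x} _ → pointwise x) ⟩
    ∑< N (λ x → + B * (+ x * ch x) + - ch B * F (0ℤ + + B * + x)) ≡⟨ ∑<-+' N _ _ ⟩
    ∑< N (λ x → + B * (+ x * ch x)) + ∑< N (λ x → - ch B * F (0ℤ + + B * + x)) ≡⟨ cong₂ _+_ (∑<-*ˡ N (+ B) _) (∑<-*ˡ N (- ch B) _) ⟩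
    + B * moment N ch + - ch B * ∑< N (λ x → F (0ℤ + + B * + x)) ≡⟨ cong (λ z → + B * moment N ch + - ch B * z) (permuted (cop-inverse cB) ∙ ∑<-cong N (λ {x} x<N → cong (λ z → + z * ch z) (ℕ.m<n⇒m%n≡m x<N))) ⟩
    + B * moment N ch + - ch B * moment N ch ≡⟨ ℤ.*-distribʳ-+ (moment N ch) (+ B) (- ch B) ⟨
    (+ B - ch B) * moment N ch ∎
    where
    F : ℤ → ℤ
    F z = + (z %ℕ N) * ch (z %ℕ N)
    F-Mod : Mod N F
    F-Mod {x} {y} d = cong (λ z → + z * ch z) (residue-unique (n%ℕd<d x N) (n%ℕd<d y N) (subst (+ N ∣_) (minus-chain x y (+ (x %ℕ N)) (+ (y %ℕ N))) (∣m∣n⇒∣m+n (∣m∣n⇒∣m-n d (∣-%ℕ x N)) (∣-%ℕ y N))))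
    permuted : (∃[ a' ] + N ∣ + B * a' - 1ℤ) → ∑< N (λ x → F (0ℤ + + B * + x)) ≡ ∑< N (λ x → F (+ x))
    permuted (a' , inv) = ∑<-affine N (+ B) a' 0ℤ {F} (λ {u} {v} → F-Mod {u} {v}) inv
    pointwise : ∀ x → + N * (+ floor B x * ch x) ≡ + B * (+ x * ch x) + - ch B * F (0ℤ + + B * + x)
    pointwise x = begin
      + N * (+ floor B x * ch x) ≡⟨ lem₁ (+ N) (+ floor B x) (+ r) (ch x) ⟩
      (+ r + + floor B x * + N) * ch x - + r * (1ℤ * ch x) ≡⟨ cong₂ (λ a b → a * ch x - + r * (b * ch x)) (sym xB) (sym (unit-square' B cB)) ⟩
      + x * + B * ch x - + r * (ch B * ch B * ch x) ≡⟨ lem₂ (+ x) (+ B) (ch x) (ch B) (+ r) ⟩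
      + B * (+ x * ch x) + - ch B * (+ r * (ch x * ch B)) ≡⟨ cong (λ z → + B * (+ x * ch x) + - ch B * (+ r * z)) (sym (mult x B) ∙ cong ch (m≡m%n+[m/n]*n (x · B) N) ∙ period-* N periodic (floor B x) r) ⟩
      + B * (+ x * ch x) + - ch B * F (+ (x · B)) ≡⟨ cong (λ z → + B * (+ x * ch x) + - ch B * F z) (pos-* x B ∙ *-comm (+ x) (+ B) ∙ sym (+-identityˡ (+ B * + x))) ⟩
      + B * (+ x * ch x) + - ch B * F (0ℤ + + B * + x) ∎
      where
      r : ℕ
      r = x · B ℕ.% N
      xB : + x * + B ≡ + r + + floor B x * + N
      xB = sym (pos-* x B) ∙ cong +_ (m≡m%n+[m/n]*n (x · B) N) ∙ cong (λ z → + r + z) (pos-* (floor B x) N)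
      lem₁ : ∀ n q r c → n * (q * c) ≡ (r + q * n) * c - r * (1ℤ * c)
      lem₁ = ring
      lem₂ : ∀ x b c d r → x * b * c - r * (d * d * c) ≡ b * (x * c) + - d * (r * (c * d))
      lem₂ = ring

  module _ (h : ℕ) (formula : + N * + h + moment N ch ≡ 0ℤ) where

    weighted-band-sum : ∀ B → 1 ℕ.< B → Cop (+ N) (+ B) → ∑< (B ℕ./ 2) (λ k → (+ B - + 1 - + 2 * + k) * band B k) ≡ (+ B - ch B) * + h
    weighted-band-sum B B>1 cB = *-cancelˡ (+ 2 * + N) (i*j≢0 {+ 2} {+ N} (λ ()) (λ e → ℕ.≢-nonZero⁻¹ N (+-injective e))) (begin
      + 2 * + N * ∑< (B ℕ./ 2) T ≡⟨ cong (_* ∑< (B ℕ./ 2) T) (*-comm (+ 2) (+ N)) ∙ *-assoc (+ N) (+ 2) _ ⟩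
      + N * (+ 2 * ∑< (B ℕ./ 2) T) ≡⟨ cong (+ N *_) (doubled (even⊎odd B)) ⟨
      + N * ∑< B T ≡⟨ cong (+ N *_) (band-sum B (<-trans (s≤s z≤n) B>1) g) ⟩
      + N * ∑< N (λ x → g (floor B x) * ch x) ≡⟨ cong (+ N *_) (∑<-cong N (λ {x} _ → lem₁ (+ B) (+ floor B x) (ch x)) ∙ ∑<-+' N _ _ ∙ cong₂ _+_ (∑<-*ˡ N (+ B - + 1) ch) (∑<-*ˡ N (- + 2) _)) ⟩
      + N * ((+ B - + 1) * ∑< N ch + - + 2 * V) ≡⟨ cong (λ z → + N * ((+ B - + 1) * z + - + 2 * V)) (Periodic.mean (character-periodic character N>1)) ⟩
      + N * ((+ B - + 1) * 0ℤ + - + 2 * V) ≡⟨ lem₂ (+ N) (+ B) V ⟩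
      - + 2 * (+ N * V) ≡⟨ cong (- + 2 *_) (floor-moment B cB) ⟩
      - + 2 * ((+ B - ch B) * moment N ch) ≡⟨ lem₃ (+ B - ch B) (moment N ch) (+ N * + h) ⟩
      + 2 * ((+ B - ch B) * (+ N * + h)) - + 2 * (+ B - ch B) * (+ N * + h + moment N ch) ≡⟨ cong (λ z → + 2 * ((+ B - ch B) * (+ N * + h)) - + 2 * (+ B - ch B) * z) formula ⟩
      + 2 * ((+ B - ch B) * (+ N * + h)) - + 2 * (+ B - ch B) * 0ℤ ≡⟨ lem₄ (+ B - ch B) (+ N) (+ h) ⟩
      + 2 * + N * ((+ B - ch B) * + h) ∎)
      where
      g T : ℕ → ℤ
      g k = + B - + 1 - + 2 * + k
      T k = g k * band B k
      V : ℤ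
      V = ∑< N (λ x → + floor B x * ch x)
      lem₁ : ∀ b q c → (b - + 1 - + 2 * q) * c ≡ (b - + 1) * c + - + 2 * (q * c)
      lem₁ = ring
      lem₂ : ∀ n b v → n * ((b - + 1) * 0ℤ + - + 2 * v) ≡ - + 2 * (n * v)
      lem₂ = ring
      lem₃ : ∀ c m n → - + 2 * (c * m) ≡ + 2 * (c * n) - + 2 * c * (n + m)
      lem₃ = ring
      lem₄ : ∀ c n h → + 2 * (c * (n * h)) - + 2 * c * 0ℤ ≡ + 2 * n * (c * h)
      lem₄ = ring
      symmetric : ∀ k → k ℕ.< B → T (B ℕ.∸ suc k) ≡ T k
      symmetric k k<B = cong₂ (λ a b → (+ B - + 1 - + 2 * a) * b) (sym (ℤ.⊖-≥ k<B) ∙ sym (m-n≡m⊖n B (suc k))) (band-opposite cB k<B) ∙ lem (+ B) (+ k) (band B k)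
        where lem : ∀ b k e → (b - + 1 - + 2 * (b - (1ℤ + k))) * - e ≡ (b - + 1 - + 2 * k) * e
              lem = ring
      reflected : ∀ H R → B ≡ H ℕ.+ R → ∑< H (λ i → T (R ℕ.+ i)) ≡ ∑< H T
      reflected H R B≡ = ∑<-reverse H _ ∙ ∑<-cong H (λ {i} i<H → cong T (sym (+-∸-assoc R i<H) ∙ cong (ℕ._∸ suc i) (+-comm R H ∙ sym B≡)) ∙ symmetric i (<-≤-trans i<H (subst (H ℕ.≤_) (sym B≡) (m≤m+n H R))))
      halve : ∀ r H → r ℕ.< 2 → (r ℕ.+ (H ℕ.+ H)) ℕ./ 2 ≡ H
      halve r H r<2 = cong (λ n → (r ℕ.+ n) ℕ./ 2) (lem H) ∙ ℕ.+-distrib-/-∣ʳ r (dividesₙ H refl) ∙ cong₂ ℕ._+_ (ℕ.m<n⇒m/n≡0 r<2) (ℕ.m*n/n≡m H 2)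
        where lem : ∀ H → H ℕ.+ H ≡ H · 2
              lem = ringₙ
      doubled : (∃[ H ] B ≡ H ℕ.+ H) ⊎ (∃[ H ] B ≡ odd H) → ∑< B T ≡ + 2 * ∑< (B ℕ./ 2) T
      doubled (inj₁ (H , e)) = cong (λ n → ∑< n T) e ∙ ∑<-+ H H T ∙ cong (λ z → ∑< H T + z) (reflected H H e) ∙ +-double (∑< H T) ∙ cong (λ n → + 2 * ∑< n T) (sym (cong (ℕ._/ 2) e ∙ halve 0 H (s≤s z≤n)))
      doubled (inj₂ (H , e)) = cong (λ n → ∑< n T) e ∙ ∑<-+ (suc H) H T ∙ cong₂ _+_ (∑<-suc H T ∙ cong (λ z → ∑< H T + z) middle ∙ ℤ.+-identityʳ (∑< H T)) (reflected H (suc H) (e ∙ sym (+-suc H H))) ∙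
          trans (+-double (∑< H T)) (cong (λ n → + 2 * ∑< n T) (sym (cong (ℕ._/ 2) e ∙ halve 1 H (s≤s (s≤s z≤n)))))
        where
        middle : T H ≡ 0ℤ
        middle = cong (λ b → (+ b - + 1 - + 2 * + H) * band B H) e ∙ cong (_* band B H) (lem (+ H)) ∙ *-zeroˡ (band B H)
          where lem : ∀ h → 1ℤ + (h + h) - + 1 - + 2 * h ≡ 0ℤ
                lem = ring

  merged-bands : ∀ B₁ B₂ .{{_ : NonZero B₂}} k → ∑< B₂ (λ j → band (B₁ · B₂) (k · B₂ ℕ.+ j)) ≡ band B₁ k
  merged-bands B₁ B₂ k = ∑<-swap B₂ N (λ j x → ⟦ floor B x ℕ.≟ k · B₂ ℕ.+ j ⟧ * ch x) ∙ ∑<-cong N (λ {x} _ → ∑<-*ʳ B₂ (ch x) _ ∙ cong (_* ch x) (by-dec x (floor B₁ x ℕ.≟ k)))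
    where
    B : ℕ
    B = B₁ · B₂
    coarse : ∀ x → floor B x ℕ./ B₂ ≡ floor B₁ x
    coarse x = ℕ.m/n/o≡m/[n*o] (x · B) N B₂ {{_}} {{_}} {{m*n≢0 N B₂}} ∙ cong (λ z → ℕ._/_ z (N · B₂) {{m*n≢0 N B₂}}) (sym (ℕ.*-assoc x B₁ B₂)) ∙ ℕ.m*n/o*n≡m/o (x · B₁) B₂ N {{_}} {{m*n≢0 N B₂}}
    by-dec : ∀ x → (d : Dec (floor B₁ x ≡ k)) → ∑< B₂ (λ j → ⟦ floor B x ℕ.≟ k · B₂ ℕ.+ j ⟧) ≡ ⟦ floor B₁ x ℕ.≟ k ⟧
    by-dec x (yes e) = ∑<-single B₂ {floor B x ℕ.% B₂} (λ j → ⟦ floor B x ℕ.≟ k · B₂ ℕ.+ j ⟧) (m%n<n (floor B x) B₂)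
        (λ {j} _ j≢ → ⟦⟧-no (floor B x ℕ.≟ k · B₂ ℕ.+ j) (λ e' → j≢ (ℕ.+-cancelˡ-≡ (k · B₂) j _ (sym e' ∙ split)))) ∙
      trans (⟦⟧-yes (floor B x ℕ.≟ k · B₂ ℕ.+ floor B x ℕ.% B₂) split) (sym (⟦⟧-yes (floor B₁ x ℕ.≟ k) e))
      where
      split : floor B x ≡ k · B₂ ℕ.+ floor B x ℕ.% B₂
      split = m≡m%n+[m/n]*n (floor B x) B₂ ∙ cong (λ q → floor B x ℕ.% B₂ ℕ.+ q · B₂) (coarse x ∙ e) ∙ +-comm (floor B x ℕ.% B₂) (k · B₂)
    by-dec x (no ≢k) = trans (∑<-zero B₂ (λ {j} j< → ⟦⟧-no (floor B x ℕ.≟ k · B₂ ℕ.+ j) (λ e → ≢k (sym (coarse x) ∙ cong (ℕ._/ B₂) (e ∙ +-comm (k · B₂) j) ∙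
        trans (ℕ.+-distrib-/-∣ʳ j (dividesₙ k refl)) (cong₂ ℕ._+_ (ℕ.m<n⇒m/n≡0 j<) (ℕ.m*n/n≡m k B₂)))))) (sym (⟦⟧-no (floor B₁ x ℕ.≟ k) ≢k))

module _ {m : ℤ} (S : Setting m) (sf : SquareFree m) (large : discriminant m < - (+ 4)) (h : ℕ) (order : HasOrder (ClassGroup m) h) where
  open Setting S

  N>4 : 4 ℕ.< N
  N>4 = subst (4 ℕ.<_) N≡ (magnitude large)
    where
    magnitude : ∀ {z} → z < - (+ 4) → 4 ℕ.< ∣ z ∣
    magnitude (-<- h) = s≤s h

  ch : ℕ → ℤ
  ch x = χ m (+ x)

  ffm : f * f * m ≡ - + N
  ffm = lem (f * f * m) (+ 4 * n₀) ∙ cong (_- + 4 * n₀) disc ∙ lem' (t * t) (+ 4 * n₀) ∙ cong -_ disc-N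
    where
    lem : ∀ a b → a ≡ a + b - b
    lem = ring
    lem' : ∀ a b → a - b ≡ - (b - a)
    lem' = ring

  ∣m∣>1 : 1 ℕ.< ∣ m ∣
  ∣m∣>1 = ℕ.≰⇒> (λ m≤1 → ℕ.<⇒≱ N>4 (subst (ℕ._≤ 4) (sym (abs-* (f * f) m) ∙ cong ∣_∣ ffm ∙ ∣-i∣≡∣i∣ (+ N)) (*-mono-≤ (ff≤4 kind) m≤1)))
    where
    ff≤4 : Kind m t f → ∣ f * f ∣ ℕ.≤ 4
    ff≤4 (odd-disc _ f≡) = subst (λ f → ∣ f * f ∣ ℕ.≤ 4) (sym f≡) (s≤s z≤n)
    ff≤4 (even-disc _ _ f≡ _) = subst (λ f → ∣ f * f ∣ ℕ.≤ 4) (sym f≡) ≤-refl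

  𝓞 : QuadraticOrder
  𝓞 = record { m = m ; t = t ; f = f ; n₀ = n₀ ; N = N ; disc = disc ; disc-N = disc-N ; N>4 = N>4 ; kind = kind ; sf = sf }

  -- The transport keeps Agda from comparing the two class groups by unfolding them.
  order' : HasOrder (ClassGroup (QuadraticOrder.m 𝓞)) h
  order' = subst (λ m → HasOrder (ClassGroup m) h) m≡ order
    where m≡ : m ≡ QuadraticOrder.m 𝓞
          m≡ = refl

  dirichlet : + N * + h + moment N ch ≡ 0ℤ
  dirichlet = go (prime-divisor ∣ m ∣ ∣m∣>1)
    where
    go : (∃[ p ] Prime p × p ∣ₙ ∣ m ∣) → + N * + h + moment N ch ≡ 0ℤ
    go (p , pr , p∣∣m∣) = ClassNumberFormula.class-number-formula 𝓞 h order' ch character roots p pr p∣m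
        (subst (+ p ∣_) (cong -_ ffm ∙ neg-involutive (+ N)) (∣m⇒∣-m (∣n⇒∣m*n (f * f) p∣m)))
      where p∣m : + p ∣ m
            p∣m = ∣ᵤ⇒∣ {+ p} {m} p∣∣m∣

  private
    instance
      N≢0 : NonZero N
      N≢0 = ℕ.>-nonZero (<-trans (s≤s z≤n) N>4)
    N>1 : 1 ℕ.< N
    N>1 = <-trans (s≤s (s≤s z≤n)) N>4
  open Bands character N>1

  E≡band : ∀ B → Cop (+ N) (+ B) → ∀ k → E m B k ≡ band B k
  E≡band B cB k = cong (λ n → sumℤ (map ch (X[ n ] B k))) N≡ ∙ X-sum≡band B k cB

  coprime⇒cop : ∀ {B} → Coprime B ∣ discriminant m ∣ → Cop (+ N) (+ B)
  coprime⇒cop {B} c = gcd⇒cop N B (Coprimality.coprime⇒gcd≡1 (subst (Coprime B) N≡ c))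

  weighted-E-sum : ∀ B → 1 ℕ.< B → Cop (+ N) (+ B) → (E' : ℕ → ℤ) → (∀ k → E' k ≡ band B k) →
    Σ< (B / 2) (λ k → (+ B - + 1 - + 2 * + k) * E' k) ≡ (+ B - χ m (+ B)) * + h
  weighted-E-sum B B>1 cB E' E'≡ = Σ<≡∑< (B / 2) _ ∙ ∑<-cong (B / 2) (λ {k} _ → cong ((+ B - + 1 - + 2 * + k) *_) (E'≡ k)) ∙ weighted-band-sum h dirichlet B B>1 cB

  merged-E : ∀ B B₁ B₂ → B ≡ B₁ · B₂ → 1 ℕ.< B → Cop (+ N) (+ B) → ∀ k → Σ< B₂ (λ j → E m B (k · B₂ ℕ.+ j)) ≡ band B₁ k
  merged-E B B₁ B₂ B≡ B>1 cB k = Σ<≡∑< B₂ _ ∙ ∑<-cong B₂ (λ {j} _ → E≡band B cB (k · B₂ ℕ.+ j) ∙ cong (λ b → band b (k · B₂ ℕ.+ j)) B≡) ∙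
      merged-bands B₁ B₂ {{ℕ.≢-nonZero (λ B₂≡0 → contradiction (cong (B₁ ·_) (sym B₂≡0) ∙ sym B≡) (λ e → ℕ.<⇒≢ (<-trans (s≤s z≤n) B>1) (sym (ℕ.*-zeroʳ B₁) ∙ e)))}} k

  both-sums : (B : ℕ) → 1 ℕ.< B → Coprime B ∣ discriminant m ∣ →
      (Σ< (B / 2) (λ k → (+ B - + 1 - + 2 * + k) * E m B k) ≡ (+ B - χ m (+ B)) * + h)
    × ((B₁ B₂ : ℕ) → B ≡ B₁ · B₂ → 1 ℕ.< B₁ → B₁ ℕ.< B →
       Σ< (B₁ / 2) (λ k → (+ B₁ - + 1 - + 2 * + k) * Σ< B₂ (λ j → E m B (k · B₂ ℕ.+ j))) ≡ (+ B₁ - χ m (+ B₁)) * + h)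
  both-sums B B>1 coprime = weighted-E-sum B B>1 cB (E m B) (E≡band B cB) ,
    λ B₁ B₂ B≡ B₁>1 _ → weighted-E-sum B₁ B₁>1 (factor B₁ B₂ B≡) _ (merged-E B B₁ B₂ B≡ B>1 cB)
    where
    cB : Cop (+ N) (+ B)
    cB = coprime⇒cop coprime
    factor : ∀ B₁ B₂ → B ≡ B₁ · B₂ → Cop (+ N) (+ B₁)
    factor B₁ B₂ B≡ = cop-factorʳ (+ B₂) (+ B₁) (subst (λ z → Cop (+ N) z) (cong +_ (B≡ ∙ ℕ.*-comm B₁ B₂) ∙ pos-* B₂ B₁) cB)

theorem3p2 :
    (m : ℤ) → m < 0ℤ → SquareFree m → discriminant m < - (+ 4) →
    (h : ℕ) → HasOrder (ClassGroup m) h →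
    (B : ℕ) → 1 ℕ.< B → Coprime B ∣ discriminant m ∣ →
      (Σ< (B / 2) (λ k → (+ B - + 1 - + 2 * + k) * E m B k)
         ≡ (+ B - χ m (+ B)) * + h)
    × ((B₁ B₂ : ℕ) → B ≡ B₁ · B₂ → 1 ℕ.< B₁ → B₁ ℕ.< B →
       Σ< (B₁ / 2) (λ k → (+ B₁ - + 1 - + 2 * + k) * Σ< B₂ (λ j → E m B (k · B₂ ℕ.+ j)))
         ≡ (+ B₁ - χ m (+ B₁)) * + h)
theorem3p2 m m<0 sf = both-sums (setting m m<0 sf) sf
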